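{- Let $F$ be the function field of a smooth projective geometrically irreducible curve $X$ over $\mathbb{F}_q$, let $x$ be a place of $F$, and let $h_2=\#(\mathrm{Cl}\,F)[2]$. Label each vertex $[g]$ of $\mathcal{G}_x$ by the class of $\det g$ in $\mathrm{Cl}\,F/2\,\mathrm{Cl}\,F$. If the prime divisor $x$ is a square in the divisor class group (i.e. its class lies in $2\,\mathrm{Cl}\,F$), then all vertices in the same component of $\mathcal{G}_x$ have the same label, and there are $2h_2$ components, each of which has a different label. Otherwise, the vertices of each component have one of two labels that differ by the class of $x$ in $\mathrm{Cl}\,F/2\,\mathrm{Cl}\,F$, and two adjacent vertices have different labels, so each connected component is bipartite.
   Context: $\mathbb{A}$ is the adele ring of $F$, $\mathcal{O}_{\mathbb{A}}=\prod_y\mathcal{O}_y$, $G=\mathrm{PGL}_2$, $K=G(\mathcal{O}_{\mathbb{A}})$, $\kappa_x$ the residue field at $x$ and $\pi_x$ a uniformizer at $x$. $\mathrm{Cl}\,F=F^\times\backslash\mathbb{A}^\times/\mathcal{O}_{\mathbb{A}}^\times$ is the divisor class group and $(\mathrm{Cl}\,F)[2]$ its $2$-torsion. The label map is $$\det: G(F)\backslash G(\mathbb{A})/K\to F^\times\backslash\mathbb{A}^\times/\mathcal{O}_{\mathbb{A}}^\times\mathcal{Q}_{\mathbb{A}}\simeq\mathrm{Cl}\,F/2\,\mathrm{Cl}\,F,$$ where $\mathcal{Q}_{\mathbb{A}}$ is the group of squares in $\mathbb{A}^\times$. $\mathcal{G}_x$ is the graph of the unramified Hecke operator $\Phi_x$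 (the characteristic function of $K\begin{pmatrix}\pi_x&0\\0&1\end{pmatrix}K$, with $\pi_x$ viewed as an idele concentrated at $x$): its vertex set is $G(F)\backslash G(\mathbb{A})/K$, and there is an edge from $[g]$ to $[g']$ if and only if $[g']=[g\xi_w]$ for some $w\in\mathbb{P}^1(\kappa_x)$, where $\xi_w=\begin{pmatrix}\pi_x&b\\0&1\end{pmatrix}$ for $w=[1:b]$ and $\xi_w=\begin{pmatrix}1&0\\0&\pi_x\end{pmatrix}$ for $w=[0:1]$, placed in the component at $x$ (with $\kappa_x\subset F_x$). The existence of an edge is symmetric in its two end points. Components are connected components of the underlying unoriented graph. -}

module Defs where

open import Level using (0ℓ)
open import Algebra.Apartness.Bundles using (HeytingField)
open import Algebra.Bundles using (AbelianGroup; CommutativeRing; Group)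
open import Algebra.Definitions using (Invertible)
open import Algebra.Morphism.Bundles using (GroupHomomorphism; RingHomomorphism)
import Algebra.Construct.DirectProduct as DirectProduct
import Algebra.Construct.Pointwise as Pointwise
import Algebra.Definitions.RawMonoid as RawMonoidOperations
import Algebra.Morphism.Construct.Composition as Composition
import Algebra.Properties.AbelianGroup as AbelianGroupProperties
import Algebra.Properties.CommutativeSemigroup as CommutativeSemigroupProperties
import Algebra.Properties.Group as GroupProperties
import Algebra.Properties.Ring as RingProperties
import Algebra.Solver.Ring.NaturalCoefficients.Default as SemiringSolver
open import Axiom.ExcludedMiddle using (ExcludedMiddle)
open import Data.Bool.Base using (Bool)
open import Data.Empty using (⊥-elim)
open import Data.Fin.Base using (Fin)
open import Data.Integer.Base as ℤ using (ℤ; +_; -[1+_]; +≤+)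
import Data.Integer.Properties as ℤ
open import Data.List.Base using (List; []; _∷_; _++_; foldr)
open import Data.List.Relation.Unary.Any using (Any; here; there)
open import Data.List.Relation.Unary.Any.Properties using (++⁺ˡ; ++⁺ʳ)
open import Data.Maybe.Base using (just; nothing; zipWith)
open import Data.Maybe.Properties using (just-injective)
open import Data.Nat.Base as ℕ using (ℕ)
import Data.Nat.Properties as ℕ
open import Data.Product.Base using (Σ; ∃-syntax; Σ-syntax; _×_; _,_; proj₁; proj₂)
open import Data.Sum.Base using (_⊎_)
open import Function.Base using (_∘_; case_of_)
open import Function.Bundles using (Bijection; Equivalence; Func; _⇔_)
open import Relation.Binary.Bundles using (Setoid)
import Relation.Binary.Construct.Closure.Equivalence as EqClosure
import Relation.Binary.Construct.On as On
open import Relation.Binary.Core using (Rel)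
open import Relation.Binary.PropositionalEquality as ≡ using (_≡_; _≢_)
open import Relation.Binary.Structures using (IsEquivalence)
open import Relation.Nullary.Construct.Add.Supremum using (_⁺; ⊤⁺; [_])
open import Relation.Nullary.Decidable.Core using (Dec; yes; no)
open import Relation.Nullary.Negation.Core using (¬_)
open import Relation.Unary using (Pred)
import Relation.Binary.Construct.Add.Supremum.NonStrict as AddSupremum
import Relation.Binary.Reasoning.Setoid as SetoidReasoning

Ring : Set₁
Ring = CommutativeRing 0ℓ 0ℓ

Ab : Set₁
Ab = AbelianGroup 0ℓ 0ℓ

Grp : Set₁
Grp = Group 0ℓ 0ℓ

infix 4 _⟶ʳ_ _⟶ᵍ_

_⟶ʳ_ : Ring → Ring → Set
R ⟶ʳ S = RingHomomorphism (CommutativeRing.rawRing R) (CommutativeRing.rawRing S)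

_⟶ᵍ_ : Grp → Grp → Set
G ⟶ᵍ H = GroupHomomorphism (Group.rawGroup G) (Group.rawGroup H)

fieldRing : HeytingField 0ℓ 0ℓ 0ℓ → Ring
fieldRing = HeytingCommutativeRing.commutativeRing ∘ HeytingField.heytingCommutativeRing
  where open import Algebra.Apartness.Bundles using (HeytingCommutativeRing)

HasCardinality : Setoid 0ℓ 0ℓ → ℕ → Set
HasCardinality S n = Bijection (≡.setoid (Fin n)) S

record IsSubring (R : Ring) (P : Pred (CommutativeRing.Carrier R) 0ℓ) : Set where
  open CommutativeRing R
  field
    +-closed : ∀ {a b} → P a → P b → P (a + b)
    *-closed : ∀ {a b} → P a → P b → P (a * b)
    -‿closed : ∀ {a} → P a → P (- a)
    0#-closed : P 0#
    1#-closed : P 1#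

module _ (R : Ring) {P : Pred (CommutativeRing.Carrier R) 0ℓ} (isSubring : IsSubring R P) where
  open CommutativeRing R
  open IsSubring isSubring

  subring : Ring
  subring = record
    { Carrier = Σ Carrier P
    ; _≈_ = λ a b → proj₁ a ≈ proj₁ b
    ; _+_ = λ (a , p) (b , q) → a + b , +-closed p q
    ; _*_ = λ (a , p) (b , q) → a * b , *-closed p q
    ; -_ = λ (a , p) → - a , -‿closed p
    ; 0# = 0# , 0#-closed
    ; 1# = 1# , 1#-closed
    ; isCommutativeRing = record
      { isRing = record
        { +-isAbelianGroup = record
          { isGroup = record
            { isMonoid = record
              { isSemigroup = record
                { isMagma = record
                  { isEquivalence = On.isEquivalence proj₁ isEquivalence
                  ; ∙-cong = +-cong
                  }
                ; assoc = λ _ _ _ → +-assoc _ _ _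
                }
              ; identity = (λ _ → +-identityˡ _) , (λ _ → +-identityʳ _)
              }
            ; inverse = (λ _ → -‿inverseˡ _) , (λ _ → -‿inverseʳ _)
            ; ⁻¹-cong = -‿cong
            }
          ; comm = λ _ _ → +-comm _ _
          }
        ; *-cong = *-cong
        ; *-assoc = λ _ _ _ → *-assoc _ _ _
        ; *-identity = (λ _ → *-identityˡ _) , (λ _ → *-identityʳ _)
        ; distrib = (λ _ _ _ → distribˡ _ _ _) , (λ _ _ _ → distribʳ _ _ _)
        }
      ; *-comm = λ _ _ → *-comm _ _
      }
    }

  inclusion : subring ⟶ʳ R
  inclusion = record
    { ⟦_⟧ = proj₁
    ; isRingHomomorphism = record
      { isSemiringHomomorphism = record
        { isNearSemiringHomomorphism = record
          { +-isMonoidHomomorphism = record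
            { isMagmaHomomorphism = record
              { isRelHomomorphism = record { cong = λ p → p }
              ; homo = λ _ _ → refl
              }
            ; ε-homo = refl
            }
          ; *-homo = λ _ _ → refl
          }
        ; 1#-homo = refl
        }
      ; -‿homo = λ _ → refl
      }
    }

record IsIdeal (R : Ring) (I : Pred (CommutativeRing.Carrier R) 0ℓ) : Set where
  open CommutativeRing R
  field
    resp : ∀ {a b} → a ≈ b → I a → I b
    0#-closed : I 0#
    +-closed : ∀ {a b} → I a → I b → I (a + b)
    *-absorb : ∀ r {a} → I a → I (r * a)

module _ (R : Ring) {I : Pred (CommutativeRing.Carrier R) 0ℓ} (isIdeal : IsIdeal R I) where
  open CommutativeRing R
  open IsIdeal isIdeal
  open RingProperties ring

  infix 4 _≈/_

  _≈/_ : Rel Carrier 0ℓ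
  a ≈/ b = I (a - b)

  private
    ≈⇒≈/ : ∀ {a b} → a ≈ b → a ≈/ b
    ≈⇒≈/ {a} {b} a≈b = resp (sym (x≈y⇒x∙y⁻¹≈ε a≈b)) 0#-closed

    neg : ∀ {a} → I a → I (- a)
    neg i = resp (-1*x≈-x _) (*-absorb (- 1#) i)

    ≈/-sym : ∀ {a b} → a ≈/ b → b ≈/ a
    ≈/-sym i = resp (⁻¹-anti-homo-// _ _) (neg i)

    ≈/-trans : ∀ {a b c} → a ≈/ b → b ≈/ c → a ≈/ c
    ≈/-trans {a} {b} {c} i j = resp eq (+-closed i j)
      where
      open SetoidReasoning setoid
      eq : (a - b) + (b - c) ≈ a - c
      eq = begin
        (a - b) + (b - c)    ≈⟨ +-assoc a (- b) (b - c) ⟩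
        a + (- b + (b - c))  ≈⟨ +-congˡ (sym (+-assoc (- b) b (- c))) ⟩
        a + (- b + b - c)    ≈⟨ +-congˡ (+-congʳ (-‿inverseˡ b)) ⟩
        a + (0# - c)         ≈⟨ +-congˡ (+-identityˡ (- c)) ⟩
        a - c                ∎

    ≈/-+ : ∀ {a b c d} → a ≈/ b → c ≈/ d → (a + c) ≈/ (b + d)
    ≈/-+ {a} {b} {c} {d} i j = resp eq (+-closed i j)
      where
      open SetoidReasoning setoid
      open CommutativeSemigroupProperties +-commutativeSemigroup using (interchange)
      eq : (a - b) + (c - d) ≈ (a + c) - (b + d)
      eq = begin
        (a - b) + (c - d)      ≈⟨ interchange a (- b) c (- d) ⟩
        (a + c) + (- b - d)    ≈⟨ +-congˡ (-‿+-comm b d) ⟩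
        (a + c) - (b + d)      ∎

    ≈/-* : ∀ {a b c d} → a ≈/ b → c ≈/ d → (a * c) ≈/ (b * d)
    ≈/-* {a} {b} {c} {d} i j = ≈/-trans
      (resp (x[y-z]≈xy-xz a c d) (*-absorb a j))
      (resp (trans (*-comm d (a - b)) ([y-z]x≈yx-zx d a b)) (*-absorb d i))

    ≈/-neg : ∀ {a b} → a ≈/ b → (- a) ≈/ (- b)
    ≈/-neg {a} {b} i = resp (sym (-‿+-comm a (- b))) (neg i)

  quotientRing : Ring
  quotientRing = record
    { Carrier = Carrier
    ; _≈_ = _≈/_
    ; _+_ = _+_
    ; _*_ = _*_
    ; -_ = -_
    ; 0# = 0#
    ; 1# = 1#
    ; isCommutativeRing = record
      { isRing = record
        { +-isAbelianGroup = record
          { isGroup = record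
            { isMonoid = record
              { isSemigroup = record
                { isMagma = record
                  { isEquivalence = record
                    { refl = ≈⇒≈/ refl
                    ; sym = ≈/-sym
                    ; trans = ≈/-trans
                    }
                  ; ∙-cong = ≈/-+
                  }
                ; assoc = λ a b c → ≈⇒≈/ (+-assoc a b c)
                }
              ; identity = (≈⇒≈/ ∘ +-identityˡ) , (≈⇒≈/ ∘ +-identityʳ)
              }
            ; inverse = (≈⇒≈/ ∘ -‿inverseˡ) , (≈⇒≈/ ∘ -‿inverseʳ)
            ; ⁻¹-cong = ≈/-neg
            }
          ; comm = λ a b → ≈⇒≈/ (+-comm a b)
          }
        ; *-cong = ≈/-*
        ; *-assoc = λ a b c → ≈⇒≈/ (*-assoc a b c)
        ; *-identity = (≈⇒≈/ ∘ *-identityˡ) , (≈⇒≈/ ∘ *-identityʳ)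
        ; distrib = (λ a b c → ≈⇒≈/ (distribˡ a b c)) , (λ a b c → ≈⇒≈/ (distribʳ a b c))
        }
      ; *-comm = λ a b → ≈⇒≈/ (*-comm a b)
      }
    }

  projection : R ⟶ʳ quotientRing
  projection = record
    { ⟦_⟧ = λ a → a
    ; isRingHomomorphism = record
      { isSemiringHomomorphism = record
        { isNearSemiringHomomorphism = record
          { +-isMonoidHomomorphism = record
            { isMagmaHomomorphism = record
              { isRelHomomorphism = record { cong = ≈⇒≈/ }
              ; homo = λ _ _ → ≈⇒≈/ refl
              }
            ; ε-homo = ≈⇒≈/ refl
            }
          ; *-homo = λ _ _ → ≈⇒≈/ refl
          }
        ; 1#-homo = ≈⇒≈/ refl
        }
      ; -‿homo = λ _ → ≈⇒≈/ refl
      }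
    }

Π-ring : (A : Set) → (A → Ring) → Ring
Π-ring A R = record
  { Carrier = ∀ i → Carrier i
  ; _≈_ = λ a b → ∀ i → _≈_ i (a i) (b i)
  ; _+_ = λ a b i → _+_ i (a i) (b i)
  ; _*_ = λ a b i → _*_ i (a i) (b i)
  ; -_ = λ a i → -_ i (a i)
  ; 0# = λ i → 0# i
  ; 1# = λ i → 1# i
  ; isCommutativeRing = record
    { isRing = record
      { +-isAbelianGroup = record
        { isGroup = record
          { isMonoid = record
            { isSemigroup = record
              { isMagma = record
                { isEquivalence = record
                  { refl = λ i → refl i
                  ; sym = λ p i → sym i (p i)
                  ; trans = λ p q i → trans i (p i) (q i)
                  }
                ; ∙-cong = λ p q i → +-cong i (p i) (q i)
                }
              ; assoc = λ a b c i → +-assoc i (a i) (b i) (c i)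
              }
            ; identity = (λ a i → +-identityˡ i (a i)) , (λ a i → +-identityʳ i (a i))
            }
          ; inverse = (λ a i → -‿inverseˡ i (a i)) , (λ a i → -‿inverseʳ i (a i))
          ; ⁻¹-cong = λ p i → -‿cong i (p i)
          }
        ; comm = λ a b i → +-comm i (a i) (b i)
        }
      ; *-cong = λ p q i → *-cong i (p i) (q i)
      ; *-assoc = λ a b c i → *-assoc i (a i) (b i) (c i)
      ; *-identity = (λ a i → *-identityˡ i (a i)) , (λ a i → *-identityʳ i (a i))
      ; distrib = (λ a b c i → distribˡ i (a i) (b i) (c i)) , (λ a b c i → distribʳ i (a i) (b i) (c i))
      }
    ; *-comm = λ a b i → *-comm i (a i) (b i)
    }
  }
  where open module R i = CommutativeRing (R i)

IsUnit : (R : Ring) → CommutativeRing.Carrier R → Set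
IsUnit R = Invertible _≈_ 1# _*_
  where open CommutativeRing R

module _ (R : Ring) where
  open CommutativeRing R
  open SetoidReasoning setoid

  isUnit : ∀ {a} b → b * a ≈ 1# → IsUnit R a
  isUnit b ba≈1 = b , ba≈1 , trans (*-comm _ b) ba≈1

  isUnit-* : ∀ {a b} → IsUnit R a → IsUnit R b → IsUnit R (a * b)
  isUnit-* {a} {b} (a⁻¹ , p , _) (b⁻¹ , q , _) = isUnit (a⁻¹ * b⁻¹) (begin
    (a⁻¹ * b⁻¹) * (a * b)  ≈⟨ interchange a⁻¹ b⁻¹ a b ⟩
    (a⁻¹ * a) * (b⁻¹ * b)  ≈⟨ *-cong p q ⟩
    1# * 1#                ≈⟨ *-identityˡ 1# ⟩
    1#                     ∎)
    where open CommutativeSemigroupProperties *-commutativeSemigroup using (interchange)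

  isUnit-resp : ∀ {a b} → a ≈ b → IsUnit R a → IsUnit R b
  isUnit-resp a≈b (c , p , _) = isUnit c (trans (*-congˡ (sym a≈b)) p)

  private
    ⁻¹-cong′ : ∀ {a b} ((a⁻¹ , _) : IsUnit R a) ((b⁻¹ , _) : IsUnit R b) → a ≈ b → a⁻¹ ≈ b⁻¹
    ⁻¹-cong′ {a} {b} (a⁻¹ , p , _) (b⁻¹ , _ , q) a≈b = begin
      a⁻¹              ≈⟨ sym (*-identityʳ a⁻¹) ⟩
      a⁻¹ * 1#         ≈⟨ *-congˡ (sym q) ⟩
      a⁻¹ * (b * b⁻¹)  ≈⟨ sym (*-assoc a⁻¹ b b⁻¹) ⟩
      (a⁻¹ * b) * b⁻¹  ≈⟨ *-congʳ (*-congˡ (sym a≈b)) ⟩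
      (a⁻¹ * a) * b⁻¹  ≈⟨ *-congʳ p ⟩
      1# * b⁻¹         ≈⟨ *-identityˡ b⁻¹ ⟩
      b⁻¹              ∎

  Units : Ab
  Units = record
    { Carrier = Σ Carrier (IsUnit R)
    ; _≈_ = λ a b → proj₁ a ≈ proj₁ b
    ; _∙_ = λ (a , p) (b , q) → a * b , isUnit-* p q
    ; ε = 1# , isUnit 1# (*-identityˡ 1#)
    ; _⁻¹ = λ (a , a⁻¹ , p , q) → a⁻¹ , a , q , p
    ; isAbelianGroup = record
      { isGroup = record
        { isMonoid = record
          { isSemigroup = record
            { isMagma = record
              { isEquivalence = On.isEquivalence proj₁ isEquivalence
              ; ∙-cong = *-cong
              }
            ; assoc = λ _ _ _ → *-assoc _ _ _
            }
          ; identity = (λ _ → *-identityˡ _) , (λ _ → *-identityʳ _)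
          }
        ; inverse = (λ (_ , _ , p , _) → p) , (λ (_ , _ , _ , q) → q)
        ; ⁻¹-cong = λ {(_ , u)} {(_ , v)} → ⁻¹-cong′ u v
        }
      ; comm = λ _ _ → *-comm _ _
      }
    }

record Matrix₂ (A : Set) : Set where
  constructor mat
  field
    e₁₁ e₁₂ e₂₁ e₂₂ : A

module Matrices (R : Ring) where
  open CommutativeRing R hiding (zero)
  open RingProperties ring
  open SetoidReasoning setoid
  open SemiringSolver commutativeSemiring using (solve; _:+_; _:*_; _:=_; con)

  infix 4 _≈ᴹ_
  infixl 7 _*ᴹ_ _·ᴹ_

  record _≈ᴹ_ (M N : Matrix₂ Carrier) : Set where
    constructor mat≈
    private
      module M = Matrix₂ M
      module N = Matrix₂ N
    field
      ≈₁₁ : M.e₁₁ ≈ N.e₁₁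
      ≈₁₂ : M.e₁₂ ≈ N.e₁₂
      ≈₂₁ : M.e₂₁ ≈ N.e₂₁
      ≈₂₂ : M.e₂₂ ≈ N.e₂₂

  _*ᴹ_ : Matrix₂ Carrier → Matrix₂ Carrier → Matrix₂ Carrier
  mat a b c d *ᴹ mat e f g h =
    mat (a * e + b * g) (a * f + b * h) (c * e + d * g) (c * f + d * h)

  _·ᴹ_ : Carrier → Matrix₂ Carrier → Matrix₂ Carrier
  r ·ᴹ mat a b c d = mat (r * a) (r * b) (r * c) (r * d)

  1ᴹ : Matrix₂ Carrier
  1ᴹ = mat 1# 0# 0# 1#

  det : Matrix₂ Carrier → Carrier
  det (mat a b c d) = a * d - b * c

  adj : Matrix₂ Carrier → Matrix₂ Carrier
  adj (mat a b c d) = mat d (- b) (- c) a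

  ≈ᴹ-refl : ∀ {M} → M ≈ᴹ M
  ≈ᴹ-refl = mat≈ refl refl refl refl

  ≈ᴹ-sym : ∀ {M N} → M ≈ᴹ N → N ≈ᴹ M
  ≈ᴹ-sym (mat≈ p q r s) = mat≈ (sym p) (sym q) (sym r) (sym s)

  ≈ᴹ-trans : ∀ {L M N} → L ≈ᴹ M → M ≈ᴹ N → L ≈ᴹ N
  ≈ᴹ-trans (mat≈ p q r s) (mat≈ p′ q′ r′ s′) =
    mat≈ (trans p p′) (trans q q′) (trans r r′) (trans s s′)

  ≈ᴹ-setoid : Setoid 0ℓ 0ℓ
  ≈ᴹ-setoid = record
    { Carrier = Matrix₂ Carrier
    ; _≈_ = _≈ᴹ_
    ; isEquivalence = record { refl = ≈ᴹ-refl ; sym = ≈ᴹ-sym ; trans = ≈ᴹ-trans }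
    }

  *ᴹ-cong : ∀ {L M N O} → L ≈ᴹ M → N ≈ᴹ O → L *ᴹ N ≈ᴹ M *ᴹ O
  *ᴹ-cong (mat≈ a b c d) (mat≈ e f g h) = mat≈
    (+-cong (*-cong a e) (*-cong b g)) (+-cong (*-cong a f) (*-cong b h))
    (+-cong (*-cong c e) (*-cong d g)) (+-cong (*-cong c f) (*-cong d h))

  ·ᴹ-cong : ∀ {r s M N} → r ≈ s → M ≈ᴹ N → r ·ᴹ M ≈ᴹ s ·ᴹ N
  ·ᴹ-cong r (mat≈ a b c d) = mat≈ (*-cong r a) (*-cong r b) (*-cong r c) (*-cong r d)

  *ᴹ-assoc : ∀ L M N → (L *ᴹ M) *ᴹ N ≈ᴹ L *ᴹ (M *ᴹ N)
  *ᴹ-assoc (mat a b c d) (mat e f g h) (mat i j k l) =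
    mat≈ (lemma a b e f g h i k) (lemma a b e f g h j l)
         (lemma c d e f g h i k) (lemma c d e f g h j l)
    where
    lemma : ∀ a b e f g h i k →
            (a * e + b * g) * i + (a * f + b * h) * k ≈ a * (e * i + f * k) + b * (g * i + h * k)
    lemma = solve 8 (λ a b e f g h i k →
      (a :* e :+ b :* g) :* i :+ (a :* f :+ b :* h) :* k :=
      a :* (e :* i :+ f :* k) :+ b :* (g :* i :+ h :* k)) refl

  *ᴹ-identityˡ : ∀ M → 1ᴹ *ᴹ M ≈ᴹ M
  *ᴹ-identityˡ (mat a b c d) = mat≈ (l a c) (l b d) (r a c) (r b d)
    where
    l : ∀ a c → 1# * a + 0# * c ≈ a
    l a c = trans (+-cong (*-identityˡ a) (zeroˡ c)) (+-identityʳ a)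
    r : ∀ a c → 0# * a + 1# * c ≈ c
    r a c = trans (+-cong (zeroˡ a) (*-identityˡ c)) (+-identityˡ c)

  *ᴹ-identityʳ : ∀ M → M *ᴹ 1ᴹ ≈ᴹ M
  *ᴹ-identityʳ (mat a b c d) = mat≈ (l a b) (r a b) (l c d) (r c d)
    where
    l : ∀ a c → a * 1# + c * 0# ≈ a
    l a c = trans (+-cong (*-identityʳ a) (zeroʳ c)) (+-identityʳ a)
    r : ∀ a c → a * 0# + c * 1# ≈ c
    r a c = trans (+-cong (zeroʳ a) (*-identityʳ c)) (+-identityˡ c)

  ·ᴹ-*ᴹ : ∀ r M N → (r ·ᴹ M) *ᴹ N ≈ᴹ r ·ᴹ (M *ᴹ N)
  ·ᴹ-*ᴹ r (mat a b c d) (mat e f g h) =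
    mat≈ (lemma r a b e g) (lemma r a b f h) (lemma r c d e g) (lemma r c d f h)
    where
    lemma : ∀ r a b e g → (r * a) * e + (r * b) * g ≈ r * (a * e + b * g)
    lemma = solve 5 (λ r a b e g →
      (r :* a) :* e :+ (r :* b) :* g := r :* (a :* e :+ b :* g)) refl

  *ᴹ-·ᴹ : ∀ r M N → M *ᴹ (r ·ᴹ N) ≈ᴹ r ·ᴹ (M *ᴹ N)
  *ᴹ-·ᴹ r (mat a b c d) (mat e f g h) =
    mat≈ (lemma r a b e g) (lemma r a b f h) (lemma r c d e g) (lemma r c d f h)
    where
    lemma : ∀ r a b e g → a * (r * e) + b * (r * g) ≈ r * (a * e + b * g)
    lemma = solve 5 (λ r a b e g →
      a :* (r :* e) :+ b :* (r :* g) := r :* (a :* e :+ b :* g)) refl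

  ·ᴹ-assoc : ∀ r s M → (r * s) ·ᴹ M ≈ᴹ r ·ᴹ (s ·ᴹ M)
  ·ᴹ-assoc r s (mat a b c d) =
    mat≈ (*-assoc r s a) (*-assoc r s b) (*-assoc r s c) (*-assoc r s d)

  ·ᴹ-identity : ∀ M → 1# ·ᴹ M ≈ᴹ M
  ·ᴹ-identity (mat a b c d) =
    mat≈ (*-identityˡ a) (*-identityˡ b) (*-identityˡ c) (*-identityˡ d)

  det-cong : ∀ {M N} → M ≈ᴹ N → det M ≈ det N
  det-cong (mat≈ a b c d) = +-cong (*-cong a d) (-‿cong (*-cong b c))

  private
    +⇒- : ∀ {p q s t} → p + t ≈ s + q → p - q ≈ s - t
    +⇒- {p} {q} {s} {t} eq = begin
      p - q                ≈⟨ +-congʳ (sym (//-rightDividesʳ t p)) ⟩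
      (p + t) - t - q      ≈⟨ +-congʳ (+-congʳ eq) ⟩
      (s + q) - t - q      ≈⟨ rearrange s q (- t) (- q) ⟩
      (s - t) + (q - q)    ≈⟨ +-congˡ (-‿inverseʳ q) ⟩
      (s - t) + 0#         ≈⟨ +-identityʳ _ ⟩
      s - t                ∎
      where
      rearrange : ∀ s q t′ q′ → (s + q) + t′ + q′ ≈ (s + t′) + (q + q′)
      rearrange = solve 4 (λ s q t′ q′ → (s :+ q) :+ t′ :+ q′ := (s :+ t′) :+ (q :+ q′)) refl

    product-of-differences : ∀ x y z w → (x - y) * (z - w) ≈ (x * z + y * w) - (x * w + y * z)
    product-of-differences x y z w = begin
      (x - y) * (z - w)                    ≈⟨ [y-z]x≈yx-zx (z - w) x y ⟩
      x * (z - w) - y * (z - w)            ≈⟨ +-cong (x[y-z]≈xy-xz x z w) (-‿cong (x[y-z]≈xy-xz y z w)) ⟩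
      (x * z - x * w) - (y * z - y * w)    ≈⟨ +-congˡ (⁻¹-anti-homo-// (y * z) (y * w)) ⟩
      (x * z - x * w) + (y * w - y * z)    ≈⟨ interchange _ _ _ _ ⟩
      (x * z + y * w) + (- (x * w) - y * z)
        ≈⟨ +-congˡ (-‿+-comm _ _) ⟩
      (x * z + y * w) - (x * w + y * z)    ∎
      where open CommutativeSemigroupProperties +-commutativeSemigroup using (interchange)

  det-* : ∀ M N → det (M *ᴹ N) ≈ det M * det N
  det-* (mat a b c d) (mat e f g h) = trans (+⇒- (lemma a b c d e f g h))
    (sym (product-of-differences (a * d) (b * c) (e * h) (f * g)))
    where
    lemma : ∀ a b c d e f g h →
      (a * e + b * g) * (c * f + d * h) + ((a * d) * (f * g) + (b * c) * (e * h)) ≈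
      ((a * d) * (e * h) + (b * c) * (f * g)) + (a * f + b * h) * (c * e + d * g)
    lemma = solve 8 (λ a b c d e f g h →
      (a :* e :+ b :* g) :* (c :* f :+ d :* h) :+ ((a :* d) :* (f :* g) :+ (b :* c) :* (e :* h)) :=
      ((a :* d) :* (e :* h) :+ (b :* c) :* (f :* g)) :+ (a :* f :+ b :* h) :* (c :* e :+ d :* g)) refl

  det-1ᴹ : det 1ᴹ ≈ 1#
  det-1ᴹ = begin
    1# * 1# - 0# * 0#  ≈⟨ +-cong (*-identityˡ 1#) (-‿cong (zeroˡ 0#)) ⟩
    1# - 0#            ≈⟨ +-congˡ -0#≈0# ⟩
    1# + 0#            ≈⟨ +-identityʳ 1# ⟩
    1#                 ∎

  det-· : ∀ r M → det (r ·ᴹ M) ≈ (r * r) * det M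
  det-· r (mat a b c d) = begin
    (r * a) * (r * d) - (r * b) * (r * c)      ≈⟨ +-cong (lemma r a d) (-‿cong (lemma r b c)) ⟩
    (r * r) * (a * d) - (r * r) * (b * c)      ≈⟨ sym (x[y-z]≈xy-xz (r * r) _ _) ⟩
    (r * r) * (a * d - b * c)                  ∎
    where
    lemma : ∀ r a d → (r * a) * (r * d) ≈ (r * r) * (a * d)
    lemma = solve 3 (λ r a d → (r :* a) :* (r :* d) := (r :* r) :* (a :* d)) refl

  det-adj : ∀ M → det (adj M) ≈ det M
  det-adj (mat a b c d) = +-cong (*-comm d a) (-‿cong (begin
    - b * - c      ≈⟨ sym (-‿distribˡ-* b (- c)) ⟩
    - (b * - c)    ≈⟨ -‿cong (sym (-‿distribʳ-* b c)) ⟩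
    - - (b * c)    ≈⟨ -‿involutive (b * c) ⟩
    b * c          ∎))

  adj-cong : ∀ {M N} → M ≈ᴹ N → adj M ≈ᴹ adj N
  adj-cong (mat≈ a b c d) = mat≈ d (-‿cong b) (-‿cong c) a

  adj-inverseʳ : ∀ M → M *ᴹ adj M ≈ᴹ det M ·ᴹ 1ᴹ
  adj-inverseʳ (mat a b c d) = mat≈
    (trans (+-congˡ (sym (-‿distribʳ-* b c))) (sym (*-identityʳ _)))
    (trans (cancel a b b a (*-comm b a)) (sym (zeroʳ _)))
    (trans (trans (+-comm _ _) (cancel d c c d (*-comm c d))) (sym (zeroʳ _)))
    (begin
      c * - b + d * a     ≈⟨ +-comm _ _ ⟩
      d * a + c * - b     ≈⟨ +-cong (*-comm d a) (sym (-‿distribʳ-* c b)) ⟩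
      a * d - c * b       ≈⟨ +-congˡ (-‿cong (*-comm c b)) ⟩
      a * d - b * c       ≈⟨ sym (*-identityʳ _) ⟩
      (a * d - b * c) * 1# ∎)
    where
    cancel : ∀ a b c d → c * d ≈ a * b → a * - b + c * d ≈ 0#
    cancel a b c d eq = begin
      a * - b + c * d      ≈⟨ +-cong (sym (-‿distribʳ-* a b)) eq ⟩
      - (a * b) + a * b    ≈⟨ -‿inverseˡ (a * b) ⟩
      0#                   ∎

  adj-inverseˡ : ∀ M → adj M *ᴹ M ≈ᴹ det M ·ᴹ 1ᴹ
  adj-inverseˡ M@(mat a b c d) = ≈ᴹ-trans
    (*ᴹ-cong (≈ᴹ-refl {adj M}) (mat≈ refl (sym (-‿involutive b)) (sym (-‿involutive c)) refl))
    (≈ᴹ-trans (adj-inverseʳ (adj M)) (·ᴹ-cong (det-adj M) ≈ᴹ-refl))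

  GL₂ : Grp
  GL₂ = record
    { Carrier = Σ (Matrix₂ Carrier) (IsUnit R ∘ det)
    ; _≈_ = λ g h → proj₁ g ≈ᴹ proj₁ h
    ; _∙_ = λ (M , u) (N , v) → M *ᴹ N , isUnit-resp R (sym (det-* M N)) (isUnit-* R u v)
    ; ε = 1ᴹ , isUnit-resp R (sym det-1ᴹ) (isUnit R 1# (*-identityˡ 1#))
    ; _⁻¹ = λ (M , u@(δ , p , q)) → δ ·ᴹ adj M ,
        isUnit-resp R (sym (trans (det-· δ (adj M)) (*-congˡ (det-adj M))))
          (isUnit-* R (isUnit-* R (det M , q , p) (det M , q , p)) u)
    ; isGroup = record
      { isMonoid = record
        { isSemigroup = record
          { isMagma = record
            { isEquivalence = On.isEquivalence proj₁ (Setoid.isEquivalence ≈ᴹ-setoid)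
            ; ∙-cong = *ᴹ-cong
            }
          ; assoc = λ (L , _) (M , _) (N , _) → *ᴹ-assoc L M N
          }
        ; identity = (λ (M , _) → *ᴹ-identityˡ M) , (λ (M , _) → *ᴹ-identityʳ M)
        }
      ; inverse = inverseˡ , inverseʳ
      ; ⁻¹-cong = λ {(M , u)} {(N , v)} eq →
          ·ᴹ-cong (AbelianGroup.⁻¹-cong (Units R) {det M , u} {det N , v} (det-cong eq)) (adj-cong eq)
      }
    }
    where
    scale : ∀ M (δ : Carrier) → δ * det M ≈ 1# → δ ·ᴹ (det M ·ᴹ 1ᴹ) ≈ᴹ 1ᴹ
    scale M δ p = ≈ᴹ-trans (≈ᴹ-sym (·ᴹ-assoc δ (det M) 1ᴹ))
      (≈ᴹ-trans (·ᴹ-cong p ≈ᴹ-refl) (·ᴹ-identity 1ᴹ))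

    inverseˡ : ∀ ((M , δ , _) : Σ (Matrix₂ Carrier) (IsUnit R ∘ det)) → (δ ·ᴹ adj M) *ᴹ M ≈ᴹ 1ᴹ
    inverseˡ (M , δ , p , _) = ≈ᴹ-trans (·ᴹ-*ᴹ δ (adj M) M)
      (≈ᴹ-trans (·ᴹ-cong refl (adj-inverseˡ M)) (scale M δ p))

    inverseʳ : ∀ ((M , δ , _) : Σ (Matrix₂ Carrier) (IsUnit R ∘ det)) → M *ᴹ (δ ·ᴹ adj M) ≈ᴹ 1ᴹ
    inverseʳ (M , δ , p , _) = ≈ᴹ-trans (*ᴹ-·ᴹ δ M (adj M))
      (≈ᴹ-trans (·ᴹ-cong refl (adj-inverseʳ M)) (scale M δ p))

open Matrices public using (GL₂)

record IsCongruence (G : Grp) (_∼_ : Rel (Group.Carrier G) 0ℓ) : Set where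
  open Group G using (Carrier; _≈_; _∙_)
  field
    isEquivalence : IsEquivalence _∼_
    reflexive : ∀ {g h} → g ≈ h → g ∼ h
    ∙-cong : ∀ {g h k l} → g ∼ h → k ∼ l → (g ∙ k) ∼ (h ∙ l)

module _ (G : Grp) {_∼_ : Rel (Group.Carrier G) 0ℓ} (isCongruence : IsCongruence G _∼_) where
  open Group G hiding (isEquivalence; reflexive; ∙-cong)
  open Group G using () renaming (∙-congʳ to ≈-congʳ)
  open IsCongruence isCongruence

  private
    module ∼ = IsEquivalence isEquivalence

    ⁻¹-cong-∼ : ∀ {g h} → g ∼ h → (g ⁻¹) ∼ (h ⁻¹)
    ⁻¹-cong-∼ {g} {h} g∼h = ∼.trans (reflexive (sym eq₁))
      (∼.trans (∙-cong (∙-cong (∼.refl {h ⁻¹}) (∼.sym g∼h)) (∼.refl {g ⁻¹})) (reflexive eq₂))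
      where
      eq₁ : h ⁻¹ ∙ h ∙ g ⁻¹ ≈ g ⁻¹
      eq₁ = trans (≈-congʳ (inverseˡ h)) (identityˡ (g ⁻¹))
      eq₂ : h ⁻¹ ∙ g ∙ g ⁻¹ ≈ h ⁻¹
      eq₂ = GroupProperties.//-rightDividesʳ G g (h ⁻¹)

  quotientGroup : Grp
  quotientGroup = record
    { Carrier = Carrier
    ; _≈_ = _∼_
    ; _∙_ = _∙_
    ; ε = ε
    ; _⁻¹ = _⁻¹
    ; isGroup = record
      { isMonoid = record
        { isSemigroup = record
          { isMagma = record { isEquivalence = isEquivalence ; ∙-cong = ∙-cong }
          ; assoc = λ g h k → reflexive (assoc g h k)
          }
        ; identity = (reflexive ∘ identityˡ) , (reflexive ∘ identityʳ)
        }
      ; inverse = (reflexive ∘ inverseˡ) , (reflexive ∘ inverseʳ)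
      ; ⁻¹-cong = ⁻¹-cong-∼
      }
    }

module _ (A : Ab) {_∼_ : Rel (AbelianGroup.Carrier A) 0ℓ}
         (isCongruence : IsCongruence (AbelianGroup.group A) _∼_) where
  open AbelianGroup A

  quotientAb : Ab
  quotientAb = record
    { isAbelianGroup = record
      { isGroup = Group.isGroup (quotientGroup group isCongruence)
      ; comm = λ a b → IsCongruence.reflexive isCongruence (comm a b)
      }
    }

module DoubleCoset (Γ G K : Grp) (φ : Γ ⟶ᵍ G) (ψ : K ⟶ᵍ G) where
  open Group G hiding (isEquivalence; reflexive; setoid)
  open GroupProperties G
  private
    module Γ = Group Γ
    module K = Group K
    module φ = GroupHomomorphism φ
    module ψ = GroupHomomorphism ψ

  infix 4 _∼_

  _∼_ : Rel Carrier 0ℓ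
  g ∼ h = ∃[ γ ] ∃[ κ ] φ.⟦ γ ⟧ ∙ g ∙ ψ.⟦ κ ⟧ ≈ h

  private
    ≈⇒∼ : ∀ {g h} → g ≈ h → g ∼ h
    ≈⇒∼ g≈h = Γ.ε , K.ε ,
      trans (∙-cong (∙-congʳ φ.ε-homo) ψ.ε-homo) (trans (identityʳ _) (trans (identityˡ _) g≈h))

    ∼-sym : ∀ {g h} → g ∼ h → h ∼ g
    ∼-sym {g} {h} (γ , κ , eq) = γ Γ.⁻¹ , κ K.⁻¹ , (begin
      φ.⟦ γ Γ.⁻¹ ⟧ ∙ h ∙ ψ.⟦ κ K.⁻¹ ⟧                  ≈⟨ ∙-cong (∙-cong (φ.⁻¹-homo γ) (sym eq)) (ψ.⁻¹-homo κ) ⟩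
      a ⁻¹ ∙ (a ∙ g ∙ b) ∙ b ⁻¹                          ≈⟨ ∙-congʳ (∙-congˡ (assoc a g b)) ⟩
      a ⁻¹ ∙ (a ∙ (g ∙ b)) ∙ b ⁻¹                        ≈⟨ ∙-congʳ (\\-leftDividesʳ a (g ∙ b)) ⟩
      g ∙ b ∙ b ⁻¹                                       ≈⟨ //-rightDividesʳ b g ⟩
      g                                                  ∎)
      where
      open SetoidReasoning (Group.setoid G)
      a = φ.⟦ γ ⟧
      b = ψ.⟦ κ ⟧

    ∼-trans : ∀ {g h k} → g ∼ h → h ∼ k → g ∼ k
    ∼-trans {g} {h} {k} (γ , κ , p) (γ′ , κ′ , q) = γ′ Γ.∙ γ , κ K.∙ κ′ , (begin
      φ.⟦ γ′ Γ.∙ γ ⟧ ∙ g ∙ ψ.⟦ κ K.∙ κ′ ⟧  ≈⟨ ∙-cong (∙-congʳ (φ.homo γ′ γ)) (ψ.homo κ κ′) ⟩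
      (a′ ∙ a) ∙ g ∙ (b ∙ b′)              ≈⟨ sym (assoc _ b b′) ⟩
      (a′ ∙ a) ∙ g ∙ b ∙ b′                ≈⟨ ∙-congʳ (∙-congʳ (assoc a′ a g)) ⟩
      a′ ∙ (a ∙ g) ∙ b ∙ b′                ≈⟨ ∙-congʳ (assoc a′ (a ∙ g) b) ⟩
      a′ ∙ (a ∙ g ∙ b) ∙ b′                ≈⟨ ∙-congʳ (∙-congˡ p) ⟩
      a′ ∙ h ∙ b′                          ≈⟨ q ⟩
      k                                    ∎)
      where
      open SetoidReasoning (Group.setoid G)
      a = φ.⟦ γ ⟧
      b = ψ.⟦ κ ⟧
      a′ = φ.⟦ γ′ ⟧
      b′ = ψ.⟦ κ′ ⟧

  isEquivalence : IsEquivalence _∼_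
  isEquivalence = record { refl = ≈⇒∼ refl ; sym = ∼-sym ; trans = ∼-trans }

  reflexive : ∀ {g h} → g ≈ h → g ∼ h
  reflexive = ≈⇒∼

  setoid : Setoid 0ℓ 0ℓ
  setoid = record { isEquivalence = isEquivalence }

module _ (A : Ab) (Γ K : Grp)
         (φ : Γ ⟶ᵍ AbelianGroup.group A) (ψ : K ⟶ᵍ AbelianGroup.group A) where
  open AbelianGroup A
  open CommutativeSemigroupProperties commutativeSemigroup using (interchange)
  private
    module Γ = Group Γ
    module K = Group K
    module φ = GroupHomomorphism φ
    module ψ = GroupHomomorphism ψ

    module D = DoubleCoset Γ group K φ ψ

    isCongruence : IsCongruence group D._∼_
    isCongruence = record
      { isEquivalence = D.isEquivalence
      ; reflexive = D.reflexive
      ; ∙-cong = λ (γ , κ , p) (γ′ , κ′ , q) → γ Γ.∙ γ′ , κ K.∙ κ′ ,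
          trans (∙-cong (∙-congʳ (φ.homo γ γ′)) (ψ.homo κ κ′))
          (trans (∙-congʳ (interchange _ _ _ _)) (trans (interchange _ _ _ _) (∙-cong p q)))
      }

  doubleQuotient : Ab
  doubleQuotient = quotientAb A isCongruence

module _ (A : Ab) where
  open AbelianGroup A

  infix 4 _∼²_

  _∼²_ : Rel Carrier 0ℓ
  a ∼² b = ∃[ d ] a ∙ (d ∙ d) ≈ b

  private
    open CommutativeSemigroupProperties commutativeSemigroup using (interchange)

    isCongruence : IsCongruence group _∼²_
    isCongruence = record
      { isEquivalence = record
        { refl = ∼²-refl
        ; sym = ∼²-sym
        ; trans = λ {a} {b} {c} (d , p) (e , q) → d ∙ e ,
            trans (∙-congˡ (interchange d e d e)) (trans (sym (assoc a _ _)) (trans (∙-congʳ p) q))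
        }
      ; reflexive = λ a≈b → ε , trans (∙-congˡ (identityˡ ε)) (trans (identityʳ _) a≈b)
      ; ∙-cong = λ (d , p) (e , q) → d ∙ e ,
          trans (∙-congˡ (interchange d e d e)) (trans (interchange _ _ _ _) (∙-cong p q))
      }
      where
      ∼²-refl : ∀ {a} → a ∼² a
      ∼²-refl {a} = ε , trans (∙-congˡ (identityˡ ε)) (identityʳ a)
      ∼²-sym : ∀ {a b} → a ∼² b → b ∼² a
      ∼²-sym {a} {b} (d , p) = d ⁻¹ ,
        trans (∙-cong (sym p) (AbelianGroupProperties.⁻¹-∙-comm A d d))
          (GroupProperties.//-rightDividesʳ group (d ∙ d) a)

  mod2 : Ab
  mod2 = quotientAb A isCongruence

  IsSquare : Pred Carrier 0ℓ
  IsSquare a = ∃[ d ] d ∙ d ≈ a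

  2-torsion : Setoid 0ℓ 0ℓ
  2-torsion = record
    { Carrier = ∃[ a ] a ∙ a ≈ ε
    ; _≈_ = λ a b → proj₁ a ≈ proj₁ b
    ; isEquivalence = On.isEquivalence proj₁ isEquivalence
    }

-- R ↦ GL₂(R)/R^×.  For the rings used below (a field, the adeles, a product
-- of valuation rings) this is the group of R-points of the algebraic group
-- PGL₂.
module _ (R : Ring) where
  open CommutativeRing R using (refl)
  open Matrices R hiding (GL₂)
  private
    module Units = AbelianGroup (Units R)

    _∼_ : Rel (Group.Carrier (GL₂ R)) 0ℓ
    (M , _) ∼ (N , _) = Σ[ u ∈ Units.Carrier ] proj₁ u ·ᴹ M ≈ᴹ N

    isCongruence : IsCongruence (GL₂ R) _∼_
    isCongruence = record
      { isEquivalence = record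
        { refl = λ {(M , _)} → Units.ε , ·ᴹ-identity M
        ; sym = λ {(M , _)} (r@(u , v , vu≈1 , _) , uM≈N) → r Units.⁻¹ ,
            ≈ᴹ-trans (·ᴹ-cong refl (≈ᴹ-sym uM≈N)) (≈ᴹ-trans (≈ᴹ-sym (·ᴹ-assoc v u M))
              (≈ᴹ-trans (·ᴹ-cong vu≈1 ≈ᴹ-refl) (·ᴹ-identity M)))
        ; trans = λ {(M , _)} (r , p) (s , q) → s Units.∙ r ,
            ≈ᴹ-trans (·ᴹ-assoc (proj₁ s) (proj₁ r) M) (≈ᴹ-trans (·ᴹ-cong refl p) q)
        }
      ; reflexive = λ {(M , _)} M≈N → Units.ε , ≈ᴹ-trans (·ᴹ-identity M) M≈N
      ; ∙-cong = λ {(M , _)} {_} {(N , _)} (r , p) (s , q) → r Units.∙ s ,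
          ≈ᴹ-trans (·ᴹ-assoc (proj₁ r) (proj₁ s) (M *ᴹ N))
          (≈ᴹ-trans (·ᴹ-cong refl (≈ᴹ-sym (*ᴹ-·ᴹ (proj₁ s) M N)))
          (≈ᴹ-trans (≈ᴹ-sym (·ᴹ-*ᴹ (proj₁ r) M _)) (*ᴹ-cong p q)))
      }

  PGL₂ : Grp
  PGL₂ = quotientGroup (GL₂ R) isCongruence

module Functoriality {R S : Ring} (f : R ⟶ʳ S) where
  private
    module R = CommutativeRing R
    module S = CommutativeRing S
    module f = RingHomomorphism f
    module MR = Matrices R
    module MS = Matrices S

  isUnit-map : ∀ {a} → IsUnit R a → IsUnit S f.⟦ a ⟧
  isUnit-map (b , p , q) = f.⟦ b ⟧ ,
    S.trans (S.sym (f.*-homo _ _)) (S.trans (f.⟦⟧-cong p) f.1#-homo) ,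
    S.trans (S.sym (f.*-homo _ _)) (S.trans (f.⟦⟧-cong q) f.1#-homo)

  Units-map : AbelianGroup.group (Units R) ⟶ᵍ AbelianGroup.group (Units S)
  Units-map = record
    { ⟦_⟧ = λ (a , u) → f.⟦ a ⟧ , isUnit-map u
    ; isGroupHomomorphism = record
      { isMonoidHomomorphism = record
        { isMagmaHomomorphism = record
          { isRelHomomorphism = record { cong = f.⟦⟧-cong }
          ; homo = λ _ _ → f.*-homo _ _
          }
        ; ε-homo = f.1#-homo
        }
      ; ⁻¹-homo = λ _ → S.refl
      }
    }

  mapᴹ : Matrix₂ R.Carrier → Matrix₂ S.Carrier
  mapᴹ (mat a b c d) = mat f.⟦ a ⟧ f.⟦ b ⟧ f.⟦ c ⟧ f.⟦ d ⟧

  det-map : ∀ M → f.⟦ MR.det M ⟧ S.≈ MS.det (mapᴹ M)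
  det-map (mat a b c d) = S.trans (f.+-homo _ _)
    (S.+-cong (f.*-homo a d) (S.trans (f.-‿homo _) (S.-‿cong (f.*-homo b c))))

  mapᴹ-cong : ∀ {M N} → M MR.≈ᴹ N → mapᴹ M MS.≈ᴹ mapᴹ N
  mapᴹ-cong (MR.mat≈ p q r s) =
    MS.mat≈ (f.⟦⟧-cong p) (f.⟦⟧-cong q) (f.⟦⟧-cong r) (f.⟦⟧-cong s)

  mapᴹ-* : ∀ M N → mapᴹ (M MR.*ᴹ N) MS.≈ᴹ mapᴹ M MS.*ᴹ mapᴹ N
  mapᴹ-* (mat a b c d) (mat e g h i) =
    MS.mat≈ (homo a e b h) (homo a g b i) (homo c e d h) (homo c g d i)
    where
    homo : ∀ a b c d → f.⟦ a R.* b R.+ c R.* d ⟧ S.≈ f.⟦ a ⟧ S.* f.⟦ b ⟧ S.+ f.⟦ c ⟧ S.* f.⟦ d ⟧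
    homo a b c d = S.trans (f.+-homo _ _) (S.+-cong (f.*-homo a b) (f.*-homo c d))

  mapᴹ-· : ∀ r M → mapᴹ (r MR.·ᴹ M) MS.≈ᴹ f.⟦ r ⟧ MS.·ᴹ mapᴹ M
  mapᴹ-· r (mat a b c d) =
    MS.mat≈ (f.*-homo r a) (f.*-homo r b) (f.*-homo r c) (f.*-homo r d)

  GL₂-map : GL₂ R ⟶ᵍ GL₂ S
  GL₂-map = record
    { ⟦_⟧ = λ (M , u) → mapᴹ M , isUnit-resp S (det-map M) (isUnit-map u)
    ; isGroupHomomorphism = record
      { isMonoidHomomorphism = record
        { isMagmaHomomorphism = record
          { isRelHomomorphism = record { cong = mapᴹ-cong }
          ; homo = λ (M , _) (N , _) → mapᴹ-* M N
          }
        ; ε-homo = MS.mat≈ f.1#-homo f.0#-homo f.0#-homo f.1#-homo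
        }
      ; ⁻¹-homo = λ (M , δ , _) → MS.≈ᴹ-trans (mapᴹ-· δ (MR.adj M))
          (MS.·ᴹ-cong S.refl (MS.mat≈ S.refl (f.-‿homo _) (f.-‿homo _) S.refl))
      }
    }

  PGL₂-map : PGL₂ R ⟶ᵍ PGL₂ S
  PGL₂-map = record
    { ⟦_⟧ = GL.⟦_⟧
    ; isGroupHomomorphism = record
      { isMonoidHomomorphism = record
        { isMagmaHomomorphism = record
          { isRelHomomorphism = record
            { cong = λ {(M , _)} ((u , u-unit) , p) → (f.⟦ u ⟧ , isUnit-map u-unit) ,
                MS.≈ᴹ-trans (MS.≈ᴹ-sym (mapᴹ-· u M)) (mapᴹ-cong p)
            }
          ; homo = λ g h → reflexive GL.⟦ g Gᴿ.∙ h ⟧ (GL.⟦ g ⟧ Gˢ.∙ GL.⟦ h ⟧) (GL.homo g h)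
          }
        ; ε-homo = reflexive GL.⟦ Gᴿ.ε ⟧ Gˢ.ε GL.ε-homo
        }
      ; ⁻¹-homo = λ g → reflexive GL.⟦ g Gᴿ.⁻¹ ⟧ (GL.⟦ g ⟧ Gˢ.⁻¹) (GL.⁻¹-homo g)
      }
    }
    where
    module Gᴿ = Group (GL₂ R)
    module Gˢ = Group (GL₂ S)
    module GL = GroupHomomorphism GL₂-map
    reflexive : ∀ g h → MS._≈ᴹ_ (proj₁ g) (proj₁ h) → Group._≈_ (PGL₂ S) g h
    reflexive (M , _) _ p = AbelianGroup.ε (Units S) , MS.≈ᴹ-trans (MS.·ᴹ-identity M) p

-- R, A and O are the field F, its adeles and the integral adeles.
module Adelic (R A O : Ring) (ι : R ⟶ʳ A) (κ : O ⟶ʳ A) where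
  private
    module ι = Functoriality {R} {A} ι
    module κ = Functoriality {O} {A} κ
    module A = CommutativeRing A
    module M = Matrices A

  -- R^×\A^×/O^×
  classGroup : Ab
  classGroup = doubleQuotient (Units A) (AbelianGroup.group (Units R)) (AbelianGroup.group (Units O))
    ι.Units-map κ.Units-map

  -- PGL₂(R)\PGL₂(A)/PGL₂(O)
  vertices : Setoid 0ℓ 0ℓ
  vertices = DoubleCoset.setoid (PGL₂ R) (PGL₂ A) (PGL₂ O) ι.PGL₂-map κ.PGL₂-map

  label : Func vertices (AbelianGroup.setoid (mod2 classGroup))
  label = record
    { to = λ (g , u) → M.det g , u
    ; cong = λ {g} {h} → label-cong g h
    }
    where
    open SetoidReasoning A.setoid

    label-cong : ∀ g h → Setoid._≈_ vertices g h →
      AbelianGroup._≈_ (mod2 classGroup) (M.det (proj₁ g) , proj₂ g) (M.det (proj₁ h) , proj₂ h)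
    label-cong (g , _) (h , _) ((γ , γ-unit) , (k , k-unit) , u , ugkh) =
      u , (Matrices.det R γ , γ-unit) , (Matrices.det O k , k-unit) , (begin
        γ′ A.* (M.det g A.* (r A.* r)) A.* k′
          ≈⟨ rearrange γ′ (M.det g) (r A.* r) k′ ⟩
        r A.* r A.* (γ′ A.* M.det g A.* k′)
          ≈⟨ A.*-congˡ (A.*-cong (A.*-congʳ (ι.det-map γ)) (κ.det-map k)) ⟩
        r A.* r A.* (M.det (ι.mapᴹ γ) A.* M.det g A.* M.det (κ.mapᴹ k))
          ≈⟨ A.*-congˡ (A.sym (A.trans (M.det-* _ (κ.mapᴹ k)) (A.*-congʳ (M.det-* (ι.mapᴹ γ) g)))) ⟩
        r A.* r A.* M.det (ι.mapᴹ γ M.*ᴹ g M.*ᴹ κ.mapᴹ k)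
          ≈⟨ A.sym (M.det-· r _) ⟩
        M.det (r M.·ᴹ (ι.mapᴹ γ M.*ᴹ g M.*ᴹ κ.mapᴹ k))
          ≈⟨ M.det-cong ugkh ⟩
        M.det h ∎)
      where
      r γ′ k′ : A.Carrier
      r = proj₁ u
      γ′ = RingHomomorphism.⟦_⟧ ι (Matrices.det R γ)
      k′ = RingHomomorphism.⟦_⟧ κ (Matrices.det O k)

      open SemiringSolver A.commutativeSemiring using (solve; _:*_; _:=_)
      rearrange : ∀ a b c d → a A.* (b A.* c) A.* d A.≈ c A.* (a A.* b A.* d)
      rearrange = solve 4 (λ a b c d → a :* (b :* c) :* d := c :* (a :* b :* d)) A.refl

module Polynomials (k R : Ring) (φ : k ⟶ʳ R) where
  private
    module k = CommutativeRing k
    module R = CommutativeRing R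
    module φ = RingHomomorphism φ

  -- A polynomial c₀ + c₁X + c₂X² + … over k is the list c₀ ∷ c₁ ∷ c₂ ∷ ….
  eval : List k.Carrier → R.Carrier → R.Carrier
  eval p a = foldr (λ c r → φ.⟦ c ⟧ R.+ a R.* r) R.0# p

  NonzeroPoly : Pred (List k.Carrier) 0ℓ
  NonzeroPoly = Any (k._≉ k.0#)

  Algebraic : Pred R.Carrier 0ℓ
  Algebraic a = ∃[ p ] NonzeroPoly p × eval p a R.≈ R.0#

  -- Every z is of the form Σᵢ (cᵢ(t)/d(t)) eᵢ.
  GeneratesOverRationalFunctions : R.Carrier → (n : ℕ) → (Fin n → R.Carrier) → Set
  GeneratesOverRationalFunctions t n e = ∀ z → ∃[ d ] Σ[ c ∈ (Fin n → List k.Carrier) ]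
    NonzeroPoly d × eval d t R.* z R.≈ sum (λ i → eval (c i) t R.* e i)
    where open RawMonoidOperations R.+-rawMonoid using (sum)

-- The function fields of smooth projective geometrically irreducible curves
-- over a finite field 𝔽q: finite extensions F of 𝔽q(t), t transcendental, with
-- 𝔽q algebraically closed in F.  The fields are classical ones: under excluded
-- middle the (tight) apartness of a Heyting field is the negation of equality.
record FunctionField : Set₁ where
  field
    q : ℕ
    𝔽q : HeytingField 0ℓ 0ℓ 0ℓ
    𝔽q-cardinality : HasCardinality (CommutativeRing.setoid (fieldRing 𝔽q)) q
    F : HeytingField 0ℓ 0ℓ 0ℓ
    constants : fieldRing 𝔽q ⟶ʳ fieldRing F

  open RingHomomorphism constants using (⟦_⟧)
  open HeytingField F using (Carrier; _≈_)
  open Polynomials (fieldRing 𝔽q) (fieldRing F) constants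

  field
    transcendence-degree-one : ∃[ t ] ¬ Algebraic t ×
      (∃[ n ] ∃[ e ] GeneratesOverRationalFunctions t n e)
    algebraically-closed : ∀ a → Algebraic a → ∃[ c ] ⟦ c ⟧ ≈ a

ℤ∞ : Set
ℤ∞ = ℤ ⁺

infixl 6 _+∞_

_+∞_ : ℤ∞ → ℤ∞ → ℤ∞
_+∞_ = zipWith ℤ._+_

open AddSupremum ℤ._≤_ public using () renaming (_≤⁺_ to _≤∞_)
open AddSupremum ℤ._≤_ using (≤⁺-trans; _≤⊤⁺) renaming ([_] to [_]≤)

-- The places of F: its normalised discrete valuations.  They are trivial on 𝔽q,
-- whose nonzero elements are roots of unity.
record Place (K : FunctionField) : Set where
  open FunctionField K using (F)
  open CommutativeRing (fieldRing F)
  field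
    v : Carrier → ℤ∞
    v-cong : ∀ {a b} → a ≈ b → v a ≡ v b
    v-⊤ : ∀ a → v a ≡ ⊤⁺ ⇔ a ≈ 0#
    v-* : ∀ a b → v (a * b) ≡ v a +∞ v b
    -- v (a + b) is at least the minimum of v a and v b
    v-+ : ∀ {a b n} → n ≤∞ v a → n ≤∞ v b → n ≤∞ v (a + b)
    normalised : ∃[ a ] v a ≡ [ + 1 ]

Eventually : Pred ℕ 0ℓ → Set
Eventually P = ∃[ M ] ∀ n → M ℕ.≤ n → P n

private
  eventually₂ : {P Q R : Pred ℕ 0ℓ} → (∀ n → P n → Q n → R n) →
                Eventually P → Eventually Q → Eventually R
  eventually₂ f (M , p) (N , q) = M ℕ.⊔ N ,
    λ n M⊔N≤n → f n (p n (ℕ.m⊔n≤o⇒m≤o M N M⊔N≤n)) (q n (ℕ.m⊔n≤o⇒n≤o M N M⊔N≤n))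

  eventually₁ : {P Q : Pred ℕ 0ℓ} → (∀ n → P n → Q n) → Eventually P → Eventually Q
  eventually₁ f (M , p) = M , λ n M≤n → f n (p n M≤n)

module _ {K : FunctionField} where
  open FunctionField K using (F)
  open CommutativeRing (fieldRing F)
  open RingProperties ring
  open CommutativeSemigroupProperties +-commutativeSemigroup using (interchange)

  infix 4 _≈ₚ_

  _≈ₚ_ : Rel (Place K) 0ℓ
  y ≈ₚ z = ∀ a → Place.v y a ≡ Place.v z a

  private
    ≈ₚ-sym : ∀ {y z} → y ≈ₚ z → z ≈ₚ y
    ≈ₚ-sym e a = ≡.sym (e a)

    ≈ₚ-trans : ∀ {w y z} → w ≈ₚ y → y ≈ₚ z → w ≈ₚ z
    ≈ₚ-trans d e a = ≡.trans (d a) (e a)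

  module _ (y : Place K) where
    open Place y

    infix 4 _≤v_

    _≤v_ : ℤ → Carrier → Set
    N ≤v a = [ N ] ≤∞ v a

    private
      ≤v-resp : ∀ {N a b} → a ≈ b → N ≤v a → N ≤v b
      ≤v-resp {N} a≈b = ≡.subst ([ N ] ≤∞_) (v-cong a≈b)

      ≤v-0 : ∀ {N} → N ≤v 0#
      ≤v-0 {N} = ≡.subst ([ N ] ≤∞_) (≡.sym (Equivalence.from (v-⊤ 0#) refl)) ([ N ] ≤⊤⁺)

      ≤v-weaken : ∀ {M N a} → M ℤ.≤ N → N ≤v a → M ≤v a
      ≤v-weaken M≤N = ≤⁺-trans ℤ.≤-trans [ M≤N ]≤

      ≤v-* : ∀ {M N a b} → M ≤v a → N ≤v b → (M ℤ.+ N) ≤v (a * b)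
      ≤v-* {M} {N} {a} {b} p q = ≡.subst ([ M ℤ.+ N ] ≤∞_) (≡.sym (v-* a b)) (add p q)
        where
        add : ∀ {m n} → [ M ] ≤∞ m → [ N ] ≤∞ n → [ M ℤ.+ N ] ≤∞ (m +∞ n)
        add [ p ]≤ [ q ]≤ = [ ℤ.+-mono-≤ p q ]≤
        add [ p ]≤ (_ ≤⊤⁺) = _ ≤⊤⁺
        add (_ ≤⊤⁺) _ = _ ≤⊤⁺

      double-nonneg : ∀ m → [ + 0 ] ≤∞ (m +∞ m) → [ + 0 ] ≤∞ m
      double-nonneg nothing _ = _ ≤⊤⁺
      double-nonneg (just (+ n)) _ = [ +≤+ ℕ.z≤n ]≤
      double-nonneg (just -[1+ n ]) [ () ]≤

      idempotent-nonneg : ∀ m → m ≡ m +∞ m → [ + 0 ] ≤∞ m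
      idempotent-nonneg nothing _ = _ ≤⊤⁺
      idempotent-nonneg (just (+ n)) _ = [ +≤+ ℕ.z≤n ]≤
      idempotent-nonneg (just -[1+ n ]) eq = ⊥-elim (ℕ.m≢1+m+n n (ℤ.-[1+-injective (just-injective eq)))

      ≤v-1 : (+ 0) ≤v 1#
      ≤v-1 = idempotent-nonneg (v 1#) (≡.trans (v-cong (sym (*-identityˡ 1#))) (v-* 1# 1#))

      ≤v--1 : (+ 0) ≤v (- 1#)
      ≤v--1 = double-nonneg (v (- 1#)) (≡.subst ([ + 0 ] ≤∞_) (v-* (- 1#) (- 1#))
        (≤v-resp (sym (trans (-1*x≈-x (- 1#)) (-‿involutive 1#))) ≤v-1))

      ≤v-neg : ∀ {N a} → N ≤v a → N ≤v (- a)
      ≤v-neg {N} {a} p = ≤v-resp (-1*x≈-x a)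
        (≡.subst (λ M → M ≤v (- 1# * a)) (ℤ.+-identityˡ N) (≤v-* ≤v--1 p))

    Cauchy : Pred (ℕ → Carrier) 0ℓ
    Cauchy a = ∀ N → ∃[ M ] ∀ m n → M ℕ.≤ m → M ℕ.≤ n → N ≤v (a m - a n)

    Null : Pred (ℕ → Carrier) 0ℓ
    Null a = ∀ N → Eventually (λ n → N ≤v a n)

    private
      eventually-bounded : ∀ {a} → Cauchy a → ∃[ B ] Eventually (λ n → B ≤v a n)
      eventually-bounded {a} cauchy with cauchy (+ 0)
      ... | M , close with lower-bound (v (a M))
        where
        lower-bound : ∀ m → ∃[ B ] B ℤ.≤ + 0 × [ B ] ≤∞ m
        lower-bound nothing = + 0 , ℤ.≤-refl , (_ ≤⊤⁺)
        lower-bound (just m) = + 0 ℤ.⊓ m , ℤ.i⊓j≤i (+ 0) m , [ ℤ.i⊓j≤j (+ 0) m ]≤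
      ... | B , B≤0 , B≤aM = B , M , λ n M≤n →
        ≤v-resp (//-rightDividesˡ (a M) (a n))
          (v-+ (≤v-weaken B≤0 (close n M M≤n ℕ.≤-refl)) B≤aM)

      ≤v-*-bounded : ∀ {B N a b} → B ≤v a → (N ℤ.- B) ≤v b → N ≤v (a * b)
      ≤v-*-bounded {B} {N} p q = ≡.subst (_≤v _) eq (≤v-* p q)
        where
        eq : B ℤ.+ (N ℤ.- B) ≡ N
        eq = ≡.trans (ℤ.+-comm B (N ℤ.- B)) (≡.trans (ℤ.+-assoc N (ℤ.- B) B)
          (≡.trans (≡.cong (λ M → N ℤ.+ M) (ℤ.+-inverseˡ B)) (ℤ.+-identityʳ N)))

      sub-+ : ∀ a b c d → (a - b) + (c - d) ≈ (a + c) - (b + d)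
      sub-+ a b c d = trans (interchange a (- b) c (- d)) (+-congˡ (-‿+-comm b d))

      sub-neg : ∀ a b → - (a - b) ≈ - a - - b
      sub-neg a b = sym (-‿+-comm a (- b))

      sub-* : ∀ a b c d → a * (c - d) + d * (a - b) ≈ a * c - b * d
      sub-* a b c d = begin
        a * (c - d) + d * (a - b)            ≈⟨ +-cong (x[y-z]≈xy-xz a c d) (x[y-z]≈xy-xz d a b) ⟩
        (a * c - a * d) + (d * a - d * b)    ≈⟨ +-congˡ (+-cong (*-comm d a) (-‿cong (*-comm d b))) ⟩
        (a * c - a * d) + (a * d - b * d)    ≈⟨ sym (+-assoc _ _ _) ⟩
        (a * c - a * d) + a * d - b * d      ≈⟨ +-congʳ (//-rightDividesˡ (a * d) (a * c)) ⟩
        a * c - b * d                        ∎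
        where open SetoidReasoning setoid

      pairs : ∀ {M₁ M₂ m n} → M₁ ℕ.⊔ M₂ ℕ.≤ m → M₁ ℕ.⊔ M₂ ℕ.≤ n →
              (M₁ ℕ.≤ m × M₁ ℕ.≤ n) × (M₂ ℕ.≤ m × M₂ ℕ.≤ n)
      pairs {M₁} {M₂} p q =
        (ℕ.m⊔n≤o⇒m≤o M₁ M₂ p , ℕ.m⊔n≤o⇒m≤o M₁ M₂ q) , (ℕ.m⊔n≤o⇒n≤o M₁ M₂ p , ℕ.m⊔n≤o⇒n≤o M₁ M₂ q)

    constant-cauchy : ∀ a → Cauchy (λ _ → a)
    constant-cauchy a N = 0 , λ _ _ _ _ → ≤v-resp (sym (-‿inverseʳ a)) ≤v-0

    cauchy-isSubring : IsSubring (Pointwise.commutativeRing ℕ (fieldRing F)) Cauchy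
    cauchy-isSubring = record
      { +-closed = +-closed
      ; *-closed = *-closed
      ; -‿closed = λ {a} p N → case p N of λ (M , close) → M ,
          λ m n M≤m M≤n → ≤v-resp (sub-neg (a m) (a n)) (≤v-neg (close m n M≤m M≤n))
      ; 0#-closed = constant-cauchy 0#
      ; 1#-closed = constant-cauchy 1#
      }
      where
      +-closed : ∀ {a b} → Cauchy a → Cauchy b → Cauchy (λ n → a n + b n)
      +-closed {a} {b} p q N with p N | q N
      ... | M₁ , close₁ | M₂ , close₂ = M₁ ℕ.⊔ M₂ , λ m n M≤m M≤n →
        let (m₁ , n₁) , (m₂ , n₂) = pairs M≤m M≤n in
        ≤v-resp (sub-+ (a m) (a n) (b m) (b n)) (v-+ (close₁ m n m₁ n₁) (close₂ m n m₂ n₂))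

      *-closed : ∀ {a b} → Cauchy a → Cauchy b → Cauchy (λ n → a n * b n)
      *-closed {a} {b} p q N with eventually-bounded p | eventually-bounded q
      ... | A , M₁ , bound₁ | B , M₂ , bound₂ with p (N ℤ.- B) | q (N ℤ.- A)
      ... | M₃ , close₁ | M₄ , close₂ = (M₁ ℕ.⊔ M₂) ℕ.⊔ (M₃ ℕ.⊔ M₄) , λ m n M≤m M≤n →
        let (m₁₂ , n₁₂) , (m₃₄ , n₃₄) = pairs M≤m M≤n
            (m₁ , _) , (_ , n₂) = pairs m₁₂ n₁₂
            (m₃ , n₃) , (m₄ , n₄) = pairs m₃₄ n₃₄
        in ≤v-resp (sub-* (a m) (a n) (b m) (b n))
             (v-+ (≤v-*-bounded (bound₁ m m₁) (close₂ m n m₄ n₄))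
                  (≤v-*-bounded (bound₂ n n₂) (close₁ m n m₃ n₃)))

    cauchyRing : Ring
    cauchyRing = subring (Pointwise.commutativeRing ℕ (fieldRing F)) cauchy-isSubring

    null-isIdeal : IsIdeal cauchyRing (Null ∘ proj₁)
    null-isIdeal = record
      { resp = λ a≈b p N → eventually₁ (λ n → ≤v-resp (a≈b n)) (p N)
      ; 0#-closed = λ N → 0 , λ _ _ → ≤v-0
      ; +-closed = λ p q N → eventually₂ (λ n → v-+) (p N) (q N)
      ; *-absorb = λ (_ , cauchy) p N → case eventually-bounded cauchy of λ (B , bounded) →
          eventually₂ (λ n → ≤v-*-bounded) bounded (p (N ℤ.- B))
      }

    completion : Ring
    completion = quotientRing cauchyRing null-isIdeal

    embed : fieldRing F ⟶ʳ completion
    embed = record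
      { ⟦_⟧ = λ a → (λ _ → a) , constant-cauchy a
      ; isRingHomomorphism = record
        { isSemiringHomomorphism = record
          { isNearSemiringHomomorphism = record
            { +-isMonoidHomomorphism = record
              { isMagmaHomomorphism = record
                { isRelHomomorphism = record
                  { cong = λ {a} {b} a≈b N → 0 , λ _ _ →
                      ≤v-resp (trans (sym (-‿inverseʳ a)) (+-congˡ (-‿cong a≈b))) ≤v-0
                  }
                ; homo = λ a b → refl′ (a + b)
                }
              ; ε-homo = refl′ 0#
              }
            ; *-homo = λ a b → refl′ (a * b)
            }
          ; 1#-homo = refl′ 1#
          }
        ; -‿homo = λ a → refl′ (- a)
        }
      }
      where
      refl′ : ∀ a → Null (λ _ → a - a)
      refl′ a N = 0 , λ _ _ → ≤v-resp (sym (-‿inverseʳ a)) ≤v-0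

    private
      module completion = CommutativeRing completion

    -- The valuation of the limit of (aₙ) is the limit of the valuations of the aₙ.
    Valuation≥ : ℤ → Pred completion.Carrier 0ℓ
    Valuation≥ N (a , _) = Eventually (λ n → N ≤v a n)

    HasValuation : ℤ → Pred completion.Carrier 0ℓ
    HasValuation m (a , _) = Eventually (λ n → v (a n) ≡ [ m ])

    Integral : Pred completion.Carrier 0ℓ
    Integral = Valuation≥ (+ 0)

    integral-isSubring : IsSubring completion Integral
    integral-isSubring = record
      { +-closed = eventually₂ (λ n → v-+)
      ; *-closed = eventually₂ (λ n → ≤v-*)
      ; -‿closed = eventually₁ (λ n → ≤v-neg)
      ; 0#-closed = 0 , λ _ _ → ≤v-0
      ; 1#-closed = 0 , λ _ _ → ≤v-1
      }

    valuationRing : Ring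
    valuationRing = subring completion integral-isSubring

    maximal-isIdeal : IsIdeal valuationRing (Valuation≥ (+ 1) ∘ proj₁)
    maximal-isIdeal = record
      { resp = λ {((a , _) , _)} {((b , _) , _)} a≈b p →
          eventually₂ (λ n i j → ≤v-resp (recover (a n) (b n)) (v-+ (≤v-neg i) j)) (a≈b (+ 1)) p
      ; 0#-closed = 0 , λ _ _ → ≤v-0
      ; +-closed = eventually₂ (λ n → v-+)
      ; *-absorb = λ (_ , integral) → eventually₂ (λ n → ≤v-*) integral
      }
      where
      recover : ∀ a b → - (a - b) + a ≈ b
      recover a b = trans (+-congʳ (⁻¹-anti-homo-// a b)) (//-rightDividesˡ a b)

    residueField : Ring
    residueField = quotientRing valuationRing maximal-isIdeal

module _ (K : FunctionField) where
  open FunctionField K using (F)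
  open CommutativeRing (fieldRing F)

  private
    module completion (y : Place K) = CommutativeRing (completion y)

  -- The identification of the completions at two equal places.
  transport : ∀ (y z : Place K) → y ≈ₚ z → completion.Carrier z → completion.Carrier y
  transport y z e (a , cauchy) = a , λ N → case cauchy N of λ (M , close) → M ,
    λ m n M≤m M≤n → ≡.subst ([ N ] ≤∞_) (≡.sym (e (a m - a n))) (close m n M≤m M≤n)

  families : Ring
  families = Π-ring (Place K) completion

  private
    module families = CommutativeRing families

  -- A place can be given by several, pointwise equal, valuation functions; the
  -- components of a family at these must agree.
  Coherent : Pred families.Carrier 0ℓ
  Coherent a = ∀ {y z : Place K} (e : y ≈ₚ z) → completion._≈_ y (a y) (transport y z e (a z))

  AlmostEverywhereIntegral : Pred families.Carrier 0ℓ
  AlmostEverywhereIntegral a = ∃[ S ] ∀ (y : Place K) → ¬ Any (y ≈ₚ_) S → Integral y (a y)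

  IsAdele : Pred families.Carrier 0ℓ
  IsAdele a = Coherent a × AlmostEverywhereIntegral a

  private
    almost₁ : ∀ {a b} → (∀ (y : Place K) → Integral y (a y) → Integral y (b y)) →
              AlmostEverywhereIntegral a → AlmostEverywhereIntegral b
    almost₁ f (S , p) = S , λ y y∉S → f y (p y y∉S)

    almost₂ : ∀ {a b c} → (∀ (y : Place K) → Integral y (a y) → Integral y (b y) → Integral y (c y)) →
              AlmostEverywhereIntegral a → AlmostEverywhereIntegral b → AlmostEverywhereIntegral c
    almost₂ f (S , p) (T , q) = S ++ T , λ y y∉S++T →
      f y (p y (y∉S++T ∘ ++⁺ˡ)) (q y (y∉S++T ∘ ++⁺ʳ S))

  adele-isSubring : IsSubring families IsAdele
  adele-isSubring = record
    { +-closed = λ {a} {b} (p , i) (q , j) →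
        (λ {y z} e → completion.+-cong y {a y} {transport y z e (a z)} {b y} {transport y z e (b z)} (p e) (q e)) ,
        almost₂ {a} {b} {λ y → completion._+_ y (a y) (b y)}
          (λ y → IsSubring.+-closed (integral-isSubring y) {a y} {b y}) i j
    ; *-closed = λ {a} {b} (p , i) (q , j) →
        (λ {y z} e → completion.*-cong y {a y} {transport y z e (a z)} {b y} {transport y z e (b z)} (p e) (q e)) ,
        almost₂ {a} {b} {λ y → completion._*_ y (a y) (b y)}
          (λ y → IsSubring.*-closed (integral-isSubring y) {a y} {b y}) i j
    ; -‿closed = λ {a} (p , i) →
        (λ {y z} e → completion.-‿cong y {a y} {transport y z e (a z)} (p e)) ,
        almost₁ {a} {λ y → completion.-_ y (a y)}
          (λ y → IsSubring.-‿closed (integral-isSubring y) {a y}) i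
    ; 0#-closed = (λ {y} e → completion.refl y {completion.0# y}) ,
        [] , λ y _ → IsSubring.0#-closed (integral-isSubring y)
    ; 1#-closed = (λ {y} e → completion.refl y {completion.1# y}) ,
        [] , λ y _ → IsSubring.1#-closed (integral-isSubring y)
    }

  𝔸 : Ring
  𝔸 = subring families adele-isSubring

  private
    module 𝔸 = CommutativeRing 𝔸

  integralAdele-isSubring : IsSubring 𝔸 (λ (a , _) → ∀ (y : Place K) → Integral y (a y))
  integralAdele-isSubring = record
    { +-closed = λ {(a , _)} {(b , _)} p q y → IsSubring.+-closed (integral-isSubring y) {a y} {b y} (p y) (q y)
    ; *-closed = λ {(a , _)} {(b , _)} p q y → IsSubring.*-closed (integral-isSubring y) {a y} {b y} (p y) (q y)
    ; -‿closed = λ {(a , _)} p y → IsSubring.-‿closed (integral-isSubring y) {a y} (p y)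
    ; 0#-closed = λ y → IsSubring.0#-closed (integral-isSubring y)
    ; 1#-closed = λ y → IsSubring.1#-closed (integral-isSubring y)
    }

  𝒪𝔸 : Ring
  𝒪𝔸 = subring 𝔸 integralAdele-isSubring

  Principal : Pred 𝔸.Carrier 0ℓ
  Principal (a , _) = ∃[ f ] ∀ (y : Place K) → completion._≈_ y (a y) (RingHomomorphism.⟦_⟧ (embed y) f)

  principal-isSubring : IsSubring 𝔸 Principal
  principal-isSubring = record
    { +-closed = λ {(a , _)} {(b , _)} (f , p) (g , q) → f + g , λ y →
        completion.+-cong y {a y} {⟦ f ⟧ y} {b y} {⟦ g ⟧ y} (p y) (q y)
    ; *-closed = λ {(a , _)} {(b , _)} (f , p) (g , q) → f * g , λ y →
        completion.*-cong y {a y} {⟦ f ⟧ y} {b y} {⟦ g ⟧ y} (p y) (q y)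
    ; -‿closed = λ {(a , _)} (f , p) → - f , λ y → completion.-‿cong y {a y} {⟦ f ⟧ y} (p y)
    ; 0#-closed = 0# , λ y → completion.refl y {completion.0# y}
    ; 1#-closed = 1# , λ y → completion.refl y {completion.1# y}
    }
    where
    ⟦_⟧ : Carrier → ∀ y → completion.Carrier y
    ⟦ f ⟧ y = RingHomomorphism.⟦_⟧ (embed y) f

  -- F as a subring of 𝔸, embedded diagonally.  An element f of F has only
  -- finitely many poles, so the constant family f is an adele.
  F⊂𝔸 : Ring
  F⊂𝔸 = subring 𝔸 principal-isSubring

  open Adelic F⊂𝔸 𝔸 𝒪𝔸 (inclusion 𝔸 principal-isSubring) (inclusion 𝔸 integralAdele-isSubring)
    public renaming (classGroup to Cl)

infixr 4 _,ᴳ_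

_,ᴳ_ : ∀ {R S : Ring} → Group.Carrier (GL₂ R) → Group.Carrier (GL₂ S) →
       Group.Carrier (GL₂ (DirectProduct.commutativeRing R S))
(mat a b c d , u , p , p′) ,ᴳ (mat e f g h , v , q , q′) =
  mat (a , e) (b , f) (c , g) (d , h) , (u , v) , (p , q) , (p′ , q′)

module _ (em : ExcludedMiddle 0ℓ) (K : FunctionField) (x : Place K) where
  private
    module completion (y : Place K) = CommutativeRing (completion y)
    module 𝔸 = CommutativeRing (𝔸 K)

  replaceIf : ∀ y → Dec (y ≈ₚ x) → completion.Carrier x → completion.Carrier y → completion.Carrier y
  replaceIf y (yes e) α _ = transport K y x e α
  replaceIf y (no _) _ β = β

  -- replace α a is the adele with component α at x and the components of a at
  -- all other places.
  replace : completion.Carrier x → 𝔸.Carrier → 𝔸.Carrier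
  replace α (a , coherent , S , integral) =
    (λ y → replaceIf y em α (a y)) , (λ {y z} e → coherent′ y z e em em) , x ∷ S , integral′
    where
    coherent′ : ∀ y z (e : y ≈ₚ z) (d : Dec (y ≈ₚ x)) (d′ : Dec (z ≈ₚ x)) →
      completion._≈_ y (replaceIf y d α (a y)) (transport K y z e (replaceIf z d′ α (a z)))
    coherent′ y z e (yes y≈x) (yes z≈x) = completion.refl y {transport K y x y≈x α}
    coherent′ y z e (yes y≈x) (no z≉x) = ⊥-elim (z≉x (λ b → ≡.trans (≡.sym (e b)) (y≈x b)))
    coherent′ y z e (no y≉x) (yes z≈x) = ⊥-elim (y≉x (λ b → ≡.trans (e b) (z≈x b)))
    coherent′ y z e (no _) (no _) = coherent e

    integral′ : ∀ y → ¬ Any (y ≈ₚ_) (x ∷ S) → Integral y (replaceIf y em α (a y))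
    integral′ y y∉ with em {P = y ≈ₚ x}
    ... | yes y≈x = ⊥-elim (y∉ (here y≈x))
    ... | no _ = integral y (y∉ ∘ there)

  replaceHom : DirectProduct.commutativeRing (completion x) (𝔸 K) ⟶ʳ 𝔸 K
  replaceHom = record
    { ⟦_⟧ = λ (α , a) → replace α a
    ; isRingHomomorphism = record
      { isSemiringHomomorphism = record
        { isNearSemiringHomomorphism = record
          { +-isMonoidHomomorphism = record
            { isMagmaHomomorphism = record
              { isRelHomomorphism = record
                { cong = λ {(α , a , _)} {(β , b , _)} (p , q) y → cong y em α β (a y) (b y) p (q y) }
              ; homo = λ (α , a , _) (β , b , _) y → +-homo y em α β (a y) (b y)
              }
            ; ε-homo = λ y → 0#-homo y em
            }
          ; *-homo = λ (α , a , _) (β , b , _) y → *-homo y em α β (a y) (b y)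
          }
        ; 1#-homo = λ y → 1#-homo y em
        }
      ; -‿homo = λ (α , a , _) y → -‿homo y em α (a y)
      }
    }
    where
    module C = completion

    cong : ∀ y (d : Dec (y ≈ₚ x)) α β a b → C._≈_ x α β → C._≈_ y a b →
           C._≈_ y (replaceIf y d α a) (replaceIf y d β b)
    cong y (yes e) (α , _) (β , _) _ _ p _ N = case p N of λ (M , close) → M ,
      λ n M≤n → ≡.subst ([ N ] ≤∞_) (≡.sym (e _)) (close n M≤n)
    cong y (no _) _ _ _ _ _ q = q

    +-homo : ∀ y (d : Dec (y ≈ₚ x)) α β a b →
      C._≈_ y (replaceIf y d (C._+_ x α β) (C._+_ y a b)) (C._+_ y (replaceIf y d α a) (replaceIf y d β b))
    +-homo y (yes e) α β _ _ = C.refl y {transport K y x e (C._+_ x α β)}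
    +-homo y (no _) _ _ a b = C.refl y {C._+_ y a b}

    *-homo : ∀ y (d : Dec (y ≈ₚ x)) α β a b →
      C._≈_ y (replaceIf y d (C._*_ x α β) (C._*_ y a b)) (C._*_ y (replaceIf y d α a) (replaceIf y d β b))
    *-homo y (yes e) α β _ _ = C.refl y {transport K y x e (C._*_ x α β)}
    *-homo y (no _) _ _ a b = C.refl y {C._*_ y a b}

    -‿homo : ∀ y (d : Dec (y ≈ₚ x)) α a →
      C._≈_ y (replaceIf y d (C.-_ x α) (C.-_ y a)) (C.-_ y (replaceIf y d α a))
    -‿homo y (yes e) α _ = C.refl y {transport K y x e (C.-_ x α)}
    -‿homo y (no _) _ a = C.refl y {C.-_ y a}

    0#-homo : ∀ y (d : Dec (y ≈ₚ x)) → C._≈_ y (replaceIf y d (C.0# x) (C.0# y)) (C.0# y)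
    0#-homo y (yes _) = C.refl y {C.0# y}
    0#-homo y (no _) = C.refl y {C.0# y}

    1#-homo : ∀ y (d : Dec (y ≈ₚ x)) → C._≈_ y (replaceIf y d (C.1# x) (C.1# y)) (C.1# y)
    1#-homo y (yes _) = C.refl y {C.1# y}
    1#-homo y (no _) = C.refl y {C.1# y}

  localIdele : AbelianGroup.Carrier (Units (completion x)) → AbelianGroup.Carrier (Units (𝔸 K))
  localIdele (α , α⁻¹ , p , q) = GroupHomomorphism.⟦_⟧ (Functoriality.Units-map {DirectProduct.commutativeRing (completion x) (𝔸 K)} {𝔸 K} replaceHom)
    ((α , 𝔸.1#) , (α⁻¹ , 𝔸.1#) , (p , 𝔸.*-identityˡ 𝔸.1#) , (q , 𝔸.*-identityˡ 𝔸.1#))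

  localGL₂ : Group.Carrier (GL₂ (completion x)) → Group.Carrier (GL₂ (𝔸 K))
  localGL₂ g = GroupHomomorphism.⟦_⟧ (Functoriality.GL₂-map {DirectProduct.commutativeRing (completion x) (𝔸 K)} {𝔸 K} replaceHom)
    (_,ᴳ_ {completion x} {𝔸 K} g (Group.ε (GL₂ (𝔸 K))))

module _ {K : FunctionField} (x : Place K) where
  open FunctionField K using (𝔽q; F; constants)
  private
    module Fₓ = CommutativeRing (completion x)
    module κₓ = CommutativeRing (residueField x)

  Uniformiser : Set
  Uniformiser = Σ[ π ∈ AbelianGroup.Carrier (Units (completion x)) ] HasValuation x (+ 1) (proj₁ π)

  data ℙ¹ : Set where
    [1∶_] : κₓ.Carrier → ℙ¹
    [0∶1] : ℙ¹

  𝔽q⟶Fₓ : fieldRing 𝔽q ⟶ʳ completion x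
  𝔽q⟶Fₓ = record
    { isRingHomomorphism = Composition.isRingHomomorphism (λ {a} {b} {c} → Fₓ.trans {a} {b} {c})
        (RingHomomorphism.isRingHomomorphism constants)
        (RingHomomorphism.isRingHomomorphism (embed x))
    }

  -- The residue field is contained in F_x as the algebraic closure of 𝔽q in
  -- F_x: the residue class b is the element β of this closure that reduces to b.
  _Represents_ : Fₓ.Carrier → κₓ.Carrier → Set
  β Represents b = Polynomials.Algebraic (fieldRing 𝔽q) (completion x) 𝔽q⟶Fₓ β ×
    (Σ[ β-integral ∈ Integral x β ] (β , β-integral) κₓ.≈ b)

module _ (R : Ring) where
  open CommutativeRing R
  private
    module Units = AbelianGroup (Units R)

  ξ[1∶_] : Carrier → Units.Carrier → Group.Carrier (GL₂ R)
  ξ[1∶ b ] (π , π-unit) = mat π b 0# 1# , isUnit-resp R (sym det≈π) π-unit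
    where
    open RingProperties ring using (-0#≈0#)
    det≈π : π * 1# - b * 0# ≈ π
    det≈π = trans (+-cong (*-identityʳ π) (trans (-‿cong (zeroʳ b)) -0#≈0#)) (+-identityʳ π)

  ξ[0∶1] : Units.Carrier → Group.Carrier (GL₂ R)
  ξ[0∶1] (π , π-unit) = mat 1# 0# 0# π , isUnit-resp R (sym det≈π) π-unit
    where
    open RingProperties ring using (-0#≈0#)
    det≈π : 1# * π - 0# * 0# ≈ π
    det≈π = trans (+-cong (*-identityˡ π) (trans (-‿cong (zeroˡ 0#)) -0#≈0#)) (+-identityʳ π)

-- Excluded middle is used to decide which places are equal to x.
module HeckeGraph (em : ExcludedMiddle 0ℓ) {K : FunctionField} (x : Place K) (π : Uniformiser x) where
  private
    module V = Setoid (vertices K)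
    module G = Group (GL₂ (𝔸 K))

  Vertex : Set
  Vertex = V.Carrier

  labelOf : Vertex → AbelianGroup.Carrier (mod2 (Cl K))
  labelOf = Func.to (label K)

  EdgeVia : ℙ¹ x → Rel Vertex 0ℓ
  EdgeVia [1∶ b ] g g′ = ∃[ β ] (_Represents_ x β b) ×
    g′ V.≈ g G.∙ localGL₂ em K x (ξ[1∶_] (completion x) β (proj₁ π))
  EdgeVia [0∶1] g g′ = g′ V.≈ g G.∙ localGL₂ em K x (ξ[0∶1] (completion x) (proj₁ π))

  Edge : Rel Vertex 0ℓ
  Edge g g′ = ∃[ w ] EdgeVia w g g′

  -- Equal vertices are connected by definition, as Edge is a relation on
  -- representatives of vertices.
  components : Setoid 0ℓ 0ℓ
  components = EqClosure.setoid (λ g g′ → g V.≈ g′ ⊎ Edge g g′)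

  Connected : Rel Vertex 0ℓ
  Connected = Setoid._≈_ components

  componentOf : Vertex → Setoid 0ℓ 0ℓ
  componentOf g = record
    { Carrier = ∃[ g′ ] Connected g g′
    ; isEquivalence = On.isEquivalence proj₁ V.isEquivalence
    }

  IsBipartite : Vertex → Set
  IsBipartite g = Σ[ colour ∈ Func (componentOf g) (≡.setoid Bool) ]
    (∀ h h′ → Edge (proj₁ h) (proj₁ h′) → Func.to colour h ≢ Func.to colour h′)

  -- The prime divisor x corresponds to the idele π concentrated at x.
  [x] : AbelianGroup.Carrier (Cl K)
  [x] = localIdele em K x (proj₁ π)

{-# OPTIONS --safe #-}

-- The determinant of ξ_w is π_x, so an edge multiplies the label by [x].
-- Conversely, vertices with the same label are connected: by strong approximation
-- away from x every vertex is connected to some diag(a, 1) with a ≡ det g modulo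
-- squares, and
--   (a c  a )(0  1)   ( a    0)
--   ( 0  c⁻¹)(1 -c) = (c⁻¹  -1)
-- connects diag(a c², 1) to diag(a, 1).  Hence there are |Cl/2Cl| components if
-- [x] is a square.  Since ξ = [x] has infinite order and G = Cl/⟨ξ²⟩ is finite,
-- |Cl/2Cl| = |G/2G| = |G[2]| = 2 h₂, because G[2] = Cl[2] × {1, ξ}.
--
-- The arithmetic of F rests on counting instead of degrees.  As F is finite over
-- 𝔽q(t), there is a Q for each u such that a family β for which all the sums
-- Σ_{a<r} uᵃ β_{jₐ} are distinct has at most Q members.  This bounds residue fields
-- and zeros, and by the pigeonhole principle gives Riemann's inequality for the
-- multiples of x, whence strong approximation and Minkowski's bound.  It also
-- makes the valuation ring obtained from a subring maximal without a given
-- transcendental f discrete, so every such f has a pole and few functions have none.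

module Submission where

open import Defs
open import Algebra.Apartness.Bundles using (HeytingField)
open import Algebra.Bundles using (AbelianGroup; CommutativeRing; RawRing; Group)
import Algebra.Construct.DirectProduct as DirectProduct
import Algebra.Definitions.RawMonoid as RawMonoidOperations
open import Algebra.Morphism.Bundles using (RingHomomorphism; GroupHomomorphism)
import Algebra.Properties.AbelianGroup as AbelianGroupProperties
import Algebra.Properties.CommutativeMonoid.Mult as Powers
import Algebra.Properties.CommutativeSemigroup as CommutativeSemigroupProperties
import Algebra.Properties.Group as GroupProperties
import Algebra.Properties.Ring as RingProperties
import Algebra.Properties.Semiring.Exp as Exponentiation
import Algebra.Properties.Semiring.Mult.TCOptimised as Multiples
import Algebra.Solver.CommutativeMonoid as CommutativeMonoidSolver
import Algebra.Solver.Ring as RingSolver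
open import Algebra.Solver.Ring.AlmostCommutativeRing using (fromCommutativeRing; _-Raw-AlmostCommutative⟶_)
open import Axiom.ExcludedMiddle using (ExcludedMiddle)
open import Data.Bool.Base using (Bool; true; false)
open import Data.Empty using (⊥; ⊥-elim)
open import Data.Fin.Base as Fin using (Fin; zero; suc)
import Data.Fin.Permutation as Fin
import Data.Fin.Properties as Fin
open import Data.Integer.Base as ℤ using (ℤ; +_; -[1+_]; +≤+; -<+)
import Data.Integer.DivMod as ℤ
import Data.Integer.Properties as ℤ
import Data.Integer.Tactic.RingSolver as ℤ
open import Data.List.Base using (List; []; _∷_; length; filter; _++_; map; concat; replicate; tabulate; lookup)
open import Data.List.Membership.Propositional using (_∈_)
open import Data.List.Membership.Propositional.Properties using (∈-tabulate⁺)
open import Data.List.Properties using (length-map; length-tabulate; ++-identityʳ; length-++)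
open import Data.List.Relation.Unary.All as All using (All; []; _∷_)
open import Data.List.Relation.Unary.All.Properties as All using (¬Any⇒All¬)
open import Data.List.Relation.Unary.AllPairs as AllPairs using (AllPairs; []; _∷_)
import Data.List.Relation.Unary.AllPairs.Properties as AllPairs
open import Data.List.Relation.Unary.Any as Any using (Any; here; there)
open import Data.List.Relation.Unary.Any.Properties using (++⁺ˡ; ++⁺ʳ; lookup-index)
open import Data.Maybe.Base using (Maybe; just; nothing)
open import Data.Maybe.Properties using (just-injective)
open import Data.Nat.Base as ℕ using (ℕ; zero; suc; _≤_; s≤s; z≤n)
import Data.Nat.Properties as ℕ
open import Data.Nat.Tactic.RingSolver as ℕ using (solve-∀)
open import Data.Product.Base as Product using (_×_; _,_; proj₁; proj₂; ∃; ∃-syntax; Σ-syntax; ∃₂; uncurry)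
open import Data.Sum.Base as Sum using (_⊎_; inj₁; inj₂)
open import Data.Unit.Base using (⊤; tt)
open import Function.Base using (_∘_)
open import Function.Bundles using (Bijection; Equivalence; mk⇔; Func)
import Function.Construct.Composition as Compose
import Function.Construct.Symmetry as Symmetry
open import Function.Properties.Bijection using (Bijection⇒Inverse)
open import Level using (0ℓ)
open import Relation.Binary.Bundles using (Setoid)
import Relation.Binary.Construct.Add.Supremum.NonStrict as AddSupremum
import Relation.Binary.Construct.Closure.Equivalence as EqClosure
import Relation.Binary.Construct.On as On
open import Relation.Binary.Core using (Rel)
open import Relation.Binary.Definitions using (Tri; tri<; tri≈; tri>)
open import Relation.Binary.PropositionalEquality as ≡ using (_≡_; _≢_)
import Relation.Binary.Reasoning.Setoid as SetoidReasoning
open import Relation.Binary.Structures using (IsEquivalence)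
open import Relation.Nullary.Construct.Add.Supremum using (⊤⁺; [_])
open import Relation.Nullary.Decidable.Core using (yes; no; Dec; ¬?)
open import Relation.Nullary.Negation.Core using (¬_)
open import Relation.Unary using (Pred)

-- The numbers Q depend on u alone and not on the set of places at which the sums are integral; this
-- uniformity turns one count into the finiteness of the zeros of every function. The norm of a
-- divisor, a product of orders of residue fields, takes the place of its degree, and `growth-rate`
-- removes the constant factors that such counts leave behind. A place is any normalised valuation,
-- so a place with a prescribed property has to be built. It is needed to show that a function
-- without poles is constant: each transcendental function must have a pole. Hence at most q
-- functions have no poles, a nonconstant function cannot have all its zeros and poles at x, and ξ
-- has infinite order. Dividing by ξ² rather than by ξ keeps G/2G equal to Cl/2Cl, since ξ² is a
-- square whereas ξ need not be one. Minkowski's bound then makes G finite: up to principal ideles,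
-- a class is described by boundedly many small orders off x and by the order at x modulo 2.

-- The pair (m , n) stands for the integer m - n.
module IntegerSolver (R : Ring) where
  open CommutativeRing R
  open RingProperties ring
  private
    open Multiples semiring using (×-homo-+; ×1-homo-*) renaming (_×_ to _·_)
    open SetoidReasoning setoid
    open CommutativeSemigroupProperties +-commutativeSemigroup using (interchange)

    Coefficients : RawRing 0ℓ 0ℓ
    Coefficients = record
      { Carrier = ℕ × ℕ
      ; _≈_ = _≡_
      ; _+_ = λ (m , n) (m′ , n′) → m ℕ.+ m′ , n ℕ.+ n′
      ; _*_ = λ (m , n) (m′ , n′) → m ℕ.* m′ ℕ.+ n ℕ.* n′ , m ℕ.* n′ ℕ.+ n ℕ.* m′
      ; -_ = λ (m , n) → n , m
      ; 0# = 0 , 0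
      ; 1# = 1 , 0
      }

    -- Coefficients of the form (m , 0) are evaluated without a subtraction, so that `con (0 , 0)`
    -- and `con (1 , 0)` are `0#` and `1#` by definition.
    difference ⟦_⟧ : ℕ × ℕ → Carrier
    difference (m , n) = m · 1# - n · 1#
    ⟦ m , zero ⟧ = m · 1#
    ⟦ m , suc n ⟧ = difference (m , suc n)

    ⟦⟧≈ : ∀ a → ⟦ a ⟧ ≈ difference a
    ⟦⟧≈ (m , zero) = sym (trans (+-congˡ -0#≈0#) (+-identityʳ _))
    ⟦⟧≈ (m , suc n) = refl

    sums : ∀ a b c d → (a - b) + (c - d) ≈ (a + c) - (b + d)
    sums a b c d = trans (interchange a (- b) c (- d)) (+-congˡ (-‿+-comm b d))

    products : ∀ x y z w → (x - y) * (z - w) ≈ (x * z + y * w) - (x * w + y * z)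
    products x y z w = begin
      (x - y) * (z - w)                    ≈⟨ [y-z]x≈yx-zx (z - w) x y ⟩
      x * (z - w) - y * (z - w)            ≈⟨ +-cong (x[y-z]≈xy-xz x z w) (-‿cong (x[y-z]≈xy-xz y z w)) ⟩
      (x * z - x * w) - (y * z - y * w)    ≈⟨ +-congˡ (⁻¹-anti-homo-// (y * z) (y * w)) ⟩
      (x * z - x * w) + (y * w - y * z)    ≈⟨ sums _ _ _ _ ⟩
      (x * z + y * w) - (x * w + y * z)    ∎

    ·-sum : ∀ m n m′ n′ → (m ℕ.* n ℕ.+ m′ ℕ.* n′) · 1# ≈ (m · 1#) * (n · 1#) + (m′ · 1#) * (n′ · 1#)
    ·-sum m n m′ n′ = trans (×-homo-+ 1# (m ℕ.* n) (m′ ℕ.* n′)) (+-cong (×1-homo-* m n) (×1-homo-* m′ n′))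

    homomorphism : Coefficients -Raw-AlmostCommutative⟶ fromCommutativeRing R
    homomorphism = record
      { ⟦_⟧ = ⟦_⟧
      ; +-homo = λ a@(m , n) b@(m′ , n′) → begin
          ⟦ m ℕ.+ m′ , n ℕ.+ n′ ⟧                       ≈⟨ ⟦⟧≈ (m ℕ.+ m′ , n ℕ.+ n′) ⟩
          (m ℕ.+ m′) · 1# - (n ℕ.+ n′) · 1#
            ≈⟨ +-cong (×-homo-+ 1# m m′) (-‿cong (×-homo-+ 1# n n′)) ⟩
          (m · 1# + m′ · 1#) - (n · 1# + n′ · 1#)        ≈⟨ sym (sums _ _ _ _) ⟩
          difference a + difference b                    ≈⟨ sym (+-cong (⟦⟧≈ a) (⟦⟧≈ b)) ⟩
          ⟦ a ⟧ + ⟦ b ⟧                                  ∎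
      ; *-homo = λ a@(m , n) b@(m′ , n′) → begin
          ⟦ m ℕ.* m′ ℕ.+ n ℕ.* n′ , m ℕ.* n′ ℕ.+ n ℕ.* m′ ⟧   ≈⟨ ⟦⟧≈ (m ℕ.* m′ ℕ.+ n ℕ.* n′ , m ℕ.* n′ ℕ.+ n ℕ.* m′) ⟩
          (m ℕ.* m′ ℕ.+ n ℕ.* n′) · 1# - (m ℕ.* n′ ℕ.+ n ℕ.* m′) · 1#
            ≈⟨ +-cong (·-sum m m′ n n′) (-‿cong (·-sum m n′ n m′)) ⟩
          _                                              ≈⟨ sym (products _ _ _ _) ⟩
          difference a * difference b                    ≈⟨ sym (*-cong (⟦⟧≈ a) (⟦⟧≈ b)) ⟩
          ⟦ a ⟧ * ⟦ b ⟧                                  ∎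
      ; -‿homo = λ a@(m , n) → begin
          ⟦ n , m ⟧           ≈⟨ ⟦⟧≈ (n , m) ⟩
          n · 1# - m · 1#     ≈⟨ sym (⁻¹-anti-homo-// _ _) ⟩
          - difference a      ≈⟨ -‿cong (sym (⟦⟧≈ a)) ⟩
          - ⟦ a ⟧             ∎
      ; 0-homo = refl
      ; 1-homo = refl
      }

    _≟_ : ∀ a b → Maybe (⟦ a ⟧ ≈ ⟦ b ⟧)
    -- Distinct pairs can stand for one integer; they do so when the cross sums agree.
    a@(m , n) ≟ b@(m′ , n′) with m ℕ.+ n′ ℕ.≟ m′ ℕ.+ n
    ... | no _ = nothing
    ... | yes eq = just (begin
      ⟦ a ⟧                            ≈⟨ ⟦⟧≈ a ⟩
      m · 1# - n · 1#                  ≈⟨ +-congʳ (sym (//-rightDividesʳ (n′ · 1#) (m · 1#))) ⟩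
      m · 1# + n′ · 1# - n′ · 1# - n · 1#
        ≈⟨ +-congʳ (+-congʳ (trans (sym (×-homo-+ 1# m n′)) (trans (reflexive (≡.cong (_· 1#) eq)) (×-homo-+ 1# m′ n)))) ⟩
      m′ · 1# + n · 1# - n′ · 1# - n · 1#
        ≈⟨ trans (+-assoc _ _ _) (sums′ _ _ _ _) ⟩
      (m′ · 1# - n′ · 1#) + (n · 1# - n · 1#)   ≈⟨ trans (+-congˡ (-‿inverseʳ _)) (+-identityʳ _) ⟩
      m′ · 1# - n′ · 1#                ≈⟨ sym (⟦⟧≈ b) ⟩
      ⟦ b ⟧                            ∎)
      where
      sums′ : ∀ a b c d → (a + b) + (c + d) ≈ (a + c) + (b + d)
      sums′ = interchange

  open RingSolver Coefficients (fromCommutativeRing R) homomorphism _≟_ public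
    using (solve; con; _:+_; _:*_; _:-_; :-_; _:=_)

-- Counting

module _ where
  open import Data.Nat.Base using (_+_; _*_; _^_; _<_)

  -- Bernoulli's inequality (1 + 1/Q)ʳ ≥ 1 + r/Q with the denominators cleared.
  bernoulli : ∀ Q r → Q ^ r * (Q + r) ≤ suc Q ^ r * Q
  bernoulli Q zero = ℕ.≤-reflexive (≡.cong (1 *_) (ℕ.+-identityʳ Q))
  bernoulli Q (suc r) = begin
    Q * Q ^ r * (Q + suc r)              ≤⟨ ℕ.m≤m+n _ (Q ^ r * r) ⟩
    Q * Q ^ r * (Q + suc r) + Q ^ r * r  ≡⟨ identity Q r (Q ^ r) ⟩
    suc Q * (Q ^ r * (Q + r))            ≤⟨ ℕ.*-monoʳ-≤ (suc Q) (bernoulli Q r) ⟩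
    suc Q * (suc Q ^ r * Q)              ≡⟨ ℕ.*-assoc (suc Q) (suc Q ^ r) Q ⟨
    suc Q * suc Q ^ r * Q                ∎
    where
    open ℕ.≤-Reasoning
    identity : ∀ Q r p → Q * p * (Q + suc r) + p * r ≡ suc Q * (p * (Q + r))
    identity = solve-∀

  -- If m > Q, then (Q + 1)ʳ ≤ K Qʳ for all r, against Bernoulli's inequality at r = K Q. The
  -- counting arguments that place mʳ distinct objects in a set of size K Qʳ end with this lemma,
  -- which discards K.
  growth-rate : ∀ {m Q} K → (∀ r → m ^ r ≤ K * Q ^ r) → m ≤ Q
  growth-rate {m} {zero} K bound = ℕ.≤-trans (ℕ.≤-reflexive (≡.sym (ℕ.*-identityʳ m)))
    (ℕ.≤-trans (bound 1) (ℕ.≤-reflexive (ℕ.*-zeroʳ K)))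
  growth-rate {m} {Q@(suc _)} K bound with m ℕ.≤? Q
  ... | yes m≤Q = m≤Q
  ... | no m≰Q = ⊥-elim (ℕ.<-irrefl ≡.refl (begin-strict
    Q ^ r * r            <⟨ ℕ.*-monoʳ-< (Q ^ r) ⦃ ℕ.m^n≢0 Q r ⦄ (ℕ.m<n+m r {Q} ℕ.z<s) ⟩
    Q ^ r * (Q + r)      ≤⟨ bernoulli Q r ⟩
    suc Q ^ r * Q        ≤⟨ ℕ.*-monoˡ-≤ Q (ℕ.^-monoˡ-≤ r (ℕ.≰⇒> m≰Q)) ⟩
    m ^ r * Q            ≤⟨ ℕ.*-monoˡ-≤ Q (bound r) ⟩
    K * Q ^ r * Q        ≡⟨ identity K (Q ^ r) Q ⟩
    Q ^ r * r            ∎))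
    where
    open ℕ.≤-Reasoning
    r = K * Q
    identity : ∀ K p Q → K * p * Q ≡ p * (K * Q)
    identity = solve-∀

  length-filter-¬ : {A : Set} {P : Pred A 0ℓ} (P? : ∀ a → Dec (P a)) (xs : List A) →
    length (filter P? xs) + length (filter (¬? ∘ P?) xs) ≡ length xs
  length-filter-¬ P? [] = ≡.refl
  length-filter-¬ P? (x ∷ xs) with P? x
  ... | yes _ = ≡.cong suc (length-filter-¬ P? xs)
  ... | no _ = ≡.trans (ℕ.+-suc _ _) (≡.cong suc (length-filter-¬ P? xs))

  IsSeparated : {A : Set} → Rel A 0ℓ → ∀ {m} → (Fin m → A) → Set
  IsSeparated _∼_ β = ∀ i j → β i ∼ β j → i ≡ j

  IsComplete : {A : Set} → Pred A 0ℓ → Rel A 0ℓ → ∀ {m} → (Fin m → A) → Set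
  IsComplete P _∼_ β = ∀ a → P a → ∃[ j ] a ∼ β j

  module _ (em : ExcludedMiddle 0ℓ) {A : Set} where

    -- Pigeonhole principle for a relation `hasColour`, which need not single out one colour of an
    -- element. If colour `zero` covers at most b members, more than q b are left for the other q
    -- colours.
    many-of-one-colour : ∀ {R : Rel A 0ℓ} {P : Pred A 0ℓ} q {b} (hasColour : Fin q → Pred A 0ℓ) xs →
      AllPairs R xs → All P xs → All (λ a → ∃[ c ] hasColour c a) xs → q * b < length xs →
      ∃[ c ] ∃[ ys ] AllPairs R ys × All P ys × All (hasColour c) ys × b < length ys
    many-of-one-colour zero hasColour (_ ∷ _) _ _ ((() , _) ∷ _) _
    many-of-one-colour (suc q) {b} hasColour xs distinct ps colours many
      with b ℕ.<? length (filter (λ a → em {P = hasColour zero a}) xs)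
    ... | yes b< = zero , _ , AllPairs.filter⁺ _ distinct , All.filter⁺ _ ps , All.all-filter _ xs , b<
    ... | no b≮ with many-of-one-colour q {b} (hasColour ∘ suc) rest (AllPairs.filter⁺ _ distinct)
           (All.filter⁺ _ ps) colours′ many′
      where
      colour₀? = λ a → em {P = hasColour zero a}
      rest = filter (¬? ∘ colour₀?) xs
      colours′ : All (λ a → ∃[ c ] hasColour (suc c) a) rest
      colours′ = All.zipWith (λ where
          (¬c , zero , c) → ⊥-elim (¬c c)
          (¬c , suc i , c) → i , c)
        (All.all-filter (¬? ∘ colour₀?) xs , All.filter⁺ (¬? ∘ colour₀?) colours)
      many′ : q * b < length rest
      many′ = ℕ.+-cancelˡ-< b (q * b) (length rest) (ℕ.<-≤-trans many (ℕ.≤-trans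
        (ℕ.≤-reflexive (≡.sym (length-filter-¬ colour₀? xs)))
        (ℕ.+-monoˡ-≤ (length rest) (ℕ.≮⇒≥ b≮))))
    ... | c , ys , rest = suc c , ys , rest

    module _ {P : Pred A 0ℓ} {_∼_ : Rel A 0ℓ} (∼-sym : ∀ {a b} → a ∼ b → b ∼ a) {Q : ℕ}
             (bounded : ∀ m (β : Fin m → A) → (∀ i → P (β i)) → IsSeparated _∼_ β → m ≤ Q) where

      private
        extend : ∀ fuel m → Q < m + fuel → (β : Fin m → A) → (∀ i → P (β i)) → IsSeparated _∼_ β →
          ∃[ m ] Σ[ β ∈ (Fin m → A) ] (∀ i → P (β i)) × IsSeparated _∼_ β × IsComplete P _∼_ β
        extend zero m Q<m β ps sep = ⊥-elim (ℕ.<⇒≱ (ℕ.<-≤-trans Q<m (ℕ.≤-reflexive (ℕ.+-identityʳ m))) (bounded m β ps sep))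
        extend (suc fuel) m Q< β ps sep with em {P = ∃[ a ] P a × (∀ j → ¬ a ∼ β j)}
        ... | yes (a , p , new) = extend fuel (suc m) (ℕ.<-≤-trans Q< (ℕ.≤-reflexive (ℕ.+-suc m fuel))) β′ ps′ sep′
          where
          β′ : Fin (suc m) → A
          β′ zero = a
          β′ (suc i) = β i
          ps′ : ∀ i → P (β′ i)
          ps′ zero = p
          ps′ (suc i) = ps i
          sep′ : IsSeparated _∼_ β′
          sep′ zero zero _ = ≡.refl
          sep′ zero (suc j) a∼β = ⊥-elim (new j a∼β)
          sep′ (suc i) zero β∼a = ⊥-elim (new i (∼-sym β∼a))
          sep′ (suc i) (suc j) e = ≡.cong suc (sep i j e)
        ... | no complete = m , β , ps , sep , λ a p → case′ a p
          where
          case′ : ∀ a → P a → ∃[ j ] a ∼ β j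
          case′ a p with em {P = ∃[ j ] a ∼ β j}
          ... | yes found = found
          ... | no missing = ⊥-elim (complete (a , p , λ j e → missing (j , e)))

      -- Greedy choice: a member related to none of the present ones is added as long as there is
      -- one, and the bound Q ends this. When no such member exists, excluded middle gives
      -- completeness.
      maximal-family : ∃[ m ] Σ[ β ∈ (Fin m → A) ] (∀ i → P (β i)) × IsSeparated _∼_ β × IsComplete P _∼_ β
      maximal-family = extend (suc Q) 0 ℕ.≤-refl (λ ()) (λ ()) (λ ())

    maximal-list : (Good : List A → Set) {Q : ℕ} → Good [] → (∀ xs → Good xs → length xs ≤ Q) →
      ∃[ xs ] Good xs × (∀ x → ¬ Good (x ∷ xs))
    maximal-list Good {Q} good[] bounded = extend (suc Q) [] ℕ.≤-refl good[]
      where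
      extend : ∀ fuel xs → Q < length xs + fuel → Good xs → ∃[ xs ] Good xs × (∀ x → ¬ Good (x ∷ xs))
      extend zero xs Q< good = ⊥-elim (ℕ.<⇒≱ (ℕ.<-≤-trans Q< (ℕ.≤-reflexive (ℕ.+-identityʳ (length xs)))) (bounded xs good))
      extend (suc fuel) xs Q< good with em {P = ∃[ x ] Good (x ∷ xs)}
      ... | yes (x , good′) = extend fuel (x ∷ xs) (ℕ.<-≤-trans Q< (ℕ.≤-reflexive (ℕ.+-suc (length xs) fuel))) good′
      ... | no maximal = xs , good , λ x good′ → maximal (x , good′)

  uniform-bound : ∀ {m} {P : ℕ → Fin m → Set} → (∀ {M N l} → M ≤ N → P M l → P N l) →
    (∀ l → ∃[ N ] P N l) → ∃[ N ] ∀ l → P N l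
  uniform-bound {zero} weaken bound = 0 , λ ()
  uniform-bound {suc m} {P} weaken bound with bound zero | uniform-bound {m} {λ N l → P N (suc l)} weaken (bound ∘ suc)
  ... | M , p | N , ps = M ℕ.⊔ N , λ where
    zero → weaken (ℕ.m≤m⊔n M N) p
    (suc l) → weaken (ℕ.m≤n⊔m M N) (ps l)

-- Digit expansions and the growth of F over 𝔽q(t)

module Horner (R : Ring) where
  open CommutativeRing R hiding (zero)

  -- Σ_a uᵃ β_{jₐ}, where j₀, …, j_{r-1} are the base m digits of the argument.
  horner : Carrier → ∀ {m} → (Fin m → Carrier) → ∀ r → Fin (m ℕ.^ r) → Carrier
  horner u β zero _ = 0#
  horner u {m} β (suc r) i = β (proj₁ (Fin.remQuot {m} (m ℕ.^ r) i)) + u * horner u β r (proj₂ (Fin.remQuot {m} (m ℕ.^ r) i))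

  module _ (P : Pred Carrier 0ℓ) (0#-closed : P 0#) (+-closed : ∀ {a b} → P a → P b → P (a + b))
           (*-closed : ∀ {a b} → P a → P b → P (a * b)) {u m} {β : Fin m → Carrier} (Pu : P u) (Pβ : ∀ j → P (β j)) where

    horner-closed : ∀ r i → P (horner u β r i)
    horner-closed zero i = 0#-closed
    horner-closed (suc r) i = +-closed (Pβ _) (*-closed Pu (horner-closed r _))

module Field (em : ExcludedMiddle 0ℓ) (H : HeytingField 0ℓ 0ℓ 0ℓ) where
  private
    R = fieldRing H
  open CommutativeRing R hiding (zero)
  open RingProperties ring
  open Exponentiation semiring using (_^_)
  open HeytingField H using (_#_; #⇒invertible; invertible⇒#; tight; #-irrefl)
  open SetoidReasoning setoid
  open Horner R
  open IntegerSolver R using (solve; _:+_; _:*_; _:-_; :-_; _:=_; con)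

  private
    x-0≈x : ∀ x → x - 0# ≈ x
    x-0≈x x = trans (+-congˡ -0#≈0#) (+-identityʳ x)

  abstract
    inverse : ∀ {a} → a ≉ 0# → ∃[ b ] b * a ≈ 1#
    inverse {a} a≉0 with em {P = a # 0#}
    ... | no ¬a#0 = ⊥-elim (a≉0 (proj₁ (tight a 0#) ¬a#0))
    ... | yes a#0 with #⇒invertible a#0
    ... | b , ba , _ = b , trans (*-congˡ (sym (x-0≈x a))) ba

    1≉0 : 1# ≉ 0#
    1≉0 1≈0 = #-irrefl 1≈0 (invertible⇒# (1# , trans (*-identityˡ _) (x-0≈x 1#) , trans (*-identityʳ _) (x-0≈x 1#)))

    *-cancelˡ : ∀ {a b c} → a ≉ 0# → a * b ≈ a * c → b ≈ c
    *-cancelˡ {a} {b} {c} a≉0 eq with inverse a≉0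
    ... | a⁻¹ , p = begin
      b              ≈⟨ sym (undo b) ⟩
      a⁻¹ * (a * b)  ≈⟨ *-congˡ eq ⟩
      a⁻¹ * (a * c)  ≈⟨ undo c ⟩
      c              ∎
      where
      undo : ∀ b → a⁻¹ * (a * b) ≈ b
      undo b = trans (sym (*-assoc a⁻¹ a b)) (trans (*-congʳ p) (*-identityˡ b))

    *-nonzero : ∀ {a b} → a ≉ 0# → b ≉ 0# → a * b ≉ 0#
    *-nonzero {a} a≉0 b≉0 ab≈0 = b≉0 (*-cancelˡ a≉0 (trans ab≈0 (sym (zeroʳ a))))

    ^-nonzero : ∀ {a} n → a ≉ 0# → a ^ n ≉ 0#
    ^-nonzero zero a≉0 = 1≉0
    ^-nonzero (suc n) a≉0 = *-nonzero a≉0 (^-nonzero n a≉0)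

    inverse-nonzero : ∀ {a b} → b * a ≈ 1# → b ≉ 0#
    inverse-nonzero {a} ba≈1 b≈0 = 1≉0 (trans (sym ba≈1) (trans (*-congʳ b≈0) (zeroˡ a)))

    difference-zero : ∀ {a b} → a - b ≈ 0# → a ≈ b
    difference-zero = x∙y⁻¹≈ε⇒x≈y _ _

  module _ {O : Pred Carrier 0ℓ} (isSubring : IsSubring R O) where
    open IsSubring isSubring

    CongruentModulo : Carrier → Carrier → Carrier → Set
    CongruentModulo u a b = ∃[ o ] O o × a - b ≈ u * o

    congruent-sym : ∀ {u a b} → CongruentModulo u a b → CongruentModulo u b a
    congruent-sym {u} {a} {b} (o , p , eq) = - o , -‿closed p ,
      trans (sym (⁻¹-anti-homo-// a b)) (trans (-‿cong eq) (-‿distribʳ-* u o))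

    -- Two equal sums have leading digits that differ by u times an element of `O`, hence equal
    -- leading digits. These cancel, then u cancels, and the remaining digits agree by induction, as
    -- in an expansion to the base u.
    horner-separated : ∀ {u m} {β : Fin m → Carrier} → O u → u ≉ 0# → (∀ j → O (β j)) →
      IsSeparated (CongruentModulo u) β → ∀ r → IsSeparated _≈_ (horner u β r)
    horner-separated _ _ _ _ zero zero zero _ = ≡.refl
    horner-separated {u} {m} {β} Ou u≉0 Oβ sep (suc r) i i′ eq = ≡.trans (≡.sym (Fin.combine-remQuot {m} (m ℕ.^ r) i))
      (≡.trans (≡.cong₂ Fin.combine j≡j′ k≡k′) (Fin.combine-remQuot {m} (m ℕ.^ r) i′))
      where
      j = proj₁ (Fin.remQuot {m} (m ℕ.^ r) i)
      j′ = proj₁ (Fin.remQuot {m} (m ℕ.^ r) i′)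
      k = proj₂ (Fin.remQuot {m} (m ℕ.^ r) i)
      k′ = proj₂ (Fin.remQuot {m} (m ℕ.^ r) i′)
      s = horner u β r k
      s′ = horner u β r k′
      O-horner : ∀ k → O (horner u β r k)
      O-horner = horner-closed O 0#-closed +-closed *-closed Ou Oβ r
      j≡j′ : j ≡ j′
      j≡j′ = sep j j′ (s′ - s , +-closed (O-horner k′) (-‿closed (O-horner k)) , (begin
        β j - β j′                                  ≈⟨ expand (β j) (β j′) (u * s) (u * s′) ⟩
        (β j + u * s) - (β j′ + u * s′) + (u * s′ - u * s)   ≈⟨ +-congʳ (x≈y⇒x∙y⁻¹≈ε eq) ⟩
        0# + (u * s′ - u * s)                       ≈⟨ collect u s s′ ⟩
        u * (s′ - s)                                ∎))
        where
        expand : ∀ b b′ x y → b - b′ ≈ (b + x) - (b′ + y) + (y - x)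
        expand = solve 4 (λ b b′ x y → b :- b′ := (b :+ x) :- (b′ :+ y) :+ (y :- x)) refl
        collect : ∀ u s s′ → 0# + (u * s′ - u * s) ≈ u * (s′ - s)
        collect = solve 3 (λ u s s′ → con (0 , 0) :+ (u :* s′ :- u :* s) := u :* (s′ :- s)) refl
      k≡k′ : k ≡ k′
      k≡k′ = horner-separated Ou u≉0 Oβ sep r k k′ (*-cancelˡ u≉0 (+-cancelˡ (β j) _ _
        (trans eq (+-congʳ (reflexive (≡.cong β (≡.sym j≡j′)))))))

module Growth (em : ExcludedMiddle 0ℓ) (K : FunctionField) where
  open FunctionField K using (𝔽q; F; constants; q; 𝔽q-cardinality; transcendence-degree-one)
  open CommutativeRing (fieldRing F) hiding (zero)
  open RingProperties ring
  open Exponentiation semiring using (_^_)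
  open SetoidReasoning setoid
  open Horner (fieldRing F)
  open Field em F
  open Polynomials (fieldRing 𝔽q) (fieldRing F) constants
  open RawMonoidOperations +-rawMonoid using (sum)
  open IntegerSolver (fieldRing F) using (solve; _:+_; _:*_; _:=_; con)
  private
    module k = CommutativeRing (fieldRing 𝔽q)
    module φ = RingHomomorphism constants
    module enumeration = Bijection 𝔽q-cardinality

  t : Carrier
  t = proj₁ transcendence-degree-one

  t-transcendental : ¬ Algebraic t
  t-transcendental = proj₁ (proj₂ transcendence-degree-one)

  private
    n : ℕ
    n = proj₁ (proj₂ (proj₂ transcendence-degree-one))

    e : Fin n → Carrier
    e = proj₁ (proj₂ (proj₂ (proj₂ transcendence-degree-one)))

    generates : GeneratesOverRationalFunctions t n e
    generates = proj₂ (proj₂ (proj₂ (proj₂ transcendence-degree-one)))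

  eval-nonzero : ∀ {p} → NonzeroPoly p → eval p t ≉ 0#
  eval-nonzero {p} nonzero p≈0 = t-transcendental (p , nonzero , p≈0)

  -- A vector of n coefficients in 𝔽q is coded by a number below qⁿ. Spaces of functions are then
  -- bounded through their codes, although the eₗ are only known to generate and may be dependent.
  combination : Fin (q ℕ.^ n) → Carrier
  combination i = sum (λ l → φ.⟦ enumeration.to (Fin.finToFun i l) ⟧ * e l)

  -- V N is the set of the Σ_l p_l(t) e_l with deg p_l < N.
  record V (N : ℕ) (a : Carrier) : Set where
    constructor _,_
    field
      code : Fin ((q ℕ.^ n) ℕ.^ N)
      value : a ≈ horner t combination N code

  private
    index : k.Carrier → Fin q
    index c = proj₁ (enumeration.surjective c)

    index-to : ∀ c → φ.⟦ enumeration.to (index c) ⟧ ≈ φ.⟦ c ⟧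
    index-to c = φ.⟦⟧-cong (proj₂ (enumeration.surjective c) ≡.refl)

    sum-cong : ∀ {n} {f g : Fin n → Carrier} → (∀ l → f l ≈ g l) → sum f ≈ sum g
    sum-cong {zero} f≈g = refl
    sum-cong {suc n} f≈g = +-cong (f≈g zero) (sum-cong (f≈g ∘ suc))

    combination-of : ∀ (c : Fin n → k.Carrier) → ∃[ i ] sum (λ l → φ.⟦ c l ⟧ * e l) ≈ combination i
    combination-of c = Fin.funToFin (index ∘ c) , sum-cong (λ l → *-congʳ (begin
      φ.⟦ c l ⟧                             ≈⟨ sym (index-to (c l)) ⟩
      φ.⟦ enumeration.to (index (c l)) ⟧    ≈⟨ reflexive (≡.cong (λ i → φ.⟦ enumeration.to i ⟧) (≡.sym (Fin.finToFun-funToFin (index ∘ c) l))) ⟩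
      φ.⟦ enumeration.to (Fin.finToFun (Fin.funToFin (index ∘ c)) l) ⟧ ∎))

    sum-+ : ∀ {n} (f g : Fin n → Carrier) → sum f + sum g ≈ sum (λ l → f l + g l)
    sum-+ {zero} f g = +-identityˡ 0#
    sum-+ {suc n} f g = trans (interchange _ _ _ _) (+-congˡ (sum-+ (f ∘ suc) (g ∘ suc)))
      where
      interchange : ∀ a b c d → (a + b) + (c + d) ≈ (a + c) + (b + d)
      interchange = solve 4 (λ a b c d → (a :+ b) :+ (c :+ d) := (a :+ c) :+ (b :+ d)) refl

    sum-* : ∀ {n} a (f : Fin n → Carrier) → a * sum f ≈ sum (λ l → a * f l)
    sum-* {zero} a f = zeroʳ a
    sum-* {suc n} a f = trans (distribˡ a _ _) (+-congˡ (sum-* a (f ∘ suc)))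

    combination-+ : ∀ i j → ∃[ k ] combination i + combination j ≈ combination k
    combination-+ i j with combination-of (λ l → enumeration.to (Fin.finToFun i l) k.+ enumeration.to (Fin.finToFun j l))
    ... | k , eq = k , trans (sum-+ {n} _ _) (trans (sum-cong (λ l → sym (trans (*-congʳ (φ.+-homo _ _)) (distribʳ (e l) _ _)))) eq)

    combination-* : ∀ c i → ∃[ j ] φ.⟦ c ⟧ * combination i ≈ combination j
    combination-* c i with combination-of (λ l → c k.* enumeration.to (Fin.finToFun i l))
    ... | j , eq = j , trans (sum-* {n} _ _) (trans (sum-cong (λ l → sym (trans (*-congʳ (φ.*-homo _ _)) (*-assoc _ _ (e l))))) eq)

    δ : ∀ {n} → Fin n → Fin n → k.Carrier
    δ zero zero = k.1#
    δ zero (suc _) = k.0#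
    δ (suc l) zero = k.0#
    δ (suc l) (suc l′) = δ l l′

    sum-0 : ∀ {n} (e : Fin n → Carrier) → sum (λ l → φ.⟦ k.0# ⟧ * e l) ≈ 0#
    sum-0 e = trans (sym (sum-* _ e)) (trans (*-congʳ φ.0#-homo) (zeroˡ _))

    sum-δ : ∀ {n} (e : Fin n → Carrier) l → sum (λ l′ → φ.⟦ δ l l′ ⟧ * e l′) ≈ e l
    sum-δ e zero = trans (+-cong (trans (*-congʳ φ.1#-homo) (*-identityˡ _)) (sum-0 (e ∘ suc))) (+-identityʳ _)
    sum-δ e (suc l) = trans (+-cong (trans (*-congʳ φ.0#-homo) (zeroˡ _)) (sum-δ (e ∘ suc) l)) (+-identityˡ _)

    combination-0 : ∃[ i ] 0# ≈ combination i
    combination-0 with combination-of (λ _ → k.0#)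
    ... | i , eq = i , trans (sym (sum-0 e)) eq

    combination-e : ∀ l → ∃[ i ] e l ≈ combination i
    combination-e l with combination-of (δ l)
    ... | i , eq = i , trans (sym (sum-δ e l)) eq

  V-resp : ∀ {N a b} → a ≈ b → V N a → V N b
  V-resp a≈b (i , eq) = i , trans (sym a≈b) eq

  private
    V-head : ∀ {N i a w} → a ≈ combination i + t * w → V N w → V (suc N) a
    V-head {N} {i} {a} {w} eq (j , w≈) = Fin.combine i j , (begin
      a                                            ≈⟨ eq ⟩
      combination i + t * w                        ≈⟨ +-congˡ (*-congˡ w≈) ⟩
      combination i + t * horner t combination N j
        ≈⟨ reflexive (≡.cong (λ (i , j) → combination i + t * horner t combination N j) (≡.sym (Fin.remQuot-combine i j))) ⟩
      horner t combination (suc N) (Fin.combine i j) ∎)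

    V-split : ∀ {N a} → V (suc N) a → ∃₂ λ i w → V N w × a ≈ combination i + t * w
    V-split (i , eq) = _ , _ , (_ , refl) , eq

    V-zero : ∀ {N a} → a ≈ 0# → V N a
    V-zero {zero} a≈0 = zero , a≈0
    V-zero {suc N} {a} a≈0 with combination-0
    ... | i , 0≈ = V-head (trans a≈0 (trans (sym (+-identityʳ 0#)) (+-cong 0≈ (sym (zeroʳ t))))) (V-zero {N} refl)

  V-+ : ∀ {N a b} → V N a → V N b → V N (a + b)
  V-+ {zero} (_ , a≈0) (_ , b≈0) = zero , trans (+-cong a≈0 b≈0) (+-identityˡ 0#)
  V-+ {suc N} {a} {b} Va Vb with V-split {N} Va | V-split {N} Vb
  ... | i , w , Vw , a≈ | j , w′ , Vw′ , b≈ with combination-+ i j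
  ... | k , sum≈ = V-head (begin
    a + b                                                ≈⟨ +-cong a≈ b≈ ⟩
    (combination i + t * w) + (combination j + t * w′)   ≈⟨ rearrange _ _ _ _ _ ⟩
    (combination i + combination j) + t * (w + w′)       ≈⟨ +-congʳ sum≈ ⟩
    combination k + t * (w + w′)                         ∎) (V-+ {N} Vw Vw′)
    where
    rearrange : ∀ a b t w w′ → (a + t * w) + (b + t * w′) ≈ (a + b) + t * (w + w′)
    rearrange = solve 5 (λ a b t w w′ → (a :+ t :* w) :+ (b :+ t :* w′) := (a :+ b) :+ t :* (w :+ w′)) refl

  V-scale : ∀ {N a} c → V N a → V N (φ.⟦ c ⟧ * a)
  V-scale {zero} c (_ , a≈0) = zero , trans (*-congˡ a≈0) (zeroʳ _)
  V-scale {suc N} {a} c Va with V-split {N} Va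
  ... | i , w , Vw , a≈ with combination-* c i
  ... | j , eq = V-head (begin
    φ.⟦ c ⟧ * a                                 ≈⟨ *-congˡ a≈ ⟩
    φ.⟦ c ⟧ * (combination i + t * w)           ≈⟨ rearrange _ _ _ _ ⟩
    φ.⟦ c ⟧ * combination i + t * (φ.⟦ c ⟧ * w) ≈⟨ +-congʳ eq ⟩
    combination j + t * (φ.⟦ c ⟧ * w)           ∎) (V-scale {N} c Vw)
    where
    rearrange : ∀ c a t w → c * (a + t * w) ≈ c * a + t * (c * w)
    rearrange = solve 4 (λ c a t w → c :* (a :+ t :* w) := c :* a :+ t :* (c :* w)) refl

  V-t : ∀ {N a} → V N a → V (suc N) (t * a)
  V-t {N} Va with combination-0
  ... | i , 0≈ = V-head (trans (sym (+-identityˡ _)) (+-congʳ 0≈)) Va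

  V-suc : ∀ {N a} → V N a → V (suc N) a
  V-suc {zero} (_ , a≈0) = V-zero a≈0
  V-suc {suc N} Va with V-split {N} Va
  ... | i , w , Vw , a≈ = V-head a≈ (V-suc {N} Vw)

  V-weaken : ∀ {M N a} → M ≤ N → V M a → V N a
  V-weaken {M} {N} {a} M≤N Va = ≡.subst (λ N → V N a) (≡.trans (ℕ.+-comm (N ℕ.∸ M) M) (ℕ.m+[n∸m]≡n M≤N)) (go (N ℕ.∸ M))
    where
    go : ∀ d → V (d ℕ.+ M) a
    go zero = Va
    go (suc d) = V-suc (go d)

  V-sum : ∀ {N m} {f : Fin m → Carrier} → (∀ l → V N (f l)) → V N (sum f)
  V-sum {N} {zero} Vf = V-zero {N} refl
  V-sum {N} {suc m} Vf = V-+ {N} (Vf zero) (V-sum {N} (Vf ∘ suc))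

  V-e : ∀ l → V 1 (e l)
  V-e l with combination-e l
  ... | i , eq = V-head {w = 0#} (trans eq (sym (trans (+-congˡ (zeroʳ t)) (+-identityʳ _)))) (V-zero {0} refl)

  -- Multiplication by d raises degrees in t by at most a constant. An element of F need not have
  -- this property before a denominator is cleared.
  Bounded : Pred Carrier 0ℓ
  Bounded d = ∃[ B ] ∀ N {a} → V N a → V (N ℕ.+ B) (d * a)

  private
    eval-bounded : ∀ p → Bounded (eval p t)
    eval-bounded [] = 0 , λ N _ → V-zero {N ℕ.+ 0} (zeroˡ _)
    eval-bounded (c ∷ p) with eval-bounded p
    ... | B , bound = suc B , λ N {a} Va → ≡.subst (λ M → V M ((φ.⟦ c ⟧ + t * eval p t) * a)) (≡.sym (ℕ.+-suc N B))
      (V-resp (rearrange _ _ _ _) (V-+ (V-scale c (V-weaken (ℕ.m≤n⇒m≤1+n (ℕ.m≤m+n N B)) Va)) (V-t {N ℕ.+ B} (bound N Va))))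
      where
      rearrange : ∀ c a t x → c * a + t * (x * a) ≈ (c + t * x) * a
      rearrange = solve 4 (λ c a t x → c :* a :+ t :* (x :* a) := (c :+ t :* x) :* a) refl

    bounded-* : ∀ {c d} → Bounded c → Bounded d → Bounded (c * d)
    bounded-* {c} {d} (B , p) (C , q) = C ℕ.+ B , λ N {a} Va →
      ≡.subst (λ M → V M (c * d * a)) (ℕ.+-assoc N C B) (V-resp (sym (*-assoc c d a)) (p (N ℕ.+ C) (q N Va)))

  denominator : ∀ z → ∃[ d ] d ≉ 0# × Bounded d × ∃[ N ] V N (d * z)
  denominator z with generates z
  ... | p , c , nonzero , eq with uniform-bound {P = λ N l → V N (eval (c l) t * e l)} V-weaken
         (λ l → _ , proj₂ (eval-bounded (c l)) 1 (V-e l))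
  ... | N , Vs = eval p t , eval-nonzero nonzero , eval-bounded p , N , V-resp (sym eq) (V-sum {N} Vs)

  common-denominator : ∀ {m} (z : Fin m → Carrier) → ∃[ d ] d ≉ 0# × Bounded d × ∃[ N ] ∀ j → V N (d * z j)
  common-denominator {zero} z = 1# , 1≉0 , (0 , λ N Va → V-weaken (ℕ.m≤m+n N 0) (V-resp (sym (*-identityˡ _)) Va)) , 0 , λ ()
  common-denominator {suc m} z with denominator (z zero) | common-denominator (z ∘ suc)
  ... | d , d≉0 , bounded@(B , bound) , N , Vz | d′ , d′≉0 , bounded′@(B′ , bound′) , N′ , Vs =
    d * d′ , *-nonzero d≉0 d′≉0 , bounded-* bounded bounded′ , uniform-bound {P = λ N j → V N (d * d′ * z j)} V-weaken λ where
      zero → _ , V-resp (swap d d′ (z zero)) (bound′ N Vz)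
      (suc j) → _ , V-resp (sym (*-assoc d d′ _)) (bound N′ (Vs j))
    where
    swap : ∀ d d′ z → d′ * (d * z) ≈ d * d′ * z
    swap = solve 3 (λ d d′ z → d′ :* (d :* z) := d :* d′ :* z) refl

  -- Multiplication by d u commutes with t and with constants, so it is enough to clear the
  -- denominators of the finitely many products u eₗ.
  multiple-bounded : ∀ u → ∃[ d ] d ≉ 0# × Bounded d × Bounded (d * u)
  multiple-bounded u with common-denominator (λ l → u * e l)
  ... | d , d≉0 , bounded , B , Vs = d , d≉0 , bounded , B , bound
    where
    V-combination : ∀ i → V B (d * u * combination i)
    V-combination i = V-resp (sym (sum-* {n} _ _)) (V-sum {B} (λ l →
      V-resp (rearrange _ _ _ _) (V-scale {B} (enumeration.to (Fin.finToFun i l)) (Vs l))))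
      where
      rearrange : ∀ c d u e → c * (d * (u * e)) ≈ d * u * (c * e)
      rearrange = solve 4 (λ c d u e → c :* (d :* (u :* e)) := d :* u :* (c :* e)) refl
    bound : ∀ N {a} → V N a → V (N ℕ.+ B) (d * u * a)
    bound zero (_ , a≈0) = V-zero {B} (trans (*-congˡ a≈0) (zeroʳ _))
    bound (suc N) {a} Va with V-split {N} Va
    ... | i , w , Vw , a≈ = V-resp (trans (rearrange _ _ _ _) (*-congˡ (sym a≈)))
      (V-+ (V-weaken (ℕ.m≤n+m B (suc N)) (V-combination i)) (V-t {N ℕ.+ B} (bound N Vw)))
      where
      rearrange : ∀ du c t w → du * c + t * (du * w) ≈ du * (c + t * w)
      rearrange = solve 4 (λ du c t w → du :* c :+ t :* (du :* w) := du :* (c :+ t :* w)) refl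

  -- F being finite over 𝔽q(t), the number of values of Σ_{a<r} uᵃ β_{jₐ}
  -- grows at most like Qʳ.
  digit-bound : ∀ u → ∃[ Q ] ∀ m (β : Fin m → Carrier) → (∀ r → IsSeparated _≈_ (horner u β r)) → m ≤ Q
  digit-bound u with multiple-bounded u
  ... | d , d≉0 , (B₁ , bound₁) , (B₂ , bound₂) = (q ℕ.^ n) ℕ.^ B , bound
    where
    B = B₁ ℕ.⊔ B₂
    bound : ∀ m (β : Fin m → Carrier) → (∀ r → IsSeparated _≈_ (horner u β r)) → m ≤ (q ℕ.^ n) ℕ.^ B
    bound m β separated with common-denominator β
    ... | D , D≉0 , _ , C , Vβ = growth-rate ((q ℕ.^ n) ℕ.^ C) (λ r → ℕ.≤-trans (Fin.injective⇒≤ (code-injective r)) (ℕ.≤-reflexive (size r)))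
      where
      -- D clears the denominators of the digits and dʳ those of the powers of u; each further digit
      -- costs another B in the degree. The digits therefore influence only the factor (qⁿ)^C, and
      -- the resulting bound depends on u alone.
      V-horner : ∀ r i → V (C ℕ.+ r ℕ.* B) (d ^ r * (D * horner u β r i))
      V-horner zero i = V-zero {C ℕ.+ 0} (trans (*-congˡ (zeroʳ D)) (zeroʳ _))
      V-horner (suc r) i = V-resp (rearrange d (d ^ r) D _ u _) (V-+
        (V-weaken (ℕ.+-monoʳ-≤ C (ℕ.≤-trans (ℕ.*-monoʳ-≤ (suc r) (ℕ.m≤m⊔n B₁ B₂)) ℕ.≤-refl)) (powers (suc r) (Vβ _)))
        (V-weaken (ℕ.≤-trans (ℕ.+-monoʳ-≤ (C ℕ.+ r ℕ.* B) (ℕ.m≤n⊔m B₁ B₂)) (ℕ.≤-reflexive (shift C (r ℕ.* B) B)))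
          (bound₂ (C ℕ.+ r ℕ.* B) (V-horner r _))))
        where
        shift : ∀ C x B → C ℕ.+ x ℕ.+ B ≡ C ℕ.+ (B ℕ.+ x)
        shift = solve-∀
        powers : ∀ r {a} → V C a → V (C ℕ.+ r ℕ.* B₁) (d ^ r * a)
        powers zero Va = V-weaken (ℕ.m≤m+n C 0) (V-resp (sym (*-identityˡ _)) Va)
        powers (suc r) Va = V-weaken (ℕ.≤-reflexive (shift C (r ℕ.* B₁) B₁)) (V-resp (sym (*-assoc _ _ _)) (bound₁ (C ℕ.+ r ℕ.* B₁) (powers r Va)))
        rearrange : ∀ d dr D b u s → (d * dr) * (D * b) + d * u * (dr * (D * s)) ≈ (d * dr) * (D * (b + u * s))
        rearrange = solve 6 (λ d dr D b u s → (d :* dr) :* (D :* b) :+ d :* u :* (dr :* (D :* s)) := (d :* dr) :* (D :* (b :+ u :* s))) refl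

      code′ : ∀ r → Fin (m ℕ.^ r) → Fin ((q ℕ.^ n) ℕ.^ (C ℕ.+ r ℕ.* B))
      code′ r i = V.code (V-horner r i)

      code-injective : ∀ r {i j} → code′ r i ≡ code′ r j → i ≡ j
      code-injective r {i} {j} eq = separated r i j (*-cancelˡ D≉0 (*-cancelˡ (^-nonzero r d≉0) (begin
        d ^ r * (D * horner u β r i)                    ≈⟨ V.value (V-horner r i) ⟩
        horner t combination (C ℕ.+ r ℕ.* B) (code′ r i) ≈⟨ reflexive (≡.cong (horner t combination (C ℕ.+ r ℕ.* B)) eq) ⟩
        horner t combination (C ℕ.+ r ℕ.* B) (code′ r j) ≈⟨ sym (V.value (V-horner r j)) ⟩
        d ^ r * (D * horner u β r j)                    ∎)))

      size : ∀ r → (q ℕ.^ n) ℕ.^ (C ℕ.+ r ℕ.* B) ≡ (q ℕ.^ n) ℕ.^ C ℕ.* ((q ℕ.^ n) ℕ.^ B) ℕ.^ r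
      size r = ≡.trans (ℕ.^-distribˡ-+-* (q ℕ.^ n) C (r ℕ.* B))
        (≡.cong ((q ℕ.^ n) ℕ.^ C ℕ.*_) (≡.trans (≡.cong ((q ℕ.^ n) ℕ.^_) (ℕ.*-comm r B)) (≡.sym (ℕ.^-*-assoc (q ℕ.^ n) B r))))

  private
    size : ℕ → ℕ
    size N = (q ℕ.^ n) ℕ.^ N

    quotient : ∀ a {b} → Dec (b ≈ 0#) → Carrier
    quotient a (yes _) = 0#
    quotient a (no b≉0) = a * proj₁ (inverse b≉0)

    fraction : ∀ N → Fin (size N) → Fin (size N) → Carrier
    fraction N i j = quotient (horner t combination N i) (em {P = horner t combination N j ≈ 0#})

  -- F as a countable union of finite families, which allows a maximal subring to be reached by
  -- treating one family after the other. A zero denominator gives the default value `0#`.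
  fractions : ∀ N → Fin (size N ℕ.* size N) → Carrier
  fractions N k = fraction N (proj₁ (Fin.remQuot {size N} (size N) k)) (proj₂ (Fin.remQuot {size N} (size N) k))

  abstract
    fractions-exhaust : ∀ z → ∃[ N ] ∃[ k ] z ≈ fractions N k
    fractions-exhaust z =
      -- Clearing the denominators of z and 1 together gives z = (d z) / (d 1) with both parts in
      -- `V N`.
      let d , d≉0 , _ , N , Vs = common-denominator {2} (λ { zero → z ; (suc _) → 1# })
          i = V.code (Vs zero)
          j = V.code (Vs (suc zero))
      in N , Fin.combine i j , trans (correct d d≉0 (V.value (Vs zero)) (V.value (Vs (suc zero))) em)
           (reflexive (≡.cong₂ (fraction N) (≡.sym (≡.cong proj₁ (Fin.remQuot-combine i j))) (≡.sym (≡.cong proj₂ (Fin.remQuot-combine i j)))))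
      where
      correct : ∀ d → d ≉ 0# → ∀ {a b} → d * z ≈ a → d * 1# ≈ b → (b? : Dec (b ≈ 0#)) → z ≈ quotient a b?
      correct d d≉0 dz≈a d≈b (yes b≈0) = ⊥-elim (d≉0 (trans (sym (*-identityʳ d)) (trans d≈b b≈0)))
      correct d d≉0 {a} {b} dz≈a d≈b (no b≉0) = begin
        z                  ≈⟨ sym (*-identityʳ z) ⟩
        z * 1#             ≈⟨ *-congˡ (sym (proj₂ (inverse b≉0))) ⟩
        z * (b⁻¹ * b)      ≈⟨ *-congˡ (*-congˡ (sym d≈b)) ⟩
        z * (b⁻¹ * (d * 1#)) ≈⟨ rearrange z b⁻¹ d ⟩
        (d * z) * b⁻¹      ≈⟨ *-congʳ dz≈a ⟩
        a * b⁻¹            ∎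
        where
        b⁻¹ : Carrier
        b⁻¹ = proj₁ (inverse b≉0)
        rearrange : ∀ z c d → z * (c * (d * 1#)) ≈ (d * z) * c
        rearrange = solve 3 (λ z c d → z :* (c :* (d :* con (1 , 0))) := (d :* z) :* c) refl

open AddSupremum ℤ._≤_ using (_≤⊤⁺; ≤⁺-trans; [≤]-injective) renaming ([_] to [_]≤)

-- Valuations and approximation

private
  ≤⇒0≤ : ∀ {i j} → i ℤ.≤ j → + 0 ℤ.≤ j ℤ.- i
  ≤⇒0≤ = ℤ.i≤j⇒0≤j-i

≤-by₁ : ∀ {a b} c d → a ℤ.≤ b → b ℤ.- a ≡ d ℤ.- c → c ℤ.≤ d
≤-by₁ c d a≤b eq = ℤ.0≤i-j⇒j≤i (≡.subst (+ 0 ℤ.≤_) eq (≤⇒0≤ a≤b))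

module Valuations (em : ExcludedMiddle 0ℓ) {K : FunctionField} where
  open FunctionField K using (F)
  open CommutativeRing (fieldRing F) hiding (zero)
  open RingProperties ring
  open Exponentiation semiring using (_^_)
  open Field em F
  open Place

  infix 4 _≤[_]_

  -- A record, since y and a cannot be inferred from a bare inequality between elements of ℤ∞.
  record _≤[_]_ (N : ℤ) (y : Place K) (a : Carrier) : Set where
    constructor ≤v
    field
      [N]≤v : [ N ] ≤∞ v y a
  open _≤[_]_ public

  record Order (y : Place K) (a : Carrier) (m : ℤ) : Set where
    constructor v≡
    field
      v≡[m] : v y a ≡ [ m ]
  open Order public

  module _ {y : Place K} where

    abstract
      ≤-resp : ∀ {N a b} → a ≈ b → N ≤[ y ] a → N ≤[ y ] b
      ≤-resp {N} a≈b (≤v p) = ≤v (≡.subst ([ N ] ≤∞_) (v-cong y a≈b) p)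

      ≤-0# : ∀ {N a} → a ≈ 0# → N ≤[ y ] a
      ≤-0# {N} {a} a≈0 = ≤v (≡.subst ([ N ] ≤∞_) (≡.sym (Equivalence.from (v-⊤ y a) a≈0)) ([ N ] ≤⊤⁺))

      ≤-weaken : ∀ {M N a} → M ℤ.≤ N → N ≤[ y ] a → M ≤[ y ] a
      ≤-weaken M≤N (≤v p) = ≤v (≤⁺-trans ℤ.≤-trans [ M≤N ]≤ p)

      ≤-+ : ∀ {N a b} → N ≤[ y ] a → N ≤[ y ] b → N ≤[ y ] (a + b)
      ≤-+ (≤v p) (≤v q) = ≤v (v-+ y p q)

      ≤-* : ∀ {M N a b} → M ≤[ y ] a → N ≤[ y ] b → (M ℤ.+ N) ≤[ y ] (a * b)
      ≤-* {M} {N} {a} {b} (≤v p) (≤v q) = ≤v (≡.subst ([ M ℤ.+ N ] ≤∞_) (≡.sym (v-* y a b)) (add p q))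
        where
        add : ∀ {m n} → [ M ] ≤∞ m → [ N ] ≤∞ n → [ M ℤ.+ N ] ≤∞ (m +∞ n)
        add [ p ]≤ [ q ]≤ = [ ℤ.+-mono-≤ p q ]≤
        add [ p ]≤ (_ ≤⊤⁺) = _ ≤⊤⁺
        add (_ ≤⊤⁺) _ = _ ≤⊤⁺

      order : ∀ {a} → a ≉ 0# → ∃[ m ] Order y a m
      order {a} a≉0 with v y a in eq
      ... | nothing = ⊥-elim (a≉0 (Equivalence.to (v-⊤ y a) eq))
      ... | just m = m , v≡ eq

      order⇒nonzero : ∀ {a m} → Order y a m → a ≉ 0#
      order⇒nonzero {a} (v≡ eq) a≈0 with ≡.trans (≡.sym eq) (Equivalence.from (v-⊤ y a) a≈0)
      ... | ()

      order-cong : ∀ {a b m} → a ≈ b → Order y a m → Order y b m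
      order-cong a≈b (v≡ p) = v≡ (≡.trans (v-cong y (sym a≈b)) p)

      order-unique : ∀ {a m n} → Order y a m → Order y a n → m ≡ n
      order-unique (v≡ p) (v≡ q) = just-injective (≡.trans (≡.sym p) q)

      order⇒≤ : ∀ {a m N} → Order y a m → N ℤ.≤ m → N ≤[ y ] a
      order⇒≤ {N = N} (v≡ eq) N≤m = ≤v (≡.subst ([ N ] ≤∞_) (≡.sym eq) [ N≤m ]≤)

      ≤-order : ∀ {a m N} → Order y a m → N ≤[ y ] a → N ℤ.≤ m
      ≤-order {N = N} (v≡ eq) (≤v N≤a) = [≤]-injective (≡.subst ([ N ] ≤∞_) eq N≤a)

      order-* : ∀ {a b m n} → Order y a m → Order y b n → Order y (a * b) (m ℤ.+ n)
      order-* {a} {b} (v≡ p) (v≡ q) = v≡ (≡.trans (v-* y a b) (≡.cong₂ _+∞_ p q))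

      order-1# : Order y 1# (+ 0)
      order-1# with order 1≉0
      ... | m , eq = ≡.subst (Order y 1#) m≡0 eq
        where
        m≡m+m : m ≡ m ℤ.+ m
        m≡m+m = order-unique eq (order-cong (*-identityˡ 1#) (order-* eq eq))
        m≡0 : m ≡ + 0
        m≡0 = ≡.trans (lemma m) (≡.trans (≡.cong (ℤ._- m) (≡.sym m≡m+m)) (ℤ.+-inverseʳ m))
          where
          lemma : ∀ m → m ≡ m ℤ.+ m ℤ.- m
          lemma = ℤ.solve-∀

      ≤-1# : + 0 ≤[ y ] 1#
      ≤-1# = order⇒≤ order-1# ℤ.≤-refl

      order-inverse : ∀ {a b m} → b * a ≈ 1# → Order y a m → Order y b (ℤ.- m)
      order-inverse {a} {b} {m} ba≈1 va≡m with order {b} (inverse-nonzero ba≈1)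
      ... | n , vb≡n = ≡.subst (Order y b) (≡.trans (lemma n m) (≡.trans (≡.cong (ℤ._- m) n+m≡0) (ℤ.+-identityˡ (ℤ.- m)))) vb≡n
        where
        n+m≡0 : n ℤ.+ m ≡ + 0
        n+m≡0 = order-unique (order-cong ba≈1 (order-* vb≡n va≡m)) order-1#
        lemma : ∀ n m → n ≡ n ℤ.+ m ℤ.- m
        lemma = ℤ.solve-∀

      ≤--1# : + 0 ≤[ y ] - 1#
      ≤--1# with order { - 1# } (λ -1≈0 → 1≉0 (trans (sym (-‿involutive 1#)) (trans (-‿cong -1≈0) -0#≈0#)))
      ... | m , eq = order⇒≤ eq (nonnegative m (order-unique (order-cong square (order-* eq eq)) order-1#))
        where
        square : - 1# * - 1# ≈ 1#
        square = trans (-1*x≈-x (- 1#)) (-‿involutive 1#)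
        nonnegative : ∀ m → m ℤ.+ m ≡ + 0 → + 0 ℤ.≤ m
        nonnegative (+ n) _ = +≤+ z≤n

      ≤-neg : ∀ {N a} → N ≤[ y ] a → N ≤[ y ] - a
      ≤-neg {N} {a} p = ≤-resp (-1*x≈-x a) (≡.subst (_≤[ y ] (- 1# * a)) (ℤ.+-identityˡ N) (≤-* ≤--1# p))

      ≤-minus : ∀ {N a b} → N ≤[ y ] a → N ≤[ y ] b → N ≤[ y ] a - b
      ≤-minus p q = ≤-+ p (≤-neg q)

      ≤-swap : ∀ {N a b} → N ≤[ y ] a - b → N ≤[ y ] b - a
      ≤-swap {a = a} {b} p = ≤-resp (⁻¹-anti-homo-// a b) (≤-neg p)

      ≤-^ : ∀ {a m} n → + m ≤[ y ] a → + (n ℕ.* m) ≤[ y ] a ^ n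
      ≤-^ zero p = ≤-1#
      ≤-^ {a} {m} (suc n) p = ≡.subst (_≤[ y ] (a * a ^ n)) (≡.sym (ℤ.pos-+ m (n ℕ.* m))) (≤-* p (≤-^ n p))

      order-^ : ∀ {a m} n → Order y a m → Order y (a ^ n) (+ n ℤ.* m)
      order-^ zero p = order-1#
      order-^ {a} {m} (suc n) p = ≡.subst (Order y (a * a ^ n)) (lemma m (+ n)) (order-* p (order-^ n p))
        where
        lemma : ∀ m n → m ℤ.+ n ℤ.* m ≡ (+ 1 ℤ.+ n) ℤ.* m
        lemma = ℤ.solve-∀

      ≰⇒order : ∀ {N a} → ¬ N ≤[ y ] a → ∃[ m ] Order y a m × m ℤ.< N
      ≰⇒order {N} {a} N≰a with order {a} (λ a≈0 → N≰a (≤-0# a≈0))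
      ... | m , eq = m , eq , ℤ.≰⇒> (λ N≤m → N≰a (order⇒≤ eq N≤m))

      order-from-bounds : ∀ {m a} → m ≤[ y ] a → ¬ + 1 ℤ.+ m ≤[ y ] a → Order y a m
      order-from-bounds {m} {a} m≤a 1+m≰a with ≰⇒order 1+m≰a
      ... | n , eq , n<1+m = ≡.subst (Order y a) (ℤ.≤-antisym (≤-by₁ n m (ℤ.i<j⇒suc[i]≤j n<1+m) (lemma n m)) (≤-order eq m≤a)) eq
        where
        lemma : ∀ n m → + 1 ℤ.+ m ℤ.- (+ 1 ℤ.+ n) ≡ m ℤ.- n
        lemma = ℤ.solve-∀

      order⇒≰ : ∀ {m a} → Order y a m → ¬ + 1 ℤ.+ m ≤[ y ] a
      order⇒≰ {m} eq p = ℤ.<-irrefl ≡.refl (ℤ.suc[i]≤j⇒i<j (≤-order eq p))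

      -- A larger order of a + b would be inherited by a = (a + b) - b.
      order-+ : ∀ {m a b} → Order y a m → + 1 ℤ.+ m ≤[ y ] b → Order y (a + b) m
      order-+ {m} {a} {b} eq p = order-from-bounds
        (≤-+ (order⇒≤ eq ℤ.≤-refl) (≤-weaken (ℤ.i≤suc[i] m) p))
        (λ q → order⇒≰ eq (≤-resp (//-rightDividesʳ b a) (≤-minus q p)))

      ≤-*-cancelˡ : ∀ {m N a b} → Order y a m → m ℤ.+ N ≤[ y ] a * b → N ≤[ y ] b
      ≤-*-cancelˡ {m} {N} {a} {b} eq p with inverse (order⇒nonzero eq)
      ... | a⁻¹ , a⁻¹a≈1 = ≤-resp (trans (sym (*-assoc a⁻¹ a b)) (trans (*-congʳ a⁻¹a≈1) (*-identityˡ b)))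
        (≡.subst (_≤[ y ] (a⁻¹ * (a * b))) (lemma m N) (≤-* (order⇒≤ (order-inverse a⁻¹a≈1 eq) ℤ.≤-refl) p))
        where
        lemma : ∀ m N → ℤ.- m ℤ.+ (m ℤ.+ N) ≡ N
        lemma = ℤ.solve-∀

      bounded-below : ∀ a → ∃[ B ] ℤ.- (+ B) ≤[ y ] a
      bounded-below a with v y a in eq
      ... | nothing = 0 , ≤v (≡.subst ([ + 0 ] ≤∞_) (≡.sym eq) (_ ≤⊤⁺))
      ... | just (+ n) = 0 , order⇒≤ (v≡ eq) (+≤+ z≤n)
      ... | just -[1+ n ] = suc n , order⇒≤ (v≡ eq) ℤ.≤-refl

  module _ {y z : Place K} (y≈z : y ≈ₚ z) where

    abstract
      ≤-at : ∀ {N a} → N ≤[ y ] a → N ≤[ z ] a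
      ≤-at {N} (≤v p) = ≤v (≡.subst ([ N ] ≤∞_) (y≈z _) p)

      order-at : ∀ {a m} → Order y a m → Order z a m
      order-at (v≡ p) = v≡ (≡.trans (≡.sym (y≈z _)) p)

  abstract
    uniformiser : ∀ y → ∃[ a ] Order y a (+ 1)
    uniformiser y = proj₁ (normalised y) , v≡ (proj₂ (normalised y))

    uniformiser-power : ∀ y n → ∃[ a ] Order y a (+ n)
    uniformiser-power y n = proj₁ (uniformiser y) ^ n ,
      ≡.subst (Order y _) (ℤ.*-identityʳ (+ n)) (order-^ n (proj₂ (uniformiser y)))

  integral-isSubringᶠ : ∀ (P : Pred (Place K) 0ℓ) → IsSubring (fieldRing F) (λ a → ∀ y → P y → + 0 ≤[ y ] a)
  integral-isSubringᶠ P = record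
    { +-closed = λ p q y y∈ → ≤-+ (p y y∈) (q y y∈)
    ; *-closed = λ p q y y∈ → ≤-* (p y y∈) (q y y∈)
    ; -‿closed = λ p y y∈ → ≤-neg (p y y∈)
    ; 0#-closed = λ y y∈ → ≤-0# refl
    ; 1#-closed = λ y y∈ → ≤-1#
    }

module _ {K : FunctionField} where

  ≈ₚ-refl : {y : Place K} → y ≈ₚ y
  ≈ₚ-refl a = ≡.refl

  ≈ₚ-sym : {y z : Place K} → y ≈ₚ z → z ≈ₚ y
  ≈ₚ-sym y≈z a = ≡.sym (y≈z a)

  ≈ₚ-trans : {w y z : Place K} → w ≈ₚ y → y ≈ₚ z → w ≈ₚ z
  ≈ₚ-trans w≈y y≈z a = ≡.trans (w≈y a) (y≈z a)

  infix 4 _∈ₚ_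

  _∈ₚ_ : Place K → List (Place K) → Set
  y ∈ₚ T = Any (y ≈ₚ_) T

  ∈ₚ-resp : ∀ {y z T} → y ≈ₚ z → y ∈ₚ T → z ∈ₚ T
  ∈ₚ-resp {y} {z} {w ∷ T} y≈z (here y≈w) = here (≈ₚ-trans {w = z} {y} {w} (≈ₚ-sym {y = y} {z} y≈z) y≈w)
  ∈ₚ-resp {y} {z} y≈z (there y∈T) = there (∈ₚ-resp {y} {z} y≈z y∈T)

module Approximation (em : ExcludedMiddle 0ℓ) {K : FunctionField} where
  open FunctionField K using (F)
  open CommutativeRing (fieldRing F) hiding (zero)
  open RingProperties ring
  open Exponentiation semiring using (_^_)
  open Field em F
  open Valuations em {K}
  open SetoidReasoning setoid
  open IntegerSolver (fieldRing F) using (solve; _:+_; _:*_; _:-_; :-_; _:=_; con)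

  Pole : Place K → Carrier → Set
  Pole y a = ∃[ n ] Order y a -[1+ n ]

  abstract
    ≰⇒pole : ∀ {y a} → ¬ + 0 ≤[ y ] a → Pole y a
    ≰⇒pole ≰ with ≰⇒order ≰
    ... | -[1+ n ] , eq , -<+ = n , eq

  module _ {y z : Place K} (y≉z : ¬ y ≈ₚ z) where

    private
      -- Under an inclusion of valuation rings the units of y are units of z. Hence the valuation of
      -- z is e times that of y, where e ≥ 0 is the order at z of a uniformiser of y. As the
      -- valuation of z takes the value 1, e = 1 and the places agree.
      module _ (included : ∀ f → + 0 ≤[ y ] f → + 0 ≤[ z ] f) where
        π = proj₁ (uniformiser y)
        order-π = proj₂ (uniformiser y)

        e : ℤ
        e = proj₁ (order {z} (order⇒nonzero order-π))
        order-e : Order z π e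
        order-e = proj₂ (order {z} (order⇒nonzero order-π))

        0≤e : + 0 ℤ.≤ e
        0≤e = ≤-order order-e (included π (order⇒≤ order-π (+≤+ z≤n)))

        unit : ∀ {u} → Order y u (+ 0) → Order z u (+ 0)
        unit {u} p with order {z} (order⇒nonzero p) | inverse (order⇒nonzero p)
        ... | n , q | u⁻¹ , u⁻¹u≈1 = ≡.subst (Order z u) (ℤ.≤-antisym (ℤ.neg-cancel-≤
          (≤-order (order-inverse u⁻¹u≈1 q) (included u⁻¹ (order⇒≤ (order-inverse u⁻¹u≈1 p) ℤ.≤-refl))))
          (≤-order q (included u (order⇒≤ p ℤ.≤-refl)))) q

        scaled⁺ : ∀ {a} n → Order y a (+ n) → Order z a (+ n ℤ.* e)
        scaled⁺ {a} n p with inverse (^-nonzero n (order⇒nonzero order-π))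
        ... | b , bπⁿ≈1 = ≡.subst (Order z a) (ℤ.+-identityˡ (+ n ℤ.* e)) (order-cong undo
          (order-* (unit (≡.subst (Order y (a * b)) cancel (order-* p (order-inverse bπⁿ≈1 (order-^ n order-π))))) (order-^ n order-e)))
          where
          cancel : + n ℤ.+ ℤ.- (+ n ℤ.* + 1) ≡ + 0
          cancel = ≡.trans (≡.cong (λ m → + n ℤ.+ ℤ.- m) (ℤ.*-identityʳ (+ n))) (ℤ.+-inverseʳ (+ n))
          undo : a * b * π ^ n ≈ a
          undo = trans (*-assoc a b (π ^ n)) (trans (*-congˡ bπⁿ≈1) (*-identityʳ a))

        scaled : ∀ {a} m → Order y a m → Order z a (m ℤ.* e)
        scaled (+ n) p = scaled⁺ n p
        scaled {a} -[1+ n ] p with inverse (order⇒nonzero p)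
        ... | b , ba≈1 = ≡.subst (Order z a) (ℤ.neg-distribˡ-* (+ suc n) e)
          (order-inverse (trans (*-comm a b) ba≈1) (scaled⁺ (suc n) (order-inverse ba≈1 p)))

        e≡1 : e ≡ + 1
        e≡1 with uniformiser z
        ... | g , p with order {y} (order⇒nonzero p)
        ... | m , q = one e 0≤e (order-unique (scaled m q) p)
          where
          one : ∀ e → + 0 ℤ.≤ e → m ℤ.* e ≡ + 1 → e ≡ + 1
          one (+ k) _ eq = ≡.cong +_ (ℕ.m*n≡1⇒n≡1 ℤ.∣ m ∣ k (≡.trans (≡.sym (ℤ.abs-* m (+ k))) (≡.cong ℤ.∣_∣ eq)))

        equal : y ≈ₚ z
        equal a with em {P = a ≈ 0#}
        ... | yes a≈0 = ≡.trans (Equivalence.from (Place.v-⊤ y a) a≈0) (≡.sym (Equivalence.from (Place.v-⊤ z a) a≈0))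
        ... | no a≉0 with order {y} a≉0
        ... | m , p = ≡.trans (v≡[m] p) (≡.sym (v≡[m] (≡.subst (Order z a) (≡.trans (≡.cong (m ℤ.*_) e≡1) (ℤ.*-identityʳ m)) (scaled m p))))

    abstract
      not-included : ∃[ f ] + 0 ≤[ y ] f × Pole z f
      not-included with em {P = ∃[ f ] + 0 ≤[ y ] f × ¬ + 0 ≤[ z ] f}
      ... | yes (f , p , q) = f , p , ≰⇒pole q
      ... | no included = ⊥-elim (y≉z (equal (λ f p → case f p)))
        where
        case : ∀ f → + 0 ≤[ y ] f → + 0 ≤[ z ] f
        case f p with em {P = + 0 ≤[ z ] f}
        ... | yes q = q
        ... | no q = ⊥-elim (included (f , p , q))

  abstract
    pole-of-product : ∀ {y a b} → Pole y a → b ≉ 0# → (∀ {n} → Order y b n → n ℤ.≤ + 0) → Pole y (a * b)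
    pole-of-product {y} {a} {b} (n , p) b≉0 nonpositive with order {y} b≉0
    ... | m , q with order-* p q
    ... | r = negative _ (nonpositive q) r
      where
      negative : ∀ m → m ℤ.≤ + 0 → Order y (a * b) (-[1+ n ] ℤ.+ m) → Pole y (a * b)
      negative (+ 0) _ r = n , ≡.subst (Order y (a * b)) (ℤ.+-identityʳ -[1+ n ]) r
      negative (+ suc _) (+≤+ ()) _
      negative -[1+ m ] _ r = _ , r

    -- The quotient g/f, where f is integral at y with a pole at z and g is integral at z with a
    -- pole at y.
    separate₂ : ∀ {y z} → ¬ y ≈ₚ z → ∃[ h ] Pole y h × + 1 ≤[ z ] h
    separate₂ {y} {z} y≉z with not-included y≉z | not-included {z} {y} (y≉z ∘ ≈ₚ-sym {y = z} {y})
    ... | f , 0≤f , (m , pole-f) | g , 0≤g , pole-g with inverse (order⇒nonzero pole-f)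
    ... | f⁻¹ , f⁻¹f≈1 = g * f⁻¹ ,
      pole-of-product pole-g (inverse-nonzero f⁻¹f≈1) (λ p → nonpositive p) ,
      ≤-weaken (+≤+ (s≤s z≤n)) (≤-* 0≤g (order⇒≤ (order-inverse f⁻¹f≈1 pole-f) ℤ.≤-refl))
      where
      nonpositive : ∀ {n} → Order y f⁻¹ n → n ℤ.≤ + 0
      nonpositive {n} p = ≡.subst (ℤ._≤ + 0) (ℤ.neg-involutive n)
        (ℤ.neg-mono-≤ (≤-order (order-inverse (trans (*-comm f f⁻¹) f⁻¹f≈1) p) 0≤f))

    bounded-below-on : ∀ (T : List (Place K)) a → ∃[ B ] ∀ z → z ∈ₚ T → ℤ.- (+ B) ≤[ z ] a
    bounded-below-on [] a = 0 , λ _ ()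
    bounded-below-on (y ∷ T) a with bounded-below {y} a | bounded-below-on T a
    ... | B , p | C , q = B ℕ.⊔ C , λ where
      z (here z≈y) → ≤-weaken (ℤ.neg-mono-≤ (+≤+ (ℕ.m≤m⊔n B C))) (≤-at {y} {z} (≈ₚ-sym {y = z} {y} z≈y) p)
      z (there z∈T) → ≤-weaken (ℤ.neg-mono-≤ (+≤+ (ℕ.m≤n⊔m B C))) (q z z∈T)

  private
    abstract
      powers-outweigh : ∀ T {h h′} → (∀ z → z ∈ₚ T → + 1 ≤[ z ] h) →
        ∃[ r ] ∀ z → z ∈ₚ T → + 1 ≤[ z ] h ^ suc r × + 1 ≤[ z ] h ^ suc r * h′
      powers-outweigh T {h} {h′} vanishes with bounded-below-on T h′
      ... | B , p = B , λ z z∈T → let 1+B≤ = ≤-^ (suc B) (vanishes z z∈T) in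
        ≤-weaken (+≤+ (ℕ.≤-trans (s≤s z≤n) (ℕ.≤-reflexive (≡.sym (ℕ.*-identityʳ (suc B)))))) 1+B≤ ,
        ≤-weaken (ℤ.≤-reflexive (≡.trans (lemma (+ B)) (≡.cong (ℤ._+ ℤ.- (+ B)) (≡.trans (≡.sym (ℤ.pos-+ 1 B)) (≡.cong +_ (≡.sym (ℕ.*-identityʳ (suc B)))))))) (≤-* 1+B≤ (p z z∈T))
        where
        lemma : ∀ B → + 1 ≡ + 1 ℤ.+ B ℤ.+ ℤ.- B
        lemma = ℤ.solve-∀

      pole-^ : ∀ {y h} n → Pole y h → Pole y (h ^ suc n)
      pole-^ {y} {h} n (m , p) = _ , order-^ (suc n) p

      1+pole : ∀ {y h} → Pole y h → ∀ {m} → Order y h m → Order y (1# + h) m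
      1+pole {y} {h} (n , p) {m} q = order-cong (+-comm h 1#)
        (order-+ q (≤-weaken (≡.subst (λ m → + 1 ℤ.+ m ℤ.≤ + 0) (order-unique p q) (ℤ.i<j⇒suc[i]≤j { -[1+ n ]} -<+)) ≤-1#))

      1+zero : ∀ {z h} → + 1 ≤[ z ] h → Order z (1# + h) (+ 0)
      1+zero p = order-+ order-1# p

  abstract
    -- Let h separate y from T and h′ separate y from z. If h is integral at z, then hʳ h′ works for
    -- large r, as hʳ outweighs the poles of h′ at T. If h has a pole at z, then hʳ is replaced by
    -- hʳ/(1 + hʳ), which is a unit at the poles y and z of h and still vanishes at T.
    separate : ∀ y T → All (λ z → ¬ y ≈ₚ z) T → ∃[ h ] Pole y h × (∀ z → z ∈ₚ T → + 1 ≤[ z ] h)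
    separate y [] [] with uniformiser y
    ... | π , p with inverse (order⇒nonzero p)
    ... | π⁻¹ , eq = π⁻¹ , (0 , order-inverse eq p) , λ _ ()
    separate y (z ∷ T) (y≉z ∷ y∉T) with separate y T y∉T | separate₂ y≉z
    ... | h , pole , vanishes | h′ , pole′ , vanishes′ with powers-outweigh T {h} {h′} vanishes | em {P = + 0 ≤[ z ] h}
    ... | r , outweighs | yes 0≤h = h ^ suc r * h′ , pole-of-product (pole-^ r pole) (order⇒nonzero (proj₂ pole′)) nonpositive , λ where
        w (here w≈z) → ≤-at {z} {w} (≈ₚ-sym {y = w} {z} w≈z) (≤-* (≡.subst (λ m → + m ≤[ z ] h ^ suc r) (ℕ.*-zeroʳ r) (≤-^ (suc r) 0≤h)) vanishes′)
        w (there w∈T) → proj₂ (outweighs w w∈T)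
      where
      nonpositive : ∀ {n} → Order y h′ n → n ℤ.≤ + 0
      nonpositive q = ≡.subst (ℤ._≤ + 0) (order-unique (proj₂ pole′) q) ℤ.-≤+
    ... | r , outweighs | no 0≰h with inverse (order⇒nonzero (1+pole (pole-^ r pole) (proj₂ (pole-^ r pole))))
    ... | b , b[1+hʳ]≈1 = b * (h ^ suc r * h′) , pole″ , λ where
        w (here w≈z) → ≤-at {z} {w} (≈ₚ-sym {y = w} {z} w≈z) (≤-resp (*-assoc b (h ^ suc r) h′) (≤-* (order⇒≤ (unit (≰⇒pole 0≰h)) ℤ.≤-refl) vanishes′))
        w (there w∈T) → ≤-* (order⇒≤ (order-inverse b[1+hʳ]≈1 (1+zero (proj₁ (outweighs w w∈T)))) ℤ.≤-refl) (proj₂ (outweighs w w∈T))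
      where
      unit : ∀ {w} → Pole w h → Order w (b * h ^ suc r) (+ 0)
      unit {w} p with pole-^ r p
      ... | n , q = ≡.subst (Order w (b * h ^ suc r)) (ℤ.+-inverseˡ -[1+ n ]) (order-* (order-inverse b[1+hʳ]≈1 (1+pole (n , q) q)) q)
      pole″ : Pole y (b * (h ^ suc r * h′))
      pole″ = proj₁ pole′ , order-cong (*-assoc b (h ^ suc r) h′) (≡.subst (Order y (b * h ^ suc r * h′)) (ℤ.+-identityˡ -[1+ proj₁ pole′ ]) (order-* (unit pole) (proj₂ pole′)))

    -- hⁿ/(1 + hⁿ) with n = N + 1 is close to 1 at the poles of h and close to 0 at its zeros; it
    -- differs from 1 by 1/(1 + hⁿ).
    indicator : ∀ N y T → All (λ z → ¬ y ≈ₚ z) T → ∃[ u ] + N ≤[ y ] 1# - u × (∀ z → z ∈ₚ T → + N ≤[ z ] u)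
    indicator N y T y∉T with separate y T y∉T
    ... | h , pole , vanishes with pole-^ N pole
    ... | n , order-hᴺ with inverse (order⇒nonzero (1+pole (n , order-hᴺ) order-hᴺ))
    ... | b , b[1+hᴺ]≈1 = b * h ^ suc N ,
      ≤-resp complement (order⇒≤ (order-inverse b[1+hᴺ]≈1 (1+pole (n , order-hᴺ) order-hᴺ)) (+≤+ large)) ,
      λ z z∈T → let N≤hᴺ = ≤-^ (suc N) (vanishes z z∈T) in
        ≤-weaken (+≤+ N≤1+N*1)
          (≤-* (order⇒≤ (order-inverse b[1+hᴺ]≈1 (1+zero (≤-weaken (+≤+ (s≤s z≤n)) N≤hᴺ))) ℤ.≤-refl) N≤hᴺ)
      where
      N≤1+N*1 : N ≤ suc N ℕ.* 1
      N≤1+N*1 = ℕ.≤-trans (ℕ.n≤1+n N) (ℕ.≤-reflexive (≡.sym (ℕ.*-identityʳ (suc N))))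
      complement : b ≈ 1# - b * h ^ suc N
      complement = begin
        b                                             ≈⟨ expand b (h ^ suc N) ⟩
        b * (1# + h ^ suc N) - b * h ^ suc N          ≈⟨ +-congʳ b[1+hᴺ]≈1 ⟩
        1# - b * h ^ suc N                            ∎
        where
        expand : ∀ b h → b ≈ b * (1# + h) - b * h
        expand = solve 2 (λ b h → b := b :* (con (1 , 0) :+ h) :- b :* h) refl
      large : N ≤ suc n
      large with order-unique order-hᴺ (order-^ (suc N) (proj₂ pole))
      ... | eq = ℕ.≤-trans (ℕ.n≤1+n N) (ℕ.≤-trans (ℕ.m≤m*n (suc N) (suc (proj₁ pole)))
        (ℕ.≤-reflexive (≡.cong ℤ.∣_∣ (≡.sym (≡.trans (≡.cong ℤ.-_ eq) (ℤ.neg-distribʳ-* (+ suc N) -[1+ proj₁ pole ]))))))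

    private
      module _ (N : ℕ) (y : Place K) (T : List (Place K)) (a : Place K → Carrier)
               (coherent : ∀ y z → y ≈ₚ z → + N ≤[ y ] a y - a z)
               (f : Carrier) (close : ∀ z → z ∈ₚ T → + N ≤[ z ] f - a z) where

        correct-at : ∀ B → (∀ z → z ∈ₚ y ∷ T → ℤ.- (+ B) ≤[ z ] a y - f) →
          ∀ u → + (N ℕ.+ B) ≤[ y ] 1# - u → (∀ z → z ∈ₚ T → + (N ℕ.+ B) ≤[ z ] u) →
          ∃[ f ] ∀ z → z ∈ₚ y ∷ T → + N ≤[ z ] f - a z
        -- The correction moves f to `a y` near y. The precision N + B of u absorbs the poles of
        -- `a y - f`, whose order is at most B.
        correct-at B bounded u near-1 near-0 = f + (a y - f) * u , λ where
            z (here z≈y) → ≤-resp (telescope (f + (a y - f) * u) (a y) (a z))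
              (≤-+ (≤-at {y} {z} (≈ₚ-sym {y = z} {y} z≈y) near-y) (≤-swap (coherent z y z≈y)))
            z (there z∈T) → ≤-resp (at-z f (a y) u (a z)) (≤-+ (close z z∈T) (product {z} (near-0 z z∈T) (there z∈T)))
          where
          product : ∀ {z w} → + (N ℕ.+ B) ≤[ z ] w → z ∈ₚ (y ∷ T) → + N ≤[ z ] (a y - f) * w
          product {z} {w} q z∈ = ≡.subst (_≤[ z ] ((a y - f) * w))
            (≡.trans (≡.cong (λ M → ℤ.- (+ B) ℤ.+ M) (ℤ.pos-+ N B)) (cancel (+ N) (+ B))) (≤-* (bounded z z∈) q)
            where
            cancel : ∀ N B → ℤ.- B ℤ.+ (N ℤ.+ B) ≡ N
            cancel = ℤ.solve-∀
          telescope : ∀ x b c → (x - b) + (b - c) ≈ x - c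
          telescope = solve 3 (λ x b c → (x :- b) :+ (b :- c) := x :- c) refl
          at-y : ∀ f a u → - ((a - f) * (1# - u)) ≈ f + (a - f) * u - a
          at-y = solve 3 (λ f a u → :- ((a :- f) :* (con (1 , 0) :- u)) := f :+ (a :- f) :* u :- a) refl
          at-z : ∀ f a u b → (f - b) + (a - f) * u ≈ f + (a - f) * u - b
          at-z = solve 4 (λ f a u b → (f :- b) :+ (a :- f) :* u := f :+ (a :- f) :* u :- b) refl
          near-y : + N ≤[ y ] f + (a y - f) * u - a y
          near-y = ≤-resp (at-y f (a y) u) (≤-neg (product {y} near-1 (here (≈ₚ-refl {y = y}))))

        extend : Dec (y ∈ₚ T) → ∃[ f ] ∀ z → z ∈ₚ y ∷ T → + N ≤[ z ] f - a z
        extend (yes y∈T) = f , λ where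
          z (here z≈y) → close z (∈ₚ-resp {y = y} {z} (≈ₚ-sym {y = z} {y} z≈y) y∈T)
          z (there z∈T) → close z z∈T
        extend (no y∉T) =
          let B , bounded = bounded-below-on (y ∷ T) (a y - f)
              u , near-1 , near-0 = indicator (N ℕ.+ B) y T (¬Any⇒All¬ T y∉T)
          in correct-at B bounded u near-1 near-0

    -- Equal places may be given by different valuation functions, hence the coherence of the
    -- targets; a place that already occurs in T needs no correction.
    weak-approximation : ∀ N T (a : Place K → Carrier) → (∀ y z → y ≈ₚ z → + N ≤[ y ] a y - a z) →
      ∃[ f ] ∀ z → z ∈ₚ T → + N ≤[ z ] f - a z
    weak-approximation N [] a coherent = 0# , λ _ ()
    weak-approximation N (y ∷ T) a coherent =
      let f , close = weak-approximation N T a coherent in extend N y T a coherent f close em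

-- Divisors and Riemann–Roch spaces

module Divisors (em : ExcludedMiddle 0ℓ) (K : FunctionField) where
  open FunctionField K using (F)
  open CommutativeRing (fieldRing F) hiding (zero)
  open RingProperties ring
  open Field em F
  open Growth em K using (digit-bound)
  open Valuations em {K}
  open Approximation em {K}
  open IntegerSolver (fieldRing F) using (solve; _:+_; _:*_; _:-_; :-_; _:=_; con)

  private
    telescope : ∀ x b c → (x - b) + (b - c) ≈ x - c
    telescope = solve 3 (λ x b c → (x :- b) :+ (b :- c) := x :- c) refl

    two : ∀ {n} (c d : Fin n) → c ≢ d → 2 ≤ n
    two {suc zero} zero zero c≢d = ⊥-elim (c≢d ≡.refl)
    two {suc (suc n)} _ _ _ = s≤s (s≤s z≤n)

  abstract
    -- The bound comes from `digit-bound` and depends on u but not on `P`; for this reason it limits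
    -- the zeros of u at all places together.
    separated-bounded : ∀ {u} (P : Pred (Place K) 0ℓ) → u ≉ 0# → (∀ y → P y → + 0 ≤[ y ] u) → ∀ {m} (β : Fin m → Carrier) →
      (∀ i y → P y → + 0 ≤[ y ] β i) → IsSeparated (CongruentModulo (integral-isSubringᶠ P) u) β → m ≤ proj₁ (digit-bound u)
    separated-bounded {u} P u≉0 Ou β Oβ separated =
      proj₂ (digit-bound u) _ β (horner-separated (integral-isSubringᶠ P) Ou u≉0 Oβ separated)

    residues : ∀ y → ∃[ c ] Σ[ ω ∈ (Fin c → Carrier) ] (∀ i → + 0 ≤[ y ] ω i) ×
      IsSeparated (λ a b → + 1 ≤[ y ] a - b) ω × IsComplete (+ 0 ≤[ y ]_) (λ a b → + 1 ≤[ y ] a - b) ω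
    residues y = maximal-family em ≤-swap bounded
      where
      π : Carrier
      π = proj₁ (uniformiser y)
      order-π : Order y π (+ 1)
      order-π = proj₂ (uniformiser y)
      bounded : ∀ m (β : Fin m → Carrier) → (∀ i → + 0 ≤[ y ] β i) →
        IsSeparated (λ a b → + 1 ≤[ y ] a - b) β → m ≤ proj₁ (digit-bound π)
      bounded m β integral separated = separated-bounded (y ≡_) (order⇒nonzero order-π)
        (λ { _ ≡.refl → order⇒≤ order-π (+≤+ z≤n) }) β (λ { i _ ≡.refl → integral i })
        (λ i j (o , Oo , eq) → separated i j (≤-resp (sym eq) (≤-* (order⇒≤ order-π ℤ.≤-refl) (Oo y ≡.refl))))

  -- The order of the residue field.
  card : Place K → ℕ
  card y = proj₁ (residues y)

  ω : ∀ y → Fin (card y) → Carrier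
  ω y = proj₁ (proj₂ (residues y))

  abstract
    ω-integral : ∀ y c → + 0 ≤[ y ] ω y c
    ω-integral y = proj₁ (proj₂ (proj₂ (residues y)))

    ω-separated : ∀ y c d → + 1 ≤[ y ] ω y c - ω y d → c ≡ d
    ω-separated y = proj₁ (proj₂ (proj₂ (proj₂ (residues y))))

    ω-complete : ∀ y a → + 0 ≤[ y ] a → ∃[ c ] + 1 ≤[ y ] a - ω y c
    ω-complete y = proj₂ (proj₂ (proj₂ (proj₂ (residues y))))

    2≤card : ∀ y → 2 ≤ card y
    2≤card y =
      let c , p = ω-complete y 0# (≤-0# refl)
          d , q = ω-complete y 1# ≤-1#
      in two c d (λ c≡d → order⇒≰ order-1# (≤-resp (undo (ω y c))
           (≤-minus (≡.subst (λ d → + 1 ≤[ y ] 1# - ω y d) (≡.sym c≡d) q) p)))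
      where
      undo : ∀ w → (1# - w) - (0# - w) ≈ 1#
      undo = solve 1 (λ w → (con (1 , 0) :- w) :- (con (0 , 0) :- w) := con (1 , 0)) refl

  -- A list of places stands for an effective divisor.
  mult : List (Place K) → Place K → ℕ
  mult [] y = 0
  mult (z ∷ T) y = increment (em {P = y ≈ₚ z}) (mult T y)
    where
    increment : ∀ {P : Set} → Dec P → ℕ → ℕ
    increment (yes _) n = suc n
    increment (no _) n = n

  -- The absolute norm, q to the degree: the multiplicative substitute for the degree of a divisor.
  norm : List (Place K) → ℕ
  norm [] = 1
  norm (y ∷ T) = card y ℕ.* norm T

  abstract
    mult-here : ∀ {y z} T → y ≈ₚ z → mult (z ∷ T) y ≡ suc (mult T y)
    mult-here {y} {z} T y≈z with em {P = y ≈ₚ z}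
    ... | yes _ = ≡.refl
    ... | no y≉z = ⊥-elim (y≉z y≈z)

    mult-there : ∀ {y z} T → ¬ y ≈ₚ z → mult (z ∷ T) y ≡ mult T y
    mult-there {y} {z} T y≉z with em {P = y ≈ₚ z}
    ... | yes y≈z = ⊥-elim (y≉z y≈z)
    ... | no _ = ≡.refl

    mult-∷-≤ : ∀ y z T → mult T y ≤ mult (z ∷ T) y
    mult-∷-≤ y z T with em {P = y ≈ₚ z}
    ... | yes _ = ℕ.n≤1+n _
    ... | no _ = ℕ.≤-refl

    mult-resp : ∀ {y z} T → y ≈ₚ z → mult T y ≡ mult T z
    mult-resp [] y≈z = ≡.refl
    mult-resp {y} {z} (w ∷ T) y≈z with em {P = y ≈ₚ w} | em {P = z ≈ₚ w}
    ... | yes _ | yes _ = ≡.cong suc (mult-resp {y} {z} T y≈z)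
    ... | no _ | no _ = mult-resp {y} {z} T y≈z
    ... | yes y≈w | no z≉w = ⊥-elim (z≉w (≈ₚ-trans {w = z} {y} {w} (≈ₚ-sym {y = y} {z} y≈z) y≈w))
    ... | no y≉w | yes z≈w = ⊥-elim (y≉w (≈ₚ-trans {w = y} {z} {w} y≈z z≈w))

    mult-++ : ∀ y S T → mult (S ++ T) y ≡ mult S y ℕ.+ mult T y
    mult-++ y [] T = ≡.refl
    mult-++ y (z ∷ S) T with em {P = y ≈ₚ z}
    ... | yes _ = ≡.cong suc (mult-++ y S T)
    ... | no _ = mult-++ y S T

    mult≤length : ∀ y T → mult T y ≤ length T
    mult≤length y [] = z≤n
    mult≤length y (z ∷ T) with em {P = y ≈ₚ z}
    ... | yes _ = s≤s (mult≤length y T)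
    ... | no _ = ℕ.m≤n⇒m≤1+n (mult≤length y T)

    mult-∉ : ∀ {y} T → ¬ y ∈ₚ T → mult T y ≡ 0
    mult-∉ [] _ = ≡.refl
    mult-∉ {y} (z ∷ T) y∉ with em {P = y ≈ₚ z}
    ... | yes y≈z = ⊥-elim (y∉ (here y≈z))
    ... | no _ = mult-∉ {y} T (y∉ ∘ there)

    mult-∈ : ∀ {y T} → y ∈ₚ T → 1 ≤ mult T y
    mult-∈ {y} {z ∷ T} (here y≈z) = ≡.subst (1 ≤_) (≡.sym (mult-here {y} {z} T y≈z)) (s≤s z≤n)
    mult-∈ {y} {z ∷ T} (there y∈T) = ℕ.≤-trans (mult-∈ {y} {T} y∈T) (mult-∷-≤ y z T)

    1≤norm : ∀ T → 1 ≤ norm T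
    1≤norm [] = ℕ.≤-refl
    1≤norm (y ∷ T) = ℕ.*-mono-≤ (ℕ.≤-trans (s≤s z≤n) (2≤card y)) (1≤norm T)

    length<norm : ∀ T → length T ℕ.< norm T
    length<norm [] = s≤s z≤n
    length<norm (y ∷ T) = ℕ.≤-trans (ℕ.≤-trans (ℕ.≤-reflexive (≡.sym (ℕ.+-comm (suc (length T)) 1)))
      (ℕ.+-mono-≤ (length<norm T) (ℕ.≤-trans (1≤norm T) (ℕ.≤-reflexive (≡.sym (ℕ.+-identityʳ (norm T)))))))
      (ℕ.*-monoˡ-≤ (norm T) (2≤card y))

  -- The Chinese remainder theorem as a count: there are as many classes modulo the divisor `P` as
  -- its norm says, represented by functions that are integral at `T`.
  record Representatives (T P : List (Place K)) : Set where
    field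
      β : Fin (norm P) → Carrier
      integral : ∀ i z → z ∈ₚ T → + 0 ≤[ z ] β i
      separated : ∀ i j → (∀ z → z ∈ₚ T → + mult P z ≤[ z ] β i - β j) → i ≡ j

  private
    module Extend (T : List (Place K)) (y : Place K) (y∈T : y ∈ₚ T) (P : List (Place K)) (R : Representatives T P) where
      open Representatives R

      abstract
        bound : ∃[ B ] ∀ c z → z ∈ₚ T → ℤ.- (+ B) ≤[ z ] ω y c
        bound = uniform-bound {P = λ B c → ∀ z → z ∈ₚ T → ℤ.- (+ B) ≤[ z ] ω y c}
          (λ M≤N p z z∈T → ≤-weaken (ℤ.neg-mono-≤ (+≤+ M≤N)) (p z z∈T)) (λ c → bounded-below-on T (ω y c))

      B N m : ℕ
      B = proj₁ bound
      -- `length P` bounds all multiplicities in P, and B bounds the poles at T of the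
      -- representatives `ω`. So an error of order N disturbs neither the order m of η at y nor the
      -- vanishing of η ω at the other places.
      N = suc (length P ℕ.+ B)
      m = mult P y

      ρ : Carrier
      ρ = proj₁ (uniformiser-power y m)

      target : ∀ z → Dec (z ≈ₚ y) → Carrier
      target z (yes _) = ρ
      target z (no _) = 0#

      abstract
        coherent : ∀ z w → z ≈ₚ w → (d : Dec (z ≈ₚ y)) (e : Dec (w ≈ₚ y)) → + N ≤[ z ] target z d - target w e
        coherent z w z≈w (yes _) (yes _) = ≤-0# (-‿inverseʳ ρ)
        coherent z w z≈w (no _) (no _) = ≤-0# (-‿inverseʳ 0#)
        coherent z w z≈w (yes z≈y) (no w≉y) = ⊥-elim (w≉y (≈ₚ-trans {w = w} {z} {y} (≈ₚ-sym {y = z} {w} z≈w) z≈y))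
        coherent z w z≈w (no z≉y) (yes w≈y) = ⊥-elim (z≉y (≈ₚ-trans {w = z} {w} {y} z≈w w≈y))

        approximant : ∃[ η ] ∀ z → z ∈ₚ T → + N ≤[ z ] η - target z em
        approximant = weak-approximation N T (λ z → target z em) (λ z w z≈w → coherent z w z≈w em em)

      η : Carrier
      η = proj₁ approximant

      abstract
        order-η : Order y η (+ m)
        order-η = at-y em (proj₂ approximant y y∈T)
          where
          at-y : (d : Dec (y ≈ₚ y)) → + N ≤[ y ] η - target y d → Order y η (+ m)
          at-y (yes _) p = order-cong (recover ρ η) (order-+ (proj₂ (uniformiser-power y m))
            (≤-weaken (+≤+ (s≤s (ℕ.≤-trans (mult≤length y P) (ℕ.m≤m+n (length P) B)))) p))
            where
            recover : ∀ a b → a + (b - a) ≈ b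
            recover = solve 2 (λ a b → a :+ (b :- a) := b) refl
          at-y (no y≉y) _ = ⊥-elim (y≉y (≈ₚ-refl {y = y}))

        vanishing : ∀ c z → z ∈ₚ T → + mult P z ≤[ z ] η * ω y c
        vanishing c z z∈T = at-z em (proj₂ approximant z z∈T)
          where
          at-z : (d : Dec (z ≈ₚ y)) → + N ≤[ z ] η - target z d → + mult P z ≤[ z ] η * ω y c
          at-z (yes z≈y) _ = ≤-at {y} {z} (≈ₚ-sym {y = z} {y} z≈y) (≡.subst (λ n → + n ≤[ y ] η * ω y c)
            (≡.trans (ℕ.+-identityʳ m) (≡.sym (mult-resp {z} {y} P z≈y)))
            (≤-* (order⇒≤ order-η ℤ.≤-refl) (ω-integral y c)))
          at-z (no _) p = ≤-weaken (+≤+ (ℕ.≤-trans (mult≤length z P) (ℕ.n≤1+n _)))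
            (≡.subst (_≤[ z ] η * ω y c) (≡.trans (≡.cong (ℤ._- + B) (ℤ.pos-+ (suc (length P)) B)) (cancel (+ suc (length P)) (+ B)))
              (≤-* (≤-resp (trans (+-congˡ -0#≈0#) (+-identityʳ η)) p) (proj₂ bound c z z∈T)))
            where
            cancel : ∀ N B → N ℤ.+ B ℤ.- B ≡ N
            cancel = ℤ.solve-∀

      -- η vanishes along P, and to the exact order m at y. Reduction modulo P thus recovers i, and
      -- after division by η the residue at y recovers c.
      β′ : Fin (card y) → Fin (norm P) → Carrier
      β′ c i = β i + η * ω y c

      abstract
        separated′ : ∀ c i d j → (∀ z → z ∈ₚ T → + mult (y ∷ P) z ≤[ z ] β′ c i - β′ d j) → c ≡ d × i ≡ j
        separated′ c i d j close = ω-separated y c d (≤-*-cancelˡ order-η (≡.subst (λ n → n ≤[ y ] η * (ω y c - ω y d))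
            (≡.trans (≡.cong +_ (≡.trans (mult-here {y} {y} P (≈ₚ-refl {y = y})) (ℕ.+-comm 1 m))) (ℤ.pos-+ m 1))
            (≤-resp (factor (β i) η (ω y c) (ω y d)) (≡.subst (λ j → + mult (y ∷ P) y ≤[ y ] β′ c i - β′ d j) (≡.sym i≡j) (close y y∈T))))) , i≡j
          where
          i≡j : i ≡ j
          i≡j = separated i j (λ z z∈T → ≤-resp (isolate (β i) (β j) (η * ω y c) (η * ω y d))
            (≤-+ (≤-weaken (+≤+ (mult-∷-≤ z y P)) (close z z∈T)) (≤-minus (vanishing d z z∈T) (vanishing c z z∈T))))
            where
            isolate : ∀ a b x w → ((a + x) - (b + w)) + (w - x) ≈ a - b
            isolate = solve 4 (λ a b x w → ((a :+ x) :- (b :+ w)) :+ (w :- x) := a :- b) refl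
          factor : ∀ b η x w → (b + η * x) - (b + η * w) ≈ η * (x - w)
          factor = solve 4 (λ b η x w → (b :+ η :* x) :- (b :+ η :* w) := η :* (x :- w)) refl

  abstract
    representatives : ∀ T P → (∀ z → z ∈ₚ P → z ∈ₚ T) → Representatives T P
    representatives T [] _ = record
      { β = λ _ → 0#
      ; integral = λ _ _ _ → ≤-0# refl
      ; separated = λ { zero zero _ → ≡.refl }
      }
    representatives T (y ∷ P) P⊆T = record
      { β = λ k → β′ (quot k) (rem k)
      ; integral = λ k z z∈T → ≤-+ (integral (rem k) z z∈T) (≤-weaken (+≤+ z≤n) (vanishing (quot k) z z∈T))
      ; separated = λ k l close →
          let c≡d , i≡j = separated′ (quot k) (rem k) (quot l) (rem l) close in
          ≡.trans (≡.sym (Fin.combine-remQuot {card y} (norm P) k))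
            (≡.trans (≡.cong₂ Fin.combine c≡d i≡j) (Fin.combine-remQuot {card y} (norm P) l))
      }
      where
      R : Representatives T P
      R = representatives T P (λ z z∈P → P⊆T z (there z∈P))
      open Representatives R
      open Extend T y (P⊆T y (here (≈ₚ-refl {y = y}))) P R
      quot : Fin (card y ℕ.* norm P) → Fin (card y)
      quot k = proj₁ (Fin.remQuot {card y} (norm P) k)
      rem : Fin (card y ℕ.* norm P) → Fin (norm P)
      rem k = proj₂ (Fin.remQuot {card y} (norm P) k)

    norm-bounded : ∀ {u} → u ≉ 0# → ∀ T → (∀ z → z ∈ₚ T → + mult T z ≤[ z ] u) → norm T ≤ proj₁ (digit-bound u)
    norm-bounded {u} u≉0 T vanishes = separated-bounded (_∈ₚ T) u≉0 (λ z z∈T → ≤-weaken (+≤+ z≤n) (vanishes z z∈T))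
      β integral (λ i j (o , Oo , eq) → separated i j (λ z z∈T → ≤-resp (sym eq)
        (≡.subst (_≤[ z ] u * o) (ℤ.+-identityʳ (+ mult T z)) (≤-* (vanishes z z∈T) (Oo z z∈T)))))
      where open Representatives (representatives T T (λ _ z∈T → z∈T))

    -- `w z n` stands for "order at least n at z" of some object. Since w is dominated by the order
    -- of u, divisors along which it holds have bounded norm, hence bounded length; one that admits
    -- no further place has the exact multiplicities. The object is a function in `zeros` and an
    -- idele in `divisor-off-x`.
    maximal-divisor : (w : Place K → ℕ → Set) → (∀ {y z} n → y ≈ₚ z → w y n → w z n) →
      ∀ {u} → u ≉ 0# → (∀ z n → w z n → + n ≤[ z ] u) →
      ∃[ T ] (∀ z → z ∈ₚ T → w z (mult T z)) × (∀ z → ¬ w z (suc (mult T z)))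
    maximal-divisor w resp {u} u≉0 bounded =
      let T , good , maximal = maximal-list em Good (λ _ ())
            (λ T good → ℕ.≤-trans (ℕ.<⇒≤ (length<norm T)) (norm-bounded u≉0 T (λ z z∈T → bounded z _ (good z z∈T))))
      in T , good , λ z wz → maximal z (extended T good z wz)
      where
      Good : List (Place K) → Set
      Good T = ∀ z → z ∈ₚ T → w z (mult T z)
      extended : ∀ T → Good T → ∀ z → w z (suc (mult T z)) → Good (z ∷ T)
      extended T good z wz y y∈ = case em y∈
        where
        case : Dec (y ≈ₚ z) → y ∈ₚ z ∷ T → w y (mult (z ∷ T) y)
        case (yes y≈z) _ = ≡.subst (w y) (≡.sym (≡.trans (mult-here {y} {z} T y≈z) (≡.cong suc (mult-resp {y} {z} T y≈z)))) (resp {z} {y} _ (≈ₚ-sym {y = y} {z} y≈z) wz)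
        case (no y≉z) (here y≈z) = ⊥-elim (y≉z y≈z)
        case (no y≉z) (there y∈T) = ≡.subst (w y) (≡.sym (mult-there {y} {z} T y≉z)) (good y y∈T)

    zeros : (X : Pred (Place K) 0ℓ) → (∀ {y z} → y ≈ₚ z → X y → X z) → ∀ {u} → u ≉ 0# →
      ∃[ T ] (∀ z → z ∈ₚ T → X z × + mult T z ≤[ z ] u) × (∀ z → X z → ¬ + suc (mult T z) ≤[ z ] u)
    zeros X resp {u} u≉0 =
      let T , good , maximal = maximal-divisor (λ z n → X z × + n ≤[ z ] u)
            (λ {y} {z} n y≈z (Xy , p) → resp {y} {z} y≈z Xy , ≤-at {y} {z} y≈z p) u≉0 (λ z n → proj₂)
      in T , good , λ z Xz p → maximal z (Xz , p)

    poles : ∀ a → ∃[ T ] ∀ y → ¬ y ∈ₚ T → + 0 ≤[ y ] a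
    poles a = case em
      where
      case : Dec (a ≈ 0#) → ∃[ T ] ∀ y → ¬ y ∈ₚ T → + 0 ≤[ y ] a
      case (yes a≈0) = [] , λ _ _ → ≤-0# a≈0
      case (no a≉0) =
        let b , ba≈1 = inverse a≉0
            T , good , maximal = zeros (λ _ → ⊤) _ (inverse-nonzero ba≈1)
        in T , λ y y∉T → nonnegative (a≉0) ba≈1 (λ p → maximal y tt (≡.subst (λ n → + suc n ≤[ y ] b) (≡.sym (mult-∉ {y} T y∉T)) p))
        where
        nonnegative : ∀ {b y} → a ≉ 0# → b * a ≈ 1# → ¬ + 1 ≤[ y ] b → + 0 ≤[ y ] a
        nonnegative {b} {y} a≉0 ba≈1 b≤0 =
          let m , p = order {y} a≉0
          in order⇒≤ p (sign m (λ 1≤-m → b≤0 (order⇒≤ (order-inverse ba≈1 p) 1≤-m)))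
          where
          sign : ∀ m → ¬ + 1 ℤ.≤ ℤ.- m → + 0 ℤ.≤ m
          sign (+ _) _ = +≤+ z≤n
          sign -[1+ n ] ¬p = ⊥-elim (¬p (+≤+ (s≤s z≤n)))

-- Counting functions with prescribed zeros and poles

module RiemannRoch (em : ExcludedMiddle 0ℓ) (K : FunctionField) where
  open FunctionField K using (F; q)
  open CommutativeRing (fieldRing F) hiding (zero)
  open RingProperties ring
  open Exponentiation semiring using (_^_)
  open Horner (fieldRing F)
  open Field em F
  open Valuations em {K}
  open Approximation em {K}
  open Divisors em K
  open IntegerSolver (fieldRing F) using (solve; _:*_; _:-_; :-_; _:=_)

  -- The number of elements of a space of functions replaces its dimension; a list of distinct
  -- members is a lower bound for it.
  Many : Pred Carrier 0ℓ → ℕ → Set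
  Many P b = ∃[ as ] AllPairs _≉_ as × All P as × b ℕ.< length as

  -- The Riemann–Roch space of the divisor T - S.
  record L (S T : List (Place K)) (a : Carrier) : Set where
    constructor ∈L
    field
      bound : ∀ z → + mult S z ℤ.- + mult T z ≤[ z ] a
  open L public

  abstract
    many-mono : ∀ {P b c} → b ≤ c → Many P c → Many P b
    many-mono b≤c (as , distinct , ps , c<) = as , distinct , ps , ℕ.≤-<-trans b≤c c<

    many-from-family : ∀ {P m b} (f : Fin m → Carrier) → IsSeparated _≈_ f → (∀ i → P (f i)) → b ℕ.< m → Many P b
    many-from-family {b = b} f separated ps b< = tabulate f , AllPairs.tabulate⁺ (λ i≢j fi≈fj → i≢j (separated _ _ fi≈fj)) ,
      All.tabulate⁺ ps , ≡.subst (b ℕ.<_) (≡.sym (length-tabulate f)) b<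

    element-of-order : ∀ y m → ∃[ a ] Order y a m
    element-of-order y (+ n) = uniformiser-power y n
    element-of-order y -[1+ n ] =
      let a , p = uniformiser-power y (suc n)
          b , ba≈1 = inverse (order⇒nonzero p)
      in b , order-inverse ba≈1 p

    private
      -- Of card y * b functions more than b have the same leading coefficient at y.
      module _ (y : Place K) (P Q : Pred Carrier 0ℓ) (m : ℤ) (P⇒m≤ : ∀ {a} → P a → m ≤[ y ] a)
               (improve : ∀ {a b} → P a → P b → + 1 ℤ.+ m ≤[ y ] a - b → Q (a - b)) where

        step : ∀ b → Many P (card y ℕ.* b) → Many Q b
        step b (as , distinct , ps , many) = result (many-of-one-colour em (card y) hasColour as distinct ps colours many)
          where
          η : Carrier
          η = proj₁ (element-of-order y m)
          order-η : Order y η m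
          order-η = proj₂ (element-of-order y m)
          η⁻¹ : Carrier
          η⁻¹ = proj₁ (inverse (order⇒nonzero order-η))
          η⁻¹η≈1 : η⁻¹ * η ≈ 1#
          η⁻¹η≈1 = proj₂ (inverse (order⇒nonzero order-η))
          hasColour : Fin (card y) → Pred Carrier 0ℓ
          hasColour c a = + 1 ≤[ y ] η⁻¹ * a - ω y c
          colours : All (λ a → ∃[ c ] hasColour c a) as
          colours = All.map (λ {a} p → ω-complete y (η⁻¹ * a) (≡.subst (_≤[ y ] η⁻¹ * a) (ℤ.+-inverseˡ m)
            (≤-* (order⇒≤ (order-inverse η⁻¹η≈1 order-η) ℤ.≤-refl) (P⇒m≤ p)))) ps
          same : ∀ {c a b} → hasColour c a → hasColour c b → + 1 ℤ.+ m ≤[ y ] a - b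
          same {c} {a} {b} p q = ≤-resp cancel (≡.subst (_≤[ y ] η * ((η⁻¹ * a - ω y c) - (η⁻¹ * b - ω y c))) (ℤ.+-comm m (+ 1))
            (≤-* (order⇒≤ order-η ℤ.≤-refl) (≤-minus p q)))
            where
            regroup : ∀ η η⁻¹ a b w → η * ((η⁻¹ * a - w) - (η⁻¹ * b - w)) ≈ (η⁻¹ * η) * (a - b)
            regroup = solve 5 (λ η η⁻¹ a b w → η :* ((η⁻¹ :* a :- w) :- (η⁻¹ :* b :- w)) := (η⁻¹ :* η) :* (a :- b)) refl
            cancel : η * ((η⁻¹ * a - ω y c) - (η⁻¹ * b - ω y c)) ≈ a - b
            cancel = trans (regroup η η⁻¹ a b (ω y c)) (trans (*-congʳ η⁻¹η≈1) (*-identityˡ (a - b)))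
          result : (∃[ c ] ∃[ bs ] AllPairs _≉_ bs × All P bs × All (hasColour c) bs × b ℕ.< length bs) → Many Q b
          result (c , [] , _ , _ , _ , ())
          -- Differences with one fixed member of the class lose the leading term at y and stay
          -- distinct.
          result (c , bs@(b₀ ∷ _) , distinct , ps@(p₀ ∷ _) , cs@(c₀ ∷ _) , b<) = map (_- b₀) bs ,
            AllPairs.map⁺ (AllPairs.map (λ a≉b a-b₀≈b-b₀ → a≉b (+-cancelʳ (- b₀) _ _ a-b₀≈b-b₀)) distinct) ,
            All.map⁺ (All.zipWith (λ (p , colour) → improve p p₀ (same colour c₀)) (ps , cs)) ,
            ≡.subst (b ℕ.<_) (≡.sym (length-map (_- b₀) bs)) b<

      L-minus : ∀ {S T a b} → L S T a → L S T b → L S T (a - b)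
      L-minus (∈L p) (∈L q) = ∈L (λ z → ≤-minus (p z) (q z))

      difference-mult : ∀ S T {y z} → z ≈ₚ y → + mult S z ℤ.- + mult T z ≡ + mult S y ℤ.- + mult T y
      difference-mult S T {y} {z} z≈y = ≡.cong₂ (λ m n → + m ℤ.- + n) (mult-resp {z} {y} S z≈y) (mult-resp {z} {y} T z≈y)

    -- One more condition at y divides the count by at most `card y`; in dimensions, l(D - y) ≥ l(D)
    -- - deg y.
    vanish-more : ∀ {S T} y b → Many (L S T) (card y ℕ.* b) → Many (L (y ∷ S) T) b
    vanish-more {S} {T} y = step y (L S T) (L (y ∷ S) T) (+ mult S y ℤ.- + mult T y) (λ p → bound p y)
      (λ {a} {b} p q close → ∈L (λ z → improve {a} {b} p q close z em))
      where
      improve : ∀ {a b} → L S T a → L S T b → + 1 ℤ.+ (+ mult S y ℤ.- + mult T y) ≤[ y ] a - b → ∀ z → Dec (z ≈ₚ y) → + mult (y ∷ S) z ℤ.- + mult T z ≤[ z ] a - b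
      improve {a} {b} p q close z (yes z≈y) = ≤-at {y} {z} (≈ₚ-sym {y = z} {y} z≈y) (≡.subst (_≤[ y ] a - b) (≡.sym eq) close)
        where
        eq : + mult (y ∷ S) z ℤ.- + mult T z ≡ + 1 ℤ.+ (+ mult S y ℤ.- + mult T y)
        eq = ≡.trans (≡.cong (λ n → + n ℤ.- + mult T z) (mult-here {z} {y} S z≈y))
          (≡.trans (≡.cong (λ n → n ℤ.- + mult T z) (ℤ.pos-+ 1 (mult S z))) (≡.trans (ℤ.+-assoc (+ 1) (+ mult S z) (ℤ.- + mult T z))
            (≡.cong (λ n → + 1 ℤ.+ n) (difference-mult S T {y} {z} z≈y))))
      improve {a} {b} p q close z (no z≉y) = ≡.subst (λ n → + n ℤ.- + mult T z ≤[ z ] a - b) (≡.sym (mult-there {z} {y} S z≉y)) (bound (L-minus p q) z)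

    fewer-poles : ∀ {S T} y b → Many (L S (y ∷ T)) (card y ℕ.* b) → Many (L S T) b
    fewer-poles {S} {T} y = step y (L S (y ∷ T)) (L S T) (+ mult S y ℤ.- + mult (y ∷ T) y) (λ p → bound p y)
      (λ {a} {b} p q close → ∈L (λ z → improve {a} {b} p q close z em))
      where
      improve : ∀ {a b} → L S (y ∷ T) a → L S (y ∷ T) b → + 1 ℤ.+ (+ mult S y ℤ.- + mult (y ∷ T) y) ≤[ y ] a - b → ∀ z → Dec (z ≈ₚ y) → + mult S z ℤ.- + mult T z ≤[ z ] a - b
      improve {a} {b} p q close z (yes z≈y) = ≤-at {y} {z} (≈ₚ-sym {y = z} {y} z≈y) (≡.subst (_≤[ y ] a - b) eq close)
        where
        shift : ∀ s t → + 1 ℤ.+ (s ℤ.- (+ 1 ℤ.+ t)) ≡ s ℤ.- t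
        shift = ℤ.solve-∀
        eq : + 1 ℤ.+ (+ mult S y ℤ.- + mult (y ∷ T) y) ≡ + mult S z ℤ.- + mult T z
        eq = ≡.trans (≡.cong (λ n → + 1 ℤ.+ (+ mult S y ℤ.- + n)) (mult-here {y} {y} T (≈ₚ-refl {y = y})))
          (≡.trans (≡.cong (λ n → + 1 ℤ.+ (+ mult S y ℤ.- n)) (ℤ.pos-+ 1 (mult T y)))
          (≡.trans (shift (+ mult S y) (+ mult T y)) (≡.sym (difference-mult S T {y} {z} z≈y))))
      improve {a} {b} p q close z (no z≉y) = ≡.subst (λ n → + mult S z ℤ.- + n ≤[ z ] a - b) (mult-there {z} {y} T z≉y) (bound (L-minus p q) z)

    vanish-on : ∀ {S T} E b → Many (L S T) (norm E ℕ.* b) → Many (L (E ++ S) T) b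
    vanish-on [] b many = many-mono (ℕ.≤-reflexive (≡.sym (ℕ.+-identityʳ b))) many
    vanish-on {S} {T} (y ∷ E) b many = vanish-more y b (vanish-on E (card y ℕ.* b)
      (many-mono (ℕ.≤-reflexive (swap (norm E) (card y) b)) many))
      where
      swap : ∀ n c b → n ℕ.* (c ℕ.* b) ≡ c ℕ.* n ℕ.* b
      swap = ℕ.solve-∀

    without-poles : ∀ {S T} E b → Many (L S (E ++ T)) (norm E ℕ.* b) → Many (L S T) b
    without-poles [] b many = many-mono (ℕ.≤-reflexive (≡.sym (ℕ.+-identityʳ b))) many
    without-poles {S} {T} (y ∷ E) b many = without-poles E b (fewer-poles y (norm E ℕ.* b)
      (many-mono (ℕ.≤-reflexive (≡.sym (ℕ.*-assoc (card y) (norm E) b))) many))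

    norm-++ : ∀ S T → norm (S ++ T) ≡ norm S ℕ.* norm T
    norm-++ [] T = ≡.sym (ℕ.+-identityʳ (norm T))
    norm-++ (y ∷ S) T = ≡.trans (≡.cong (card y ℕ.*_) (norm-++ S T)) (≡.sym (ℕ.*-assoc (card y) (norm S) (norm T)))

  copies : ℕ → List (Place K) → List (Place K)
  copies n T = concat (replicate n T)

  abstract
    norm-copies : ∀ n T → norm (copies n T) ≡ norm T ℕ.^ n
    norm-copies zero T = ≡.refl
    norm-copies (suc n) T = ≡.trans (norm-++ T (copies n T)) (≡.cong (norm T ℕ.*_) (norm-copies n T))

    mult-copies : ∀ y n T → mult (copies n T) y ≡ n ℕ.* mult T y
    mult-copies y zero T = ≡.refl
    mult-copies y (suc n) T = ≡.trans (mult-++ y T (copies n T)) (≡.cong (mult T y ℕ.+_) (mult-copies y n T))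

    pole-divisor : ∀ a → ∃[ T ] ∀ z → ℤ.- (+ mult T z) ≤[ z ] a
    pole-divisor a = case em
      where
      bounded : ∀ {b z n} → a ≉ 0# → b * a ≈ 1# → ¬ + suc n ≤[ z ] b → ℤ.- (+ n) ≤[ z ] a
      bounded {b} {z} {n} a≉0 ba≈1 b≤n =
        let m , p = order {z} a≉0
        in order⇒≤ p (sign m (λ n≤-m → b≤n (order⇒≤ (order-inverse ba≈1 p) n≤-m)))
        where
        sign : ∀ m → ¬ + suc n ℤ.≤ ℤ.- m → ℤ.- (+ n) ℤ.≤ m
        sign m ¬p = ≡.subst (λ m → ℤ.- (+ n) ℤ.≤ m) (ℤ.neg-involutive m) (ℤ.neg-mono-≤ (≤-by₁ (ℤ.- m) (+ n) (ℤ.i<j⇒suc[i]≤j (ℤ.≰⇒> ¬p)) (shift (ℤ.- m) (+ n))))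
          where
          shift : ∀ m n → (+ 1 ℤ.+ n) ℤ.- (+ 1 ℤ.+ m) ≡ n ℤ.- m
          shift = ℤ.solve-∀
      case : Dec (a ≈ 0#) → ∃[ T ] ∀ z → ℤ.- (+ mult T z) ≤[ z ] a
      case (yes a≈0) = [] , λ z → ≤-0# a≈0
      case (no a≉0) =
        let b , ba≈1 = inverse a≉0
            T , _ , maximal = zeros (λ _ → ⊤) _ (inverse-nonzero ba≈1)
        in T , λ z → bounded a≉0 ba≈1 (maximal z tt)

    common-pole-divisor : ∀ {m} (a : Fin m → Carrier) → ∃[ T ] ∀ i z → ℤ.- (+ mult T z) ≤[ z ] a i
    common-pole-divisor {zero} a = [] , λ ()
    common-pole-divisor {suc m} a =
      let S , p = pole-divisor (a zero)
          T , ps = common-pole-divisor (a ∘ suc)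
      in S ++ T , λ where
        zero z → ≤-weaken (ℤ.neg-mono-≤ (+≤+ (ℕ.≤-trans (ℕ.m≤m+n (mult S z) (mult T z)) (ℕ.≤-reflexive (≡.sym (mult-++ z S T)))))) (p z)
        (suc i) z → ≤-weaken (ℤ.neg-mono-≤ (+≤+ (ℕ.≤-trans (ℕ.m≤n+m (mult T z) (mult S z)) (ℕ.≤-reflexive (≡.sym (mult-++ z S T)))))) (ps i z)

module PolesAt (em : ExcludedMiddle 0ℓ) (K : FunctionField) (x : Place K) where
  open FunctionField K using (F; q)
  open CommutativeRing (fieldRing F) hiding (zero)
  open RingProperties ring
  open Exponentiation semiring using (_^_)
  open Horner (fieldRing F)
  open Field em F
  open Valuations em {K}
  open Approximation em {K}
  open Divisors em K
  open RiemannRoch em K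
  open SetoidReasoning setoid
  open IntegerSolver (fieldRing F) using (solve; _:+_; _:*_; _:=_)

  infix 8 x^_

  -- The divisor n x.
  x^_ : ℕ → List (Place K)
  x^ n = replicate n x

  abstract
    norm-x^ : ∀ n → norm (x^ n) ≡ card x ℕ.^ n
    norm-x^ zero = ≡.refl
    norm-x^ (suc n) = ≡.cong (card x ℕ.*_) (norm-x^ n)

    mult-x^ : ∀ {y} n → y ≈ₚ x → mult (x^ n) y ≡ n
    mult-x^ zero y≈x = ≡.refl
    mult-x^ {y} (suc n) y≈x = ≡.trans (mult-here {y} {x} (x^ n) y≈x) (≡.cong suc (mult-x^ {y} n y≈x))

    mult-x^-≉ : ∀ {y} n → ¬ y ≈ₚ x → mult (x^ n) y ≡ 0
    mult-x^-≉ zero y≉x = ≡.refl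
    mult-x^-≉ {y} (suc n) y≉x = ≡.trans (mult-there {y} {x} (x^ n) y≉x) (mult-x^-≉ {y} n y≉x)

    1≤card^ : ∀ n → 1 ≤ card x ℕ.^ n
    1≤card^ n = ≡.subst (1 ≤_) (norm-x^ n) (1≤norm (x^ n))

  private
    h : Carrier
    h = proj₁ (uniformiser x)

    abstract
      order-h : Order x h (+ 1)
      order-h = proj₂ (uniformiser x)

      h⁻¹-exists : ∃[ t ] t * h ≈ 1#
      h⁻¹-exists = inverse (order⇒nonzero order-h)

      h-zeros : ∃[ T ] (∀ z → z ∈ₚ T → ¬ z ≈ₚ x × + mult T z ≤[ z ] h) × (∀ z → ¬ z ≈ₚ x → ¬ + suc (mult T z) ≤[ z ] h)
      h-zeros = zeros (λ z → ¬ z ≈ₚ x) (λ {y} {z} y≈z y≉x z≈x → y≉x (≈ₚ-trans {w = y} {z} {x} y≈z z≈x)) (order⇒nonzero order-h)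

    t : Carrier
    t = proj₁ h⁻¹-exists

    -- `P` is the divisor of zeros of the uniformiser h; x occurs in it once and `P′` is the part
    -- off x.
    P P′ : List (Place K)
    P′ = proj₁ h-zeros
    P = x ∷ P′

    abstract
      mult-P : ∀ z → Order z h (+ mult P z) ⊎ ¬ z ∈ₚ P
      mult-P z = case em em
        where
        case : Dec (z ≈ₚ x) → Dec (z ∈ₚ P) → Order z h (+ mult P z) ⊎ ¬ z ∈ₚ P
        case (yes z≈x) _ = inj₁ (≡.subst (λ n → Order z h (+ n))
          (≡.sym (≡.trans (mult-here {z} {x} P′ z≈x) (≡.cong suc (mult-∉ {z} P′ (λ z∈P′ → proj₁ (proj₁ (proj₂ h-zeros) z z∈P′) z≈x)))))
          (order-at {x} {z} (≈ₚ-sym {y = z} {x} z≈x) order-h))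
        case (no z≉x) (no z∉P) = inj₂ z∉P
        case (no z≉x) (yes (here z≈x)) = ⊥-elim (z≉x z≈x)
        case (no z≉x) (yes (there z∈P′)) = inj₁ (≡.subst (λ n → Order z h (+ n)) (≡.sym (mult-there {z} {x} P′ z≉x))
          (order-from-bounds (proj₂ (proj₁ (proj₂ h-zeros) z z∈P′)) (λ p → proj₂ (proj₂ h-zeros) z z≉x (≡.subst (_≤[ z ] h) (≡.sym (ℤ.pos-+ 1 (mult P′ z))) p))))

      t-poles : ∀ z → ℤ.- (+ mult P z) ≤[ z ] t
      t-poles z = case (mult-P z) em
        where
        case : Order z h (+ mult P z) ⊎ ¬ z ∈ₚ P → Dec (z ≈ₚ x) → ℤ.- (+ mult P z) ≤[ z ] t
        case (inj₁ p) _ = order⇒≤ (order-inverse (proj₂ h⁻¹-exists) p) ℤ.≤-refl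
        case (inj₂ z∉P) (yes z≈x) = ⊥-elim (z∉P (here z≈x))
        case (inj₂ z∉P) (no z≉x) =
          let m , p = order {z} (order⇒nonzero order-h)
          in order⇒≤ (order-inverse (proj₂ h⁻¹-exists) p) (ℤ.neg-mono-≤ (≤-by₁ m (+ mult P z)
            (ℤ.i<j⇒suc[i]≤j (ℤ.≰⇒> (λ 1+μ≤m → proj₂ (proj₂ h-zeros) z z≉x (order⇒≤ p (≡.subst (λ n → + suc n ℤ.≤ m) (mult-there {z} {x} P′ z≉x) 1+μ≤m)))))
            (≡.trans (≡.cong (ℤ._- (+ 1 ℤ.+ m)) (ℤ.pos-+ 1 (mult P z))) (shift m (+ mult P z)))))
          where
          shift : ∀ m n → (+ 1 ℤ.+ n) ℤ.- (+ 1 ℤ.+ m) ≡ n ℤ.- m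
          shift = ℤ.solve-∀

    open Representatives (representatives P P (λ _ z∈P → z∈P))

    abstract
      digits-separated : ∀ r → IsSeparated _≈_ (horner h β r)
      digits-separated = horner-separated (integral-isSubringᶠ (_∈ₚ P)) (λ z z∈P → ≤-weaken (+≤+ z≤n) (vanishes z z∈P))
        (order⇒nonzero order-h) integral (λ i j (o , Oo , eq) → separated i j (λ z z∈P → ≤-resp (sym eq)
          (≡.subst (_≤[ z ] h * o) (ℤ.+-identityʳ (+ mult P z)) (≤-* (vanishes z z∈P) (Oo z z∈P)))))
        where
        vanishes : ∀ z → z ∈ₚ P → + mult P z ≤[ z ] h
        vanishes z z∈P = case (mult-P z)
          where
          case : Order z h (+ mult P z) ⊎ ¬ z ∈ₚ P → + mult P z ≤[ z ] h
          case (inj₁ p) = order⇒≤ p ℤ.≤-refl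
          case (inj₂ z∉P) = ⊥-elim (z∉P z∈P)

      C-exists : ∃[ C ] ∀ i z → ℤ.- (+ mult C z) ≤[ z ] β i
      C-exists = common-pole-divisor β

    C : List (Place K)
    C = proj₁ C-exists

    abstract
      C-bounds : ∀ i z → ℤ.- (+ mult C z) ≤[ z ] β i
      C-bounds = proj₂ C-exists

      -- As t = h⁻¹, the factor tᴹ turns the powers 1, ..., hᴹ of the expansion into tᴹ, ..., 1. The
      -- poles are then at most M P together with those of the digits.
      scaled-digits : ∀ M i z → ℤ.- (+ (M ℕ.* mult P z ℕ.+ mult C z)) ≤[ z ] t ^ M * horner h β (suc M) i
      scaled-digits zero i z = ≤-resp (sym (trans (*-identityˡ _) (trans (+-congˡ (zeroʳ h)) (+-identityʳ _)))) (C-bounds _ z)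
      scaled-digits (suc M) i z = ≤-resp (rearrange t (t ^ M) _ h _ (proj₂ h⁻¹-exists))
        (≤-+ (≡.subst (_≤[ z ] t ^ suc M * _) (negate (suc M ℕ.* mult P z) (mult C z)) (≤-* (t^-poles (suc M)) (C-bounds _ z)))
          (≤-weaken (ℤ.neg-mono-≤ (+≤+ (ℕ.+-monoˡ-≤ (mult C z) (ℕ.m≤n+m (M ℕ.* mult P z) (mult P z))))) (scaled-digits M _ z)))
        where
        negate : ∀ m n → ℤ.- (+ m) ℤ.+ ℤ.- (+ n) ≡ ℤ.- (+ (m ℕ.+ n))
        negate m n = ≡.trans (≡.sym (ℤ.neg-distrib-+ (+ m) (+ n))) (≡.cong ℤ.-_ (≡.sym (ℤ.pos-+ m n)))
        t^-poles : ∀ M → ℤ.- (+ (M ℕ.* mult P z)) ≤[ z ] t ^ M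
        t^-poles zero = ≤-1#
        t^-poles (suc M) = ≡.subst (_≤[ z ] t ^ suc M) (negate (mult P z) (M ℕ.* mult P z)) (≤-* (t-poles z) (t^-poles M))
        rearrange : ∀ t tᴹ b h s → t * h ≈ 1# → (t * tᴹ) * b + tᴹ * s ≈ (t * tᴹ) * (b + h * s)
        rearrange t tᴹ b h s th≈1 = begin
          (t * tᴹ) * b + tᴹ * s              ≈⟨ +-congˡ (sym (*-identityˡ _)) ⟩
          (t * tᴹ) * b + 1# * (tᴹ * s)       ≈⟨ +-congˡ (*-congʳ (sym th≈1)) ⟩
          (t * tᴹ) * b + (t * h) * (tᴹ * s)  ≈⟨ collect t tᴹ b h s ⟩
          (t * tᴹ) * (b + h * s)             ∎
          where
          collect : ∀ t u b h s → (t * u) * b + (t * h) * (u * s) ≈ (t * u) * (b + h * s)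
          collect = solve 5 (λ t u b h s → (t :* u) :* b :+ (t :* h) :* (u :* s) := (t :* u) :* (b :+ h :* s)) refl

      many-digits : ∀ M b → b ℕ.< norm P ℕ.^ suc M → Many (L [] ((copies M P′ ++ C) ++ x^ M)) b
      many-digits M b b< = many-from-family (λ i → t ^ M * horner h β (suc M) i)
        (λ i j eq → digits-separated (suc M) i j (*-cancelˡ (^-nonzero M (inverse-nonzero (proj₂ h⁻¹-exists))) eq))
        (λ i → ∈L (λ z → ≤-weaken (ℤ.≤-reflexive (≡.trans (ℤ.+-identityˡ _) (≡.cong (λ n → ℤ.- (+ n)) (size z)))) (scaled-digits M i z)))
        b<
        where
        mult-P-split : ∀ z → M ℕ.* mult P z ≡ M ℕ.* mult P′ z ℕ.+ mult (x^ M) z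
        mult-P-split z = case em
          where
          case : Dec (z ≈ₚ x) → M ℕ.* mult P z ≡ M ℕ.* mult P′ z ℕ.+ mult (x^ M) z
          case (yes z≈x) = ≡.trans (≡.cong (M ℕ.*_) (mult-here {z} {x} P′ z≈x)) (≡.trans (distribute M (mult P′ z)) (≡.cong (M ℕ.* mult P′ z ℕ.+_) (≡.sym (mult-x^ {z} M z≈x))))
            where
            distribute : ∀ M n → M ℕ.* suc n ≡ M ℕ.* n ℕ.+ M
            distribute = ℕ.solve-∀
          case (no z≉x) = ≡.trans (≡.cong (M ℕ.*_) (mult-there {z} {x} P′ z≉x)) (≡.trans (≡.sym (ℕ.+-identityʳ _)) (≡.cong (M ℕ.* mult P′ z ℕ.+_) (≡.sym (mult-x^-≉ {z} M z≉x))))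
        size : ∀ z → mult ((copies M P′ ++ C) ++ x^ M) z ≡ M ℕ.* mult P z ℕ.+ mult C z
        size z = ≡.trans (mult-++ z (copies M P′ ++ C) (x^ M)) (≡.trans (≡.cong (ℕ._+ mult (x^ M) z) (≡.trans (mult-++ z (copies M P′) C) (≡.cong (ℕ._+ mult C z) (mult-copies z M P′))))
          (≡.trans (swap (M ℕ.* mult P′ z) (mult C z) (mult (x^ M) z)) (≡.cong (ℕ._+ mult C z) (≡.sym (mult-P-split z)))))
          where
          swap : ∀ a b c → a ℕ.+ b ℕ.+ c ≡ a ℕ.+ c ℕ.+ b
          swap = ℕ.solve-∀

  -- The constant of Riemann's inequality for the multiples of x.
  defect : ℕ
  defect = norm C

  abstract
    1≤defect : 1 ≤ defect
    1≤defect = 1≤norm C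

    -- The (norm P)^(M+1) expansions have poles in M P + C, and removing M P′ + C, so that only M x
    -- is left, costs the factor (norm P′)^M norm C. What remains is (card x)^M / norm C, times norm
    -- P ≥ 2 for the additional digit, and this factor makes the inequality strict.
    riemann : ∀ M b → defect ℕ.* b ≤ card x ℕ.^ M → Many (L [] (x^ M)) b
    riemann M b small = without-poles (copies M P′ ++ C) b (many-digits M _ (ℕ.<-≤-trans (ℕ.s≤s (ℕ.≤-trans
      (ℕ.≤-reflexive (≡.trans (≡.cong (ℕ._* b) (≡.trans (norm-++ (copies M P′) C) (≡.cong (ℕ._* norm C) (norm-copies M P′)))) (ℕ.*-assoc (norm P′ ℕ.^ M) (norm C) b)))
      (ℕ.*-monoʳ-≤ (norm P′ ℕ.^ M) small))) (ℕ.≤-trans (ℕ.≤-reflexive (≡.cong suc (≡.sym (power M)))) (double (norm P) (norm P ℕ.^ M) 2≤norm (1≤^ M)))))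
      where
      2≤norm : 2 ≤ norm P
      2≤norm = ℕ.*-mono-≤ (2≤card x) (1≤norm P′)
      1≤^ : ∀ M → 1 ≤ norm P ℕ.^ M
      1≤^ zero = ℕ.≤-refl
      1≤^ (suc M) = ℕ.*-mono-≤ (ℕ.≤-trans (s≤s z≤n) 2≤norm) (1≤^ M)
      power : ∀ M → norm P ℕ.^ M ≡ norm P′ ℕ.^ M ℕ.* card x ℕ.^ M
      power zero = ≡.refl
      power (suc M) = ≡.trans (≡.cong (norm P ℕ.*_) (power M)) (regroup (card x) (norm P′) (norm P′ ℕ.^ M) (card x ℕ.^ M))
        where
        regroup : ∀ c n u v → c ℕ.* n ℕ.* (u ℕ.* v) ≡ n ℕ.* u ℕ.* (c ℕ.* v)
        regroup = ℕ.solve-∀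
      double : ∀ n p → 2 ≤ n → 1 ≤ p → suc p ≤ n ℕ.* p
      double n p 2≤n 1≤p = ℕ.≤-trans (ℕ.≤-trans (ℕ.+-monoˡ-≤ p 1≤p) (ℕ.≤-reflexive (≡.cong (p ℕ.+_) (≡.sym (ℕ.+-identityʳ p))))) (ℕ.*-monoˡ-≤ p 2≤n)

    -- After the zeros E are imposed, more than one function is left, and the difference of two of
    -- them is nonzero.
    vanishing-function : ∀ E M → defect ℕ.* norm E ≤ card x ℕ.^ M → ∃[ f ] f ≉ 0# × L E (x^ M) f
    vanishing-function E M small = pick (≡.subst (λ S → Many (L S (x^ M)) 1) (++-identityʳ E) (vanish-on E 1
      (riemann M (norm E ℕ.* 1) (≡.subst (λ n → defect ℕ.* n ≤ card x ℕ.^ M) (≡.sym (ℕ.*-identityʳ (norm E))) small))))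
      where
      pick : Many (L E (x^ M)) 1 → ∃[ f ] f ≉ 0# × L E (x^ M) f
      pick (_ ∷ [] , _ , _ , s≤s ())
      pick (a ∷ b ∷ _ , (a≉b ∷ _) ∷ _ , p ∷ q ∷ _ , _) = a - b , (λ a-b≈0 → a≉b (difference-zero a-b≈0)) , ∈L (λ z → ≤-minus (bound p z) (bound q z))

    n≤card^n : ∀ n → n ≤ card x ℕ.^ n
    n≤card^n zero = z≤n
    n≤card^n (suc n) = ℕ.≤-trans (ℕ.+-mono-≤ (1≤card^ n) (n≤card^n n))
      (ℕ.≤-trans (ℕ.≤-reflexive (≡.cong (card x ℕ.^ n ℕ.+_) (≡.sym (ℕ.+-identityʳ (card x ℕ.^ n))))) (ℕ.*-monoˡ-≤ (card x ℕ.^ n) (2≤card x)))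

    vanishing : ∀ E → ∃[ M ] ∃[ f ] f ≉ 0# × L E (x^ M) f
    vanishing E = defect ℕ.* norm E , vanishing-function E _ (n≤card^n (defect ℕ.* norm E))

    L-away : ∀ {E M f z} → L E (x^ M) f → ¬ z ≈ₚ x → + mult E z ≤[ z ] f
    L-away {E} {M} {f} {z} p z≉x = ≡.subst (_≤[ z ] f) (≡.trans (≡.cong (λ n → + mult E z ℤ.- + n) (mult-x^-≉ {z} M z≉x)) (ℤ.+-identityʳ (+ mult E z))) (bound p z)

-- Strong approximation away from one place

module StrongApproximation (em : ExcludedMiddle 0ℓ) (K : FunctionField) (x : Place K) where
  open FunctionField K using (F; q)
  open CommutativeRing (fieldRing F) hiding (zero)
  open RingProperties ring
  open Exponentiation semiring using (_^_)
  open Field em F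
  open Valuations em {K}
  open Approximation em {K}
  open Divisors em K
  open RiemannRoch em K
  open PolesAt em K x
  open SetoidReasoning setoid
  open IntegerSolver (fieldRing F) using (solve; _:+_; _:*_; _:-_; :-_; _:=_)

  private
    -- Weak approximation leaves the poles outside a finite set uncontrolled. Here h has poles only
    -- at x and zeros that contain T off x. Expansions in powers of h use finitely many digits, so
    -- off x and Z their poles are bounded by one divisor C, whatever is expanded. A multiplier m
    -- that vanishes along C can therefore be fixed in advance to remove them.
    module Targets (T : List (Place K)) (n : ℕ) where

      abstract
        h-exists : ∃[ M ] ∃[ f ] f ≉ 0# × L T (x^ M) f
        h-exists = vanishing T

      h : Carrier
      h = proj₁ (proj₂ h-exists)

      abstract
        h≉0 : h ≉ 0#
        h≉0 = proj₁ (proj₂ (proj₂ h-exists))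

        h-vanishes : ∀ {z} → z ∈ₚ T → ¬ z ≈ₚ x → + 1 ≤[ z ] h
        h-vanishes {z} z∈T z≉x = ≤-weaken (+≤+ (mult-∈ {z} {T} z∈T)) (L-away {z = z} (proj₂ (proj₂ (proj₂ h-exists))) z≉x)

        h-zeros : ∃[ Z ] (∀ z → z ∈ₚ Z → ¬ z ≈ₚ x × + mult Z z ≤[ z ] h) × (∀ z → ¬ z ≈ₚ x → ¬ + suc (mult Z z) ≤[ z ] h)
        h-zeros = zeros (λ z → ¬ z ≈ₚ x) (λ {y} {z} y≈z y≉x z≈x → y≉x (≈ₚ-trans {w = y} {z} {x} y≈z z≈x)) h≉0

        h⁻¹-exists : ∃[ t ] t * h ≈ 1#
        h⁻¹-exists = inverse h≉0

      Z : List (Place K)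
      Z = proj₁ h-zeros

      h⁻¹ : Carrier
      h⁻¹ = proj₁ h⁻¹-exists

      abstract
        1≤h : ∀ z → z ∈ₚ Z → + 1 ≤[ z ] h
        1≤h z z∈Z = ≤-weaken (+≤+ (mult-∈ {z} {Z} z∈Z)) (proj₂ (proj₁ (proj₂ h-zeros) z z∈Z))

        Z-complete : ∀ z → ¬ z ≈ₚ x → + 1 ≤[ z ] h → z ∈ₚ Z
        Z-complete z z≉x 1≤h = case em
          where
          case : Dec (z ∈ₚ Z) → z ∈ₚ Z
          case (yes z∈Z) = z∈Z
          case (no z∉Z) = ⊥-elim (proj₂ (proj₂ h-zeros) z z≉x (≡.subst (λ n → + suc n ≤[ z ] h) (≡.sym (mult-∉ {z} Z z∉Z)) 1≤h))

        h⁻¹-integral : ∀ z → ¬ z ≈ₚ x → ¬ z ∈ₚ Z → + 0 ≤[ z ] h⁻¹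
        h⁻¹-integral z z≉x z∉Z =
          let m , p = order {z} h≉0
          in order⇒≤ (order-inverse (proj₂ h⁻¹-exists) p) (sign m (λ 1≤m → z∉Z (Z-complete z z≉x (order⇒≤ p 1≤m))))
          where
          sign : ∀ m → ¬ + 1 ℤ.≤ m → + 0 ℤ.≤ ℤ.- m
          sign (+ zero) _ = +≤+ z≤n
          sign (+ suc m) ¬p = ⊥-elim (¬p (+≤+ (s≤s z≤n)))
          sign -[1+ m ] _ = +≤+ z≤n

        digits : ∃[ m ] Σ[ β ∈ (Fin m → Carrier) ] (∀ i z → z ∈ₚ Z → + 0 ≤[ z ] β i) ×
          IsSeparated (CongruentModulo (integral-isSubringᶠ (_∈ₚ Z)) h) β ×
          IsComplete (λ a → ∀ z → z ∈ₚ Z → + 0 ≤[ z ] a) (CongruentModulo (integral-isSubringᶠ (_∈ₚ Z)) h) β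
        digits = maximal-family em (λ {a} {b} → congruent-sym (integral-isSubringᶠ (_∈ₚ Z)) {h} {a} {b})
          (λ m β integral separated → separated-bounded (_∈ₚ Z) h≉0 (λ z z∈Z → ≤-weaken (+≤+ z≤n) (1≤h z z∈Z)) β integral separated)

      β : Fin (proj₁ digits) → Carrier
      β = proj₁ (proj₂ digits)

      abstract
        digit : ∀ w → (∀ z → z ∈ₚ Z → + 0 ≤[ z ] w) → ∃[ j ] ∃[ o ] (∀ z → z ∈ₚ Z → + 0 ≤[ z ] o) × w - β j ≈ h * o
        digit = proj₂ (proj₂ (proj₂ (proj₂ digits)))

        C-exists : ∃[ C ] ∀ i z → ℤ.- (+ mult C z) ≤[ z ] β i
        C-exists = common-pole-divisor β

      C : List (Place K)
      C = proj₁ C-exists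

      abstract
        -- Expand w in powers of h up to an error integral at Z; the poles of the
        -- digits outside Z are bounded by C.
        expansion : ∀ M w → (∀ z → z ∈ₚ Z → + 0 ≤[ z ] h ^ M * w) →
          ∃[ f ] (∀ z → z ∈ₚ Z → + 0 ≤[ z ] w - f) × (∀ z → ¬ z ≈ₚ x → ¬ z ∈ₚ Z → ℤ.- (+ mult C z) ≤[ z ] f)
        expansion zero w integral = 0# , (λ z z∈Z → ≤-resp (trans (*-identityˡ w) (sym (trans (+-congˡ -0#≈0#) (+-identityʳ w)))) (integral z z∈Z)) , λ z _ _ → ≤-0# refl
        expansion (suc M) w integral =
          let j , o , Oo , eq = digit (h ^ suc M * w) integral
              -- β j is the digit of hᴹ⁺¹ w modulo h; subtracting it leaves a denominator of at most
              -- hᴹ.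
              d = h⁻¹ ^ suc M * β j
              f , close , bounded = expansion M (w - d) (λ z z∈Z → ≤-resp (sym (reduce j o eq)) (Oo z z∈Z))
          in f + d , (λ z z∈Z → ≤-resp (regroup w d f) (close z z∈Z)) ,
             λ z z≉x z∉Z → ≤-+ (bounded z z≉x z∉Z) (≡.subst (_≤[ z ] d) (ℤ.+-identityˡ (ℤ.- (+ mult C z)))
               (≤-* (≡.subst (λ n → + n ≤[ z ] h⁻¹ ^ suc M) (ℕ.*-zeroʳ (suc M)) (≤-^ (suc M) (h⁻¹-integral z z≉x z∉Z))) (proj₂ C-exists j z)))
          where
          regroup : ∀ w d f → (w - d) - f ≈ w - (f + d)
          regroup = solve 3 (λ w d f → (w :- d) :- f := w :- (f :+ d)) refl
          powers : ∀ M → h⁻¹ ^ M * h ^ M ≈ 1#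
          powers zero = *-identityˡ 1#
          powers (suc M) = trans (interchange h⁻¹ (h⁻¹ ^ M) h (h ^ M)) (trans (*-cong (proj₂ h⁻¹-exists) (powers M)) (*-identityˡ 1#))
            where
            interchange : ∀ a b c d → (a * b) * (c * d) ≈ (a * c) * (b * d)
            interchange = solve 4 (λ a b c d → (a :* b) :* (c :* d) := (a :* c) :* (b :* d)) refl
          reduce : ∀ j o → h ^ suc M * w - β j ≈ h * o → h ^ M * (w - h⁻¹ ^ suc M * β j) ≈ o
          reduce j o eq = *-cancelˡ h≉0 (begin
            h * (h ^ M * (w - h⁻¹ ^ suc M * β j))          ≈⟨ distribute h (h ^ M) w (h⁻¹ ^ suc M) (β j) ⟩
            h ^ suc M * w - (h⁻¹ ^ suc M * h ^ suc M) * β j  ≈⟨ +-congˡ (-‿cong (trans (*-congʳ (powers (suc M))) (*-identityˡ (β j)))) ⟩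
            h ^ suc M * w - β j                              ≈⟨ eq ⟩
            h * o                                            ∎)
            where
            distribute : ∀ h hᴹ w t b → h * (hᴹ * (w - t * b)) ≈ (h * hᴹ) * w - (t * (h * hᴹ)) * b
            distribute = solve 5 (λ h hᴹ w t b → h :* (hᴹ :* (w :- t :* b)) := (h :* hᴹ) :* w :- (t :* (h :* hᴹ)) :* b) refl

        multiplier : ∃[ M ] ∃[ f ] f ≉ 0# × L (copies n T ++ C) (x^ M) f
        multiplier = vanishing (copies n T ++ C)

      m : Carrier
      m = proj₁ (proj₂ multiplier)

      abstract
        m≉0 : m ≉ 0#
        m≉0 = proj₁ (proj₂ (proj₂ multiplier))

        m-C : ∀ z → ¬ z ≈ₚ x → + mult C z ≤[ z ] m
        m-C z z≉x = ≤-weaken (+≤+ (ℕ.≤-trans (ℕ.m≤n+m (mult C z) (mult (copies n T) z)) (ℕ.≤-reflexive (≡.sym (mult-++ z (copies n T) C)))))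
          (L-away {z = z} (proj₂ (proj₂ (proj₂ multiplier))) z≉x)

        m-T : ∀ z → ¬ z ≈ₚ x → z ∈ₚ T → + n ≤[ z ] m
        m-T z z≉x z∈T = ≤-weaken (+≤+ (ℕ.≤-trans (ℕ.≤-trans (ℕ.m≤m*n n (mult T z) ⦃ ℕ.>-nonZero (mult-∈ {z} {T} z∈T) ⦄) (ℕ.≤-reflexive (≡.sym (mult-copies z n T))))
          (ℕ.≤-trans (ℕ.m≤m+n (mult (copies n T) z) (mult C z)) (ℕ.≤-reflexive (≡.sym (mult-++ z (copies n T) C))))))
          (L-away {z = z} (proj₂ (proj₂ (proj₂ multiplier))) z≉x)

        approximate : ∀ w → ∃[ f ] (∀ z → z ∈ₚ Z → + 0 ≤[ z ] w - f) × (∀ z → ¬ z ≈ₚ x → ¬ z ∈ₚ Z → ℤ.- (+ mult C z) ≤[ z ] f)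
        approximate w =
          let B , bounded = bounded-below-on Z w
          in expansion B w (λ z z∈Z → ≡.subst (_≤[ z ] h ^ B * w) (≡.trans (≡.cong (λ n → + n ℤ.+ ℤ.- (+ B)) (ℕ.*-identityʳ B)) (ℤ.+-inverseʳ (+ B))) (≤-* (≤-^ B (1≤h z z∈Z)) (bounded z z∈Z)))

      module _ (a : Place K → Carrier) (coherent : ∀ y z → y ≈ₚ z → + n ≤[ y ] a y - a z) where

        target : ∀ z → Dec (z ∈ₚ T) → Carrier
        target z (yes _) = a z
        target z (no _) = 0#

        abstract
          target-coherent : ∀ y z → y ≈ₚ z → (d : Dec (y ∈ₚ T)) (e : Dec (z ∈ₚ T)) → + n ≤[ y ] target y d - target z e
          target-coherent y z y≈z (yes _) (yes _) = coherent y z y≈z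
          target-coherent y z y≈z (no _) (no _) = ≤-0# (-‿inverseʳ 0#)
          target-coherent y z y≈z (yes y∈T) (no z∉T) = ⊥-elim (z∉T (∈ₚ-resp {y = y} {z} y≈z y∈T))
          target-coherent y z y≈z (no y∉T) (yes z∈T) = ⊥-elim (y∉T (∈ₚ-resp {y = z} {y} (≈ₚ-sym {y = y} {z} y≈z) z∈T))

          solution : ∃[ f ] (∀ z → ¬ z ≈ₚ x → z ∈ₚ T → + n ≤[ z ] f - a z) × (∀ z → ¬ z ≈ₚ x → ¬ z ∈ₚ T → + 0 ≤[ z ] f)
          solution =
            let f₀ , near = weak-approximation n Z (λ z → target z em) (λ y z y≈z → target-coherent y z y≈z em em)
                m⁻¹ , m⁻¹m≈1 = inverse m≉0
                -- Approximating f₀/m with an error integral at Z makes m f agree with f₀ up to m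
                -- times that error, which vanishes to order n at the places of T other than x.
                f , close , bounded = approximate (m⁻¹ * f₀)
            in m * f ,
               (λ z z≉x z∈T → at-T f₀ m⁻¹ f m⁻¹m≈1 z z∈T em (near z (Z-complete z z≉x (h-vanishes {z} z∈T z≉x))) (m-T z z≉x z∈T) (close z (Z-complete z z≉x (h-vanishes {z} z∈T z≉x)))) ,
               λ z z≉x z∉T → off-T f₀ m⁻¹ f m⁻¹m≈1 z z≉x z∉T (near z) (close z) (bounded z z≉x) em
            where
            product : ∀ f₀ m⁻¹ f → m⁻¹ * m ≈ 1# → f₀ - m * (m⁻¹ * f₀ - f) ≈ m * f
            product f₀ m⁻¹ f m⁻¹m≈1 = begin
              f₀ - m * (m⁻¹ * f₀ - f)              ≈⟨ expand f₀ m m⁻¹ f ⟩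
              f₀ - (m⁻¹ * m) * f₀ + m * f          ≈⟨ +-congʳ (+-congˡ (-‿cong (trans (*-congʳ m⁻¹m≈1) (*-identityˡ f₀)))) ⟩
              f₀ - f₀ + m * f                      ≈⟨ trans (+-congʳ (-‿inverseʳ f₀)) (+-identityˡ (m * f)) ⟩
              m * f                                ∎
              where
              expand : ∀ g m t f → g - m * (t * g - f) ≈ g - (t * m) * g + m * f
              expand = solve 4 (λ g m t f → g :- m :* (t :* g :- f) := g :- (t :* m) :* g :+ m :* f) refl
            at-T : ∀ f₀ m⁻¹ f → m⁻¹ * m ≈ 1# → ∀ z → z ∈ₚ T → (d : Dec (z ∈ₚ T)) → + n ≤[ z ] f₀ - target z d → + n ≤[ z ] m → + 0 ≤[ z ] m⁻¹ * f₀ - f → + n ≤[ z ] m * f - a z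
            at-T f₀ m⁻¹ f m⁻¹m≈1 z z∈T (no z∉T) = ⊥-elim (z∉T z∈T)
            at-T f₀ m⁻¹ f m⁻¹m≈1 z z∈T (yes _) p q r = ≤-resp (trans (regroup f₀ (a z) _) (+-congʳ (product f₀ m⁻¹ f m⁻¹m≈1)))
              (≤-minus p (≡.subst (_≤[ z ] m * (m⁻¹ * f₀ - f)) (ℤ.+-identityʳ (+ n)) (≤-* q r)))
              where
              regroup : ∀ f a e → (f - a) - e ≈ (f - e) - a
              regroup = solve 3 (λ f a e → (f :- a) :- e := (f :- e) :- a) refl
            off-T : ∀ f₀ m⁻¹ f → m⁻¹ * m ≈ 1# → ∀ z → ¬ z ≈ₚ x → ¬ z ∈ₚ T → (z ∈ₚ Z → + n ≤[ z ] f₀ - target z em) → (z ∈ₚ Z → + 0 ≤[ z ] m⁻¹ * f₀ - f) →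
              (¬ z ∈ₚ Z → ℤ.- (+ mult C z) ≤[ z ] f) → Dec (z ∈ₚ Z) → + 0 ≤[ z ] m * f
            off-T f₀ m⁻¹ f m⁻¹m≈1 z z≉x z∉T near close bounded (yes z∈Z) = ≤-resp (product f₀ m⁻¹ f m⁻¹m≈1)
              (≤-minus (≤-weaken (+≤+ z≤n) (zero-target em (near z∈Z))) (≤-weaken (+≤+ z≤n) (≤-* (m-C z z≉x) (close z∈Z))))
              where
              zero-target : (d : Dec (z ∈ₚ T)) → + n ≤[ z ] f₀ - target z d → + n ≤[ z ] f₀
              zero-target (yes z∈T) _ = ⊥-elim (z∉T z∈T)
              zero-target (no _) p = ≤-resp (trans (+-congˡ -0#≈0#) (+-identityʳ f₀)) p
            off-T f₀ m⁻¹ f m⁻¹m≈1 z z≉x z∉T near close bounded (no z∉Z) = ≡.subst (_≤[ z ] m * f) (ℤ.+-inverseʳ (+ mult C z)) (≤-* (m-C z z≉x) (bounded z∉Z))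

  abstract
    strong-approximation : ∀ T n (a : Place K → Carrier) → (∀ y z → y ≈ₚ z → + n ≤[ y ] a y - a z) →
      ∃[ f ] (∀ z → ¬ z ≈ₚ x → z ∈ₚ T → + n ≤[ z ] f - a z) × (∀ z → ¬ z ≈ₚ x → ¬ z ∈ₚ T → + 0 ≤[ z ] f)
    strong-approximation T n a coherent = Targets.solution T n a coherent

-- Small places, zeros against poles, and Minkowski's bound

module Finiteness (em : ExcludedMiddle 0ℓ) (K : FunctionField) where
  open FunctionField K using (𝔽q; F; q; constants)
  open CommutativeRing (fieldRing F) hiding (zero)
  open RingProperties ring
  open Exponentiation semiring using (_^_; ^-homo-*)
  open Horner (fieldRing F)
  open Field em F
  open Polynomials (fieldRing 𝔽q) (fieldRing F) constants
  open Growth em K using (t; t-transcendental)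
  open Valuations em {K}
  open Approximation em {K}
  open Divisors em K
  open RiemannRoch em K
  open SetoidReasoning setoid
  open IntegerSolver (fieldRing F) using (solve; _:+_; _:*_; _:-_; :-_; _:=_; con)
  private
    module k = CommutativeRing (fieldRing 𝔽q)
    module φ = RingHomomorphism constants

    shift : ℕ → List k.Carrier → List k.Carrier
    shift n p = replicate n k.0# ++ p

    eval-shift : ∀ n p → eval (shift n p) t ≈ t ^ n * eval p t
    eval-shift zero p = sym (*-identityˡ _)
    eval-shift (suc n) p = begin
      φ.⟦ k.0# ⟧ + t * eval (shift n p) t   ≈⟨ +-cong φ.0#-homo (*-congˡ (eval-shift n p)) ⟩
      0# + t * (t ^ n * eval p t)           ≈⟨ trans (+-identityˡ _) (sym (*-assoc t (t ^ n) _)) ⟩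
      t ^ suc n * eval p t                  ∎

    shift-nonzero : ∀ n p → NonzeroPoly p → NonzeroPoly (shift n p)
    shift-nonzero zero p nonzero = nonzero
    shift-nonzero (suc n) p nonzero = there (shift-nonzero n p nonzero)

    k-1≉0 : k.1# k.≉ k.0#
    k-1≉0 1≈0 = 1≉0 (trans (sym φ.1#-homo) (trans (φ.⟦⟧-cong 1≈0) φ.0#-homo))

  abstract
    -- The difference is tⁱ (1 - tᵈ⁺¹), the value of a nonzero polynomial at the transcendental t.
    powers-distinct : ∀ i d → t ^ i - t ^ (i ℕ.+ suc d) ≉ 0#
    powers-distinct i d eq = t-transcendental (shift i p , shift-nonzero i p (here k-1≉0) , (begin
      eval (shift i p) t          ≈⟨ eval-shift i p ⟩
      t ^ i * eval p t            ≈⟨ *-congˡ (+-cong φ.1#-homo (*-congˡ (trans (eval-shift d _) (*-congˡ (trans (+-congˡ (zeroʳ t)) (+-identityʳ _)))))) ⟩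
      t ^ i * (1# + t * (t ^ d * φ.⟦ k.- k.1# ⟧))   ≈⟨ *-congˡ (+-congˡ (*-congˡ (*-congˡ (trans (φ.-‿homo k.1#) (-‿cong φ.1#-homo))))) ⟩
      t ^ i * (1# + t * (t ^ d * - 1#))   ≈⟨ regroup (t ^ i) t (t ^ d) ⟩
      t ^ i - t ^ i * (t * t ^ d)         ≈⟨ +-congˡ (-‿cong (sym (^-homo-* t i (suc d)))) ⟩
      t ^ i - t ^ (i ℕ.+ suc d)           ≈⟨ eq ⟩
      0#                                  ∎))
      where
      p : List k.Carrier
      p = k.1# ∷ shift d (k.- k.1# ∷ [])
      regroup : ∀ a b c → a * (1# + b * (c * - 1#)) ≈ a - a * (b * c)
      regroup = solve 3 (λ a b c → a :* (con (1 , 0) :+ b :* (c :* (:- con (1 , 0)))) := a :- a :* (b :* c)) refl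

    private
      union : ∀ {m} (P : Fin m → Pred (Place K) 0ℓ) → (∀ i → ∃[ T ] ∀ y → P i y → y ∈ₚ T) → ∃[ T ] ∀ i y → P i y → y ∈ₚ T
      union {zero} P lists = [] , λ ()
      union {suc m} P lists =
        let S , p = lists zero
            T , ps = union (P ∘ suc) (lists ∘ suc)
        in S ++ T , λ where
          zero y Py → ++⁺ˡ (p y Py)
          (suc i) y Py → ++⁺ʳ S (ps i y Py)

      zero-list : ∀ {u} → u ≉ 0# → ∃[ T ] ∀ y → + 1 ≤[ y ] u → y ∈ₚ T
      zero-list {u} u≉0 =
        let T , _ , maximal = zeros (λ _ → ⊤) _ u≉0
        in T , λ y 1≤u → case T y (maximal y tt) 1≤u em
        where
        case : ∀ T y → ¬ + suc (mult T y) ≤[ y ] u → + 1 ≤[ y ] u → Dec (y ∈ₚ T) → y ∈ₚ T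
        case T y maximal 1≤u (yes y∈T) = y∈T
        case T y maximal 1≤u (no y∉T) = ⊥-elim (maximal (≡.subst (λ n → + suc n ≤[ y ] u) (≡.sym (mult-∉ {y} T y∉T)) 1≤u))

      -- The second exponent is the first plus a positive gap, so that `powers-distinct` applies for
      -- all indices.
      Agree : ∀ {B} → Fin (suc B) → Fin (suc B) → Pred (Place K) 0ℓ
      Agree i j y = + 1 ≤[ y ] t ^ Fin.toℕ i - t ^ (Fin.toℕ i ℕ.+ suc (Fin.toℕ j))

      agreement-places : ∀ B (i : Fin (suc B)) → ∃[ T ] ∀ y → Σ[ j ∈ Fin (suc B) ] Agree i j y → y ∈ₚ T
      agreement-places B i =
        let T , ps = union (Agree i) (λ j → zero-list (powers-distinct (Fin.toℕ i) (Fin.toℕ j)))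
        in T , λ y (j , p) → ps j y p

    -- If card y ≤ B then two of the powers 1, t, …, tᴮ agree modulo y, unless y is a pole of t.
    small-places : ∀ B → ∃[ T ] ∀ y → card y ≤ B → y ∈ₚ T
    small-places B =
      let S , t-integral = poles t
          T , covers = union (λ i y → Σ[ j ∈ Fin (suc B) ] Agree i j y) (agreement-places B)
      in S ++ T , λ y small → case S T y small t-integral (covers′ T covers) em
      where
      covers′ : ∀ T → (∀ (i : Fin (suc B)) y → Σ[ j ∈ Fin (suc B) ] Agree i j y → y ∈ₚ T) →
        ∀ (i j : Fin (suc B)) y → i Fin.< j → + 1 ≤[ y ] t ^ Fin.toℕ i - t ^ Fin.toℕ j → y ∈ₚ T
      covers′ T covers i j y i<j p = covers i y (Fin.fromℕ< d<1+B , ≡.subst (λ n → + 1 ≤[ y ] t ^ Fin.toℕ i - t ^ n)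
        (≡.sym (≡.trans (≡.cong (λ n → Fin.toℕ i ℕ.+ suc n) (Fin.toℕ-fromℕ< d<1+B)) (≡.trans (ℕ.+-suc (Fin.toℕ i) d) (ℕ.m+[n∸m]≡n i<j)))) p)
        where
        d : ℕ
        d = Fin.toℕ j ℕ.∸ suc (Fin.toℕ i)
        d<1+B : d ℕ.< suc B
        d<1+B = ℕ.≤-<-trans (ℕ.m∸n≤m (Fin.toℕ j) (suc (Fin.toℕ i))) (Fin.toℕ<n j)
      case : ∀ S T y → card y ≤ B → (∀ y → ¬ y ∈ₚ S → + 0 ≤[ y ] t) → (∀ (i j : Fin (suc B)) y → i Fin.< j → + 1 ≤[ y ] t ^ Fin.toℕ i - t ^ Fin.toℕ j → y ∈ₚ T) →
        Dec (y ∈ₚ S) → y ∈ₚ S ++ T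
      case S T y small t-integral covers (yes y∈S) = ++⁺ˡ y∈S
      case S T y small t-integral covers (no y∉S) =
        let i , j , i<j , eq = Fin.pigeonhole (s≤s small) (λ i → proj₁ (colour i))
        in ++⁺ʳ S (covers i j y i<j (≤-resp (telescope _ _ _) (≤-+ (≡.subst (λ c → + 1 ≤[ y ] t ^ Fin.toℕ i - ω y c) eq (proj₂ (colour i))) (≤-swap (proj₂ (colour j))))))
        where
        telescope : ∀ x b c → (x - b) + (b - c) ≈ x - c
        telescope = solve 3 (λ x b c → (x :- b) :+ (b :- c) := x :- c) refl
        colour : ∀ (i : Fin (suc B)) → ∃[ c ] + 1 ≤[ y ] t ^ Fin.toℕ i - ω y c
        colour i = ω-complete y _ (≡.subst (λ n → + n ≤[ y ] t ^ Fin.toℕ i) (ℕ.*-zeroʳ (Fin.toℕ i)) (≤-^ (Fin.toℕ i) (t-integral y y∉S)))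

  module _ (few-constants : ¬ Many (L [] []) q) (x : Place K) where
    open PolesAt em K x

    abstract
      -- Removing one pole at x divides the number of functions by at most `card x`, and at most q
      -- functions have no poles: l(M x) ≤ M deg x + 1.
      few-poles : ∀ M → ¬ Many (L [] (x^ M)) (card x ℕ.^ M ℕ.* q)
      few-poles M many = few-constants (without-poles (x^ M) q
        (≡.subst₂ (λ T b → Many (L [] T) b) (≡.sym (++-identityʳ (x^ M))) (≡.cong (ℕ._* q) (≡.sym (norm-x^ M))) many))

      -- There are (norm E)ʳ sums of digits modulo E in powers of u. Multiplied by c, which clears
      -- the poles of the digits, they have poles at x alone, of order at most B + r k, so
      -- `few-poles` bounds their number by a constant times (card x)^(k r). Letting r grow gives
      -- one half of the product formula.
      zeros≤poles : ∀ E k {u} → u ≉ 0# → L E (x^ k) u → (∀ z → z ∈ₚ E → ¬ z ≈ₚ x) → norm E ≤ card x ℕ.^ k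
      zeros≤poles E k {u} u≉0 Lu E∌x =
        let C , C-bounds = common-pole-divisor β
            B , c , c≉0 , Lc = vanishing C
        in growth-rate (card x ℕ.^ B ℕ.* q) (λ r → ℕ.≮⇒≥ (λ big → few-poles (B ℕ.+ r ℕ.* k)
          (many-from-family {b = card x ℕ.^ (B ℕ.+ r ℕ.* k) ℕ.* q} (λ i → c * horner u β r i)
            (λ i j eq → digits-separated r i j (*-cancelˡ c≉0 eq))
            (scaled B C c (λ j z → ≤-* (bound Lc z) (C-bounds j z)) r)
            (ℕ.≤-<-trans (ℕ.≤-reflexive (size B r)) big))))
        where
        open Representatives (representatives E E (λ _ z∈E → z∈E))
        vanishes : ∀ z → z ∈ₚ E → + mult E z ≤[ z ] u
        vanishes z z∈E = L-away {z = z} Lu (E∌x z z∈E)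
        digits-separated : ∀ r → IsSeparated _≈_ (horner u β r)
        digits-separated = horner-separated (integral-isSubringᶠ (_∈ₚ E)) (λ z z∈E → ≤-weaken (+≤+ z≤n) (vanishes z z∈E)) u≉0 integral
          (λ i j (o , Oo , eq) → separated i j (λ z z∈E → ≤-resp (sym eq)
            (≡.subst (_≤[ z ] u * o) (ℤ.+-identityʳ (+ mult E z)) (≤-* (vanishes z z∈E) (Oo z z∈E)))))
        size : ∀ B r → card x ℕ.^ (B ℕ.+ r ℕ.* k) ℕ.* q ≡ card x ℕ.^ B ℕ.* q ℕ.* (card x ℕ.^ k) ℕ.^ r
        size B r = ≡.trans (≡.cong (ℕ._* q) (≡.trans (ℕ.^-distribˡ-+-* (card x) B (r ℕ.* k)) (≡.cong (card x ℕ.^ B ℕ.*_) (≡.trans (≡.cong (card x ℕ.^_) (ℕ.*-comm r k)) (≡.sym (ℕ.^-*-assoc (card x) k r))))))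
          (swap (card x ℕ.^ B) _ q)
          where
          swap : ∀ a b c → a ℕ.* b ℕ.* c ≡ a ℕ.* c ℕ.* b
          swap = ℕ.solve-∀
        module _ (B : ℕ) (C : List (Place K)) (c : Carrier) (cβ : ∀ j z → (+ mult C z ℤ.- + mult (x^ B) z) ℤ.+ ℤ.- (+ mult C z) ≤[ z ] c * β j) where
          base : ∀ j z → ℤ.- (+ mult (x^ B) z) ≤[ z ] c * β j
          base j z = ≡.subst (_≤[ z ] c * β j) (cancel (+ mult C z) (+ mult (x^ B) z)) (cβ j z)
            where
            cancel : ∀ m n → (m ℤ.- n) ℤ.+ ℤ.- m ≡ ℤ.- n
            cancel = ℤ.solve-∀
          u-poles : ∀ z → ℤ.- (+ mult (x^ k) z) ≤[ z ] u
          u-poles z = ≤-weaken (≤-by₁ (ℤ.- (+ mult (x^ k) z)) (+ mult E z ℤ.- + mult (x^ k) z) (+≤+ (z≤n {mult E z})) (shift′ (+ mult E z) (+ mult (x^ k) z))) (bound Lu z)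
            where
            shift′ : ∀ m n → m ℤ.- + 0 ≡ (m ℤ.- n) ℤ.- ℤ.- n
            shift′ = ℤ.solve-∀
          mult-sum : ∀ m n z → mult (x^ m) z ℕ.+ mult (x^ n) z ≡ mult (x^ (m ℕ.+ n)) z
          mult-sum m n z = case em
            where
            case : Dec (z ≈ₚ x) → mult (x^ m) z ℕ.+ mult (x^ n) z ≡ mult (x^ (m ℕ.+ n)) z
            case (yes z≈x) = ≡.trans (≡.cong₂ ℕ._+_ (mult-x^ {z} m z≈x) (mult-x^ {z} n z≈x)) (≡.sym (mult-x^ {z} (m ℕ.+ n) z≈x))
            case (no z≉x) = ≡.trans (≡.cong₂ ℕ._+_ (mult-x^-≉ {z} m z≉x) (mult-x^-≉ {z} n z≉x)) (≡.sym (mult-x^-≉ {z} (m ℕ.+ n) z≉x))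
          pole-bound : ∀ r i z → ℤ.- (+ mult (x^ (B ℕ.+ r ℕ.* k)) z) ≤[ z ] c * horner u β r i
          pole-bound zero i z = ≤-0# (zeroʳ c)
          pole-bound (suc r) i z = ≤-resp (sym (distribute c (β _) u (horner u β r _)))
            (≤-+ (≤-weaken (ℤ.neg-mono-≤ (+≤+ (ℕ.≤-trans (ℕ.m≤m+n (mult (x^ B) z) (mult (x^ (suc r ℕ.* k)) z)) (ℕ.≤-reflexive (mult-sum B (suc r ℕ.* k) z))))) (base _ z))
              (≡.subst (_≤[ z ] u * (c * horner u β r _)) (≡.trans (≡.sym (ℤ.neg-distrib-+ (+ mult (x^ k) z) (+ mult (x^ (B ℕ.+ r ℕ.* k)) z)))
                (≡.cong ℤ.-_ (≡.trans (≡.sym (ℤ.pos-+ (mult (x^ k) z) _)) (≡.cong +_ (≡.trans (mult-sum k (B ℕ.+ r ℕ.* k) z) (≡.cong (λ n → mult (x^ n) z) (swap k B (r ℕ.* k))))))))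
                (≤-* (u-poles z) (pole-bound r _ z))))
            where
            swap : ∀ k B n → k ℕ.+ (B ℕ.+ n) ≡ B ℕ.+ (k ℕ.+ n)
            swap = ℕ.solve-∀
            distribute : ∀ c b u s → c * (b + u * s) ≈ c * b + u * (c * s)
            distribute = solve 4 (λ c b u s → c :* (b :+ u :* s) := c :* b :+ u :* (c :* s)) refl
          scaled : ∀ r i → L [] (x^ (B ℕ.+ r ℕ.* k)) (c * horner u β r i)
          scaled r i = ∈L (λ z → ≡.subst (_≤[ z ] c * horner u β r i) (≡.sym (ℤ.+-identityˡ _)) (pole-bound r i z))

      -- Minkowski's bound.
      bounded-inverse : ∀ E → ∃[ M ] ∃[ f ] f ≉ 0# × L E (x^ M) f ×
        (∀ E′ → (∀ z → z ∈ₚ E′ ++ E → ¬ z ≈ₚ x) → L (E′ ++ E) (x^ M) f → norm E′ ≤ card x ℕ.* defect)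
      bounded-inverse E =
        -- (card x)^M is large enough to guarantee a function that vanishes along E, and exceeds
        -- `defect` times norm E by a factor of at most `card x`. This factor and the defect are the
        -- room left for further zeros E′.
        let M , big , small = logarithm (defect ℕ.* norm E) (ℕ.*-mono-≤ 1≤defect (1≤norm E))
            f , f≉0 , Lf = vanishing-function E M big
        in M , f , f≉0 , Lf , λ E′ E′∌x Lf′ → ℕ.*-cancelʳ-≤ (norm E′) (card x ℕ.* defect) (norm E) ⦃ ℕ.>-nonZero (1≤norm E) ⦄
          (ℕ.≤-trans (ℕ.≤-reflexive (≡.sym (norm-++ E′ E))) (ℕ.≤-trans (zeros≤poles (E′ ++ E) M f≉0 Lf′ E′∌x)
            (ℕ.≤-trans small (ℕ.≤-reflexive (≡.sym (ℕ.*-assoc (card x) defect (norm E)))))))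
        where
        logarithm : ∀ n → 1 ≤ n → ∃[ M ] n ≤ card x ℕ.^ M × card x ℕ.^ M ≤ card x ℕ.* n
        logarithm (suc zero) _ = 0 , ℕ.≤-refl , ℕ.≤-trans (s≤s z≤n) (ℕ.*-monoˡ-≤ 1 (2≤card x))
        logarithm (suc n@(suc _)) _ =
          let M , n≤ , ≤cn = logarithm n (s≤s z≤n) in next M n≤ ≤cn (suc n ℕ.≤? card x ℕ.^ M)
          where
          next : ∀ M → n ≤ card x ℕ.^ M → card x ℕ.^ M ≤ card x ℕ.* n → Dec (suc n ≤ card x ℕ.^ M) →
            ∃[ M ] suc n ≤ card x ℕ.^ M × card x ℕ.^ M ≤ card x ℕ.* suc n
          next M n≤ ≤cn (yes 1+n≤) = M , 1+n≤ , ℕ.≤-trans ≤cn (ℕ.*-monoʳ-≤ (card x) (ℕ.n≤1+n n))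
          next M n≤ ≤cn (no 1+n≰) = suc M ,
            ℕ.≤-trans (ℕ.+-mono-≤ (s≤s (z≤n {ℕ.pred n})) (ℕ.≤-reflexive (≡.sym (ℕ.+-identityʳ n)))) (ℕ.*-mono-≤ (2≤card x) n≤) ,
            ℕ.*-monoʳ-≤ (card x) (ℕ.<⇒≤ (ℕ.≰⇒> 1+n≰))

      -- Otherwise the powers of f or f⁻¹ are infinitely many functions without poles.
      order-at-x : ∀ {f m} → (∀ z → ¬ z ≈ₚ x → Order z f (+ 0)) → Order x f m → m ≡ + 0
      order-at-x {f} {+ zero} units p = ≡.refl
      order-at-x {f} {+ suc n} units p = ⊥-elim (few-constants (many-from-family {m = suc q} (λ i → f ^ Fin.toℕ i)
        (λ i j eq → Fin.toℕ-injective (same-power _ _ eq)) (λ i → ∈L (λ z → integral-power (Fin.toℕ i) z em)) ℕ.≤-refl))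
        where
        same-power : ∀ i j → f ^ i ≈ f ^ j → i ≡ j
        same-power i j eq = ℕ.*-cancelʳ-≡ i j (suc n) (ℤ.+-injective (≡.trans (ℤ.pos-* i (suc n))
          (≡.trans (order-unique (order-^ i p) (order-cong (sym eq) (order-^ j p))) (≡.sym (ℤ.pos-* j (suc n))))))
        integral-power : ∀ i z → Dec (z ≈ₚ x) → + 0 ≤[ z ] f ^ i
        integral-power i z (yes z≈x) = ≤-at {x} {z} (≈ₚ-sym {y = z} {x} z≈x) (order⇒≤ (order-^ i p) (≡.subst (+ 0 ℤ.≤_) (ℤ.pos-* i (suc n)) (+≤+ z≤n)))
        integral-power i z (no z≉x) = order⇒≤ (order-^ i (units z z≉x)) (ℤ.≤-reflexive (≡.sym (ℤ.*-zeroʳ (+ i))))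
      order-at-x {f} { -[1+ n ]} units p =
        let b , bf≈1 = inverse (order⇒nonzero p)
        in ⊥-elim (positive (order-at-x {b} {+ suc n} (λ z z≉x → order-inverse bf≈1 (units z z≉x)) (order-inverse bf≈1 p)))
        where
        positive : ¬ + suc n ≡ + 0
        positive ()

-- Functions without poles

module Adjunction (R : Ring) where
  open CommutativeRing R hiding (zero)
  open RingProperties ring
  open IntegerSolver R using (solve; _:+_; _:*_; _:=_)

  record IsClosed (P : Pred Carrier 0ℓ) : Set where
    field
      isSubring : IsSubring R P
      resp : ∀ {a b} → a ≈ b → P a → P b
    open IsSubring isSubring public

  -- P[z]
  data Adjoin (P : Pred Carrier 0ℓ) (z : Carrier) : Pred Carrier 0ℓ where
    const : ∀ {a} → P a → Adjoin P z a
    step : ∀ {a w b} → P a → Adjoin P z w → b ≈ a + z * w → Adjoin P z b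

  Adjoin-mono : ∀ {P Q : Pred Carrier 0ℓ} {z a} → (∀ {a} → P a → Q a) → Adjoin P z a → Adjoin Q z a
  Adjoin-mono P⊂Q (const p) = const (P⊂Q p)
  Adjoin-mono P⊂Q (step p w eq) = step (P⊂Q p) (Adjoin-mono P⊂Q w) eq

  module _ {P : Pred Carrier 0ℓ} (closed : IsClosed P) (z : Carrier) where
    open IsClosed closed

    Adjoin-resp : ∀ {a b} → a ≈ b → Adjoin P z a → Adjoin P z b
    Adjoin-resp a≈b (const p) = const (resp a≈b p)
    Adjoin-resp a≈b (step p w eq) = step p w (trans (sym a≈b) eq)

    Adjoin-z* : ∀ {a} → Adjoin P z a → Adjoin P z (z * a)
    Adjoin-z* p = step 0#-closed p (sym (+-identityˡ _))

    Adjoin-+ : ∀ {a b} → Adjoin P z a → Adjoin P z b → Adjoin P z (a + b)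
    Adjoin-+ (const p) (const q) = const (+-closed p q)
    Adjoin-+ {a} (const p) (step {b} {w} q r eq) = step (+-closed p q) r (trans (+-congˡ eq) (sym (+-assoc a b _)))
    Adjoin-+ {_} {b} (step {a} {w} p r eq) (const q) = step (+-closed p q) r (trans (+-congʳ eq) (rearrange a (z * w) b))
      where
      rearrange : ∀ a w b → (a + w) + b ≈ (a + b) + w
      rearrange = solve 3 (λ a w b → (a :+ w) :+ b := (a :+ b) :+ w) refl
    Adjoin-+ (step {a} {w} p r eq) (step {b} {w′} q s eq′) = step (+-closed p q) (Adjoin-+ r s) (trans (+-cong eq eq′) (rearrange a z w b w′))
      where
      rearrange : ∀ a z w b w′ → (a + z * w) + (b + z * w′) ≈ (a + b) + z * (w + w′)
      rearrange = solve 5 (λ a z w b w′ → (a :+ z :* w) :+ (b :+ z :* w′) := (a :+ b) :+ z :* (w :+ w′)) refl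

    Adjoin-scale : ∀ {c a} → P c → Adjoin P z a → Adjoin P z (c * a)
    Adjoin-scale pc (const p) = const (*-closed pc p)
    Adjoin-scale {c} pc (step {a} {w} p r eq) = step (*-closed pc p) (Adjoin-scale pc r) (trans (*-congˡ eq) (rearrange c a z w))
      where
      rearrange : ∀ c a z w → c * (a + z * w) ≈ c * a + z * (c * w)
      rearrange = solve 4 (λ c a z w → c :* (a :+ z :* w) := c :* a :+ z :* (c :* w)) refl

    Adjoin-* : ∀ {a b} → Adjoin P z a → Adjoin P z b → Adjoin P z (a * b)
    Adjoin-* (const p) q = Adjoin-scale p q
    Adjoin-* {_} {b} (step {a} {w} p r eq) q = Adjoin-resp (sym (trans (*-congʳ eq) (rearrange a z w b)))
      (Adjoin-+ (Adjoin-scale p q) (Adjoin-z* (Adjoin-* r q)))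
      where
      rearrange : ∀ a z w b → (a + z * w) * b ≈ a * b + z * (w * b)
      rearrange = solve 4 (λ a z w b → (a :+ z :* w) :* b := a :* b :+ z :* (w :* b)) refl

    Adjoin-closed : IsClosed (Adjoin P z)
    Adjoin-closed = record
      { isSubring = record
        { +-closed = Adjoin-+
        ; *-closed = Adjoin-*
        ; -‿closed = λ p → Adjoin-resp (-1*x≈-x _) (Adjoin-scale (-‿closed 1#-closed) p)
        ; 0#-closed = const 0#-closed
        ; 1#-closed = const 1#-closed
        }
      ; resp = Adjoin-resp
      }

    z∈Adjoin : Adjoin P z z
    z∈Adjoin = step 0#-closed (const 1#-closed) (sym (trans (+-identityˡ _) (*-identityʳ z)))

-- A subring which is maximal among those which contain g and do not contain f = g⁻¹.
module MaximalSubring (em : ExcludedMiddle 0ℓ) (K : FunctionField) (f : CommutativeRing.Carrier (fieldRing (FunctionField.F K)))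
    (transcendental : ¬ Polynomials.Algebraic (fieldRing (FunctionField.𝔽q K)) (fieldRing (FunctionField.F K)) (FunctionField.constants K) f) where
  open FunctionField K using (𝔽q; F; q; constants)
  open CommutativeRing (fieldRing F) hiding (zero)
  open RingProperties ring
  open Exponentiation semiring using (_^_)
  open Field em F
  open Growth em K using (fractions; fractions-exhaust)
  open Polynomials (fieldRing 𝔽q) (fieldRing F) constants
  open Adjunction (fieldRing F)
  open SetoidReasoning setoid
  open IntegerSolver (fieldRing F) using (solve; _:+_; _:*_; _:-_; :-_; _:=_; con)
  private
    module k = CommutativeRing (fieldRing 𝔽q)
    module φ = RingHomomorphism constants

    k-1≉0 : k.1# k.≉ k.0#
    k-1≉0 1≈0 = 1≉0 (trans (sym φ.1#-homo) (trans (φ.⟦⟧-cong 1≈0) φ.0#-homo))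

  abstract
    f≉0 : f ≉ 0#
    f≉0 f≈0 = transcendental (k.0# ∷ k.1# ∷ [] , there (here k-1≉0) , (begin
      φ.⟦ k.0# ⟧ + f * _   ≈⟨ +-cong φ.0#-homo (trans (*-congʳ f≈0) (zeroˡ _)) ⟩
      0# + 0#              ≈⟨ +-identityˡ 0# ⟩
      0#                   ∎))

    g-exists : ∃[ g ] g * f ≈ 1#
    g-exists = inverse f≉0

  g : Carrier
  g = proj₁ g-exists

  private
    Constant : Pred Carrier 0ℓ
    Constant a = ∃[ c ] φ.⟦ c ⟧ ≈ a

    constant-closed : IsClosed Constant
    constant-closed = record
      { isSubring = record
        { +-closed = λ (c , p) (d , q) → c k.+ d , trans (φ.+-homo c d) (+-cong p q)
        ; *-closed = λ (c , p) (d , q) → c k.* d , trans (φ.*-homo c d) (*-cong p q)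
        ; -‿closed = λ (c , p) → k.- c , trans (φ.-‿homo c) (-‿cong p)
        ; 0#-closed = k.0# , φ.0#-homo
        ; 1#-closed = k.1# , φ.1#-homo
        }
      ; resp = λ a≈b (c , p) → c , trans p a≈b
      }

    abstract
      eval-++ : ∀ p r → eval (p ++ r) f ≈ eval p f + f ^ length p * eval r f
      eval-++ [] r = sym (trans (+-identityˡ _) (*-identityˡ _))
      eval-++ (c ∷ p) r = trans (+-congˡ (*-congˡ (eval-++ p r))) (rearrange φ.⟦ c ⟧ f (eval p f) (f ^ length p) (eval r f))
        where
        rearrange : ∀ c f e n r → c + f * (e + n * r) ≈ (c + f * e) + (f * n) * r
        rearrange = solve 5 (λ c f e n r → c :+ f :* (e :+ n :* r) := (c :+ f :* e) :+ (f :* n) :* r) refl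

      eval-neg : ∀ p → eval (map k.-_ p) f ≈ - eval p f
      eval-neg [] = sym -0#≈0#
      eval-neg (c ∷ p) = trans (+-cong (φ.-‿homo c) (*-congˡ (eval-neg p))) (rearrange φ.⟦ c ⟧ f (eval p f))
        where
        rearrange : ∀ c f e → - c + f * - e ≈ - (c + f * e)
        rearrange = solve 3 (λ c f e → :- c :+ f :* (:- e) := :- (c :+ f :* e)) refl

      -- fⁿ w is a polynomial of degree at most n in f, for some n.
      reverse-polynomial : ∀ {w} → Adjoin Constant g w → ∃[ n ] ∃[ p ] length p ≡ suc n × f ^ n * w ≈ eval p f
      reverse-polynomial {w} (const (c , eq)) = 0 , c ∷ [] , ≡.refl , trans (*-identityˡ w) (sym (trans (+-congˡ (zeroʳ f)) (trans (+-identityʳ _) eq)))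
      reverse-polynomial {b} (step {a} {w} (c , φc≈a) r b≈) =
        let n , p , len , eq = reverse-polynomial r
        in suc n , p ++ c ∷ [] , ≡.trans (length-++ p) (≡.trans (≡.cong (ℕ._+ 1) len) (ℕ.+-comm (suc n) 1)) , (begin
          f ^ suc n * b                            ≈⟨ *-congˡ b≈ ⟩
          f ^ suc n * (a + g * w)                  ≈⟨ rearrange (f ^ n) f a g w ⟩
          (g * f) * (f ^ n * w) + f ^ suc n * a    ≈⟨ +-cong (trans (*-congʳ (proj₂ g-exists)) (trans (*-identityˡ _) eq)) (*-cong (reflexive (≡.cong (f ^_) (≡.sym len))) (sym (trans (+-congˡ (zeroʳ f)) (trans (+-identityʳ _) φc≈a)))) ⟩
          eval p f + f ^ length p * eval (c ∷ []) f  ≈⟨ sym (eval-++ p (c ∷ [])) ⟩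
          eval (p ++ c ∷ []) f                       ∎)
        where
        rearrange : ∀ n f a g w → (f * n) * (a + g * w) ≈ (g * f) * (n * w) + (f * n) * a
        rearrange = solve 5 (λ n f a g w → (f :* n) :* (a :+ g :* w) := (g :* f) :* (n :* w) :+ (f :* n) :* a) refl

      -- Otherwise fⁿ⁺¹ would be a polynomial of degree at most n in f, and f would be algebraic.
      f∉k[g] : ¬ Adjoin Constant g f
      f∉k[g] p =
        let n , r , len , eq = reverse-polynomial p
        in transcendental (map k.-_ r ++ k.1# ∷ [] , ++⁺ʳ (map k.-_ r) (here k-1≉0) , (begin
          eval (map k.-_ r ++ k.1# ∷ []) f                   ≈⟨ eval-++ (map k.-_ r) (k.1# ∷ []) ⟩
          eval (map k.-_ r) f + f ^ length (map k.-_ r) * eval (k.1# ∷ []) f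
            ≈⟨ +-cong (trans (eval-neg r) (-‿cong (sym eq))) (*-cong (reflexive (≡.cong (f ^_) (≡.trans (length-map k.-_ r) len))) (trans (+-congˡ (zeroʳ f)) (trans (+-identityʳ _) φ.1#-homo))) ⟩
          - (f ^ n * f) + (f * f ^ n) * 1#                   ≈⟨ cancel (f ^ n) f ⟩
          0#                                                 ∎))
        where
        cancel : ∀ a f → - (a * f) + (f * a) * 1# ≈ 0#
        cancel = solve 2 (λ a f → :- (a :* f) :+ (f :* a) :* con (1 , 0) := con (0 , 0)) refl

    record Admissible (P : Pred Carrier 0ℓ) : Set where
      field
        closed : IsClosed P
        f∉ : ¬ P f
        g∈ : P g

    grow : (P : Pred Carrier 0ℓ) (z : Carrier) → Dec (Adjoin P z f) → Pred Carrier 0ℓ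
    grow P z (yes _) = P
    grow P z (no _) = Adjoin P z

    process : List Carrier → Pred Carrier 0ℓ → Pred Carrier 0ℓ
    process [] P = P
    process (z ∷ zs) P = process zs (grow P z em)

    abstract
      grow-mono : ∀ P z d {a} → P a → grow P z d a
      grow-mono P z (yes _) p = p
      grow-mono P z (no _) p = const p

      grow-admissible : ∀ P z d → Admissible P → Admissible (grow P z d)
      grow-admissible P z (yes _) admissible = admissible
      grow-admissible P z (no f∉) admissible = record { closed = Adjoin-closed closed z ; f∉ = f∉ ; g∈ = const g∈ }
        where open Admissible admissible using (closed; g∈)

      grow-decides : ∀ P z d → Admissible P → grow P z d z ⊎ Adjoin (grow P z d) z f
      grow-decides P z (yes f∈) _ = inj₂ f∈
      grow-decides P z (no _) admissible = inj₁ (z∈Adjoin (Admissible.closed admissible) z)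

      process-mono : ∀ zs P {a} → P a → process zs P a
      process-mono [] P p = p
      process-mono (z ∷ zs) P p = process-mono zs (grow P z em) (grow-mono P z em p)

      process-admissible : ∀ zs P → Admissible P → Admissible (process zs P)
      process-admissible [] P admissible = admissible
      process-admissible (z ∷ zs) P admissible = process-admissible zs (grow P z em) (grow-admissible P z em admissible)

      process-decides : ∀ zs P {z} → Admissible P → z ∈ zs → process zs P z ⊎ Adjoin (process zs P) z f
      process-decides (z ∷ zs) P admissible (here ≡.refl) = Sum.map (process-mono zs (grow P z em)) (Adjoin-mono (process-mono zs (grow P z em))) (grow-decides P z em admissible)
      process-decides (w ∷ zs) P admissible (there z∈zs) = process-decides zs (grow P w em) (grow-admissible P w em admissible) z∈zs

    -- Each element of F is decided at some stage, where it is adjoined unless f would come with it;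
    -- enumeration thus replaces Zorn's lemma. A refusal is final, since f stays in P[z] when P
    -- grows.
    stage : ℕ → Pred Carrier 0ℓ
    stage zero = Adjoin Constant g
    stage (suc n) = process (tabulate (fractions n)) (stage n)

    abstract
      stage-admissible : ∀ n → Admissible (stage n)
      stage-admissible zero = record { closed = Adjoin-closed constant-closed g ; f∉ = f∉k[g] ; g∈ = z∈Adjoin constant-closed g }
      stage-admissible (suc n) = process-admissible (tabulate (fractions n)) (stage n) (stage-admissible n)

      stage-mono : ∀ {m n a} → m ≤ n → stage m a → stage n a
      stage-mono {m} {n} {a} m≤n p = ≡.subst (λ n → stage n a) (ℕ.m∸n+n≡m m≤n) (go (n ℕ.∸ m))
        where
        go : ∀ d → stage (d ℕ.+ m) a
        go zero = p
        go (suc d) = process-mono (tabulate (fractions (d ℕ.+ m))) (stage (d ℕ.+ m)) (go d)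

  O : Pred Carrier 0ℓ
  O a = ∃[ n ] stage n a

  abstract
    O-closed : IsClosed O
    O-closed = record
      { isSubring = record
        { +-closed = λ {a} {b} (m , p) (n , q) → m ℕ.⊔ n , IsClosed.+-closed (closed (m ℕ.⊔ n)) (stage-mono (ℕ.m≤m⊔n m n) p) (stage-mono (ℕ.m≤n⊔m m n) q)
        ; *-closed = λ {a} {b} (m , p) (n , q) → m ℕ.⊔ n , IsClosed.*-closed (closed (m ℕ.⊔ n)) (stage-mono (ℕ.m≤m⊔n m n) p) (stage-mono (ℕ.m≤n⊔m m n) q)
        ; -‿closed = λ {a} (n , p) → n , IsClosed.-‿closed (closed n) p
        ; 0#-closed = 0 , IsClosed.0#-closed (closed 0)
        ; 1#-closed = 0 , IsClosed.1#-closed (closed 0)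
        }
      ; resp = λ a≈b (n , p) → n , IsClosed.resp (closed n) a≈b p
      }
      where
      closed : ∀ n → IsClosed (stage n)
      closed n = Admissible.closed (stage-admissible n)

    f∉O : ¬ O f
    f∉O (n , p) = Admissible.f∉ (stage-admissible n) p

    g∈O : O g
    g∈O = 0 , Admissible.g∈ (stage-admissible 0)

    O-maximal : ∀ z → O z ⊎ Adjoin O z f
    O-maximal z =
      let N , k , z≈ = fractions-exhaust z
      in Sum.map (λ p → suc N , IsClosed.resp (Admissible.closed (stage-admissible (suc N))) (sym z≈) p)
           (λ p → change (sym z≈) (Adjoin-mono (λ q → suc N , q) p))
           (process-decides (tabulate (fractions N)) (stage N) (stage-admissible N) (∈-tabulate⁺ k))
      where
      change : ∀ {P z w a} → z ≈ w → Adjoin P z a → Adjoin P w a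
      change z≈w (const p) = const p
      change z≈w (step p r eq) = step p (change z≈w r) (trans eq (+-congˡ (*-congʳ z≈w)))

-- The discrete valuation of a maximal subring

module ValuationFromSubring (em : ExcludedMiddle 0ℓ) (K : FunctionField) (f : CommutativeRing.Carrier (fieldRing (FunctionField.F K)))
    (transcendental : ¬ Polynomials.Algebraic (fieldRing (FunctionField.𝔽q K)) (fieldRing (FunctionField.F K)) (FunctionField.constants K) f) where
  open FunctionField K using (F; q)
  open CommutativeRing (fieldRing F) hiding (zero)
  open RingProperties ring
  open Exponentiation semiring using (_^_; ^-homo-*)
  open Field em F
  open Growth em K using (digit-bound)
  open Adjunction (fieldRing F)
  open MaximalSubring em K f transcendental
  open IsClosed O-closed
  open SetoidReasoning setoid
  open IntegerSolver (fieldRing F) using (solve; _:+_; _:*_; _:-_; :-_; _:=_; con)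

  private
    gf≈1 : g * f ≈ 1#
    gf≈1 = proj₂ g-exists

    Unit M : Pred Carrier 0ℓ
    Unit z = O z × ∃[ y ] O y × y * z ≈ 1#
    M z = O z × ¬ (∃[ y ] O y × y * z ≈ 1#)

    -- Σ_{i≤n} O zⁱ
    Poly : Carrier → ℕ → Pred Carrier 0ℓ
    Poly z zero w = O w
    Poly z (suc n) w = ∃[ a ] ∃[ w′ ] O a × Poly z n w′ × w ≈ a + z * w′

    abstract
      Poly-resp : ∀ {z} n {a b} → a ≈ b → Poly z n a → Poly z n b
      Poly-resp zero a≈b p = resp a≈b p
      Poly-resp (suc n) a≈b (c , w , Oc , p , eq) = c , w , Oc , p , trans (sym a≈b) eq

      Poly-suc : ∀ {z} n {a} → Poly z n a → Poly z (suc n) a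
      Poly-suc {z} zero {a} p = a , 0# , p , 0#-closed , sym (trans (+-congˡ (zeroʳ z)) (+-identityʳ a))
      Poly-suc (suc n) (c , w , Oc , p , eq) = c , w , Oc , Poly-suc n p , eq

      Poly-+ : ∀ {z} n {a b} → Poly z n a → Poly z n b → Poly z n (a + b)
      Poly-+ zero p q = +-closed p q
      Poly-+ {z} (suc n) (c , w , Oc , p , eq) (d , w′ , Od , q , eq′) = c + d , w + w′ , +-closed Oc Od , Poly-+ n p q ,
        trans (+-cong eq eq′) (rearrange c z w d w′)
        where
        rearrange : ∀ a z w b w′ → (a + z * w) + (b + z * w′) ≈ (a + b) + z * (w + w′)
        rearrange = solve 5 (λ a z w b w′ → (a :+ z :* w) :+ (b :+ z :* w′) := (a :+ b) :+ z :* (w :+ w′)) refl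

      Poly-scale : ∀ {z} n {c a} → O c → Poly z n a → Poly z n (c * a)
      Poly-scale zero Oc p = *-closed Oc p
      Poly-scale {z} (suc n) {c} Oc (a , w , Oa , p , eq) = c * a , c * w , *-closed Oc Oa , Poly-scale n Oc p , trans (*-congˡ eq) (rearrange c a z w)
        where
        rearrange : ∀ c a z w → c * (a + z * w) ≈ c * a + z * (c * w)
        rearrange = solve 4 (λ c a z w → c :* (a :+ z :* w) := c :* a :+ z :* (c :* w)) refl

      Poly-z* : ∀ {z} n {a} → Poly z n a → Poly z (suc n) (z * a)
      Poly-z* n p = 0# , _ , 0#-closed , p , sym (+-identityˡ _)

      Adjoin⇒Poly : ∀ {z w} → Adjoin O z w → ∃[ n ] Poly z n w
      Adjoin⇒Poly (const p) = 0 , p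
      Adjoin⇒Poly (step p r eq) = let n , r′ = Adjoin⇒Poly r in suc n , _ , _ , p , r′ , eq

      monomial : ∀ {z} n {a} → O a → Poly z n (z ^ n * a)
      monomial zero p = resp (sym (*-identityˡ _)) p
      monomial {z} (suc n) {a} p = Poly-resp (suc n) (sym (*-assoc z (z ^ n) a)) (Poly-z* n (monomial n p))

      leading-term : ∀ {z} n {w} → Poly z (suc n) w → ∃[ w′ ] ∃[ a ] Poly z n w′ × O a × w ≈ w′ + a * z ^ suc n
      leading-term {z} zero (c , w , Oc , Ow , eq) = c , w , Oc , Ow , trans eq (+-congˡ (trans (*-comm z w) (*-congˡ (sym (*-identityʳ z)))))
      leading-term {z} (suc n) (c , w , Oc , p , eq) =
        let w′ , a , q , Oa , eq′ = leading-term n p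
        in c + z * w′ , a , (c , w′ , Oc , q , refl) , Oa , trans eq (trans (+-congˡ (*-congˡ eq′)) (rearrange c z w′ a (z ^ suc n)))
        where
        rearrange : ∀ c z w a zⁿ → c + z * (w + a * zⁿ) ≈ (c + z * w) + a * (z * zⁿ)
        rearrange = solve 5 (λ c z w a zⁿ → c :+ z :* (w :+ a :* zⁿ) := (c :+ z :* w) :+ a :* (z :* zⁿ)) refl

      flip-polynomial : ∀ {z y} → z * y ≈ 1# → ∀ k j {w} → k ≤ j → Poly y k w → Poly z j (z ^ j * w)
      flip-polynomial zy≈1 zero j _ p = monomial j p
      flip-polynomial {z} {y} zy≈1 (suc k) (suc j) {w} (s≤s k≤j) (b , w′ , Ob , p , eq) = Poly-resp (suc j)
        (begin
          z ^ suc j * b + z ^ j * w′              ≈⟨ +-congˡ (sym (trans (*-congʳ zy≈1) (*-identityˡ _))) ⟩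
          z ^ suc j * b + (z * y) * (z ^ j * w′)  ≈⟨ rearrange z y (z ^ j) b w′ ⟩
          z ^ suc j * (b + y * w′)                ≈⟨ *-congˡ (sym eq) ⟩
          z ^ suc j * w                           ∎)
        (Poly-+ (suc j) (monomial (suc j) Ob) (Poly-suc j (flip-polynomial zy≈1 k j k≤j p)))
        where
        rearrange : ∀ z y zʲ b w → (z * zʲ) * b + (z * y) * (zʲ * w) ≈ (z * zʲ) * (b + y * w)
        rearrange = solve 5 (λ z y zʲ b w → (z :* zʲ) :* b :+ (z :* y) :* (zʲ :* w) := (z :* zʲ) :* (b :+ y :* w)) refl

      1-gb-nonzero : ∀ {b} → O b → 1# - g * b ≉ 0#
      1-gb-nonzero {b} Ob eq = f∉O (resp (*-cancelˡ (inverse-nonzero gf≈1) (trans (sym (difference-zero eq)) (sym gf≈1))) Ob)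

      -- Inverting 1 - gb does not bring in f, so the inverse is already in O.
      1-gb-unit : ∀ {b} → O b → ∃[ w ] O w × w * (1# - g * b) ≈ 1#
      1-gb-unit {b} Ob =
        let w , eq = inverse (1-gb-nonzero Ob)
        in w , in-O w eq (O-maximal w) , eq
        where
        u : Carrier
        u = 1# - g * b
        Ou : O u
        Ou = +-closed 1#-closed (-‿closed (*-closed g∈O Ob))
        u^ : ∀ n → O (u ^ n)
        u^ zero = 1#-closed
        u^ (suc n) = *-closed Ou (u^ n)
        clear : ∀ {w a} → w * u ≈ 1# → Adjoin O w a → ∃[ n ] O (u ^ n * a)
        clear {w} {a} wu≈1 (const p) = 0 , resp (sym (*-identityˡ a)) p
        clear {w} {a} wu≈1 (step {b} {c} p r eq) =
          let n , q = clear wu≈1 r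
          in suc n , resp (begin
            u ^ suc n * b + u ^ n * c              ≈⟨ +-congˡ (sym (trans (*-congʳ wu≈1) (*-identityˡ _))) ⟩
            u ^ suc n * b + (w * u) * (u ^ n * c)  ≈⟨ rearrange u (u ^ n) b w c ⟩
            u ^ suc n * (b + w * c)                ≈⟨ *-congˡ (sym eq) ⟩
            u ^ suc n * a                          ∎) (+-closed (*-closed (u^ (suc n)) p) q)
          where
          rearrange : ∀ u n b w c → (u * n) * b + (w * u) * (n * c) ≈ (u * n) * (b + w * c)
          rearrange = solve 5 (λ u n b w c → (u :* n) :* b :+ (w :* u) :* (n :* c) := (u :* n) :* (b :+ w :* c)) refl
        -- Since u f = f - b, a power of u in front of f can be lowered without leaving O.
        descend : ∀ n → ¬ O (u ^ n * f)
        descend zero p = f∉O (resp (*-identityˡ f) p)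
        descend (suc n) p = descend n (resp (begin
          u ^ suc n * f + b * u ^ n                ≈⟨ +-congˡ (sym (trans (*-congʳ gf≈1) (*-identityˡ _))) ⟩
          u ^ suc n * f + (g * f) * (b * u ^ n)    ≈⟨ rearrange g b f (u ^ n) ⟩
          u ^ n * f                                ∎) (+-closed p (*-closed Ob (u^ n))))
          where
          rearrange : ∀ g b f n → ((1# - g * b) * n) * f + (g * f) * (b * n) ≈ n * f
          rearrange = solve 4 (λ g b f n → ((con (1 , 0) :- g :* b) :* n) :* f :+ (g :* f) :* (b :* n) := n :* f) refl
        in-O : ∀ w → w * u ≈ 1# → O w ⊎ Adjoin O w f → O w
        in-O w wu≈1 (inj₁ Ow) = Ow
        in-O w wu≈1 (inj₂ r) = let n , p = clear wu≈1 r in ⊥-elim (descend n p)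

      -- From f = b + y B follows g y B = 1 - g b, a unit of O. Multiplied by zⁿ⁺¹, this shows that
      -- zⁿ⁺¹ is a unit times g zⁿ B, a polynomial of degree at most n in z. Substituting it for the
      -- leading power of z lowers the degree of f.
      reduce : ∀ {z y} → z * y ≈ 1# → ∀ n m → m ≤ n → Poly z (suc n) f → Poly y (suc m) f → Poly z n f
      reduce {z} {y} zy≈1 n m m≤n p (b , B , Ob , q , f≈) =
        let w , Ow , wu≈1 = 1-gb-unit Ob
            A , a , r , Oa , f≈′ = leading-term n p
        in Poly-resp n (begin
          A + a * (w * (g * (z ^ n * B)))     ≈⟨ +-congˡ (*-congˡ (sym (power w wu≈1))) ⟩
          A + a * z ^ suc n                   ≈⟨ sym f≈′ ⟩
          f                                   ∎)
          (Poly-+ n r (Poly-scale n Oa (Poly-scale n Ow (Poly-scale n g∈O (flip-polynomial zy≈1 m n m≤n q)))))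
        where
        gyB≈u : g * (y * B) ≈ 1# - g * b
        gyB≈u = begin
          g * (y * B)                    ≈⟨ rearrange g b (y * B) ⟩
          g * (b + y * B) - g * b        ≈⟨ +-congʳ (trans (*-congˡ (sym f≈)) gf≈1) ⟩
          1# - g * b                     ∎
          where
          rearrange : ∀ g b c → g * c ≈ g * (b + c) - g * b
          rearrange = solve 3 (λ g b c → g :* c := g :* (b :+ c) :- g :* b) refl
        power : ∀ w → w * (1# - g * b) ≈ 1# → z ^ suc n ≈ w * (g * (z ^ n * B))
        power w wu≈1 = begin
          z ^ suc n                                 ≈⟨ sym (*-identityʳ _) ⟩
          z ^ suc n * 1#                            ≈⟨ *-congˡ (sym wu≈1) ⟩
          z ^ suc n * (w * (1# - g * b))            ≈⟨ *-congˡ (*-congˡ (sym gyB≈u)) ⟩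
          z ^ suc n * (w * (g * (y * B)))           ≈⟨ rearrange z (z ^ n) w g y B ⟩
          (z * y) * (w * (g * (z ^ n * B)))         ≈⟨ trans (*-congʳ zy≈1) (*-identityˡ _) ⟩
          w * (g * (z ^ n * B))                     ∎
          where
          rearrange : ∀ z zⁿ w g y B → (z * zⁿ) * (w * (g * (y * B))) ≈ (z * y) * (w * (g * (zⁿ * B)))
          rearrange = solve 6 (λ z zⁿ w g y B → (z :* zⁿ) :* (w :* (g :* (y :* B))) := (z :* y) :* (w :* (g :* (zⁿ :* B)))) refl

      -- Of two expressions of f, one in z and one in z⁻¹, the one whose degree is not the smaller
      -- can be shortened, until one of them puts f into O.
      f-not-in-both : ∀ fuel n m {z y} → n ℕ.+ m ≤ fuel → z * y ≈ 1# → Poly z n f → Poly y m f → ⊥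
      f-not-in-both fuel zero m _ _ p _ = f∉O p
      f-not-in-both fuel (suc n) zero _ _ _ q = f∉O q
      f-not-in-both (suc fuel) (suc n) (suc m) {z} {y} (s≤s le) zy≈1 p q = case (ℕ.≤-total m n)
        where
        case : m ≤ n ⊎ n ≤ m → ⊥
        case (inj₁ m≤n) = f-not-in-both fuel n (suc m) le zy≈1 (reduce zy≈1 n m m≤n p q) q
        case (inj₂ n≤m) = f-not-in-both fuel (suc n) m (ℕ.≤-trans (ℕ.≤-reflexive (≡.sym (ℕ.+-suc n m))) le) zy≈1 p (reduce (trans (*-comm y z) zy≈1) m n n≤m q p)

      dichotomy : ∀ {z y} → y * z ≈ 1# → O z ⊎ O y
      dichotomy {z} {y} yz≈1 = case (O-maximal z) (O-maximal y)
        where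
        case : O z ⊎ Adjoin O z f → O y ⊎ Adjoin O y f → O z ⊎ O y
        case (inj₁ Oz) _ = inj₁ Oz
        case (inj₂ _) (inj₁ Oy) = inj₂ Oy
        case (inj₂ p) (inj₂ q) =
          let n , p′ = Adjoin⇒Poly p
              m , q′ = Adjoin⇒Poly q
          in ⊥-elim (f-not-in-both (n ℕ.+ m) n m ℕ.≤-refl (trans (*-comm z y) yz≈1) p′ q′)

      divides : ∀ a b → (∃[ c ] O c × a ≈ b * c) ⊎ (∃[ c ] O c × b ≈ a * c)
      divides a b = case em em
        where
        case : Dec (a ≈ 0#) → Dec (b ≈ 0#) → (∃[ c ] O c × a ≈ b * c) ⊎ (∃[ c ] O c × b ≈ a * c)
        case (yes a≈0) _ = inj₁ (0# , 0#-closed , trans a≈0 (sym (zeroʳ b)))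
        case (no a≉0) (yes b≈0) = inj₂ (0# , 0#-closed , trans b≈0 (sym (zeroʳ a)))
        case (no a≉0) (no b≉0) =
          let a⁻¹ , p = inverse a≉0
              b⁻¹ , q = inverse b≉0
          in Sum.map (λ O₁ → a * b⁻¹ , O₁ , undo a b b⁻¹ q) (λ O₂ → b * a⁻¹ , O₂ , undo b a a⁻¹ p)
               (dichotomy (trans (interchange b a⁻¹ a b⁻¹) (trans (*-cong (trans (*-comm b b⁻¹) q) p) (*-identityˡ 1#))))
          where
          undo : ∀ a b c → c * b ≈ 1# → a ≈ b * (a * c)
          undo a b c cb≈1 = trans (sym (*-identityʳ a)) (trans (*-congˡ (sym cb≈1)) (rearrange a b c))
            where
            rearrange : ∀ a b c → a * (c * b) ≈ b * (a * c)
            rearrange = solve 3 (λ a b c → a :* (c :* b) := b :* (a :* c)) refl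
          interchange : ∀ a b c d → (a * b) * (c * d) ≈ (a * d) * (b * c)
          interchange = solve 4 (λ a b c d → (a :* b) :* (c :* d) := (a :* d) :* (b :* c)) refl

      M-* : ∀ {a b} → O b → M a → M (a * b)
      M-* {a} {b} Ob (Oa , nonunit) = *-closed Oa Ob , λ (y , Oy , eq) → nonunit (y * b , *-closed Oy Ob , trans (rearrange y b a) eq)
        where
        rearrange : ∀ y b a → (y * b) * a ≈ y * (a * b)
        rearrange = solve 3 (λ y b a → (y :* b) :* a := y :* (a :* b)) refl

      -- In a valuation ring one of a and 1 - a divides the other. If a divided 1 - a, it would
      -- divide 1; so 1 - a divides a and hence 1.
      1-M-unit : ∀ {a} → M a → ∃[ y ] O y × y * (1# - a) ≈ 1#
      1-M-unit {a} (Oa , nonunit) = case (divides a (1# - a))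
        where
        case : (∃[ c ] O c × a ≈ (1# - a) * c) ⊎ (∃[ c ] O c × 1# - a ≈ a * c) → ∃[ y ] O y × y * (1# - a) ≈ 1#
        case (inj₁ (c , Oc , eq)) = 1# + c , +-closed 1#-closed Oc , trans (expand a c) (trans (+-congˡ (sym eq)) (collapse a))
          where
          expand : ∀ a c → (1# + c) * (1# - a) ≈ (1# - a) + (1# - a) * c
          expand = solve 2 (λ a c → (con (1 , 0) :+ c) :* (con (1 , 0) :- a) := (con (1 , 0) :- a) :+ (con (1 , 0) :- a) :* c) refl
          collapse : ∀ a → (1# - a) + a ≈ 1#
          collapse = solve 1 (λ a → (con (1 , 0) :- a) :+ a := con (1 , 0)) refl
        case (inj₂ (c , Oc , eq)) = ⊥-elim (nonunit (1# + c , +-closed 1#-closed Oc , trans (expand a c) (trans (+-congˡ (sym eq)) (collapse a))))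
          where
          expand : ∀ a c → (1# + c) * a ≈ a + a * c
          expand = solve 2 (λ a c → (con (1 , 0) :+ c) :* a := a :+ a :* c) refl
          collapse : ∀ a → a + (1# - a) ≈ 1#
          collapse = solve 1 (λ a → a :+ (con (1 , 0) :- a) := con (1 , 0)) refl

      g∈M : M g
      g∈M = g∈O , λ (y , Oy , yg≈1) → f∉O (resp (*-cancelˡ (inverse-nonzero gf≈1) (trans (*-comm g y) (trans yg≈1 (sym gf≈1)))) Oy)

      M-nonzero-cancel : ∀ {u c o} → u ≉ 0# → M c → O o → u ≈ u * c * o → ⊥
      M-nonzero-cancel {u} {c} {o} u≉0 (_ , nonunit) Oo eq = nonunit (o , Oo , trans (*-comm o c) (sym (*-cancelˡ u≉0 (trans (*-identityʳ u) (trans eq (*-assoc u c o))))))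

      bounded : ∀ {u} → O u → u ≉ 0# → ∀ {m} (β : Fin m → Carrier) → (∀ i → O (β i)) →
        (∀ i j → i Fin.< j → ¬ CongruentModulo isSubring u (β i) (β j)) → m ≤ proj₁ (digit-bound u)
      bounded {u} Ou u≉0 {m} β Oβ distinct = proj₂ (digit-bound u) m β (horner-separated isSubring Ou u≉0 Oβ separated)
        where
        separated : IsSeparated (CongruentModulo isSubring u) β
        separated i j eq = case (Fin.<-cmp i j)
          where
          case : Tri (i Fin.< j) (i ≡ j) (j Fin.< i) → i ≡ j
          case (tri< i<j _ _) = ⊥-elim (distinct i j i<j eq)
          case (tri≈ _ i≡j _) = i≡j
          case (tri> _ _ j<i) = ⊥-elim (distinct j i j<i (congruent-sym isSubring eq))

    NonzeroM : Set
    NonzeroM = ∃[ a ] M a × a ≉ 0#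

    Multiple : Carrier → Carrier → Set
    Multiple u z = ∃[ o ] O o × z ≈ u * o

    -- Let u₀ = g, u₁, u₂, ... be such that each is a proper divisor of its predecessor. They are
    -- pairwise incongruent modulo g: for m < j the difference uₘ - uⱼ is uⱼ times a unit, while
    -- every multiple of g is uⱼ times a nonunit. By `digit-bound` such a sequence cannot be
    -- infinite.
    module NoUniformiser (next : ∀ ((u , _) : NonzeroM) → ∃[ z ] M z × ¬ Multiple u z) where

      chain : ℕ → NonzeroM
      chain zero = g , g∈M , inverse-nonzero gf≈1
      chain (suc n) = proj₁ (next (chain n)) , proj₁ (proj₂ (next (chain n))) ,
        λ z≈0 → proj₂ (proj₂ (next (chain n))) (0# , 0#-closed , trans z≈0 (sym (zeroʳ _)))

      u : ℕ → Carrier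
      u n = proj₁ (chain n)

      abstract
        descends-once : ∀ n → ∃[ c ] M c × u n ≈ u (suc n) * c
        descends-once n = case (divides (u (suc n)) (u n))
          where
          case : (∃[ c ] O c × u (suc n) ≈ u n * c) ⊎ (∃[ c ] O c × u n ≈ u (suc n) * c) → ∃[ c ] M c × u n ≈ u (suc n) * c
          case (inj₁ multiple) = ⊥-elim (proj₂ (proj₂ (next (chain n))) multiple)
          case (inj₂ (c , Oc , eq)) = c , (Oc , λ (y , Oy , yc≈1) → proj₂ (proj₂ (next (chain n))) (y , Oy , (begin
            u (suc n)              ≈⟨ sym (*-identityʳ _) ⟩
            u (suc n) * 1#         ≈⟨ *-congˡ (sym yc≈1) ⟩
            u (suc n) * (y * c)    ≈⟨ rearrange (u (suc n)) y c ⟩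
            u (suc n) * c * y      ≈⟨ *-congʳ (sym eq) ⟩
            u n * y                ∎))) , eq
            where
            rearrange : ∀ a y c → a * (y * c) ≈ a * c * y
            rearrange = solve 3 (λ a y c → a :* (y :* c) := a :* c :* y) refl

        descends : ∀ m d → ∃[ c ] M c × u m ≈ u (suc d ℕ.+ m) * c
        descends m zero = descends-once m
        descends m (suc d) =
          let c , Mc , eq = descends m d
              c′ , Mc′ , eq′ = descends-once (suc d ℕ.+ m)
          in c′ * c , M-* (proj₁ Mc) Mc′ , trans eq (trans (*-congʳ eq′) (*-assoc _ c′ c))

        distinct : ∀ m d → ¬ CongruentModulo isSubring (u 0) (u m) (u (suc d ℕ.+ m))
        distinct m d (o , Oo , eq) =
          let c , Mc , um≈ = descends m d
              y , Oy , y[1-c]≈1 = 1-M-unit Mc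
              c₀ , Mc₀ , u₀≈ = descends 0 (d ℕ.+ m)
          in M-nonzero-cancel {u j} {c₀} { - (o * y)} (proj₂ (proj₂ (chain j))) Mc₀ (-‿closed (*-closed Oo Oy)) (begin
            u j                                 ≈⟨ sym (*-identityʳ (u j)) ⟩
            u j * 1#                            ≈⟨ *-congˡ (sym y[1-c]≈1) ⟩
            u j * (y * (1# - c))                ≈⟨ rearrange (u j) y c ⟩
            - ((u j * c - u j) * y)             ≈⟨ -‿cong (*-congʳ (trans (+-congʳ (sym um≈)) eq)) ⟩
            - ((u 0 * o) * y)                   ≈⟨ -‿cong (*-congʳ (*-congʳ (trans u₀≈ (*-congʳ (reflexive (≡.cong (λ n → u (suc n)) (ℕ.+-identityʳ (d ℕ.+ m)))))))) ⟩
            - ((u j * c₀ * o) * y)              ≈⟨ collect (u j) c₀ o y ⟩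
            u j * c₀ * - (o * y)                ∎)
          where
          j : ℕ
          j = suc d ℕ.+ m
          rearrange : ∀ u y c → u * (y * (1# - c)) ≈ - ((u * c - u) * y)
          rearrange = solve 3 (λ u y c → u :* (y :* (con (1 , 0) :- c)) := :- ((u :* c :- u) :* y)) refl
          collect : ∀ u c o y → - ((u * c * o) * y) ≈ u * c * - (o * y)
          collect = solve 4 (λ u c o y → :- ((u :* c :* o) :* y) := u :* c :* (:- (o :* y))) refl

        impossible : ⊥
        impossible = ℕ.<-irrefl ≡.refl (bounded g∈O (inverse-nonzero gf≈1) {suc (proj₁ (digit-bound g))} (λ i → u (Fin.toℕ i)) (λ i → proj₁ (proj₁ (proj₂ (chain (Fin.toℕ i)))))
          (λ i j i<j eq → distinct (Fin.toℕ i) (Fin.toℕ j ℕ.∸ suc (Fin.toℕ i)) (≡.subst (λ n → CongruentModulo isSubring g (u (Fin.toℕ i)) (u n))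
            (≡.sym (≡.trans (≡.sym (ℕ.+-suc _ (Fin.toℕ i))) (ℕ.m∸n+n≡m i<j))) eq)))

    abstract
      uniformiser-exists : ∃[ π ] M π × π ≉ 0# × (∀ z → M z → Multiple π z)
      uniformiser-exists = case em
        where
        case : Dec (∃[ π ] M π × π ≉ 0# × (∀ z → M z → Multiple π z)) → ∃[ π ] M π × π ≉ 0# × (∀ z → M z → Multiple π z)
        case (yes found) = found
        case (no none) = ⊥-elim (NoUniformiser.impossible (λ u → next u em))
          where
          next : ∀ ((u , _) : NonzeroM) → Dec (∃[ z ] M z × ¬ Multiple u z) → ∃[ z ] M z × ¬ Multiple u z
          next u (yes found) = found
          next (u , Mu , u≉0) (no all) = ⊥-elim (none (u , Mu , u≉0 , λ z Mz → case′ z Mz em))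
            where
            case′ : ∀ z → M z → Dec (Multiple u z) → Multiple u z
            case′ z Mz (yes multiple) = multiple
            case′ z Mz (no ¬multiple) = ⊥-elim (all (z , Mz , ¬multiple))

    π : Carrier
    π = proj₁ uniformiser-exists

    abstract
      π∈M : M π
      π∈M = proj₁ (proj₂ uniformiser-exists)

      π≉0 : π ≉ 0#
      π≉0 = proj₁ (proj₂ (proj₂ uniformiser-exists))

      π-divides : ∀ z → M z → Multiple π z
      π-divides = proj₂ (proj₂ (proj₂ uniformiser-exists))

      π^∈O : ∀ n → O (π ^ n)
      π^∈O zero = 1#-closed
      π^∈O (suc n) = *-closed (proj₁ π∈M) (π^∈O n)

      π^suc∈M : ∀ n → M (π ^ suc n)
      π^suc∈M n = M-* (π^∈O n) π∈M

      -- A nonzero z in O is not divisible by all powers of π: these would be distinct modulo z.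
      O-order : ∀ {z} → O z → z ≉ 0# → ∃[ k ] ∃[ w ] Unit w × z ≈ w * π ^ k
      O-order {z} Oz z≉0 = case em
        where
        case : Dec (∃[ k ] ∃[ w ] Unit w × z ≈ w * π ^ k) → ∃[ k ] ∃[ w ] Unit w × z ≈ w * π ^ k
        case (yes found) = found
        case (no none) = ⊥-elim (ℕ.<-irrefl ≡.refl (bounded Oz z≉0 {suc (proj₁ (digit-bound z))} (λ i → π ^ Fin.toℕ i) (λ i → π^∈O (Fin.toℕ i))
          (λ i j i<j eq → distinct (Fin.toℕ i) (Fin.toℕ j ℕ.∸ suc (Fin.toℕ i)) (≡.subst (λ n → CongruentModulo isSubring z (π ^ Fin.toℕ i) (π ^ n))
            (≡.sym (≡.trans (≡.sym (ℕ.+-suc _ (Fin.toℕ i))) (ℕ.m∸n+n≡m i<j))) eq))))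
          where
          divisible : ∀ k → Multiple (π ^ k) z
          divisible zero = z , Oz , sym (*-identityˡ z)
          divisible (suc k) = let o , Oo , eq = divisible k in next o Oo eq em
            where
            next : ∀ o → O o → z ≈ π ^ k * o → Dec (∃[ y ] O y × y * o ≈ 1#) → Multiple (π ^ suc k) z
            next o Oo eq (yes unit) = ⊥-elim (none (k , o , (Oo , unit) , trans eq (*-comm _ o)))
            next o Oo eq (no nonunit) = let o′ , Oo′ , o≈ = π-divides o (Oo , nonunit)
              in o′ , Oo′ , trans eq (trans (*-congˡ o≈) (rearrange (π ^ k) π o′))
              where
              rearrange : ∀ p π o → p * (π * o) ≈ (π * p) * o
              rearrange = solve 3 (λ p π o → p :* (π :* o) := (π :* p) :* o) refl
          distinct : ∀ i d → ¬ CongruentModulo isSubring z (π ^ i) (π ^ (suc d ℕ.+ i))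
          distinct i d (o , Oo , eq) =
            let y , Oy , y[1-πᵈ]≈1 = 1-M-unit (π^suc∈M d)
                o′ , Oo′ , z≈ = divisible (suc i)
            in M-nonzero-cancel {π ^ i} {π} {o′ * o * y} (^-nonzero i π≉0) π∈M (*-closed (*-closed Oo′ Oo) Oy) (begin
              π ^ i                                         ≈⟨ sym (*-identityʳ _) ⟩
              π ^ i * 1#                                    ≈⟨ *-congˡ (sym y[1-πᵈ]≈1) ⟩
              π ^ i * (y * (1# - π ^ suc d))                ≈⟨ expand (π ^ i) y (π ^ suc d) ⟩
              (π ^ i - π ^ suc d * π ^ i) * y               ≈⟨ *-congʳ (+-congˡ (-‿cong (sym (^-homo-* π (suc d) i)))) ⟩
              (π ^ i - π ^ (suc d ℕ.+ i)) * y               ≈⟨ *-congʳ (trans eq (*-congʳ z≈)) ⟩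
              ((π * π ^ i) * o′ * o) * y                    ≈⟨ collect (π ^ i) π o′ o y ⟩
              π ^ i * π * (o′ * o * y)                      ∎)
            where
            expand : ∀ p y q → p * (y * (1# - q)) ≈ (p - q * p) * y
            expand = solve 3 (λ p y q → p :* (y :* (con (1 , 0) :- q)) := (p :- q :* p) :* y) refl
            collect : ∀ p π o′ o y → ((π * p) * o′ * o) * y ≈ p * π * (o′ * o * y)
            collect = solve 5 (λ p π o′ o y → ((π :* p) :* o′ :* o) :* y := p :* π :* (o′ :* o :* y)) refl

    -- z = w π^m for a unit w, with the sign of m removed by clearing a power of π.
    record Val (z : Carrier) (m : ℤ) : Set where
      constructor val
      field
        a b : ℕ
        m≡a-b : m ≡ + a ℤ.- + b
        w : Carrier
        unit : Unit w
        zπᵇ≈wπᵃ : z * π ^ b ≈ w * π ^ a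

    -- Membership of z in πⁿ O, which makes sense for z = 0 as well; the ultrametric inequality
    -- becomes closure of O under addition.
    record AtLeast (n : ℤ) (z : Carrier) : Set where
      constructor at-least
      field
        c d : ℕ
        n≡c-d : n ≡ + c ℤ.- + d
        o : Carrier
        Oo : O o
        zπᵈ≈oπᶜ : z * π ^ d ≈ o * π ^ c

    abstract
      Val-exists : ∀ {z} → z ≉ 0# → ∃[ m ] Val z m
      Val-exists {z} z≉0 = let y , yz≈1 = inverse z≉0 in case y yz≈1 (dichotomy yz≈1)
        where
        case : ∀ y → y * z ≈ 1# → O z ⊎ O y → ∃[ m ] Val z m
        case y yz≈1 (inj₁ Oz) = let k , w , Uw , eq = O-order Oz z≉0 in + k , val k 0 (≡.sym (ℤ.+-identityʳ (+ k))) w Uw (trans (*-identityʳ z) eq)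
        case y yz≈1 (inj₂ Oy) =
          let k , w , (Ow , w⁻¹ , Ow⁻¹ , w⁻¹w≈1) , eq = O-order Oy (inverse-nonzero yz≈1)
          in ℤ.- + k , val 0 k (≡.sym (ℤ.+-identityˡ (ℤ.- + k))) w⁻¹ (Ow⁻¹ , w , Ow , trans (*-comm w w⁻¹) w⁻¹w≈1) (begin
            z * π ^ k                   ≈⟨ sym (*-identityˡ _) ⟩
            1# * (z * π ^ k)            ≈⟨ *-congʳ (sym w⁻¹w≈1) ⟩
            w⁻¹ * w * (z * π ^ k)       ≈⟨ rearrange w⁻¹ w z (π ^ k) ⟩
            w⁻¹ * ((w * π ^ k) * z)     ≈⟨ *-congˡ (trans (*-congʳ (sym eq)) yz≈1) ⟩
            w⁻¹ * 1#                    ∎)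
          where
          rearrange : ∀ v w z p → v * w * (z * p) ≈ v * ((w * p) * z)
          rearrange = solve 4 (λ v w z p → v :* w :* (z :* p) := v :* ((w :* p) :* z)) refl

      unit-power : ∀ {w o m n} → Unit w → O o → w * π ^ m ≈ o * π ^ n → n ≤ m
      unit-power {w} {o} {m} {n} (Ow , w⁻¹ , Ow⁻¹ , w⁻¹w≈1) Oo eq = ℕ.≮⇒≥ (λ m<n → impossible (n ℕ.∸ suc m)
        (*-cancelˡ (^-nonzero m π≉0) (trans (*-comm _ w) (trans eq (trans (*-congˡ (trans (reflexive (≡.cong (π ^_) (≡.sym (≡.trans (≡.sym (ℕ.+-suc (n ℕ.∸ suc m) m)) (ℕ.m∸n+n≡m m<n))))) (^-homo-* π (suc (n ℕ.∸ suc m)) m))) (rearrange o (π ^ suc (n ℕ.∸ suc m)) (π ^ m)))))))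
        where
        rearrange : ∀ o p q → o * (p * q) ≈ q * (o * p)
        rearrange = solve 3 (λ o p q → o :* (p :* q) := q :* (o :* p)) refl
        impossible : ∀ d → w ≈ o * π ^ suc d → ⊥
        impossible d w≈ = proj₂ (π^suc∈M d) (w⁻¹ * o , *-closed Ow⁻¹ Oo , trans (*-assoc w⁻¹ o _) (trans (*-congˡ (sym w≈)) w⁻¹w≈1))

      AtLeast-≤ : ∀ {z m n} → Val z m → AtLeast n z → n ℤ.≤ m
      AtLeast-≤ {z} {m} {n} (val a b m≡ w Uw eq) (at-least c d n≡ o Oo eq′) = ≡.subst₂ ℤ._≤_ (≡.sym n≡) (≡.sym m≡)
        (≤-by₁ (+ c ℤ.- + d) (+ a ℤ.- + b) (+≤+ (unit-power {w} {o} {d ℕ.+ a} {b ℕ.+ c} Uw Oo (begin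
          w * π ^ (d ℕ.+ a)          ≈⟨ *-congˡ (^-homo-* π d a) ⟩
          w * (π ^ d * π ^ a)        ≈⟨ rearrange w (π ^ d) (π ^ a) ⟩
          (w * π ^ a) * π ^ d        ≈⟨ *-congʳ (sym eq) ⟩
          (z * π ^ b) * π ^ d        ≈⟨ swap z (π ^ b) (π ^ d) ⟩
          (z * π ^ d) * π ^ b        ≈⟨ *-congʳ eq′ ⟩
          (o * π ^ c) * π ^ b        ≈⟨ sym (rearrange o (π ^ b) (π ^ c)) ⟩
          o * (π ^ b * π ^ c)        ≈⟨ *-congˡ (sym (^-homo-* π b c)) ⟩
          o * π ^ (b ℕ.+ c)          ∎)))
          (≡.trans (≡.cong₂ ℤ._-_ (ℤ.pos-+ d a) (ℤ.pos-+ b c)) (shift (+ a) (+ b) (+ c) (+ d))))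
        where
        rearrange : ∀ w p q → w * (p * q) ≈ (w * q) * p
        rearrange = solve 3 (λ w p q → w :* (p :* q) := (w :* q) :* p) refl
        swap : ∀ w p q → (w * p) * q ≈ (w * q) * p
        swap = solve 3 (λ w p q → (w :* p) :* q := (w :* q) :* p) refl
        shift : ∀ a b c d → (d ℤ.+ a) ℤ.- (b ℤ.+ c) ≡ (a ℤ.- b) ℤ.- (c ℤ.- d)
        shift = ℤ.solve-∀

      ≤-AtLeast : ∀ {z m} n → Val z m → n ℤ.≤ m → AtLeast n z
      ≤-AtLeast {z} {m} n (val a b m≡ w (Ow , _) eq) n≤m = at-least a (e ℕ.+ b)
        (≡.trans (≡.trans (shift n m) (≡.cong₂ ℤ._-_ m≡ (≡.sym (ℤ.0≤i⇒+∣i∣≡i (ℤ.i≤j⇒0≤j-i n≤m)))))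
          (≡.trans (regroup (+ a) (+ b) (+ e)) (≡.cong (λ n → + a ℤ.- n) (≡.sym (ℤ.pos-+ e b)))))
        (w * π ^ e) (*-closed Ow (π^∈O e)) (begin
          z * π ^ (e ℕ.+ b)        ≈⟨ *-congˡ (^-homo-* π e b) ⟩
          z * (π ^ e * π ^ b)      ≈⟨ rearrange z (π ^ e) (π ^ b) ⟩
          (z * π ^ b) * π ^ e      ≈⟨ *-congʳ eq ⟩
          (w * π ^ a) * π ^ e      ≈⟨ swap w (π ^ a) (π ^ e) ⟩
          (w * π ^ e) * π ^ a      ∎)
        where
        e : ℕ
        e = ℤ.∣ m ℤ.- n ∣
        shift : ∀ n m → n ≡ m ℤ.- (m ℤ.- n)
        shift = ℤ.solve-∀
        regroup : ∀ a b e → (a ℤ.- b) ℤ.- e ≡ a ℤ.- (e ℤ.+ b)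
        regroup = ℤ.solve-∀
        rearrange : ∀ w p q → w * (p * q) ≈ (w * q) * p
        rearrange = solve 3 (λ w p q → w :* (p :* q) := (w :* q) :* p) refl
        swap : ∀ w p q → (w * p) * q ≈ (w * q) * p
        swap = solve 3 (λ w p q → (w :* p) :* q := (w :* q) :* p) refl

      AtLeast-0 : ∀ {z} n → z ≈ 0# → AtLeast n z
      AtLeast-0 {z} (+ k) z≈0 = at-least k 0 (≡.sym (ℤ.+-identityʳ (+ k))) 0# 0#-closed (trans (trans (*-congʳ z≈0) (zeroˡ _)) (sym (zeroˡ _)))
      AtLeast-0 {z} -[1+ k ] z≈0 = at-least 0 (suc k) ≡.refl 0# 0#-closed (trans (trans (*-congʳ z≈0) (zeroˡ _)) (sym (zeroˡ _)))

      AtLeast-+ : ∀ {n y z} → AtLeast n y → AtLeast n z → AtLeast n (y + z)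
      AtLeast-+ {n} {y} {z} (at-least c d n≡ o Oo eq) (at-least c′ d′ n≡′ o′ Oo′ eq′) = at-least (c ℕ.+ d′) (d ℕ.+ d′)
        (≡.trans n≡ (≡.trans (shift (+ c) (+ d) (+ d′)) (≡.cong₂ ℤ._-_ (≡.sym (ℤ.pos-+ c d′)) (≡.sym (ℤ.pos-+ d d′)))))
        (o + o′) (+-closed Oo Oo′) (begin
          (y + z) * π ^ (d ℕ.+ d′)                    ≈⟨ *-congˡ (^-homo-* π d d′) ⟩
          (y + z) * (π ^ d * π ^ d′)                  ≈⟨ expand y z (π ^ d) (π ^ d′) ⟩
          (y * π ^ d) * π ^ d′ + (z * π ^ d′) * π ^ d ≈⟨ +-cong (*-congʳ eq) (*-congʳ eq′) ⟩
          (o * π ^ c) * π ^ d′ + (o′ * π ^ c′) * π ^ d ≈⟨ +-cong (*-assoc o _ _) (*-assoc o′ _ _) ⟩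
          o * (π ^ c * π ^ d′) + o′ * (π ^ c′ * π ^ d) ≈⟨ +-cong (*-congˡ (sym (^-homo-* π c d′))) (*-congˡ (trans (sym (^-homo-* π c′ d)) (reflexive (≡.cong (π ^_) c′+d≡c+d′)))) ⟩
          o * π ^ (c ℕ.+ d′) + o′ * π ^ (c ℕ.+ d′)    ≈⟨ sym (distribʳ _ o o′) ⟩
          (o + o′) * π ^ (c ℕ.+ d′)                   ∎)
        where
        shift : ∀ c d e → c ℤ.- d ≡ (c ℤ.+ e) ℤ.- (d ℤ.+ e)
        shift = ℤ.solve-∀
        expand : ∀ y z p q → (y + z) * (p * q) ≈ (y * p) * q + (z * q) * p
        expand = solve 4 (λ y z p q → (y :+ z) :* (p :* q) := (y :* p) :* q :+ (z :* q) :* p) refl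
        c′+d≡c+d′ : c′ ℕ.+ d ≡ c ℕ.+ d′
        c′+d≡c+d′ = ℤ.+-injective (≡.trans (ℤ.pos-+ c′ d) (≡.trans (restore (+ c′) (+ d) (+ d′)) (≡.trans (≡.cong (λ n → n ℤ.+ + d′ ℤ.+ + d) (≡.trans (≡.sym n≡′) n≡)) (≡.trans (restore′ (+ c) (+ d) (+ d′)) (≡.sym (ℤ.pos-+ c d′))))))
          where
          restore : ∀ c′ d d′ → c′ ℤ.+ d ≡ (c′ ℤ.- d′) ℤ.+ d′ ℤ.+ d
          restore = ℤ.solve-∀
          restore′ : ∀ c d d′ → (c ℤ.- d) ℤ.+ d′ ℤ.+ d ≡ c ℤ.+ d′
          restore′ = ℤ.solve-∀

      Val-unique : ∀ {z m n} → Val z m → Val z n → m ≡ n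
      Val-unique {z} {m} {n} p q = ℤ.≤-antisym (AtLeast-≤ q (≤-AtLeast m p ℤ.≤-refl)) (AtLeast-≤ p (≤-AtLeast n q ℤ.≤-refl))

      Val-nonzero : ∀ {z m} → Val z m → z ≉ 0#
      Val-nonzero {z} {m} (val a b _ w (Ow , w⁻¹ , _ , w⁻¹w≈1) eq) z≈0 = *-nonzero (inverse-nonzero (trans (*-comm w w⁻¹) w⁻¹w≈1)) (^-nonzero a π≉0)
        (trans (sym eq) (trans (*-congʳ z≈0) (zeroˡ _)))

      Val-resp : ∀ {y z m} → y ≈ z → Val y m → Val z m
      Val-resp y≈z (val a b m≡ w Uw eq) = val a b m≡ w Uw (trans (*-congʳ (sym y≈z)) eq)

      Val-* : ∀ {y z m n} → Val y m → Val z n → Val (y * z) (m ℤ.+ n)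
      Val-* {y} {z} {m} {n} (val a b m≡ w (Ow , w⁻¹ , Ow⁻¹ , p) eq) (val a′ b′ n≡ w′ (Ow′ , w′⁻¹ , Ow′⁻¹ , p′) eq′) = val (a ℕ.+ a′) (b ℕ.+ b′)
        (≡.trans (≡.cong₂ ℤ._+_ m≡ n≡) (≡.trans (shift (+ a) (+ b) (+ a′) (+ b′)) (≡.cong₂ ℤ._-_ (≡.sym (ℤ.pos-+ a a′)) (≡.sym (ℤ.pos-+ b b′)))))
        (w * w′) (*-closed Ow Ow′ , w⁻¹ * w′⁻¹ , *-closed Ow⁻¹ Ow′⁻¹ , trans (interchange w⁻¹ w′⁻¹ w w′) (trans (*-cong p p′) (*-identityˡ 1#)))
        (begin
          (y * z) * π ^ (b ℕ.+ b′)               ≈⟨ *-congˡ (^-homo-* π b b′) ⟩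
          (y * z) * (π ^ b * π ^ b′)             ≈⟨ interchange y z (π ^ b) (π ^ b′) ⟩
          (y * π ^ b) * (z * π ^ b′)             ≈⟨ *-cong eq eq′ ⟩
          (w * π ^ a) * (w′ * π ^ a′)            ≈⟨ interchange w (π ^ a) w′ (π ^ a′) ⟩
          (w * w′) * (π ^ a * π ^ a′)            ≈⟨ *-congˡ (sym (^-homo-* π a a′)) ⟩
          (w * w′) * π ^ (a ℕ.+ a′)              ∎)
        where
        interchange : ∀ a b c d → (a * b) * (c * d) ≈ (a * c) * (b * d)
        interchange = solve 4 (λ a b c d → (a :* b) :* (c :* d) := (a :* c) :* (b :* d)) refl
        shift : ∀ a b c d → (a ℤ.- b) ℤ.+ (c ℤ.- d) ≡ (a ℤ.+ c) ℤ.- (b ℤ.+ d)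
        shift = ℤ.solve-∀

    value : ∀ z → Dec (z ≈ 0#) → ℤ∞
    value z (yes _) = ⊤⁺
    value z (no z≉0) = [ proj₁ (Val-exists z≉0) ]

    abstract
      value-⊤ : ∀ {z} → z ≈ 0# → ∀ d → value z d ≡ ⊤⁺
      value-⊤ z≈0 (yes _) = ≡.refl
      value-⊤ z≈0 (no z≉0) = ⊥-elim (z≉0 z≈0)

      value-Val : ∀ {z m} → Val z m → ∀ d → value z d ≡ [ m ]
      value-Val p (yes z≈0) = ⊥-elim (Val-nonzero p z≈0)
      value-Val p (no z≉0) = ≡.cong [_] (Val-unique (proj₂ (Val-exists z≉0)) p)

      value-cong : ∀ {y z} → y ≈ z → ∀ d e → value y d ≡ value z e
      value-cong y≈z (yes y≈0) e = ≡.sym (value-⊤ (trans (sym y≈z) y≈0) e)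
      value-cong y≈z (no y≉0) e = ≡.sym (value-Val (Val-resp y≈z (proj₂ (Val-exists y≉0))) e)

      value-* : ∀ y z d e d′ → value (y * z) d′ ≡ value y d +∞ value z e
      value-* y z (yes y≈0) e d′ = value-⊤ (trans (*-congʳ y≈0) (zeroˡ z)) d′
      value-* y z (no _) (yes z≈0) d′ = value-⊤ (trans (*-congˡ z≈0) (zeroʳ y)) d′
      value-* y z (no y≉0) (no z≉0) d′ = value-Val (Val-* (proj₂ (Val-exists y≉0)) (proj₂ (Val-exists z≉0))) d′

      ≤value⇒AtLeast : ∀ {n} z d → [ n ] ≤∞ value z d → AtLeast n z
      ≤value⇒AtLeast {n} z (yes z≈0) _ = AtLeast-0 n z≈0
      ≤value⇒AtLeast {n} z (no z≉0) [ n≤m ]≤ = ≤-AtLeast n (proj₂ (Val-exists z≉0)) n≤m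

      AtLeast⇒≤value : ∀ {n} z d → AtLeast n z → [ n ] ≤∞ value z d
      AtLeast⇒≤value z (yes _) _ = _ ≤⊤⁺
      AtLeast⇒≤value z (no z≉0) p = [ AtLeast-≤ (proj₂ (Val-exists z≉0)) p ]≤

      value-+ : ∀ n y z → n ≤∞ value y em → n ≤∞ value z em → n ≤∞ value (y + z) em
      value-+ nothing y z p q = ≡.subst (⊤⁺ ≤∞_) (≡.sym (value-⊤ (trans (+-cong (is-0 y em p) (is-0 z em q)) (+-identityˡ 0#)) em)) (⊤⁺ ≤⊤⁺)
        where
        is-0 : ∀ z d → ⊤⁺ ≤∞ value z d → z ≈ 0#
        is-0 z (yes z≈0) _ = z≈0
      value-+ (just n) y z p q = AtLeast⇒≤value (y + z) em (AtLeast-+ (≤value⇒AtLeast y em p) (≤value⇒AtLeast z em q))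

      value≡⊤⇒0 : ∀ z d → value z d ≡ ⊤⁺ → z ≈ 0#
      value≡⊤⇒0 z (yes z≈0) _ = z≈0

      Val-π : Val π (+ 1)
      Val-π = val 1 0 ≡.refl 1# (1#-closed , 1# , 1#-closed , *-identityˡ 1#) (trans (*-identityʳ π) (sym (trans (*-identityˡ _) (*-identityʳ π))))

      -- g is not a unit of O, since its inverse f is not in O. So g has positive order and f has a
      -- pole.
      Val-f : ∃[ k ] Val f -[1+ k ]
      Val-f =
        let k , w , Uw , eq = O-order g∈O (inverse-nonzero gf≈1) in case k w Uw eq
        where
        case : ∀ k w → Unit w → g ≈ w * π ^ k → ∃[ k ] Val f -[1+ k ]
        case zero w (_ , w⁻¹ , Ow⁻¹ , p) eq = ⊥-elim (proj₂ g∈M (w⁻¹ , Ow⁻¹ , trans (*-congˡ (trans eq (*-identityʳ w))) p))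
        case (suc k) w (Ow , w⁻¹ , Ow⁻¹ , p) eq = k , val 0 (suc k) ≡.refl w⁻¹ (Ow⁻¹ , w , Ow , trans (*-comm w w⁻¹) p) (begin
          f * π ^ suc k                ≈⟨ sym (trans (*-congʳ p) (*-identityˡ _)) ⟩
          (w⁻¹ * w) * (f * π ^ suc k)  ≈⟨ rearrange w⁻¹ w f (π ^ suc k) ⟩
          w⁻¹ * ((w * π ^ suc k) * f)  ≈⟨ *-congˡ (trans (*-congʳ (sym eq)) gf≈1) ⟩
          w⁻¹ * 1#                     ∎)
          where
          rearrange : ∀ v w f p → (v * w) * (f * p) ≈ v * ((w * p) * f)
          rearrange = solve 4 (λ v w f p → (v :* w) :* (f :* p) := v :* ((w :* p) :* f)) refl

    place : Place K
    place = record
      { v = λ z → value z em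
      ; v-cong = λ y≈z → value-cong y≈z em em
      ; v-⊤ = λ z → mk⇔ (value≡⊤⇒0 z em) (λ z≈0 → value-⊤ z≈0 em)
      ; v-* = λ y z → value-* y z em em em
      ; v-+ = λ {y} {z} {n} → value-+ n y z
      ; normalised = π , value-Val Val-π em
      }

  abstract
    place-with-pole : ∃[ y ] ∃[ k ] Place.v {K} y f ≡ [ -[1+ k ] ]
    place-with-pole = place , proj₁ Val-f , value-Val (proj₂ Val-f) em

module Constants (em : ExcludedMiddle 0ℓ) (K : FunctionField) where
  open FunctionField K using (𝔽q; F; q; constants; algebraically-closed; 𝔽q-cardinality)
  open CommutativeRing (fieldRing F) hiding (zero)
  open Field em F
  open Polynomials (fieldRing 𝔽q) (fieldRing F) constants
  open Valuations em {K}
  open RiemannRoch em K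
  private
    module φ = RingHomomorphism constants

  abstract
    -- 𝔽q being algebraically closed in F, an algebraic function is constant, and a transcendental
    -- one has a pole at the place built from a maximal subring.
    integral⇒constant : ∀ f → (∀ y → + 0 ≤[ y ] f) → ∃[ c ] φ.⟦ c ⟧ ≈ f
    integral⇒constant f integral = case em
      where
      case : Dec (Algebraic f) → ∃[ c ] φ.⟦ c ⟧ ≈ f
      case (yes algebraic) = algebraically-closed f algebraic
      case (no transcendental) =
        let y , k , pole = ValuationFromSubring.place-with-pole em K f transcendental
        in ⊥-elim (negative (≤-order (v≡ pole) (integral y)))
        where
        negative : ∀ {k} → ¬ + 0 ℤ.≤ -[1+ k ]
        negative ()

    few-constants : ¬ Many (L [] []) q
    few-constants (as , distinct , ps , many) = same (many-of-one-colour em q hasColour as distinct ps (All.map colour ps)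
      (≡.subst (ℕ._< length as) (≡.sym (ℕ.*-identityʳ q)) many))
      where
      hasColour : Fin q → Pred Carrier 0ℓ
      hasColour i a = φ.⟦ Bijection.to 𝔽q-cardinality i ⟧ ≈ a
      colour : ∀ {a} → L [] [] a → ∃[ i ] hasColour i a
      colour {a} p =
        let c , φc≈a = integral⇒constant a (bound p)
            i , eq = Bijection.surjective 𝔽q-cardinality c
        in i , trans (φ.⟦⟧-cong (eq ≡.refl)) φc≈a
      same : ¬ (∃[ i ] ∃[ bs ] AllPairs _≉_ bs × All (L [] []) bs × All (hasColour i) bs × 1 ℕ.< length bs)
      same (i , _ ∷ [] , _ , _ , _ , s≤s ())
      same (i , a ∷ b ∷ _ , (a≉b ∷ _) ∷ _ , _ , p ∷ q ∷ _ , _) = a≉b (trans (sym p) q)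

-- The double coset graph over abstract rings

module AdelicReflexivity (Γ A O : Ring) (ι : Γ ⟶ʳ A) (κ : O ⟶ʳ A) where
  open CommutativeRing A
  open Matrices A hiding (GL₂)
  private
    module ι = RingHomomorphism ι
    module κ = RingHomomorphism κ

  abstract
    ≈ᴹ⇒vertex : ∀ (g h : Group.Carrier (GL₂ A)) → proj₁ g ≈ᴹ proj₁ h → Setoid._≈_ (Adelic.vertices Γ A O ι κ) g h
    ≈ᴹ⇒vertex g h g≈h = Group.ε (PGL₂ Γ) , Group.ε (PGL₂ O) , AbelianGroup.ε (Units A) ,
      ≈ᴹ-trans (·ᴹ-identity _) (≈ᴹ-trans (*ᴹ-cong (≈ᴹ-trans (*ᴹ-cong (mat≈ ι.1#-homo ι.0#-homo ι.0#-homo ι.1#-homo) ≈ᴹ-refl) (*ᴹ-identityˡ (proj₁ g)))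
        (mat≈ κ.1#-homo κ.0#-homo κ.0#-homo κ.1#-homo)) (≈ᴹ-trans (*ᴹ-identityʳ _) g≈h))

    ≈⇒class : ∀ (a b : AbelianGroup.Carrier (Units A)) → proj₁ a ≈ proj₁ b → AbelianGroup._≈_ (Adelic.classGroup Γ A O ι κ) a b
    ≈⇒class a b a≈b = AbelianGroup.ε (Units Γ) , AbelianGroup.ε (Units O) ,
      trans (*-cong (trans (*-congʳ ι.1#-homo) (*-identityˡ _)) κ.1#-homo) (trans (*-identityʳ _) a≈b)

-- PGL₂(Γ)\PGL₂(A)/PGL₂(O) with the edges given by diag(1, ϖ), where C is the
-- relation of lying in the same component.
module Components (Γ A O : Ring) (ι : Γ ⟶ʳ A) (κ : O ⟶ʳ A) (ϖ : AbelianGroup.Carrier (Units A))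
    (C : Rel (Group.Carrier (GL₂ A)) 0ℓ) (C-isEquivalence : IsEquivalence C)
    (vertex⇒C : ∀ g h → Setoid._≈_ (Adelic.vertices Γ A O ι κ) g h → C g h)
    (D : Group.Carrier (GL₂ A)) (ξ≈D : Matrices._≈ᴹ_ A (proj₁ (ξ[0∶1] A ϖ)) (proj₁ D))
    (edge⇒C : ∀ g h → Setoid._≈_ (Adelic.vertices Γ A O ι κ) h (Group._∙_ (GL₂ A) g D) → C g h) where
  open CommutativeRing A hiding (zero)
  open RingProperties ring
  open Exponentiation semiring using (_^_)
  open Matrices A hiding (GL₂)
  open SetoidReasoning setoid
  open IntegerSolver A using (solve; _:+_; _:*_; _:-_; :-_; _:=_; con)
  private
    module Γ = CommutativeRing Γ
    module O = CommutativeRing O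
    module ι = RingHomomorphism ι
    module κ = RingHomomorphism κ
    module G = Group (GL₂ A)
    module C = IsEquivalence C-isEquivalence
    module FΓ = Functoriality {Γ} {A} ι
    module FO = Functoriality {O} {A} κ
    module SO = IntegerSolver O

    Vertex : Set
    Vertex = G.Carrier

    A× Γ× O× : Set
    A× = AbelianGroup.Carrier (Units A)
    Γ× = AbelianGroup.Carrier (Units Γ)
    O× = AbelianGroup.Carrier (Units O)

    ϖ₀ : Carrier
    ϖ₀ = proj₁ ϖ

    times-D : Vertex → Vertex
    times-D g = g G.∙ ξ[0∶1] A ϖ

    abstract
      D-edge : ∀ g → C g (times-D g)
      D-edge g = edge⇒C g (times-D g) (AdelicReflexivity.≈ᴹ⇒vertex Γ A O ι κ (times-D g) (g G.∙ D) (*ᴹ-cong (≈ᴹ-refl {proj₁ g}) ξ≈D))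

  -- For the idele ϖ that is a uniformiser at x and 1 elsewhere, this is integrality away from x.
  IntegralOff : Carrier → Set
  IntegralOff a = ∃[ n ] ∃[ o ] κ.⟦ o ⟧ ≈ ϖ₀ ^ n * a

  private
    abstract
      same : ∀ g h → proj₁ g ≈ᴹ proj₁ h → C g h
      same g h g≈h = vertex⇒C g h (AdelicReflexivity.≈ᴹ⇒vertex Γ A O ι κ g h g≈h)

      left : ∀ (γ : Group.Carrier (GL₂ Γ)) {N} → FΓ.mapᴹ (proj₁ γ) ≈ᴹ N → ∀ g h → N *ᴹ proj₁ g ≈ᴹ proj₁ h → C g h
      left γ {N} γ≈N g h eq = vertex⇒C g h (γ , Group.ε (PGL₂ O) , AbelianGroup.ε (Units A) ,
        ≈ᴹ-trans (·ᴹ-identity _) (≈ᴹ-trans (*ᴹ-cong (*ᴹ-cong γ≈N ≈ᴹ-refl) (mat≈ κ.1#-homo κ.0#-homo κ.0#-homo κ.1#-homo)) (≈ᴹ-trans (*ᴹ-identityʳ _) eq)))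

      right : ∀ (k : Group.Carrier (GL₂ O)) {N} → FO.mapᴹ (proj₁ k) ≈ᴹ N → ∀ g h → proj₁ g *ᴹ N ≈ᴹ proj₁ h → C g h
      right k {N} k≈N g h eq = vertex⇒C g h (Group.ε (PGL₂ Γ) , k , AbelianGroup.ε (Units A) ,
        ≈ᴹ-trans (·ᴹ-identity _) (≈ᴹ-trans (*ᴹ-cong (≈ᴹ-trans (*ᴹ-cong (mat≈ ι.1#-homo ι.0#-homo ι.0#-homo ι.1#-homo) ≈ᴹ-refl) (*ᴹ-identityˡ (proj₁ g))) k≈N) eq))

      scale : ∀ (u : A×) g h → proj₁ u ·ᴹ proj₁ g ≈ᴹ proj₁ h → C g h
      scale u g h eq = vertex⇒C g h (Group.ε (PGL₂ Γ) , Group.ε (PGL₂ O) , u ,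
        ≈ᴹ-trans (·ᴹ-cong refl (≈ᴹ-trans (*ᴹ-cong (≈ᴹ-trans (*ᴹ-cong (mat≈ ι.1#-homo ι.0#-homo ι.0#-homo ι.1#-homo) ≈ᴹ-refl) (*ᴹ-identityˡ (proj₁ g)))
          (mat≈ κ.1#-homo κ.0#-homo κ.0#-homo κ.1#-homo)) (*ᴹ-identityʳ _))) eq)

      edge : ∀ g h → proj₁ g *ᴹ mat 1# 0# 0# ϖ₀ ≈ᴹ proj₁ h → C g h
      edge g h eq = C.trans (D-edge g) (same (times-D g) h eq)

    module Unimodular (R : Ring) where
      private
        module R = CommutativeRing R
        module S = IntegerSolver R

      abstract
        unipotent-det : ∀ o → Matrices.det R (mat R.1# o R.0# R.1#) R.≈ R.1#
        unipotent-det = S.solve 1 (λ o → S.con (1 , 0) S.:* S.con (1 , 0) S.:- o S.:* S.con (0 , 0) S.:= S.con (1 , 0)) R.refl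

        swap-det : R.- R.1# R.* Matrices.det R (mat R.0# R.1# R.1# R.0#) R.≈ R.1#
        swap-det = S.solve 0 (S.:- S.con (1 , 0) S.:* (S.con (0 , 0) S.:* S.con (0 , 0) S.:- S.con (1 , 0) S.:* S.con (1 , 0)) S.:= S.con (1 , 0)) R.refl

        diagonal-det : ∀ u v → u R.* v R.≈ Matrices.det R (mat u R.0# R.0# v)
        diagonal-det = S.solve 2 (λ u v → u S.:* v S.:= u S.:* v S.:- S.con (0 , 0) S.:* S.con (0 , 0)) R.refl

      unipotent : R.Carrier → Group.Carrier (GL₂ R)
      unipotent o = mat R.1# o R.0# R.1# , isUnit-resp R (R.sym (unipotent-det o)) (isUnit R R.1# (R.*-identityˡ R.1#))

      swap : Group.Carrier (GL₂ R)
      swap = mat R.0# R.1# R.1# R.0# , isUnit R (R.- R.1#) swap-det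

      diagonal : (u v : AbelianGroup.Carrier (Units R)) → Group.Carrier (GL₂ R)
      diagonal (u , Uu) (v , Uv) = mat u R.0# R.0# v , isUnit-resp R (diagonal-det u v) (isUnit-* R Uu Uv)

    upper : A× → Carrier → A× → Vertex
    upper (α , Uα) β (δ , Uδ) = mat α β 0# δ , isUnit-resp A (sym (det≈ α β δ)) (isUnit-* A Uα Uδ)
      where
      det≈ : ∀ α β δ → det (mat α β 0# δ) ≈ α * δ
      det≈ = solve 3 (λ α β δ → α :* δ :- β :* con (0 , 0) := α :* δ) refl

    lower : A× → Carrier → A× → Vertex
    lower (α , Uα) γ (δ , Uδ) = mat α 0# γ δ , isUnit-resp A (sym (det≈ α γ δ)) (isUnit-* A Uα Uδ)
      where
      det≈ : ∀ α γ δ → det (mat α 0# γ δ) ≈ α * δ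
      det≈ = solve 3 (λ α γ δ → α :* δ :- con (0 , 0) :* γ := α :* δ) refl

    diag : A× → A× → Vertex
    diag α δ = upper α 0# δ

    1× : A×
    1× = AbelianGroup.ε (Units A)

    infixl 7 _·_
    _·_ : A× → A× → A×
    _·_ = AbelianGroup._∙_ (Units A)

    abstract
      right-unipotent : ∀ o g h → proj₁ g *ᴹ mat 1# κ.⟦ o ⟧ 0# 1# ≈ᴹ proj₁ h → C g h
      right-unipotent o = right (Unimodular.unipotent O o) (mat≈ κ.1#-homo refl κ.0#-homo κ.1#-homo)

      right-swap : ∀ g h → proj₁ g *ᴹ mat 0# 1# 1# 0# ≈ᴹ proj₁ h → C g h
      right-swap = right (Unimodular.swap O) (mat≈ κ.0#-homo κ.1#-homo κ.1#-homo κ.0#-homo)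

      right-diagonal : ∀ (u v : O×) g h → proj₁ g *ᴹ mat κ.⟦ proj₁ u ⟧ 0# 0# κ.⟦ proj₁ v ⟧ ≈ᴹ proj₁ h → C g h
      right-diagonal u v = right (Unimodular.diagonal O u v) (mat≈ refl κ.0#-homo κ.0#-homo refl)

      left-unipotent : ∀ f g h → mat 1# ι.⟦ f ⟧ 0# 1# *ᴹ proj₁ g ≈ᴹ proj₁ h → C g h
      left-unipotent f = left (Unimodular.unipotent Γ f) (mat≈ ι.1#-homo refl ι.0#-homo ι.1#-homo)

      left-swap : ∀ g h → mat 0# 1# 1# 0# *ᴹ proj₁ g ≈ᴹ proj₁ h → C g h
      left-swap = left (Unimodular.swap Γ) (mat≈ ι.0#-homo ι.1#-homo ι.1#-homo ι.0#-homo)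

      left-diagonal : ∀ (u v : Γ×) g h → mat ι.⟦ proj₁ u ⟧ 0# 0# ι.⟦ proj₁ v ⟧ *ᴹ proj₁ g ≈ᴹ proj₁ h → C g h
      left-diagonal u v = left (Unimodular.diagonal Γ u v) (mat≈ refl ι.0#-homo ι.0#-homo refl)

      -- After n edges b has become ϖⁿ b, which lies in O and is absorbed; then n edges lead back.
      -- Within a component an off-diagonal entry thus matters only up to integrality away from x,
      -- which is what strong approximation provides.
      right-unipotent-off : ∀ n b → (∃[ o ] κ.⟦ o ⟧ ≈ ϖ₀ ^ n * b) → ∀ g h → proj₁ g *ᴹ mat 1# b 0# 1# ≈ᴹ proj₁ h → C g h
      right-unipotent-off zero b (o , eq) g h gu≈h = right-unipotent o g h
        (≈ᴹ-trans {proj₁ g *ᴹ mat 1# κ.⟦ o ⟧ 0# 1#} {proj₁ g *ᴹ mat 1# b 0# 1#} {proj₁ h}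
          (*ᴹ-cong {proj₁ g} {proj₁ g} {mat 1# κ.⟦ o ⟧ 0# 1#} {mat 1# b 0# 1#} ≈ᴹ-refl (mat≈ refl (trans eq (*-identityˡ b)) refl refl)) gu≈h)
      right-unipotent-off (suc n) b (o , eq) g h gu≈h =
        C.trans (D-edge g) (C.trans
          (right-unipotent-off n (ϖ₀ * b) (o , trans eq (rearrange ϖ₀ (ϖ₀ ^ n) b)) (times-D g) (times-D h) moved)
          (C.sym (D-edge h)))
        where
        rearrange : ∀ w wⁿ b → (w * wⁿ) * b ≈ wⁿ * (w * b)
        rearrange = solve 3 (λ w wⁿ b → (w :* wⁿ) :* b := wⁿ :* (w :* b)) refl
        -- diag(1, ϖ) u(ϖ b) = u(b) diag(1, ϖ)
        commute : mat 1# 0# 0# ϖ₀ *ᴹ mat 1# (ϖ₀ * b) 0# 1# ≈ᴹ mat 1# b 0# 1# *ᴹ mat 1# 0# 0# ϖ₀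
        commute = mat≈
          (solve 1 (λ b → con (1 , 0) :* con (1 , 0) :+ con (0 , 0) :* con (0 , 0) := con (1 , 0) :* con (1 , 0) :+ b :* con (0 , 0)) refl b)
          (solve 2 (λ b w → con (1 , 0) :* (w :* b) :+ con (0 , 0) :* con (1 , 0) := con (1 , 0) :* con (0 , 0) :+ b :* w) refl b ϖ₀)
          (solve 1 (λ w → con (0 , 0) :* con (1 , 0) :+ w :* con (0 , 0) := con (0 , 0) :* con (1 , 0) :+ con (1 , 0) :* con (0 , 0)) refl ϖ₀)
          (solve 2 (λ b w → con (0 , 0) :* (w :* b) :+ w :* con (1 , 0) := con (0 , 0) :* con (0 , 0) :+ con (1 , 0) :* w) refl b ϖ₀)
        move : ∀ M N D U U′ → D *ᴹ U ≈ᴹ U′ *ᴹ D → M *ᴹ U′ ≈ᴹ N → (M *ᴹ D) *ᴹ U ≈ᴹ N *ᴹ D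
        move M N D U U′ DU≈U′D MU′≈N = ≈ᴹ-trans {(M *ᴹ D) *ᴹ U} {M *ᴹ (D *ᴹ U)} {N *ᴹ D} (*ᴹ-assoc M D U)
          (≈ᴹ-trans {M *ᴹ (D *ᴹ U)} {M *ᴹ (U′ *ᴹ D)} {N *ᴹ D} (*ᴹ-cong {M} {M} {D *ᴹ U} {U′ *ᴹ D} ≈ᴹ-refl DU≈U′D)
          (≈ᴹ-trans {M *ᴹ (U′ *ᴹ D)} {(M *ᴹ U′) *ᴹ D} {N *ᴹ D} (≈ᴹ-sym (*ᴹ-assoc M U′ D)) (*ᴹ-cong {M *ᴹ U′} {N} {D} {D} MU′≈N ≈ᴹ-refl)))
        moved : (proj₁ g *ᴹ mat 1# 0# 0# ϖ₀) *ᴹ mat 1# (ϖ₀ * b) 0# 1# ≈ᴹ proj₁ h *ᴹ mat 1# 0# 0# ϖ₀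
        moved = move (proj₁ g) (proj₁ h) (mat 1# 0# 0# ϖ₀) (mat 1# (ϖ₀ * b) 0# 1#) (mat 1# b 0# 1#) commute gu≈h

      diag-scale : ∀ (u : A×) α δ → C (diag α δ) (diag (u · α) (u · δ))
      diag-scale u α δ = scale u (diag α δ) (diag (u · α) (u · δ)) (mat≈ refl (zeroʳ _) (zeroʳ _) refl)

      diag-cong : ∀ {α δ α′ δ′ : A×} → proj₁ α ≈ proj₁ α′ → proj₁ δ ≈ proj₁ δ′ → C (diag α δ) (diag α′ δ′)
      diag-cong {α} {δ} {α′} {δ′} p q = same (diag α δ) (diag α′ δ′) (mat≈ p refl refl q)

    T : A× → Vertex
    T a = diag a 1×

    abstract
      diag⇒T : ∀ α δ → C (diag α δ) (T (α · AbelianGroup._⁻¹ (Units A) δ))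
      diag⇒T α δ@(_ , _ , p , _) = C.trans (diag-scale δ⁻¹ α δ) (diag-cong {δ⁻¹ · α} {δ⁻¹ · δ} {α · δ⁻¹} {1×} (*-comm _ _) p)
        where
        δ⁻¹ : A×
        δ⁻¹ = AbelianGroup._⁻¹ (Units A) δ

      -- The edge leads from diag(a ϖ, 1) to diag(a ϖ, ϖ), a scalar multiple of diag(a, 1).
      T-ϖ : ∀ a → C (T (a · ϖ)) (T a)
      T-ϖ a@(a₀ , _) = C.trans (edge (T (a · ϖ)) (diag (a · ϖ) ϖ) (mat≈
          (solve 1 (λ α → α :* con (1 , 0) :+ con (0 , 0) :* con (0 , 0) := α) refl (a₀ * ϖ₀))
          (solve 2 (λ α w → α :* con (0 , 0) :+ con (0 , 0) :* w := con (0 , 0)) refl (a₀ * ϖ₀) ϖ₀)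
          (solve 0 (con (0 , 0) :* con (1 , 0) :+ con (1 , 0) :* con (0 , 0) := con (0 , 0)) refl)
          (solve 1 (λ w → con (0 , 0) :* con (0 , 0) :+ con (1 , 0) :* w := w) refl ϖ₀)))
        (C.trans (diag⇒T (a · ϖ) ϖ) (diag-cong {(a · ϖ) · AbelianGroup._⁻¹ (Units A) ϖ} {1×} {a} {1×}
          (trans (*-assoc a₀ ϖ₀ _) (trans (*-congˡ (proj₂ (proj₂ (proj₂ ϖ)))) (*-identityʳ a₀))) refl))

      T-Γ : ∀ a (f : Γ×) (fA : A×) → proj₁ fA ≈ ι.⟦ proj₁ f ⟧ → C (T a) (T (fA · a))
      T-Γ a@(a₀ , _) f@(f₀ , _) fA@(fA₀ , _) eq = left-diagonal f (AbelianGroup.ε (Units Γ)) (T a) (T (fA · a)) (mat≈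
        (trans (solve 2 (λ f α → f :* α :+ con (0 , 0) :* con (0 , 0) := f :* α) refl ι.⟦ f₀ ⟧ a₀) (*-congʳ (sym eq)))
        (solve 1 (λ f → f :* con (0 , 0) :+ con (0 , 0) :* con (1 , 0) := con (0 , 0)) refl ι.⟦ f₀ ⟧)
        (solve 2 (λ α i → con (0 , 0) :* α :+ i :* con (0 , 0) := con (0 , 0)) refl a₀ ι.⟦ Γ.1# ⟧)
        (trans (solve 1 (λ i → con (0 , 0) :* con (0 , 0) :+ i :* con (1 , 0) := i) refl ι.⟦ Γ.1# ⟧) ι.1#-homo))

      T-O : ∀ a (u : O×) (uA : A×) → proj₁ uA ≈ κ.⟦ proj₁ u ⟧ → C (T a) (T (uA · a))
      T-O a@(a₀ , _) u@(u₀ , _) uA@(uA₀ , _) eq = right-diagonal u (AbelianGroup.ε (Units O)) (T a) (T (uA · a)) (mat≈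
        (trans (solve 2 (λ u α → α :* u :+ con (0 , 0) :* con (0 , 0) := u :* α) refl κ.⟦ u₀ ⟧ a₀) (*-congʳ (sym eq)))
        (solve 2 (λ α i → α :* con (0 , 0) :+ con (0 , 0) :* i := con (0 , 0)) refl a₀ κ.⟦ O.1# ⟧)
        (solve 1 (λ u → con (0 , 0) :* u :+ con (1 , 0) :* con (0 , 0) := con (0 , 0)) refl κ.⟦ u₀ ⟧)
        (trans (solve 1 (λ i → con (0 , 0) :* con (0 , 0) :+ con (1 , 0) :* i := i) refl κ.⟦ O.1# ⟧) κ.1#-homo))

  module _ (strong-approximation : ∀ a ρ → ∃[ f ] IntegralOff ((a - ι.⟦ f ⟧) * ρ)) where

    private
      abstract
        upper⇒diag : ∀ α β δ → C (upper α β δ) (diag α δ)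
        upper⇒diag α@(α₀ , α⁻¹ , α⁻¹α≈1 , αα⁻¹≈1) β δ@(δ₀ , δ⁻¹ , δ⁻¹δ≈1 , δδ⁻¹≈1) =
          -- (β δ⁻¹ - f) δ α⁻¹ is the b for which diag(α, δ), multiplied on the right by the
          -- unipotent matrix of b, has the upper right entry β - f δ.
          let f , n , o , eq = strong-approximation (β * δ⁻¹) (δ₀ * α⁻¹)
              b = (β * δ⁻¹ - ι.⟦ f ⟧) * (δ₀ * α⁻¹)
          in C.trans (left-unipotent (Γ.- f) (upper α β δ) (upper α (β - ι.⟦ f ⟧ * δ₀) δ) (translate f))
               (C.sym (right-unipotent-off n b (o , eq) (diag α δ) (upper α (β - ι.⟦ f ⟧ * δ₀) δ) (mat≈
                 (solve 1 (λ α → α :* con (1 , 0) :+ con (0 , 0) :* con (0 , 0) := α) refl α₀)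
                 (product f)
                 (solve 1 (λ δ → con (0 , 0) :* con (1 , 0) :+ δ :* con (0 , 0) := con (0 , 0)) refl δ₀)
                 (solve 2 (λ b δ → con (0 , 0) :* b :+ δ :* con (1 , 0) := δ) refl b δ₀))))
          where
          translate : ∀ f → mat 1# ι.⟦ Γ.- f ⟧ 0# 1# *ᴹ proj₁ (upper α β δ) ≈ᴹ proj₁ (upper α (β - ι.⟦ f ⟧ * δ₀) δ)
          translate f = mat≈
            (solve 2 (λ α f → con (1 , 0) :* α :+ f :* con (0 , 0) := α) refl α₀ ι.⟦ Γ.- f ⟧)
            (trans (+-congˡ (*-congʳ (ι.-‿homo f))) (solve 3 (λ β f δ → con (1 , 0) :* β :+ (:- f) :* δ := β :- f :* δ) refl β ι.⟦ f ⟧ δ₀))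
            (solve 1 (λ α → con (0 , 0) :* α :+ con (1 , 0) :* con (0 , 0) := con (0 , 0)) refl α₀)
            (solve 2 (λ β δ → con (0 , 0) :* β :+ con (1 , 0) :* δ := δ) refl β δ₀)
          product : ∀ f → α₀ * ((β * δ⁻¹ - ι.⟦ f ⟧) * (δ₀ * α⁻¹)) + 0# * 1# ≈ β - ι.⟦ f ⟧ * δ₀
          product f = begin
            α₀ * ((β * δ⁻¹ - ι.⟦ f ⟧) * (δ₀ * α⁻¹)) + 0# * 1#   ≈⟨ rearrange α₀ β δ⁻¹ ι.⟦ f ⟧ δ₀ α⁻¹ ⟩
            (α⁻¹ * α₀) * (β * (δ⁻¹ * δ₀) - ι.⟦ f ⟧ * δ₀)        ≈⟨ trans (*-cong α⁻¹α≈1 (+-congʳ (trans (*-congˡ δ⁻¹δ≈1) (*-identityʳ β)))) (*-identityˡ _) ⟩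
            β - ι.⟦ f ⟧ * δ₀                                    ∎
            where
            rearrange : ∀ α β e f δ a → α * ((β * e - f) * (δ * a)) + 0# * 1# ≈ (a * α) * (β * (e * δ) - f * δ)
            rearrange = solve 6 (λ α β e f δ a → α :* ((β :* e :- f) :* (δ :* a)) :+ con (0 , 0) :* con (1 , 0) := (a :* α) :* (β :* (e :* δ) :- f :* δ)) refl

        conjugate : ∀ α γ δ → C (lower α γ δ) (upper δ γ α)
        conjugate α@(α₀ , _) γ δ@(δ₀ , _) = C.trans
          (left-swap (lower α γ δ) m (≈ᴹ-refl {mat 0# 1# 1# 0# *ᴹ mat α₀ 0# γ δ₀}))
          (right-swap m (upper δ γ α) (mat≈
            (solve 4 (λ α γ δ z → (con (0 , 0) :* α :+ con (1 , 0) :* γ) :* con (0 , 0) :+ (con (0 , 0) :* con (0 , 0) :+ con (1 , 0) :* δ) :* con (1 , 0) := δ) refl α₀ γ δ₀ 0#)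
            (solve 3 (λ α γ δ → (con (0 , 0) :* α :+ con (1 , 0) :* γ) :* con (1 , 0) :+ (con (0 , 0) :* con (0 , 0) :+ con (1 , 0) :* δ) :* con (0 , 0) := γ) refl α₀ γ δ₀)
            (solve 3 (λ α γ δ → (con (1 , 0) :* α :+ con (0 , 0) :* γ) :* con (0 , 0) :+ (con (1 , 0) :* con (0 , 0) :+ con (0 , 0) :* δ) :* con (1 , 0) := con (0 , 0)) refl α₀ γ δ₀)
            (solve 3 (λ α γ δ → (con (1 , 0) :* α :+ con (0 , 0) :* γ) :* con (1 , 0) :+ (con (1 , 0) :* con (0 , 0) :+ con (0 , 0) :* δ) :* con (0 , 0) := α) refl α₀ γ δ₀)))
          where
          m : Vertex
          m = Group._∙_ (GL₂ A) (Unimodular.swap A) (lower α γ δ)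

        -- Swapping rows and columns makes the matrix upper triangular; once it is diagonal, the
        -- same swaps put its entries back.
        lower⇒diag : ∀ α γ δ → C (lower α γ δ) (diag α δ)
        lower⇒diag α γ δ = C.trans (conjugate α γ δ) (C.trans (upper⇒diag δ γ α)
          (C.sym (C.trans (same (diag α δ) (lower α 0# δ) ≈ᴹ-refl) (conjugate α 0# δ))))

        -- (c a)(0 1)   shows diag(a c, c⁻¹) ~ diag(a, -1) for integral c.
        T-square-integral : ∀ a (c : A×) o → κ.⟦ o ⟧ ≈ proj₁ c → C (T (a · (c · c))) (T a)
        T-square-integral a@(a₀ , _) c@(c₀ , c⁻¹ , c⁻¹c≈1 , cc⁻¹≈1) o κo≈c =
          C.trans (diag-scale c⁻ (a · (c · c)) 1×)
          (C.trans (diag-cong {c⁻ · (a · (c · c))} {c⁻ · 1×} {a · c} {c⁻} (trans (regroup c⁻¹ a₀ c₀) (trans (*-congʳ c⁻¹c≈1) (*-identityˡ _))) (*-identityʳ c⁻¹))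
          (C.trans (C.sym (upper⇒diag (a · c) a₀ c⁻))
          (C.trans (right-swap (upper (a · c) a₀ c⁻) m (≈ᴹ-refl {mat (a₀ * c₀) a₀ 0# c⁻¹ *ᴹ mat 0# 1# 1# 0#}))
          (C.trans (right-unipotent (O.- o) m (lower a c⁻¹ -1×) eliminate)
          (C.trans (lower⇒diag a c⁻¹ -1×)
            (right-diagonal (AbelianGroup.ε (Units O)) -1ᴼ (diag a -1×) (T a) (mat≈
              (trans (solve 2 (λ a i → a :* i :+ con (0 , 0) :* con (0 , 0) := a :* i) refl a₀ κ.⟦ O.1# ⟧) (trans (*-congˡ κ.1#-homo) (*-identityʳ a₀)))
              (solve 2 (λ a i → a :* con (0 , 0) :+ con (0 , 0) :* i := con (0 , 0)) refl a₀ κ.⟦ O.- O.1# ⟧)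
              (solve 1 (λ i → con (0 , 0) :* i :+ (:- con (1 , 0)) :* con (0 , 0) := con (0 , 0)) refl κ.⟦ O.1# ⟧)
              (trans (+-congˡ (*-congˡ (trans (κ.-‿homo O.1#) (-‿cong κ.1#-homo)))) (solve 0 (con (0 , 0) :* con (0 , 0) :+ (:- con (1 , 0)) :* (:- con (1 , 0)) := con (1 , 0)) refl)))))))))
          where
          c⁻ : A×
          c⁻ = AbelianGroup._⁻¹ (Units A) c
          -1× : A×
          -1× = - 1# , isUnit A (- 1#) (solve 0 ((:- con (1 , 0)) :* (:- con (1 , 0)) := con (1 , 0)) refl)
          -1ᴼ : O×
          -1ᴼ = O.- O.1# , isUnit O (O.- O.1#) (SO.solve 0 ((SO.:- SO.con (1 , 0)) SO.:* (SO.:- SO.con (1 , 0)) SO.:= SO.con (1 , 0)) O.refl)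
          m : Vertex
          m = Group._∙_ (GL₂ A) (upper (a · c) a₀ c⁻) (Unimodular.swap A)
          regroup : ∀ e a c → e * (a * (c * c)) ≈ (e * c) * (a * c)
          regroup = solve 3 (λ e a c → e :* (a :* (c :* c)) := (e :* c) :* (a :* c)) refl
          κ-o : κ.⟦ O.- o ⟧ ≈ - c₀
          κ-o = trans (κ.-‿homo o) (-‿cong κo≈c)
          eliminate : proj₁ m *ᴹ mat 1# κ.⟦ O.- o ⟧ 0# 1# ≈ᴹ mat a₀ 0# c⁻¹ (- 1#)
          eliminate = ≈ᴹ-trans (*ᴹ-cong (≈ᴹ-refl {proj₁ m}) (mat≈ refl κ-o refl refl)) (mat≈
            (solve 2 (λ a c → ((a :* c) :* con (0 , 0) :+ a :* con (1 , 0)) :* con (1 , 0) :+ ((a :* c) :* con (1 , 0) :+ a :* con (0 , 0)) :* con (0 , 0) := a) refl a₀ c₀)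
            (solve 2 (λ a c → ((a :* c) :* con (0 , 0) :+ a :* con (1 , 0)) :* (:- c) :+ ((a :* c) :* con (1 , 0) :+ a :* con (0 , 0)) :* con (1 , 0) := con (0 , 0)) refl a₀ c₀)
            (solve 1 (λ e → (con (0 , 0) :* con (0 , 0) :+ e :* con (1 , 0)) :* con (1 , 0) :+ (con (0 , 0) :* con (1 , 0) :+ e :* con (0 , 0)) :* con (0 , 0) := e) refl c⁻¹)
            (trans (solve 2 (λ e c → (con (0 , 0) :* con (0 , 0) :+ e :* con (1 , 0)) :* (:- c) :+ (con (0 , 0) :* con (1 , 0) :+ e :* con (0 , 0)) :* con (1 , 0) := :- (e :* c)) refl c⁻¹ c₀) (-‿cong c⁻¹c≈1)))

        T-cong : ∀ a b → proj₁ a ≈ proj₁ b → C (T a) (T b)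
        T-cong a b p = diag-cong {a} {1×} {b} {1×} p refl

        T-ϖ^ : ∀ n a (b : A×) → proj₁ b ≈ proj₁ a * (ϖ₀ ^ n * ϖ₀ ^ n) → C (T b) (T a)
        T-ϖ^ zero a b eq = T-cong b a (trans eq (trans (*-congˡ (*-identityˡ 1#)) (*-identityʳ _)))
        T-ϖ^ (suc n) a b eq = C.trans (T-ϖ^ n ((a · ϖ) · ϖ) b (trans eq (rearrange _ ϖ₀ (ϖ₀ ^ n)))) (C.trans (T-ϖ (a · ϖ)) (T-ϖ a))
          where
          rearrange : ∀ a w n → a * ((w * n) * (w * n)) ≈ ((a * w) * w) * (n * n)
          rearrange = solve 3 (λ a w n → a :* ((w :* n) :* (w :* n)) := ((a :* w) :* w) :* (n :* n)) refl

    module _ (clear-denominators : ∀ (c : A×) → Σ[ f ∈ Γ× ] ∃[ n ] ∃[ o ] κ.⟦ o ⟧ ≈ ϖ₀ ^ n * (ι.⟦ proj₁ f ⟧ * proj₁ c))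
             -- Elimination over O in the lower row (c d): adding m c to d produces an idele d′, of
             -- which c is the integral multiple e d′.
             (triangularise : ∀ a b c d → IsUnit A (a * d - b * c) →
               ∃[ m ] ∃[ e ] Σ[ d′ ∈ A× ] proj₁ d′ ≈ d + κ.⟦ m ⟧ * c × c ≈ κ.⟦ e ⟧ * proj₁ d′) where

      private
        ^-unit : ℕ → A×
        ^-unit zero = 1×
        ^-unit (suc n) = ϖ · ^-unit n

        ^-unit≈ : ∀ n → proj₁ (^-unit n) ≈ ϖ₀ ^ n
        ^-unit≈ zero = refl
        ^-unit≈ (suc n) = *-congˡ (^-unit≈ n)

        abstract
          -- Replacing c by ϖⁿ f c changes c² by f² and ϖ²ⁿ, which do not change the component; for
          -- suitable f and n the new c is integral.
          T-square : ∀ a (c : A×) → C (T (a · (c · c))) (T a)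
          T-square a c =
            let f , n , o , eq = clear-denominators c
                fA = ι.⟦ proj₁ f ⟧ , FΓ.isUnit-map (proj₂ f)
                c′ = ^-unit n · (fA · c)
            in C.trans (T-Γ (a · (c · c)) f fA refl) (C.trans (T-Γ (fA · (a · (c · c))) f fA refl)
                 (C.trans (C.sym (T-ϖ^ n (fA · (fA · (a · (c · c)))) (a · (c′ · c′))
                   (trans (*-congˡ (*-cong (*-congʳ (^-unit≈ n)) (*-congʳ (^-unit≈ n)))) (rearrange (proj₁ a) (proj₁ c) ι.⟦ proj₁ f ⟧ (ϖ₀ ^ n)))))
                   (T-square-integral a c′ o (trans eq (*-congʳ (sym (^-unit≈ n)))))))
            where
            rearrange : ∀ a c f w → a * ((w * (f * c)) * (w * (f * c))) ≈ (f * (f * (a * (c * c)))) * (w * w)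
            rearrange = solve 4 (λ a c f w → a :* ((w :* (f :* c)) :* (w :* (f :* c))) := (f :* (f :* (a :* (c :* c)))) :* (w :* w)) refl

          -- Column operations over O remove the lower left entry, and `upper⇒diag` the upper right
          -- one. Making the second diagonal entry 1 divides by the scalar d′, whose square appears
          -- in the determinant.
          normal-form : ∀ (g : Vertex) → ∃₂ λ (a d : A×) → C g (T a) × det (proj₁ g) ≈ proj₁ a * (proj₁ d * proj₁ d)
          normal-form g@(mat a b c d , Ug) = result
            where
            m e : O.Carrier
            m = proj₁ (triangularise a b c d (proj₂ g))
            e = proj₁ (proj₂ (triangularise a b c d (proj₂ g)))
            d′ : A×
            d′ = proj₁ (proj₂ (proj₂ (triangularise a b c d (proj₂ g))))
            d′≈ : proj₁ d′ ≈ d + κ.⟦ m ⟧ * c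
            d′≈ = proj₁ (proj₂ (proj₂ (proj₂ (triangularise a b c d (proj₂ g)))))
            c≈ : c ≈ κ.⟦ e ⟧ * proj₁ d′
            c≈ = proj₂ (proj₂ (proj₂ (proj₂ (triangularise a b c d (proj₂ g)))))
            β α : Carrier
            β = b + κ.⟦ m ⟧ * a
            α = a - κ.⟦ e ⟧ * β
            αd′≈det : α * proj₁ d′ ≈ det (proj₁ g)
            αd′≈det = begin
              (a - κ.⟦ e ⟧ * β) * proj₁ d′               ≈⟨ expand a κ.⟦ e ⟧ β (proj₁ d′) ⟩
              a * proj₁ d′ - β * (κ.⟦ e ⟧ * proj₁ d′)    ≈⟨ +-cong (*-congˡ d′≈) (-‿cong (*-congˡ (sym c≈))) ⟩
              a * (d + κ.⟦ m ⟧ * c) - (b + κ.⟦ m ⟧ * a) * c ≈⟨ cancel a b c d κ.⟦ m ⟧ ⟩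
              a * d - b * c                              ∎
              where
              expand : ∀ a e b d → (a - e * b) * d ≈ a * d - b * (e * d)
              expand = solve 4 (λ a e b d → (a :- e :* b) :* d := a :* d :- b :* (e :* d)) refl
              cancel : ∀ a b c d m → a * (d + m * c) - (b + m * a) * c ≈ a * d - b * c
              cancel = solve 5 (λ a b c d m → a :* (d :+ m :* c) :- (b :+ m :* a) :* c := a :* d :- b :* c) refl
            α× : A×
            α× = α , isUnit A (proj₁ Ug * proj₁ d′) (trans (rearrange (proj₁ Ug) (proj₁ d′) α) (trans (*-congˡ αd′≈det) (proj₁ (proj₂ Ug))))
              where
              rearrange : ∀ u d α → (u * d) * α ≈ u * (α * d)
              rearrange = solve 3 (λ u d α → (u :* d) :* α := u :* (α :* d)) refl
            g₁ g₂ g₃ : Vertex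
            g₁ = Group._∙_ (GL₂ A) g (Unimodular.unipotent A κ.⟦ m ⟧)
            g₂ = Group._∙_ (GL₂ A) g₁ (Unimodular.swap A)
            g₃ = Group._∙_ (GL₂ A) g₂ (Unimodular.unipotent A κ.⟦ O.- e ⟧)
            d⁻ : A×
            d⁻ = AbelianGroup._⁻¹ (Units A) d′
            g₃-swap : proj₁ g₃ *ᴹ mat 0# 1# 1# 0# ≈ᴹ proj₁ (upper α× β d′)
            g₃-swap = ≈ᴹ-trans (*ᴹ-cong (*ᴹ-cong (≈ᴹ-refl {proj₁ g₂}) (mat≈ refl (κ.-‿homo e) refl refl)) (≈ᴹ-refl {mat 0# 1# 1# 0#})) (mat≈
              (entry-e a b κ.⟦ m ⟧ κ.⟦ e ⟧)
              (entry a b κ.⟦ m ⟧ κ.⟦ e ⟧)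
              (trans (entry-e c d κ.⟦ m ⟧ κ.⟦ e ⟧) (trans (+-congˡ (-‿cong (trans (*-congˡ (trans (+-congˡ refl) (sym d′≈))) (sym c≈)))) (-‿inverseʳ c)))
              (trans (entry c d κ.⟦ m ⟧ κ.⟦ e ⟧) (sym d′≈)))
              where
              entry-e : ∀ a b m e →
                ((((a * 1# + b * 0#) * 0# + (a * m + b * 1#) * 1#) * 1# + ((a * 1# + b * 0#) * 1# + (a * m + b * 1#) * 0#) * 0#) * 0# +
                 (((a * 1# + b * 0#) * 0# + (a * m + b * 1#) * 1#) * - e + ((a * 1# + b * 0#) * 1# + (a * m + b * 1#) * 0#) * 1#) * 1#) ≈ a - e * (b + m * a)
              entry-e = solve 4 (λ a b m e →
                ((((a :* con (1 , 0) :+ b :* con (0 , 0)) :* con (0 , 0) :+ (a :* m :+ b :* con (1 , 0)) :* con (1 , 0)) :* con (1 , 0) :+ ((a :* con (1 , 0) :+ b :* con (0 , 0)) :* con (1 , 0) :+ (a :* m :+ b :* con (1 , 0)) :* con (0 , 0)) :* con (0 , 0)) :* con (0 , 0) :+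
                 (((a :* con (1 , 0) :+ b :* con (0 , 0)) :* con (0 , 0) :+ (a :* m :+ b :* con (1 , 0)) :* con (1 , 0)) :* (:- e) :+ ((a :* con (1 , 0) :+ b :* con (0 , 0)) :* con (1 , 0) :+ (a :* m :+ b :* con (1 , 0)) :* con (0 , 0)) :* con (1 , 0)) :* con (1 , 0)) := a :- e :* (b :+ m :* a)) refl
              entry : ∀ a b m e →
                ((((a * 1# + b * 0#) * 0# + (a * m + b * 1#) * 1#) * 1# + ((a * 1# + b * 0#) * 1# + (a * m + b * 1#) * 0#) * 0#) * 1# +
                 (((a * 1# + b * 0#) * 0# + (a * m + b * 1#) * 1#) * - e + ((a * 1# + b * 0#) * 1# + (a * m + b * 1#) * 0#) * 1#) * 0#) ≈ b + m * a
              entry = solve 4 (λ a b m e →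
                ((((a :* con (1 , 0) :+ b :* con (0 , 0)) :* con (0 , 0) :+ (a :* m :+ b :* con (1 , 0)) :* con (1 , 0)) :* con (1 , 0) :+ ((a :* con (1 , 0) :+ b :* con (0 , 0)) :* con (1 , 0) :+ (a :* m :+ b :* con (1 , 0)) :* con (0 , 0)) :* con (0 , 0)) :* con (1 , 0) :+
                 (((a :* con (1 , 0) :+ b :* con (0 , 0)) :* con (0 , 0) :+ (a :* m :+ b :* con (1 , 0)) :* con (1 , 0)) :* (:- e) :+ ((a :* con (1 , 0) :+ b :* con (0 , 0)) :* con (1 , 0) :+ (a :* m :+ b :* con (1 , 0)) :* con (0 , 0)) :* con (1 , 0)) :* con (0 , 0)) := b :+ m :* a) refl
            connected : C g (T (α× · d⁻))
            connected = C.trans (right-unipotent m g g₁ ≈ᴹ-refl) (C.trans (right-swap g₁ g₂ ≈ᴹ-refl) (C.trans (right-unipotent (O.- e) g₂ g₃ ≈ᴹ-refl)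
              (C.trans (right-swap g₃ (upper α× β d′) g₃-swap) (C.trans (upper⇒diag α× β d′) (diag⇒T α× d′)))))
            result : ∃₂ λ (a d : A×) → C g (T a) × det (proj₁ g) ≈ proj₁ a * (proj₁ d * proj₁ d)
            result = α× · d⁻ , d′ , connected , trans (sym αd′≈det) (sym (trans (rearrange α (proj₁ d⁻) (proj₁ d′))
              (trans (*-congʳ (proj₁ (proj₂ (proj₂ d′)))) (*-identityˡ _))))
              where
              rearrange : ∀ α e d → (α * e) * (d * d) ≈ (e * d) * (α * d)
              rearrange = solve 3 (λ α e d → (α :* e) :* (d :* d) := (e :* d) :* (α :* d)) refl

      abstract
        label⇒component : ∀ (g h : Vertex) →
          AbelianGroup._≈_ (mod2 (Adelic.classGroup Γ A O ι κ)) (det (proj₁ g) , proj₂ g) (det (proj₁ h) , proj₂ h) → C g h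
        label⇒component g h (s , γ , k , eq) =
          let a , d , g~a , det-g = normal-form g
              b , e , h~b , det-h = normal-form h
              γA = ι.⟦ proj₁ γ ⟧ , FΓ.isUnit-map (proj₂ γ)
              kA = κ.⟦ proj₁ k ⟧ , FO.isUnit-map (proj₂ k)
              e⁻ = AbelianGroup._⁻¹ (Units A) e
              -- With det g = a d² and det h = b e², equality of the labels reads b = γ k a (d s
              -- e⁻¹)².
              c = (d · s) · e⁻
          in C.trans g~a (C.trans (C.sym (T-square a c)) (C.trans (T-Γ (a · (c · c)) γ γA refl) (C.trans (T-O (γA · (a · (c · c))) k kA refl)
               (C.trans (T-cong (kA · (γA · (a · (c · c)))) b (solve-b (proj₁ a) (proj₁ d) (proj₁ e⁻) (proj₁ e) (proj₁ b) (proj₁ (proj₂ (proj₂ e))) det-g det-h)) (C.sym h~b)))))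
          where
          s₀ γ₀ k₀ : Carrier
          s₀ = proj₁ s
          γ₀ = ι.⟦ proj₁ γ ⟧
          k₀ = κ.⟦ proj₁ k ⟧
          solve-b : ∀ a d e⁻ e b → e⁻ * e ≈ 1# → det (proj₁ g) ≈ a * (d * d) → det (proj₁ h) ≈ b * (e * e) →
            k₀ * (γ₀ * (a * (((d * s₀) * e⁻) * ((d * s₀) * e⁻)))) ≈ b
          solve-b a d e⁻ e b e⁻e≈1 det-g det-h = begin
            k₀ * (γ₀ * (a * (((d * s₀) * e⁻) * ((d * s₀) * e⁻))))   ≈⟨ regroup k₀ γ₀ a d s₀ e⁻ ⟩
            γ₀ * ((a * (d * d)) * (s₀ * s₀)) * k₀ * (e⁻ * e⁻)       ≈⟨ *-congʳ (*-congʳ (*-congˡ (*-congʳ (sym det-g)))) ⟩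
            γ₀ * (det (proj₁ g) * (s₀ * s₀)) * k₀ * (e⁻ * e⁻)       ≈⟨ *-congʳ (trans eq det-h) ⟩
            b * (e * e) * (e⁻ * e⁻)                                 ≈⟨ collect b e e⁻ ⟩
            b * ((e⁻ * e) * (e⁻ * e))                               ≈⟨ *-congˡ (trans (*-cong e⁻e≈1 e⁻e≈1) (*-identityˡ 1#)) ⟩
            b * 1#                                                  ≈⟨ *-identityʳ b ⟩
            b                                                       ∎
            where
            regroup : ∀ k γ a d s e → k * (γ * (a * (((d * s) * e) * ((d * s) * e)))) ≈ γ * ((a * (d * d)) * (s * s)) * k * (e * e)
            regroup = solve 6 (λ k γ a d s e → k :* (γ :* (a :* (((d :* s) :* e) :* ((d :* s) :* e)))) := γ :* ((a :* (d :* d)) :* (s :* s)) :* k :* (e :* e)) refl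
            collect : ∀ b e f → b * (e * e) * (f * f) ≈ b * ((f * e) * (f * e))
            collect = solve 3 (λ b e f → b :* (e :* e) :* (f :* f) := b :* ((f :* e) :* (f :* e))) refl

-- Completions and adeles

module CompletionValuation (em : ExcludedMiddle 0ℓ) {K : FunctionField} where
  open FunctionField K using (F)
  open CommutativeRing (fieldRing F) hiding (zero)
  open RingProperties ring
  open Field em F
  open Valuations em {K}
  open IntegerSolver (fieldRing F) using (solve; _:+_; _:*_; _:-_; :-_; _:=_)

  Completed : Place K → Set
  Completed y = CommutativeRing.Carrier (completion y)

  infix 4 _≤⟦_⟧_

  -- The valuation of the limit of a sequence.
  record _≤⟦_⟧_ (N : ℤ) (y : Place K) (α : ℕ → Carrier) : Set where
    constructor ev
    field
      eventually : ∃[ M ] ∀ n → M ≤ n → N ≤[ y ] α n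
  open _≤⟦_⟧_ public

  record HasOrder (y : Place K) (α : ℕ → Carrier) (m : ℤ) : Set where
    constructor ev
    field
      eventually : ∃[ M ] ∀ n → M ≤ n → Order y (α n) m

  private
    module R (y : Place K) = CommutativeRing (completion y)

    both : ∀ {P Q S : ℕ → Set} → (∀ n → P n → Q n → S n) → (∃[ M ] ∀ n → M ≤ n → P n) → (∃[ M ] ∀ n → M ≤ n → Q n) → ∃[ M ] ∀ n → M ≤ n → S n
    both f (M , p) (N , q) = M ℕ.⊔ N , λ n le → f n (p n (ℕ.m⊔n≤o⇒m≤o M N le)) (q n (ℕ.m⊔n≤o⇒n≤o M N le))

    each : ∀ {P Q : ℕ → Set} → (∀ n → P n → Q n) → (∃[ M ] ∀ n → M ≤ n → P n) → ∃[ M ] ∀ n → M ≤ n → Q n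
    each f (M , p) = M , λ n le → f n (p n le)

    at-some : ∀ {P : ℕ → Set} → (∃[ M ] ∀ n → M ≤ n → P n) → ∃ P
    at-some (M , p) = M , p M ℕ.≤-refl

  module _ {y : Place K} where

    from-Valuation≥ : ∀ {N} {α : Completed y} → Valuation≥ y N α → N ≤⟦ y ⟧ proj₁ α
    from-Valuation≥ p = ev (each (λ _ → ≤v) p)

    to-Valuation≥ : ∀ {N} {α : Completed y} → N ≤⟦ y ⟧ proj₁ α → Valuation≥ y N α
    to-Valuation≥ (ev p) = each (λ _ → [N]≤v) p

    from-HasValuation : ∀ {m} {α : Completed y} → HasValuation y m α → HasOrder y (proj₁ α) m
    from-HasValuation p = ev (each (λ _ → v≡) p)

    from-Null : ∀ {α} → Null y α → ∀ N → ∃[ M ] ∀ n → M ≤ n → N ≤[ y ] α n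
    from-Null p N = each (λ _ → ≤v) (p N)

    to-Null : ∀ {α} → (∀ N → ∃[ M ] ∀ n → M ≤ n → N ≤[ y ] α n) → Null y α
    to-Null p N = each (λ _ → [N]≤v) (p N)

    abstract
      ⟦≤⟧-resp : ∀ {N α β} → Null y (λ n → α n - β n) → N ≤⟦ y ⟧ α → N ≤⟦ y ⟧ β
      ⟦≤⟧-resp {N} α≈β (ev p) = ev (both (λ n q r → ≤-resp (recover _ _) (≤-minus r q)) (from-Null α≈β N) p)
        where
        recover : ∀ a b → a - (a - b) ≈ b
        recover = solve 2 (λ a b → a :- (a :- b) := b) refl

      order-resp : ∀ {m α β} → Null y (λ n → α n - β n) → HasOrder y α m → HasOrder y β m
      order-resp {m} α≈β (ev p) = ev (both (λ n q r → order-cong (recover _ _) (order-+ r (≤-neg q))) (from-Null α≈β (+ 1 ℤ.+ m)) p)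
        where
        recover : ∀ a b → a - (a - b) ≈ b
        recover = solve 2 (λ a b → a :- (a :- b) := b) refl

      ⟦≤⟧-weaken : ∀ {M N α} → M ℤ.≤ N → N ≤⟦ y ⟧ α → M ≤⟦ y ⟧ α
      ⟦≤⟧-weaken M≤N (ev p) = ev (each (λ _ → ≤-weaken M≤N) p)

      ⟦≤⟧-minus : ∀ {N α β} → N ≤⟦ y ⟧ α → N ≤⟦ y ⟧ β → N ≤⟦ y ⟧ (λ n → α n - β n)
      ⟦≤⟧-minus (ev p) (ev q) = ev (both (λ _ → ≤-minus) p q)

      ⟦≤⟧-* : ∀ {M N α β} → M ≤⟦ y ⟧ α → N ≤⟦ y ⟧ β → M ℤ.+ N ≤⟦ y ⟧ (λ n → α n * β n)
      ⟦≤⟧-* (ev p) (ev q) = ev (both (λ _ → ≤-*) p q)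

      hasOrder-* : ∀ {m n α β} → HasOrder y α m → HasOrder y β n → HasOrder y (λ n → α n * β n) (m ℤ.+ n)
      hasOrder-* (ev p) (ev q) = ev (both (λ _ → order-*) p q)

      hasOrder-unique : ∀ {m n α} → HasOrder y α m → HasOrder y α n → m ≡ n
      hasOrder-unique (ev p) (ev q) = let _ , r , s = at-some (both (λ _ → _,_) p q) in order-unique r s

      hasOrder⇒≤ : ∀ {m N α} → HasOrder y α m → N ℤ.≤ m → N ≤⟦ y ⟧ α
      hasOrder⇒≤ (ev p) N≤m = ev (each (λ _ q → order⇒≤ q N≤m) p)

      ≤-hasOrder : ∀ {m N α} → HasOrder y α m → N ≤⟦ y ⟧ α → N ℤ.≤ m
      ≤-hasOrder (ev p) (ev q) = let _ , r , s = at-some (both (λ _ → _,_) p q) in ≤-order r s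

      hasOrder-1 : HasOrder y (λ _ → 1#) (+ 0)
      hasOrder-1 = ev (0 , λ _ _ → order-1#)

      hasOrder-+ : ∀ {m α β} → HasOrder y α m → + 1 ℤ.+ m ≤⟦ y ⟧ β → HasOrder y (λ n → α n + β n) m
      hasOrder-+ (ev p) (ev q) = ev (both (λ _ → order-+) p q)

      embed-order : ∀ {f m} → Order y f m → HasOrder y (λ _ → f) m
      embed-order p = ev (0 , λ _ _ → p)

      order-embed : ∀ {f m} → HasOrder y (λ _ → f) m → Order y f m
      order-embed (ev p) = proj₂ (at-some p)

      embed-≤ : ∀ {f N} → N ≤[ y ] f → N ≤⟦ y ⟧ (λ _ → f)
      embed-≤ p = ev (0 , λ _ _ → p)

      approximation : ∀ (α : Completed y) N → ∃[ a ] ∃[ M ] ∀ n → M ≤ n → N ≤[ y ] proj₁ α n - a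
      approximation (a , cauchy) N = let M , close = cauchy N in a M , M , λ n M≤n → ≤v (close n M M≤n ℕ.≤-refl)

      -- A Cauchy sequence with terms of order < N beyond the point where its
      -- terms differ by elements of order ≥ N has constant order.
      order-or-≤ : ∀ (α : Completed y) N → N ≤⟦ y ⟧ proj₁ α ⊎ ∃[ m ] HasOrder y (proj₁ α) m × m ℤ.< N
      order-or-≤ α@(a , cauchy) N = case em
        where
        M : ℕ
        M = proj₁ (cauchy N)
        close : ∀ m n → M ≤ m → M ≤ n → N ≤[ y ] a m - a n
        close m n M≤m M≤n = ≤v (proj₂ (cauchy N) m n M≤m M≤n)
        recover : ∀ a b → a + (b - a) ≈ b
        recover = solve 2 (λ a b → a :+ (b :- a) := b) refl
        case : Dec (N ≤[ y ] a M) → N ≤⟦ y ⟧ proj₁ α ⊎ ∃[ m ] HasOrder y (proj₁ α) m × m ℤ.< N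
        case (yes N≤aM) = inj₁ (ev (M , λ n M≤n → ≤-resp (recover _ _) (≤-+ N≤aM (close n M M≤n ℕ.≤-refl))))
        case (no N≰aM) =
          let m , p , m<N = ≰⇒order N≰aM
          in inj₂ (m , ev (M , λ n M≤n → order-cong (recover _ _) (order-+ p (≤-weaken (ℤ.i<j⇒suc[i]≤j m<N) (close n M M≤n ℕ.≤-refl)))) , m<N)

      ⟦≤⟧-bounded-below : ∀ (α : Completed y) → ∃[ B ] ℤ.- (+ B) ≤⟦ y ⟧ proj₁ α
      ⟦≤⟧-bounded-below α = case (order-or-≤ α (+ 0))
        where
        case : + 0 ≤⟦ y ⟧ proj₁ α ⊎ (∃[ m ] HasOrder y (proj₁ α) m × m ℤ.< + 0) → ∃[ B ] ℤ.- (+ B) ≤⟦ y ⟧ proj₁ α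
        case (inj₁ p) = 0 , p
        case (inj₂ (-[1+ n ] , p , -<+)) = suc n , hasOrder⇒≤ p ℤ.≤-refl
        case (inj₂ (+ n , p , ℤ.+<+ ()))

      infinite-order⇒0 : ∀ {α : Completed y} → (∀ N → N ≤⟦ y ⟧ proj₁ α) → R._≈_ y α (R.0# y)
      infinite-order⇒0 {α} p = to-Null (λ N → each (λ n → ≤-resp (sym (trans (+-congˡ -0#≈0#) (+-identityʳ (proj₁ α n))))) (eventually (p N)))

      -- If the sequence never settles at one order, the first alternative of `order-or-≤` holds for
      -- every N, so it tends to 0.
      zero-or-order : ∀ (α : Completed y) → R._≈_ y α (R.0# y) ⊎ ∃[ m ] HasOrder y (proj₁ α) m
      zero-or-order α = case em
        where
        case : Dec (∃[ m ] HasOrder y (proj₁ α) m) → R._≈_ y α (R.0# y) ⊎ ∃[ m ] HasOrder y (proj₁ α) m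
        case (yes found) = inj₂ found
        case (no none) = inj₁ (infinite-order⇒0 {α} (λ N → bound N (order-or-≤ α N)))
          where
          bound : ∀ N → N ≤⟦ y ⟧ proj₁ α ⊎ (∃[ m ] HasOrder y (proj₁ α) m × m ℤ.< N) → N ≤⟦ y ⟧ proj₁ α
          bound N (inj₁ p) = p
          bound N (inj₂ (m , p , _)) = ⊥-elim (none (m , p))

      zero⇒≤ : ∀ {α : Completed y} {N} → R._≈_ y α (R.0# y) → N ≤⟦ y ⟧ proj₁ α
      zero⇒≤ {α} {N} α≈0 = ev (each (λ n → ≤-resp (trans (+-congˡ -0#≈0#) (+-identityʳ (proj₁ α n)))) (from-Null α≈0 N))

      hasOrder⇒≉0 : ∀ {α : Completed y} {m} → HasOrder y (proj₁ α) m → ¬ R._≈_ y α (R.0# y)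
      hasOrder⇒≉0 {α} {m} p α≈0 = ℤ.<-irrefl ≡.refl (ℤ.suc[i]≤j⇒i<j (≤-hasOrder p (zero⇒≤ {α} {+ 1 ℤ.+ m} α≈0)))

      unit⇒order : ∀ {α : Completed y} → IsUnit (completion y) α → ∃[ m ] HasOrder y (proj₁ α) m
      unit⇒order {α} (β , βα≈1 , _) = case (zero-or-order α)
        where
        module S = CommutativeRing (completion y)
        case : R._≈_ y α (R.0# y) ⊎ (∃[ m ] HasOrder y (proj₁ α) m) → ∃[ m ] HasOrder y (proj₁ α) m
        case (inj₂ found) = found
        case (inj₁ α≈0) = ⊥-elim (hasOrder⇒≉0 {S.1#} hasOrder-1 (S.trans {S.1#} {β S.* α} {S.0#} (S.sym {β S.* α} {S.1#} βα≈1)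
          (S.trans {β S.* α} {β S.* S.0#} {S.0#} (S.*-congˡ {β} {α} {S.0#} α≈0) (S.zeroʳ β))))

      inverse-order : ∀ {α β : Completed y} {m} → R._≈_ y (R._*_ y β α) (R.1# y) → HasOrder y (proj₁ α) m → HasOrder y (proj₁ β) (ℤ.- m)
      inverse-order {α} {β} {m} βα≈1 p =
        let n , q = unit⇒order {β} (isUnit (completion y) {β} α (R.trans y {R._*_ y α β} {R._*_ y β α} {R.1# y} (R.*-comm y α β) βα≈1))
        in ≡.subst (HasOrder y (proj₁ β)) (negate n m (hasOrder-unique (order-resp βα≈1 (hasOrder-* q p)) hasOrder-1)) q
        where
        negate : ∀ n m → n ℤ.+ m ≡ + 0 → n ≡ ℤ.- m
        negate n m eq = ≡.trans (expand n m) (≡.trans (≡.cong (ℤ._- m) eq) (ℤ.+-identityˡ (ℤ.- m)))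
          where
          expand : ∀ n m → n ≡ n ℤ.+ m ℤ.- m
          expand = ℤ.solve-∀

      private
        invert : ∀ a → Dec (a ≈ 0#) → Carrier
        invert a (yes _) = 0#
        invert a (no a≉0) = proj₁ (inverse a≉0)

        invert-* : ∀ {a m} d → Order y a m → invert a d * a ≈ 1#
        invert-* (yes a≈0) p = ⊥-elim (order⇒nonzero p a≈0)
        invert-* (no a≉0) p = proj₂ (inverse a≉0)

      -- From some point on the terms have constant order and can be inverted one by one; `invert`
      -- takes the value `0#` at the earlier terms that vanish.
      order⇒unit : ∀ {α : Completed y} {m} → HasOrder y (proj₁ α) m → IsUnit (completion y) α
      order⇒unit {α@(a , cauchy)} {m} (ev (M , p)) = isUnit (completion y) {α} α⁻¹ (to-Null (λ N → M , λ n M≤n → ≤-0# (x≈y⇒x∙y⁻¹≈ε (invert-* em (p n M≤n)))))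
        where
        b : ℕ → Carrier
        b n = invert (a n) em
        order-b : ∀ n → M ≤ n → Order y (b n) (ℤ.- m)
        order-b n M≤n = order-inverse (invert-* em (p n M≤n)) (p n M≤n)
        -- b i - b j = b i b j (a j - a i)
        identity : ∀ bᵢ bⱼ aᵢ aⱼ → bᵢ * aᵢ ≈ 1# → bⱼ * aⱼ ≈ 1# → (bᵢ * bⱼ) * (aⱼ - aᵢ) ≈ bᵢ - bⱼ
        identity bᵢ bⱼ aᵢ aⱼ p q = trans (expand bᵢ bⱼ aᵢ aⱼ) (+-cong (trans (*-congʳ q) (*-identityˡ bᵢ)) (-‿cong (trans (*-congʳ p) (*-identityˡ bⱼ))))
          where
          expand : ∀ b c a d → (b * c) * (d - a) ≈ (c * d) * b - (b * a) * c
          expand = solve 4 (λ b c a d → (b :* c) :* (d :- a) := (c :* d) :* b :- (b :* a) :* c) refl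
        b-cauchy : Cauchy y b
        b-cauchy N =
          -- In bᵢ - bⱼ = bᵢ bⱼ (aⱼ - aᵢ) the factor bᵢ bⱼ has order -2 m, which the precision N + 2
          -- m makes up for.
          let M′ , close = cauchy (N ℤ.+ m ℤ.+ m)
          in M ℕ.⊔ M′ , λ i j le le′ →
            let pᵢ = p i (ℕ.m⊔n≤o⇒m≤o M M′ le)
                pⱼ = p j (ℕ.m⊔n≤o⇒m≤o M M′ le′)
            in [N]≤v (≤-resp (identity (b i) (b j) (a i) (a j) (invert-* em pᵢ) (invert-* em pⱼ))
                 (≡.subst (_≤[ y ] (b i * b j) * (a j - a i)) (cancel m N)
                   (≤-* (order⇒≤ (order-* (order-b i (ℕ.m⊔n≤o⇒m≤o M M′ le)) (order-b j (ℕ.m⊔n≤o⇒m≤o M M′ le′))) ℤ.≤-refl)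
                     (≤v (close j i (ℕ.m⊔n≤o⇒n≤o M M′ le′) (ℕ.m⊔n≤o⇒n≤o M M′ le))))))
          where
          cancel : ∀ m N → (ℤ.- m ℤ.+ ℤ.- m) ℤ.+ (N ℤ.+ m ℤ.+ m) ≡ N
          cancel = ℤ.solve-∀
        α⁻¹ : Completed y
        α⁻¹ = b , b-cauchy

  module _ {y z : Place K} (y≈z : y ≈ₚ z) where

    abstract
      transport-≤ : ∀ {N α} → N ≤⟦ z ⟧ α → N ≤⟦ y ⟧ α
      transport-≤ (ev p) = ev (each (λ _ → ≤-at {z} {y} (≈ₚ-sym {y = y} {z} y≈z)) p)

      transport-order : ∀ {m α} → HasOrder z α m → HasOrder y α m
      transport-order (ev p) = ev (each (λ _ → order-at {z} {y} (≈ₚ-sym {y = y} {z} y≈z)) p)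

module Adeles (em : ExcludedMiddle 0ℓ) (K : FunctionField) where
  open FunctionField K using (F)
  open CommutativeRing (fieldRing F) hiding (zero)
  open RingProperties ring
  open Field em F
  open Valuations em {K}
  open Divisors em K using (poles)
  open CompletionValuation em {K}
  private
    module R (y : Place K) = CommutativeRing (completion y)
    module A = CommutativeRing (𝔸 K)

  infix 9 _⟪_⟫

  -- A sequence which represents the component at y.
  _⟪_⟫ : A.Carrier → Place K → ℕ → Carrier
  a ⟪ y ⟫ = proj₁ (proj₁ a y)

  embedding : ∀ y → Carrier → Completed y
  embedding y = RingHomomorphism.⟦_⟧ (embed y)

  abstract
    adele-≤-at : ∀ (a : A.Carrier) {y z N} → y ≈ₚ z → N ≤⟦ z ⟧ a ⟪ z ⟫ → N ≤⟦ y ⟧ a ⟪ y ⟫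
    adele-≤-at a {y} {z} y≈z p = ⟦≤⟧-resp (R.sym y {proj₁ a y} {transport K y z y≈z (proj₁ a z)} (proj₁ (proj₂ a) {y} {z} y≈z)) (transport-≤ {y} {z} y≈z p)

    adele-order-at : ∀ (a : A.Carrier) {y z m} → y ≈ₚ z → HasOrder z (a ⟪ z ⟫) m → HasOrder y (a ⟪ y ⟫) m
    adele-order-at a {y} {z} y≈z p = order-resp (R.sym y {proj₁ a y} {transport K y z y≈z (proj₁ a z)} (proj₁ (proj₂ a) {y} {z} y≈z)) (transport-order {y} {z} y≈z p)

    poles-of : ∀ (a : A.Carrier) → ∃[ S ] ∀ y → ¬ y ∈ₚ S → + 0 ≤⟦ y ⟧ a ⟪ y ⟫
    poles-of (a , _ , S , integral) = S , λ y y∉S → from-Valuation≥ {α = a y} (integral y y∉S)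

    adele-bounded-below : ∀ (a : A.Carrier) S → ∃[ B ] ∀ y → y ∈ₚ S → ℤ.- (+ B) ≤⟦ y ⟧ a ⟪ y ⟫
    adele-bounded-below a [] = 0 , λ _ ()
    adele-bounded-below a (z ∷ S) =
      let B , p = ⟦≤⟧-bounded-below {z} (proj₁ a z)
          C , q = adele-bounded-below a S
      in B ℕ.⊔ C , λ where
        y (here y≈z) → ⟦≤⟧-weaken (ℤ.neg-mono-≤ (+≤+ (ℕ.m≤m⊔n B C))) (adele-≤-at a {y} {z} y≈z p)
        y (there y∈S) → ⟦≤⟧-weaken (ℤ.neg-mono-≤ (+≤+ (ℕ.m≤n⊔m B C))) (q y y∈S)

    from-integral : ∀ (o : CommutativeRing.Carrier (𝒪𝔸 K)) y → + 0 ≤⟦ y ⟧ proj₁ o ⟪ y ⟫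
    from-integral ((a , _) , integral) y = from-Valuation≥ {α = a y} (integral y)

    embedding-cong : ∀ {f g} y → f ≈ g → R._≈_ y (embedding y f) (embedding y g)
    embedding-cong y f≈g = RingHomomorphism.⟦⟧-cong (embed y) f≈g

  to-integral : ∀ (a : A.Carrier) → (∀ y → + 0 ≤⟦ y ⟧ a ⟪ y ⟫) → CommutativeRing.Carrier (𝒪𝔸 K)
  to-integral a integral = a , λ y → to-Valuation≥ {α = proj₁ a y} (integral y)

  principal : Carrier → CommutativeRing.Carrier (F⊂𝔸 K)
  principal f = ((λ y → embedding y f) , (λ {y} {z} _ → R.refl y {embedding y f}) ,
    proj₁ (poles f) , λ y y∉ → to-Valuation≥ {y = y} {α = embedding y f} (embed-≤ (proj₂ (poles f) y y∉))) , f , λ y → R.refl y {embedding y f}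

  principal-unit : ∀ {f} → f ≉ 0# → IsUnit (F⊂𝔸 K) (principal f)
  principal-unit {f} f≉0 = isUnit (F⊂𝔸 K) {principal f} (principal (proj₁ (inverse f≉0))) (λ y → embedding-cong y (proj₂ (inverse f≉0)))

  abstract
    -- The local inverses form an adele: they are coherent because inverses are unique, and integral
    -- outside S because the orders of a are not positive there.
    order⇒idele : ∀ (a : A.Carrier) → (∀ y → ∃[ m ] HasOrder y (a ⟪ y ⟫) m) →
      ∀ S → (∀ y m → ¬ y ∈ₚ S → HasOrder y (a ⟪ y ⟫) m → m ℤ.≤ + 0) → IsUnit (𝔸 K) a
    order⇒idele a@(a₀ , coherent , _) orders S nonpositive = isUnit (𝔸 K) {a} a⁻¹ (λ y → inverseˡ y)
      where
      b : ∀ y → Completed y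
      b y = proj₁ (order⇒unit {α = a₀ y} (proj₂ (orders y)))
      inverseˡ : ∀ y → R._≈_ y (R._*_ y (b y) (a₀ y)) (R.1# y)
      inverseˡ y = proj₁ (proj₂ (order⇒unit {α = a₀ y} (proj₂ (orders y))))
      unique : ∀ y β γ → R._≈_ y (R._*_ y β (a₀ y)) (R.1# y) → R._≈_ y (R._*_ y γ (a₀ y)) (R.1# y) → R._≈_ y β γ
      unique y β γ p q = begin
        β                  ≈⟨ S.sym {β S.* S.1#} {β} (S.*-identityʳ β) ⟩
        β S.* S.1#         ≈⟨ S.*-congˡ {β} {S.1#} {γ S.* a₀ y} (S.sym {γ S.* a₀ y} {S.1#} q) ⟩
        β S.* (γ S.* a₀ y) ≈⟨ swap β γ (a₀ y) ⟩
        γ S.* (β S.* a₀ y) ≈⟨ S.*-congˡ {γ} {β S.* a₀ y} {S.1#} p ⟩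
        γ S.* S.1#         ≈⟨ S.*-identityʳ γ ⟩
        γ                  ∎
        where
        module S = CommutativeRing (completion y)
        open SetoidReasoning S.setoid
        swap : ∀ β γ α → β S.* (γ S.* α) S.≈ γ S.* (β S.* α)
        swap β γ α = S.trans {β S.* (γ S.* α)} {(β S.* γ) S.* α} {γ S.* (β S.* α)} (S.sym {(β S.* γ) S.* α} {β S.* (γ S.* α)} (S.*-assoc β γ α))
          (S.trans {(β S.* γ) S.* α} {(γ S.* β) S.* α} {γ S.* (β S.* α)} (S.*-congʳ {α} {β S.* γ} {γ S.* β} (S.*-comm β γ)) (S.*-assoc γ β α))
      transported : ∀ y z (e : y ≈ₚ z) → R._≈_ y (R._*_ y (transport K y z e (b z)) (a₀ y)) (R.1# y)
      transported y z e = S.trans {tb S.* a₀ y} {tb S.* ta} {S.1#} (S.*-congˡ {tb} {a₀ y} {ta} (coherent {y} {z} e))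
        (λ N → proj₁ (inverseˡ z N) , λ n le → ≡.subst ([ N ] ≤∞_) (≡.sym (e _)) (proj₂ (inverseˡ z N) n le))
        where
        module S = CommutativeRing (completion y)
        tb ta : Completed y
        tb = transport K y z e (b z)
        ta = transport K y z e (a₀ z)
      a⁻¹ : A.Carrier
      a⁻¹ = b , (λ {y} {z} e → unique y (b y) (transport K y z e (b z)) (inverseˡ y) (transported y z e)) ,
        S , λ y y∉S → to-Valuation≥ {α = b y} (hasOrder⇒≤ (inverse-order {α = a₀ y} {b y} (inverseˡ y) (proj₂ (orders y))) (ℤ.neg-mono-≤ (nonpositive y _ y∉S (proj₂ (orders y)))))

    idele-order : ∀ ((a , _) : AbelianGroup.Carrier (Units (𝔸 K))) y → ∃[ m ] HasOrder y (a ⟪ y ⟫) m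
    idele-order (a , b , p , q) y = unit⇒order {α = proj₁ a y} (proj₁ b y , p y , q y)

    idele-inverse-order : ∀ (a : AbelianGroup.Carrier (Units (𝔸 K))) {y m} → HasOrder y (proj₁ a ⟪ y ⟫) m →
      HasOrder y (proj₁ (AbelianGroup._⁻¹ (Units (𝔸 K)) a) ⟪ y ⟫) (ℤ.- m)
    idele-inverse-order (a , b , p , q) {y} r = inverse-order {α = proj₁ a y} {proj₁ b y} (p y) r

  module Approximation𝔸 (x : Place K) where
    open StrongApproximation em K x
    open PolesAt em K x
    open Divisors em K
    open RiemannRoch em K
    open IntegerSolver (fieldRing F) using (solve; _:+_; _:-_; :-_; _:=_)

    abstract
      -- At the finitely many places where a or ρ may fail to be integral, f approximates a closely
      -- enough to outweigh the poles of ρ. At all other places off x each of a, f and ρ is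
      -- integral.
      strong-approximation-𝔸 : ∀ (a ρ : A.Carrier) → ∃[ f ] ∀ y → ¬ y ≈ₚ x → + 0 ≤⟦ y ⟧ (λ n → ((a ⟪ y ⟫) n - f) * (ρ ⟪ y ⟫) n)
      strong-approximation-𝔸 a ρ =
        let S , a-integral = poles-of a
            S′ , ρ-integral = poles-of ρ
            n , ρ-bounded = adele-bounded-below ρ (S ++ S′)
            f , close , f-integral = strong-approximation (S ++ S′) n (target n) (coherent n)
        in f , λ y y≉x → case S S′ n f y y≉x (a-integral y) (ρ-integral y) (ρ-bounded y) (close y y≉x) (f-integral y y≉x) em
        where
        target : ℕ → Place K → Carrier
        target n y = proj₁ (approximation {y} (proj₁ a y) (+ n))
        coherent : ∀ n y z → y ≈ₚ z → + n ≤[ y ] target n y - target n z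
        coherent n y z y≈z =
          let M , p = proj₂ (approximation {y} (proj₁ a y) (+ n))
              M′ , q = proj₂ (approximation {z} (proj₁ a z) (+ n))
              M″ , r = from-Null {y} (proj₁ (proj₂ a) {y} {z} y≈z) (+ n)
              N = M ℕ.⊔ (M′ ℕ.⊔ M″)
          in ≤-resp (telescope (target n y) (target n z) ((a ⟪ y ⟫) N) ((a ⟪ z ⟫) N))
               (≤-+ (≤-+ (≤-swap (p N (ℕ.m≤m⊔n M _))) (r N (ℕ.≤-trans (ℕ.m≤n⊔m M′ M″) (ℕ.m≤n⊔m M (M′ ℕ.⊔ M″)))))
                 (≤-at {z} {y} (≈ₚ-sym {y = y} {z} y≈z) (q N (ℕ.≤-trans (ℕ.m≤m⊔n M′ M″) (ℕ.m≤n⊔m M (M′ ℕ.⊔ M″))))))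
          where
          telescope : ∀ t u a b → ((t - a) + (a - b)) + (b - u) ≈ t - u
          telescope = solve 4 (λ t u a b → ((t :- a) :+ (a :- b)) :+ (b :- u) := t :- u) refl
        case : ∀ S S′ n f y → ¬ y ≈ₚ x → (¬ y ∈ₚ S → + 0 ≤⟦ y ⟧ a ⟪ y ⟫) → (¬ y ∈ₚ S′ → + 0 ≤⟦ y ⟧ ρ ⟪ y ⟫) → (y ∈ₚ S ++ S′ → ℤ.- (+ n) ≤⟦ y ⟧ ρ ⟪ y ⟫) →
          (y ∈ₚ S ++ S′ → + n ≤[ y ] f - target n y) → (¬ y ∈ₚ S ++ S′ → + 0 ≤[ y ] f) → Dec (y ∈ₚ S ++ S′) →
          + 0 ≤⟦ y ⟧ (λ n → ((a ⟪ y ⟫) n - f) * (ρ ⟪ y ⟫) n)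
        case S S′ n f y y≉x a-integral ρ-integral ρ-bounded close f-integral (yes y∈) =
          ≡.subst (λ m → m ≤⟦ y ⟧ (λ n → ((a ⟪ y ⟫) n - f) * (ρ ⟪ y ⟫) n)) (ℤ.+-inverseʳ (+ n)) (⟦≤⟧-* near (ρ-bounded y∈))
          where
          near : + n ≤⟦ y ⟧ (λ k → (a ⟪ y ⟫) k - f)
          near = let M , p = proj₂ (approximation {y} (proj₁ a y) (+ n))
            in ev (M , λ k M≤k → ≤-resp (telescope ((a ⟪ y ⟫) k) (target n y) f) (≤-+ (p k M≤k) (≤-swap (close y∈))))
            where
            telescope : ∀ x b c → (x - b) + (b - c) ≈ x - c
            telescope = solve 3 (λ x b c → (x :- b) :+ (b :- c) := x :- c) refl
        case S S′ n f y y≉x a-integral ρ-integral ρ-bounded close f-integral (no y∉) =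
          ⟦≤⟧-* (⟦≤⟧-minus (a-integral (λ y∈S → y∉ (++⁺ˡ y∈S))) (embed-≤ (f-integral y∉))) (ρ-integral (λ y∈S′ → y∉ (++⁺ʳ S y∈S′)))

      clear-poles : ∀ (a : A.Carrier) → ∃[ f ] f ≉ 0# × (∀ y → ¬ y ≈ₚ x → + 0 ≤⟦ y ⟧ (λ n → f * (a ⟪ y ⟫) n))
      clear-poles a =
        let S , integral = poles-of a
            B , bounded = adele-bounded-below a S
            _ , f , f≉0 , Lf = vanishing (copies B S)
        in f , f≉0 , λ y y≉x → case S B f y (integral y) (bounded y) (L-away {z = y} Lf y≉x) em
        where
        case : ∀ S B f y → (¬ y ∈ₚ S → + 0 ≤⟦ y ⟧ a ⟪ y ⟫) → (y ∈ₚ S → ℤ.- (+ B) ≤⟦ y ⟧ a ⟪ y ⟫) → + mult (copies B S) y ≤[ y ] f → Dec (y ∈ₚ S) → + 0 ≤⟦ y ⟧ (λ n → f * (a ⟪ y ⟫) n)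
        case S B f y integral bounded vanishes (no y∉S) = ⟦≤⟧-* (embed-≤ (≤-weaken (+≤+ z≤n) vanishes)) (integral y∉S)
        case S B f y integral bounded vanishes (yes y∈S) = ≡.subst (λ m → m ≤⟦ y ⟧ (λ n → f * (a ⟪ y ⟫) n)) (ℤ.+-inverseʳ (+ B))
          (⟦≤⟧-* (embed-≤ (≤-weaken (+≤+ (ℕ.≤-trans (ℕ.m≤m*n B (mult S y) ⦃ ℕ.>-nonZero (mult-∈ {y} {S} y∈S) ⦄) (ℕ.≤-reflexive (≡.sym (mult-copies y B S))))) vanishes)) (bounded y∈S))

module Identities (R : Ring) where
  open CommutativeRing R
  open IntegerSolver R using (solve; _:*_; _:+_; _:-_; _:=_; con)

  abstract
    x≈x+0y : ∀ x y → x ≈ x + 0# * y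
    x≈x+0y = solve 2 (λ x y → x := x :+ con (0 , 0) :* y) refl

    y+x≈x+1y : ∀ x y → y + x ≈ x + 1# * y
    y+x≈x+1y = solve 2 (λ x y → y :+ x := x :+ con (1 , 0) :* y) refl

    x+y-y≈x : ∀ x y → (x + y) - y ≈ x
    x+y-y≈x = solve 2 (λ x y → (x :+ y) :- y := x) refl

    x0-y0≈0 : ∀ x y → x * 0# - y * 0# ≈ 0#
    x0-y0≈0 = solve 2 (λ x y → x :* con (0 , 0) :- y :* con (0 , 0) := con (0 , 0)) refl

module LocalUniformiser (em : ExcludedMiddle 0ℓ) {K : FunctionField} (x : Place K) (π : Uniformiser x) where
  open FunctionField K using (F)
  open CommutativeRing (fieldRing F) using (Carrier; _≈_; 0#; 1#; _+_; _*_; _-_)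
  open Valuations em {K}
  open CompletionValuation em {K}
  open Adeles em K
  open Approximation𝔸 x
  private
    module R (y : Place K) = CommutativeRing (completion y)
    module A = CommutativeRing (𝔸 K)
  open Exponentiation A.semiring using (_^_)

  ϖ : AbelianGroup.Carrier (Units (𝔸 K))
  ϖ = localIdele em K x (proj₁ π)

  abstract
    ϖ-order-at-x : ∀ {y} → y ≈ₚ x → HasOrder y (proj₁ ϖ ⟪ y ⟫) (+ 1)
    ϖ-order-at-x {y} y≈x = case em
      where
      case : (d : Dec (y ≈ₚ x)) → HasOrder y (proj₁ (replaceIf em K x y d (proj₁ (proj₁ π)) (R.1# y))) (+ 1)
      case (yes e) = transport-order {y} {x} e (from-HasValuation {x} {α = proj₁ (proj₁ π)} (proj₂ π))
      case (no y≉x) = ⊥-elim (y≉x y≈x)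

    ϖ-order-off-x : ∀ {y} → ¬ y ≈ₚ x → HasOrder y (proj₁ ϖ ⟪ y ⟫) (+ 0)
    ϖ-order-off-x {y} y≉x = case em
      where
      case : (d : Dec (y ≈ₚ x)) → HasOrder y (proj₁ (replaceIf em K x y d (proj₁ (proj₁ π)) (R.1# y))) (+ 0)
      case (yes e) = ⊥-elim (y≉x e)
      case (no _) = hasOrder-1 {y}

    power-order : ∀ (a : A.Carrier) {y m} n → HasOrder y (a ⟪ y ⟫) m → HasOrder y ((a ^ n) ⟪ y ⟫) (+ n ℤ.* m)
    power-order a {y} zero p = hasOrder-1 {y}
    power-order a {y} {m} (suc n) p = ≡.subst (HasOrder y ((a ^ suc n) ⟪ y ⟫)) (lemma m (+ n)) (hasOrder-* p (power-order a n p))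
      where
      lemma : ∀ m n → m ℤ.+ n ℤ.* m ≡ (+ 1 ℤ.+ n) ℤ.* m
      lemma = ℤ.solve-∀

    -- Only a pole at x is left, and its order bounds the number of factors ϖ that are needed.
    integral-after-ϖ : ∀ (a : A.Carrier) → (∀ y → ¬ y ≈ₚ x → + 0 ≤⟦ y ⟧ a ⟪ y ⟫) → ∃[ n ] ∀ y → + 0 ≤⟦ y ⟧ (proj₁ ϖ ^ n A.* a) ⟪ y ⟫
    integral-after-ϖ a integral =
      let B , bounded = ⟦≤⟧-bounded-below {x} (proj₁ a x)
      in B , λ y → case B bounded y em
      where
      case : ∀ B → ℤ.- (+ B) ≤⟦ x ⟧ a ⟪ x ⟫ → ∀ y → Dec (y ≈ₚ x) → + 0 ≤⟦ y ⟧ (proj₁ ϖ ^ B A.* a) ⟪ y ⟫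
      case B bounded y (yes y≈x) = ≡.subst (λ m → m ≤⟦ y ⟧ (proj₁ ϖ ^ B A.* a) ⟪ y ⟫)
        (≡.trans (≡.cong (ℤ._- + B) (ℤ.*-identityʳ (+ B))) (ℤ.+-inverseʳ (+ B)))
        (⟦≤⟧-* (hasOrder⇒≤ (power-order (proj₁ ϖ) B (ϖ-order-at-x {y} y≈x)) ℤ.≤-refl) (adele-≤-at a {y} {x} y≈x bounded))
      case B bounded y (no y≉x) = ⟦≤⟧-* {α = (proj₁ ϖ ^ B) ⟪ y ⟫} {a ⟪ y ⟫}
        (hasOrder⇒≤ (power-order (proj₁ ϖ) B (ϖ-order-off-x {y} y≉x)) (ℤ.≤-reflexive (≡.sym (ℤ.*-zeroʳ (+ B))))) (integral y y≉x)

    strong-approximation-F : ∀ (a ρ : A.Carrier) → Σ[ f ∈ CommutativeRing.Carrier (F⊂𝔸 K) ] ∃[ n ] Σ[ o ∈ CommutativeRing.Carrier (𝒪𝔸 K) ]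
      proj₁ o A.≈ proj₁ ϖ ^ n A.* ((a A.- proj₁ f) A.* ρ)
    strong-approximation-F a ρ =
      let f , integral = strong-approximation-𝔸 a ρ
          n , after = integral-after-ϖ ((a A.- proj₁ (principal f)) A.* ρ) integral
          b = proj₁ ϖ ^ n A.* ((a A.- proj₁ (principal f)) A.* ρ)
      in principal f , n , to-integral b after , A.refl {b}

    clear-denominators : ∀ (c : AbelianGroup.Carrier (Units (𝔸 K))) → Σ[ f ∈ AbelianGroup.Carrier (Units (F⊂𝔸 K)) ] ∃[ n ] Σ[ o ∈ CommutativeRing.Carrier (𝒪𝔸 K) ]
      proj₁ o A.≈ proj₁ ϖ ^ n A.* (proj₁ (proj₁ f) A.* proj₁ c)
    clear-denominators (c , _) =
      let f , f≉0 , integral = clear-poles c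
          n , after = integral-after-ϖ (proj₁ (principal f) A.* c) integral
          b = proj₁ ϖ ^ n A.* (proj₁ (principal f) A.* c)
      in (principal f , principal-unit f≉0) , n , to-integral b after , A.refl {b}

  module Triangularise (a b c d : A.Carrier) (unit : IsUnit (𝔸 K) (a A.* d A.- b A.* c)) where

    -- v(d) ≤ v(c) at y; the adele m is 0 at these places and 1 elsewhere, so
    -- that d + m c has the order min(v(c), v(d)) everywhere.
    Dominates : Place K → Set
    Dominates y = ∃[ N ] N ≤⟦ y ⟧ c ⟪ y ⟫ × ¬ + 1 ℤ.+ N ≤⟦ y ⟧ d ⟪ y ⟫

    choose : ∀ y → Dec (Dominates y) → Completed y
    choose y (yes _) = R.0# y
    choose y (no _) = R.1# y

    abstract
      dominates-at : ∀ {y z} → y ≈ₚ z → Dominates y → Dominates z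
      dominates-at {y} {z} y≈z (N , p , q) = N , adele-≤-at c {z} {y} (≈ₚ-sym {y = y} {z} y≈z) p , λ r → q (adele-≤-at d {y} {z} y≈z r)

      choose-coherent : ∀ {y z} (e : y ≈ₚ z) (p : Dec (Dominates y)) (q : Dec (Dominates z)) → R._≈_ y (choose y p) (transport K y z e (choose z q))
      choose-coherent {y} e (yes _) (yes _) = R.refl y {R.0# y}
      choose-coherent {y} e (no _) (no _) = R.refl y {R.1# y}
      choose-coherent {y} {z} e (yes p) (no q) = ⊥-elim (q (dominates-at {y} {z} e p))
      choose-coherent {y} {z} e (no p) (yes q) = ⊥-elim (p (dominates-at {z} {y} (≈ₚ-sym {y = y} {z} e) q))

      choose-integral : ∀ y (p : Dec (Dominates y)) → + 0 ≤⟦ y ⟧ proj₁ (choose y p)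
      choose-integral y (yes _) = zero⇒≤ {y} {R.0# y} (R.refl y {R.0# y})
      choose-integral y (no _) = hasOrder⇒≤ (hasOrder-1 {y}) ℤ.≤-refl

    m : A.Carrier
    m = (λ y → choose y em) , (λ {y} {z} e → choose-coherent {y} {z} e em em) , [] , λ y _ → to-Valuation≥ {y} {α = choose y em} (choose-integral y em)

    mᴼ : CommutativeRing.Carrier (𝒪𝔸 K)
    mᴼ = to-integral m (λ y → choose-integral y em)

    d′ : A.Carrier
    d′ = d A.+ m A.* c

    abstract
      c-or-d-nonzero : ∀ y → R._≈_ y (proj₁ c y) (R.0# y) → R._≈_ y (proj₁ d y) (R.0# y) → ⊥
      c-or-d-nonzero y c≈0 d≈0 =
        let k , p = unit⇒order {y} {proj₁ (a A.* d A.- b A.* c) y} (proj₁ (proj₁ unit) y , proj₁ (proj₂ unit) y , proj₂ (proj₂ unit) y)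
        in hasOrder⇒≉0 {y} {proj₁ (a A.* d A.- b A.* c) y} p (begin
          α S.* δ S.- β S.* γ
            ≈⟨ S.+-cong {α S.* δ} {α S.* S.0#} {S.- (β S.* γ)} {S.- (β S.* S.0#)} (S.*-congˡ {α} {δ} {S.0#} d≈0) (S.-‿cong {β S.* γ} {β S.* S.0#} (S.*-congˡ {β} {γ} {S.0#} c≈0)) ⟩
          α S.* S.0# S.- β S.* S.0#   ≈⟨ Identities.x0-y0≈0 (completion y) α β ⟩
          S.0# ∎)
        where
        module S = CommutativeRing (completion y)
        open SetoidReasoning S.setoid
        α β γ δ : Completed y
        α = proj₁ a y
        β = proj₁ b y
        γ = proj₁ c y
        δ = proj₁ d y

      d′-order : ∀ y → ∃[ k ] HasOrder y (d′ ⟪ y ⟫) k × k ≤⟦ y ⟧ c ⟪ y ⟫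
      d′-order y = case em
        where
        module S = CommutativeRing (completion y)
        γ δ : Completed y
        γ = proj₁ c y
        δ = proj₁ d y
        Result : Dec (Dominates y) → Set
        Result p = ∃[ k ] HasOrder y (λ n → proj₁ δ n + proj₁ (choose y p) n * proj₁ γ n) k × k ≤⟦ y ⟧ proj₁ γ
        from-d : ∀ {N} → N ≤⟦ y ⟧ proj₁ γ → ¬ + 1 ℤ.+ N ≤⟦ y ⟧ proj₁ δ → + 1 ℤ.+ N ≤⟦ y ⟧ proj₁ δ ⊎ (∃[ k ] HasOrder y (proj₁ δ) k × k ℤ.< + 1 ℤ.+ N) →
          ∃[ k ] HasOrder y (λ n → proj₁ δ n + 0# * proj₁ γ n) k × k ≤⟦ y ⟧ proj₁ γ
        from-d N≤γ ¬p (inj₁ p) = ⊥-elim (¬p p)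
        from-d {N} N≤γ ¬p (inj₂ (k , order-δ , k<1+N)) = k , order-resp (Identities.x≈x+0y (completion y) δ γ) order-δ ,
          ⟦≤⟧-weaken (≤-by₁ k N (ℤ.i<j⇒suc[i]≤j k<1+N) (shift k N)) N≤γ
          where
          shift : ∀ k N → (+ 1 ℤ.+ N) ℤ.- (+ 1 ℤ.+ k) ≡ N ℤ.- k
          shift = ℤ.solve-∀
        large-d : ¬ Dominates y → ∀ {N} → N ≤⟦ y ⟧ proj₁ γ → Dec (+ 1 ℤ.+ N ≤⟦ y ⟧ proj₁ δ) → + 1 ℤ.+ N ≤⟦ y ⟧ proj₁ δ
        large-d ¬dominates p (yes q) = q
        large-d ¬dominates p (no ¬q) = ⊥-elim (¬dominates (_ , p , ¬q))
        from-c : ¬ Dominates y → γ S.≈ S.0# ⊎ (∃[ k ] HasOrder y (proj₁ γ) k) → ∃[ k ] HasOrder y (λ n → proj₁ δ n + 1# * proj₁ γ n) k × k ≤⟦ y ⟧ proj₁ γ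
        from-c ¬dominates (inj₁ γ≈0) = ⊥-elim (c-or-d-nonzero y γ≈0 (infinite-order⇒0 {y} {δ} (λ N →
          ⟦≤⟧-weaken (ℤ.i≤suc[i] N) (large-d ¬dominates (zero⇒≤ {y} {γ} {N} γ≈0) em))))
        from-c ¬dominates (inj₂ (k , p)) = k , order-resp (Identities.y+x≈x+1y (completion y) δ γ)
          (hasOrder-+ p (large-d ¬dominates (hasOrder⇒≤ p ℤ.≤-refl) em)) , hasOrder⇒≤ p ℤ.≤-refl
        case : (p : Dec (Dominates y)) → Result p
        case (yes (N , N≤γ , ¬p)) = from-d N≤γ ¬p (order-or-≤ {y} δ (+ 1 ℤ.+ N))
        case (no ¬dominates) = from-c ¬dominates (zero-or-order {y} γ)

      -- An inverse adele requires d′ to have no zeros at almost all places. If d′ vanished where a,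
      -- b and the inverse of the determinant are integral, then c and d would vanish there, and so
      -- would the product of the determinant and its inverse, which is 1.
      d′-unit : IsUnit (𝔸 K) d′
      d′-unit =
        let S₁ , a-integral = poles-of a
            S₂ , b-integral = poles-of b
            S₃ , Δ⁻¹-integral = poles-of (proj₁ unit)
            S₄ , d-integral = poles-of d
        in order⇒idele d′ (λ y → proj₁ (d′-order y) , proj₁ (proj₂ (d′-order y))) (S₁ ++ S₂ ++ S₃) (λ y k y∉ p →
             nonpositive y k p (a-integral y (λ y∈ → y∉ (++⁺ˡ y∈))) (b-integral y (λ y∈ → y∉ (++⁺ʳ S₁ (++⁺ˡ y∈)))) (Δ⁻¹-integral y (λ y∈ → y∉ (++⁺ʳ S₁ (++⁺ʳ S₂ y∈)))))
        where
        nonpositive : ∀ y k → HasOrder y (d′ ⟪ y ⟫) k → + 0 ≤⟦ y ⟧ a ⟪ y ⟫ → + 0 ≤⟦ y ⟧ b ⟪ y ⟫ → + 0 ≤⟦ y ⟧ proj₁ unit ⟪ y ⟫ → k ℤ.≤ + 0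
        nonpositive y k p 0≤a 0≤b 0≤Δ⁻¹ = ℤ.≮⇒≥ (λ 0<k → ℤ.<-irrefl ≡.refl (ℤ.suc[i]≤j⇒i<j (≤-hasOrder (hasOrder-1 {y}) (one-small (ℤ.i<j⇒suc[i]≤j 0<k)))))
          where
          module S = CommutativeRing (completion y)
          μγ : Completed y
          μγ = proj₁ m y S.* proj₁ c y
          one-small : + 1 ℤ.≤ k → + 1 ≤⟦ y ⟧ (λ _ → 1#)
          one-small 1≤k = ⟦≤⟧-resp (proj₁ (proj₂ unit) y) (⟦≤⟧-* 0≤Δ⁻¹ (⟦≤⟧-minus (⟦≤⟧-* 0≤a 1≤δ) (⟦≤⟧-* 0≤b 1≤γ)))
            where
            1≤γ : + 1 ≤⟦ y ⟧ c ⟪ y ⟫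
            1≤γ = ⟦≤⟧-weaken (≡.subst (+ 1 ℤ.≤_) (hasOrder-unique p (proj₁ (proj₂ (d′-order y)))) 1≤k) (proj₂ (proj₂ (d′-order y)))
            1≤δ : + 1 ≤⟦ y ⟧ d ⟪ y ⟫
            1≤δ = ⟦≤⟧-resp (Identities.x+y-y≈x (completion y) (proj₁ d y) μγ)
              (⟦≤⟧-minus (hasOrder⇒≤ p 1≤k) (⟦≤⟧-* (choose-integral y em) 1≤γ))

      -- The order of d′ is nowhere larger than that of c, so c/d′ is integral.
      e-integral : ∀ y → + 0 ≤⟦ y ⟧ (c A.* proj₁ d′-unit) ⟪ y ⟫
      e-integral y = ≡.subst (λ n → n ≤⟦ y ⟧ (c A.* proj₁ d′-unit) ⟪ y ⟫) (ℤ.+-inverseʳ k)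
        (⟦≤⟧-* k≤c (hasOrder⇒≤ (inverse-order {y} {proj₁ d′ y} {proj₁ (proj₁ d′-unit) y} (proj₁ (proj₂ d′-unit) y) p) ℤ.≤-refl))
        where
        k : ℤ
        k = proj₁ (d′-order y)
        p : HasOrder y (d′ ⟪ y ⟫) k
        p = proj₁ (proj₂ (d′-order y))
        k≤c : k ≤⟦ y ⟧ c ⟪ y ⟫
        k≤c = proj₂ (proj₂ (d′-order y))

      c≈ed′ : c A.≈ (c A.* proj₁ d′-unit) A.* d′
      c≈ed′ = A.trans {c} {c A.* A.1#} {(c A.* proj₁ d′-unit) A.* d′} (A.sym {c A.* A.1#} {c} (A.*-identityʳ c))
        (A.trans {c A.* A.1#} {c A.* (proj₁ d′-unit A.* d′)} {(c A.* proj₁ d′-unit) A.* d′}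
          (A.*-congˡ {c} {A.1#} {proj₁ d′-unit A.* d′} (A.sym {proj₁ d′-unit A.* d′} {A.1#} (proj₁ (proj₂ d′-unit))))
          (A.sym {(c A.* proj₁ d′-unit) A.* d′} {c A.* (proj₁ d′-unit A.* d′)} (A.*-assoc c (proj₁ d′-unit) d′)))

  abstract
    triangularise : ∀ a b c d → IsUnit (𝔸 K) (a A.* d A.- b A.* c) →
      Σ[ m ∈ CommutativeRing.Carrier (𝒪𝔸 K) ] Σ[ e ∈ CommutativeRing.Carrier (𝒪𝔸 K) ] Σ[ d′ ∈ AbelianGroup.Carrier (Units (𝔸 K)) ]
        proj₁ d′ A.≈ d A.+ proj₁ m A.* c × c A.≈ proj₁ e A.* proj₁ d′
    triangularise a b c d unit = mᴼ , to-integral (c A.* proj₁ d′-unit) e-integral , (d′ , d′-unit) , A.refl {d′} , c≈ed′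
      where open Triangularise a b c d unit

-- Labels modulo squares and components

module ModuloSquares (A : Ab) where
  open AbelianGroup A
  open SetoidReasoning setoid
  private
    module Q = AbelianGroup (mod2 A)

  abstract
    ≈⇒≈₂ : ∀ {a b} → a ≈ b → a Q.≈ b
    ≈⇒≈₂ {a} a≈b = ε , trans (∙-congˡ (identityˡ ε)) (trans (identityʳ a) a≈b)

    square⇒≈₂ε : ∀ {a} → IsSquare A a → a Q.≈ ε
    square⇒≈₂ε {a} (d , dd≈a) = d ⁻¹ , (begin
      a ∙ (d ⁻¹ ∙ d ⁻¹)        ≈⟨ ∙-cong (sym dd≈a) (AbelianGroupProperties.⁻¹-∙-comm A d d) ⟩
      d ∙ d ∙ (d ∙ d) ⁻¹       ≈⟨ inverseʳ (d ∙ d) ⟩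
      ε                        ∎)

    ≈₂ε⇒square : ∀ {a} → a Q.≈ ε → IsSquare A a
    ≈₂ε⇒square {a} (d , add≈ε) = d ⁻¹ , (begin
      d ⁻¹ ∙ d ⁻¹              ≈⟨ AbelianGroupProperties.⁻¹-∙-comm A d d ⟩
      (d ∙ d) ⁻¹               ≈⟨ sym (GroupProperties.inverseˡ-unique group a (d ∙ d) add≈ε) ⟩
      a                        ∎)

    a∙a≈₂ε : ∀ a → a ∙ a Q.≈ ε
    a∙a≈₂ε a = square⇒≈₂ε (a , refl)

module LocalDeterminant (R S T : Ring) (f : DirectProduct.commutativeRing R S ⟶ʳ T) where
  private
    module R = CommutativeRing R
    module S = CommutativeRing S
    module T = CommutativeRing T
    module f = RingHomomorphism f

  abstract
    det-map-× : ∀ (g : Group.Carrier (GL₂ R)) (h : Group.Carrier (GL₂ S)) a b → Matrices.det R (proj₁ g) R.≈ a → Matrices.det S (proj₁ h) S.≈ b →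
      Matrices.det T (proj₁ (GroupHomomorphism.⟦_⟧ (Functoriality.GL₂-map {DirectProduct.commutativeRing R S} {T} f) (_,ᴳ_ {R} {S} g h))) T.≈ f.⟦ a , b ⟧
    det-map-× (mat _ _ _ _ , _ , _ , _) (mat _ _ _ _ , _ , _ , _) a b det-g det-h =
      T.trans (T.sym (Functoriality.det-map {DirectProduct.commutativeRing R S} {T} f _)) (f.⟦⟧-cong (det-g , det-h))

    ξ-map : ∀ (π : AbelianGroup.Carrier (Units R)) (X : AbelianGroup.Carrier (Units T)) → proj₁ X T.≈ f.⟦ proj₁ π , S.1# ⟧ →
      Matrices._≈ᴹ_ T (proj₁ (ξ[0∶1] T X))
        (proj₁ (GroupHomomorphism.⟦_⟧ (Functoriality.GL₂-map {DirectProduct.commutativeRing R S} {T} f) (_,ᴳ_ {R} {S} (ξ[0∶1] R π) (Group.ε (GL₂ S)))))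
    ξ-map (_ , _ , _ , _) X X≈ = Matrices.mat≈ (T.sym f.1#-homo) (T.sym f.0#-homo) (T.sym f.0#-homo) X≈

module _ (R : Ring) where
  open CommutativeRing R
  open IntegerSolver R using (solve; _:*_; _:-_; _:=_; con)

  abstract
    det-ξ[1∶] : ∀ b π → Matrices.det R (proj₁ (ξ[1∶_] R b π)) ≈ proj₁ π
    det-ξ[1∶] b (π , _) = solve 2 (λ π b → π :* con (1 , 0) :- b :* con (0 , 0) := π) refl π b

    det-ξ[0∶1] : ∀ π → Matrices.det R (proj₁ (ξ[0∶1] R π)) ≈ proj₁ π
    det-ξ[0∶1] (π , _) = solve 1 (λ π → con (1 , 0) :* π :- con (0 , 0) :* con (0 , 0) := π) refl π

module Labels (em : ExcludedMiddle 0ℓ) {K : FunctionField} (x : Place K) (π : Uniformiser x) where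
  open HeckeGraph em x π
  open LocalUniformiser em x π
  private
    module A = CommutativeRing (𝔸 K)
    module V = Setoid (vertices K)
    module Q = AbelianGroup (mod2 (Cl K))
    module M = Matrices (𝔸 K)

  open AdelicReflexivity (F⊂𝔸 K) (𝔸 K) (𝒪𝔸 K) (inclusion (𝔸 K) (principal-isSubring K)) (inclusion (𝔸 K) (integralAdele-isSubring K))
  open ModuloSquares (Cl K) public

  private
    local : Group.Carrier (GL₂ (completion x)) → Group.Carrier (GL₂ (𝔸 K))
    local = localGL₂ em K x

    local≡ : ∀ h → localGL₂ em K x h ≡ local h
    local≡ _ = ≡.refl

    hom : DirectProduct.commutativeRing (completion x) (𝔸 K) ⟶ʳ 𝔸 K
    hom = replaceHom em K x

  abstract
    ≈⇒≈₂-label : ∀ a b → proj₁ a A.≈ proj₁ b → a Q.≈ b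
    ≈⇒≈₂-label a b a≈b = ≈⇒≈₂ {a} {b} (≈⇒class a b a≈b)

    label-step : ∀ g k ℓ → M.det (proj₁ k) A.≈ proj₁ ℓ → ∀ g′ → g′ V.≈ Group._∙_ (GL₂ (𝔸 K)) g k → labelOf g′ Q.≈ labelOf g Q.∙ ℓ
    label-step g k ℓ det-k g′ g′≈ = Q.trans {labelOf g′} {labelOf (Group._∙_ (GL₂ (𝔸 K)) g k)} {labelOf g Q.∙ ℓ}
      (Func.cong (label K) {g′} {Group._∙_ (GL₂ (𝔸 K)) g k} g′≈)
      (≈⇒≈₂-label (labelOf (Group._∙_ (GL₂ (𝔸 K)) g k)) (AbelianGroup._∙_ (Units (𝔸 K)) (labelOf g) ℓ)
        (A.trans {M.det (proj₁ g M.*ᴹ proj₁ k)} {M.det (proj₁ g) A.* M.det (proj₁ k)} {M.det (proj₁ g) A.* proj₁ ℓ} (M.det-* (proj₁ g) (proj₁ k))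
          (A.*-congˡ {M.det (proj₁ g)} {M.det (proj₁ k)} {proj₁ ℓ} det-k)))

    det-local : ∀ h → CommutativeRing._≈_ (completion x) (Matrices.det (completion x) (proj₁ h)) (proj₁ (proj₁ π)) → M.det (proj₁ (local h)) A.≈ proj₁ [x]
    det-local h det-h = LocalDeterminant.det-map-× (completion x) (𝔸 K) (𝔸 K) hom h (Group.ε (GL₂ (𝔸 K))) (proj₁ (proj₁ π)) A.1# det-h M.det-1ᴹ

    edge-label : ∀ g g′ → Edge g g′ → labelOf g′ Q.≈ labelOf g Q.∙ [x]
    edge-label g g′ ([1∶ b ] , β , _ , g′≈) = label-step g (local (ξ[1∶_] (completion x) β (proj₁ π))) [x]
      (det-local (ξ[1∶_] (completion x) β (proj₁ π)) (det-ξ[1∶] (completion x) β (proj₁ π))) g′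
      (≡.subst (λ k → g′ V.≈ Group._∙_ (GL₂ (𝔸 K)) g k) (local≡ (ξ[1∶_] (completion x) β (proj₁ π))) g′≈)
    edge-label g g′ ([0∶1] , g′≈) = label-step g (local (ξ[0∶1] (completion x) (proj₁ π))) [x]
      (det-local (ξ[0∶1] (completion x) (proj₁ π)) (det-ξ[0∶1] (completion x) (proj₁ π))) g′
      (≡.subst (λ k → g′ V.≈ Group._∙_ (GL₂ (𝔸 K)) g k) (local≡ (ξ[0∶1] (completion x) (proj₁ π))) g′≈)

    [x]∙[x]≈ε : [x] Q.∙ [x] Q.≈ Q.ε
    [x]∙[x]≈ε = a∙a≈₂ε [x]

    labels-in-component : ∀ g g′ → Connected g g′ → labelOf g′ Q.≈ labelOf g ⊎ labelOf g′ Q.≈ labelOf g Q.∙ [x]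
    labels-in-component g g′ = EqClosure.fold {S = λ g h → labelOf h Q.≈ labelOf g ⊎ labelOf h Q.≈ labelOf g Q.∙ [x]} isEquivalence
      (λ {h} {k} → step h k) {g} {g′}
      where
      step : ∀ g h → g V.≈ h ⊎ Edge g h → labelOf h Q.≈ labelOf g ⊎ labelOf h Q.≈ labelOf g Q.∙ [x]
      step g h (inj₁ g≈h) = inj₁ (Q.sym {labelOf g} {labelOf h} (Func.cong (label K) {g} {h} g≈h))
      step g h (inj₂ edge) = inj₂ (edge-label g h edge)
      flip : ∀ a b → b Q.≈ a Q.∙ [x] → a Q.≈ b Q.∙ [x]
      flip a b b≈ax = Q.sym {b Q.∙ [x]} {a} (Q.trans {b Q.∙ [x]} {a Q.∙ [x] Q.∙ [x]} {a} (Q.∙-congʳ {[x]} {b} {a Q.∙ [x]} b≈ax)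
        (Q.trans {a Q.∙ [x] Q.∙ [x]} {a Q.∙ ([x] Q.∙ [x])} {a} (Q.assoc a [x] [x])
        (Q.trans {a Q.∙ ([x] Q.∙ [x])} {a Q.∙ Q.ε} {a} (Q.∙-congˡ {a} {[x] Q.∙ [x]} {Q.ε} [x]∙[x]≈ε) (Q.identityʳ a))))
      -- Symmetry and transitivity hold because [x] ∙ [x] is trivial modulo squares.
      isEquivalence : IsEquivalence (λ g h → labelOf h Q.≈ labelOf g ⊎ labelOf h Q.≈ labelOf g Q.∙ [x])
      isEquivalence = record
        { refl = λ {g} → inj₁ (Q.refl {labelOf g})
        ; sym = λ {g} {h} → Sum.map (Q.sym {labelOf h} {labelOf g}) (flip (labelOf g) (labelOf h))
        ; trans = λ {g} {h} {k} → λ where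
            (inj₁ p) (inj₁ q) → inj₁ (Q.trans {labelOf k} {labelOf h} {labelOf g} q p)
            (inj₁ p) (inj₂ q) → inj₂ (Q.trans {labelOf k} {labelOf h Q.∙ [x]} {labelOf g Q.∙ [x]} q (Q.∙-congʳ {[x]} {labelOf h} {labelOf g} p))
            (inj₂ p) (inj₁ q) → inj₂ (Q.trans {labelOf k} {labelOf h} {labelOf g Q.∙ [x]} q p)
            (inj₂ p) (inj₂ q) → inj₁ (Q.trans {labelOf k} {labelOf h Q.∙ [x]} {labelOf g} q (Q.sym {labelOf g} {labelOf h Q.∙ [x]} (flip (labelOf g) (labelOf h) p)))
        }

    private
      vertex⇒Connected : ∀ g h → g V.≈ h → Connected g h
      vertex⇒Connected g h g≈h = EqClosure.return (inj₁ g≈h)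

      ξ≈ : proj₁ (ξ[0∶1] (𝔸 K) ϖ) M.≈ᴹ proj₁ (local (ξ[0∶1] (completion x) (proj₁ π)))
      ξ≈ = LocalDeterminant.ξ-map (completion x) (𝔸 K) (𝔸 K) hom (proj₁ π) ϖ (A.refl {proj₁ ϖ})

      edge⇒Connected : ∀ g g′ → g′ V.≈ Group._∙_ (GL₂ (𝔸 K)) g (local (ξ[0∶1] (completion x) (proj₁ π))) → Connected g g′
      edge⇒Connected g g′ g′≈ = EqClosure.return (inj₂ ([0∶1] , ≡.subst (λ k → g′ V.≈ Group._∙_ (GL₂ (𝔸 K)) g k) (≡.sym (local≡ (ξ[0∶1] (completion x) (proj₁ π)))) g′≈))

    same-label⇒Connected : ∀ g h → labelOf g Q.≈ labelOf h → Connected g h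
    same-label⇒Connected = Components.label⇒component (F⊂𝔸 K) (𝔸 K) (𝒪𝔸 K) (inclusion (𝔸 K) (principal-isSubring K)) (inclusion (𝔸 K) (integralAdele-isSubring K)) ϖ
      Connected (Setoid.isEquivalence components) vertex⇒Connected (local (ξ[0∶1] (completion x) (proj₁ π))) ξ≈ edge⇒Connected
      strong-approximation-F clear-denominators triangularise

    vertex-with-label : ∀ a → ∃[ g ] labelOf g Q.≈ a
    -- This matrix is diag(a, 1).
    vertex-with-label a = ξ[1∶_] (𝔸 K) A.0# a , ≈⇒≈₂-label (labelOf (ξ[1∶_] (𝔸 K) A.0# a)) a (det-ξ[1∶] (𝔸 K) A.0# a)

-- Class groups

module _ (S : Setoid 0ℓ 0ℓ) where
  open Setoid S

  abstract
    enumerated : ∀ {n} (b : HasCardinality S n) a → ∃[ j ] a ≈ Bijection.to b j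
    enumerated b a = let j , bj≈a = Bijection.strictlySurjective b a in j , sym bj≈a

    family⇒cardinality : ∀ {n} (β : Fin n → Carrier) → IsSeparated _≈_ β → (∀ a → ∃[ j ] a ≈ β j) → HasCardinality S n
    family⇒cardinality β separated complete = record
      { to = β
      ; cong = λ i≡j → reflexive (≡.cong β i≡j)
      ; bijective = (λ {i} {j} → separated i j) , λ a → let j , a≈βj = complete a in
          j , λ i≡j → trans (reflexive (≡.cong β i≡j)) (sym a≈βj)
      }

    cardinality-unique : ∀ {m n} → HasCardinality S m → HasCardinality S n → m ≡ n
    cardinality-unique b c = Fin.↔⇒≡ (Compose.inverse (Bijection⇒Inverse b) (Symmetry.inverse (Bijection⇒Inverse c)))

    product⇒cardinality : ∀ {m n} (β : Fin m → Fin n → Carrier) → (∀ i k j l → β i k ≈ β j l → i ≡ j × k ≡ l) →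
      (∀ a → ∃₂ λ i k → a ≈ β i k) → HasCardinality S (m ℕ.* n)
    product⇒cardinality {m} {n} β separated complete = family⇒cardinality (λ e → uncurry β (Fin.remQuot {m} n e))
      (λ e f βe≈βf → let i≡j , k≡l = separated (proj₁ (Fin.remQuot {m} n e)) (proj₂ (Fin.remQuot {m} n e)) (proj₁ (Fin.remQuot {m} n f)) (proj₂ (Fin.remQuot {m} n f)) βe≈βf
        in ≡.trans (≡.sym (Fin.combine-remQuot {m} n e)) (≡.trans (≡.cong₂ Fin.combine i≡j k≡l) (Fin.combine-remQuot {m} n f)))
      (λ a → let i , k , a≈ = complete a in Fin.combine i k , trans a≈ (reflexive (≡.sym (≡.cong (uncurry β) (Fin.remQuot-combine i k)))))

-- |G| = |2G| |G[2]| = |2G| |G/2G| for a finite abelian group G.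
module _ (em : ExcludedMiddle 0ℓ) (G : Ab) {N : ℕ}
         (finite : ∀ m (β : Fin m → AbelianGroup.Carrier G) → IsSeparated (AbelianGroup._≈_ G) β → m ≤ N) where
  open AbelianGroup G
  open ModuloSquares G
  open SetoidReasoning setoid
  open CommutativeSemigroupProperties commutativeSemigroup using (interchange)
  private
    module Q = AbelianGroup (mod2 G)

    -- Equality of squares, whose classes are the cosets of G[2]; the squares of a separated and
    -- complete family for it list 2G without repetition.
    _∼_ : Rel Carrier 0ℓ
    a ∼ b = a ∙ a ≈ b ∙ b

    abstract
      cancelˡ : ∀ a b c → a ∙ b ≈ a ∙ c → b ≈ c
      cancelˡ = GroupProperties.∙-cancelˡ group

      square : ∀ a b → (a ∙ b) ∙ (a ∙ b) ≈ (a ∙ a) ∙ (b ∙ b)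
      square a b = interchange a b a b

      divide : ∀ a b → a ≈ b ∙ (b ⁻¹ ∙ a)
      divide a b = trans (sym (identityˡ a)) (trans (∙-congʳ (sym (inverseʳ b))) (assoc b (b ⁻¹) a))

      module _ {a b} (t : HasCardinality (2-torsion G) a) (r : Fin b → Carrier) (separated : IsSeparated _∼_ r) (complete : ∀ g → ∃[ i ] g ∼ r i) where
        private
          τ : Fin a → Carrier
          τ k = proj₁ (Bijection.to t k)

          τ² : ∀ k → τ k ∙ τ k ≈ ε
          τ² k = proj₂ (Bijection.to t k)

        roots×torsion : HasCardinality setoid (b ℕ.* a)
        roots×torsion = product⇒cardinality setoid (λ i k → r i ∙ τ k)
          (λ i k j l eq → let i≡j = separated i j (trans (sym (square-τ i k)) (trans (∙-cong eq eq) (square-τ j l))) in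
            i≡j , Bijection.injective t (cancelˡ (r j) (τ k) (τ l) (trans (∙-congʳ (reflexive (≡.cong r (≡.sym i≡j)))) eq)))
          (λ g → let i , g∼r = complete g ; k , eq = enumerated (2-torsion G) t (r i ⁻¹ ∙ g , quotient-torsion g (r i) g∼r) in
            i , k , trans (divide g (r i)) (∙-congˡ eq))
          where
          square-τ : ∀ i k → (r i ∙ τ k) ∙ (r i ∙ τ k) ≈ r i ∙ r i
          square-τ i k = trans (square (r i) (τ k)) (trans (∙-congˡ (τ² k)) (identityʳ (r i ∙ r i)))
          quotient-torsion : ∀ g h → g ∼ h → (h ⁻¹ ∙ g) ∙ (h ⁻¹ ∙ g) ≈ ε
          quotient-torsion g h g∼h = begin
            (h ⁻¹ ∙ g) ∙ (h ⁻¹ ∙ g)      ≈⟨ square (h ⁻¹) g ⟩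
            (h ⁻¹ ∙ h ⁻¹) ∙ (g ∙ g)      ≈⟨ ∙-congˡ g∼h ⟩
            (h ⁻¹ ∙ h ⁻¹) ∙ (h ∙ h)      ≈⟨ sym (square (h ⁻¹) h) ⟩
            (h ⁻¹ ∙ h) ∙ (h ⁻¹ ∙ h)      ≈⟨ ∙-cong (inverseˡ h) (inverseˡ h) ⟩
            ε ∙ ε                        ≈⟨ identityˡ ε ⟩
            ε                            ∎

      module _ {m b} (c : Fin m → Carrier) (separated′ : IsSeparated Q._≈_ c) (complete′ : ∀ g → ∃[ k ] g Q.≈ c k)
               (r : Fin b → Carrier) (separated : IsSeparated _∼_ r) (complete : ∀ g → ∃[ i ] g ∼ r i) where

        squares×cosets : HasCardinality setoid (b ℕ.* m)
        squares×cosets = product⇒cardinality setoid (λ i k → (r i ∙ r i) ∙ c k)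
          (λ i k j l eq →
            let k≡l = separated′ k l (Q.trans {c k} {(r i ∙ r i) ∙ c k} {c l} (coset (c k) (r i)) (Q.trans {(r i ∙ r i) ∙ c k} {(r j ∙ r j) ∙ c l} {c l}
                  (≈⇒≈₂ eq) (Q.sym {c l} {(r j ∙ r j) ∙ c l} (coset (c l) (r j)))))
            in separated i j (GroupProperties.∙-cancelʳ group (c l) (r i ∙ r i) (r j ∙ r j) (trans (∙-congˡ (reflexive (≡.cong c (≡.sym k≡l)))) eq)) , k≡l)
          (λ g → let k , d , eq = complete′ g ; i , d∼r = complete (d ⁻¹) in i , k , (begin
            g                              ≈⟨ divide g (d ⁻¹ ∙ d ⁻¹) ⟩
            (d ⁻¹ ∙ d ⁻¹) ∙ ((d ⁻¹ ∙ d ⁻¹) ⁻¹ ∙ g)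
              ≈⟨ ∙-cong d∼r (trans (∙-congʳ (trans (⁻¹-cong (AbelianGroupProperties.⁻¹-∙-comm G d d)) (GroupProperties.⁻¹-involutive group (d ∙ d)))) (comm (d ∙ d) g)) ⟩
            (r i ∙ r i) ∙ (g ∙ (d ∙ d))    ≈⟨ ∙-congˡ eq ⟩
            (r i ∙ r i) ∙ c k              ∎))
          where
          coset : ∀ a d → a Q.≈ (d ∙ d) ∙ a
          coset a d = d , comm a (d ∙ d)

  abstract
    torsion⇒mod2 : ∀ {a} → HasCardinality (2-torsion G) a → HasCardinality (AbelianGroup.setoid (mod2 G)) a
    torsion⇒mod2 {a} t =
      let b , r , _ , r-separated , r-complete = maximal-family em {P = λ _ → ⊤} {_∼_} sym
            (λ m β _ separated → finite m (λ i → β i ∙ β i) separated)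
          m , c , _ , c-separated , c-complete = maximal-family em {P = λ _ → ⊤} {Q._≈_} (λ {a} {b} → Q.sym {a} {b})
            (λ m β _ separated → finite m β (λ i j eq → separated i j (≈⇒≈₂ eq)))
          b*a≡b*m = cardinality-unique setoid (roots×torsion t r r-separated (λ g → r-complete g tt))
            (squares×cosets c c-separated (λ g → c-complete g tt) r r-separated (λ g → r-complete g tt))
      in ≡.subst (HasCardinality (AbelianGroup.setoid (mod2 G)))
           -- b can be cancelled: it is positive, as ε has the same square as some member of r.
           (≡.sym (ℕ.*-cancelˡ-≡ a m b {{Fin.nonZeroIndex (proj₁ (r-complete ε tt))}} b*a≡b*m))
           (family⇒cardinality (AbelianGroup.setoid (mod2 G)) c c-separated (λ g → c-complete g tt))

parity : ∀ n → ∃[ e ] (n ≡ e ℕ.+ e ⊎ n ≡ suc (e ℕ.+ e))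
parity zero = 0 , inj₁ ≡.refl
parity (suc n) with parity n
... | e , inj₁ n≡2e = e , inj₂ (≡.cong suc n≡2e)
... | e , inj₂ n≡1+2e = suc e , inj₁ (≡.trans (≡.cong suc n≡1+2e) (≡.cong suc (≡.sym (ℕ.+-suc e e))))

-- G = A/⟨ξ²⟩ is finite with G[2] = A[2] × {1, ξ}, and G/2G = A/2A.
module InfiniteOrder (A : Ab) (ξ : AbelianGroup.Carrier A) where
  open AbelianGroup A
  open SetoidReasoning setoid
  open CommutativeSemigroupProperties commutativeSemigroup using (interchange)
  open RawMonoidOperations rawMonoid using () renaming (_×_ to _⊗_)
  open Powers commutativeMonoid using (×-homo-+)
  private
    module Solver = CommutativeMonoidSolver commutativeMonoid

  infix 8 ξ^_
  ξ^_ : ℕ → Carrier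
  ξ^ n = n ⊗ ξ

  infix 4 _∼_
  -- Congruence modulo ⟨ξ²⟩; a natural power of ξ² on each side stands for one integral power.
  _∼_ : Rel Carrier 0ℓ
  a ∼ b = ∃₂ λ i j → a ∙ ξ^ (i ℕ.+ i) ≈ b ∙ ξ^ (j ℕ.+ j)

  abstract
    ξ^-induction : (P : ℕ → Carrier → Set) → P 0 ε → (∀ n a → P n a → P (suc n) (ξ ∙ a)) → ∀ n → P n (ξ^ n)
    ξ^-induction P base step zero = base
    ξ^-induction P base step (suc n) = step n (ξ^ n) (ξ^-induction P base step n)

    ξ^-+ : ∀ m n → ξ^ (m ℕ.+ n) ≈ ξ^ m ∙ ξ^ n
    ξ^-+ m n = ×-homo-+ ξ m n

    private
      cancelʳ : ∀ c a b → a ∙ c ≈ b ∙ c → a ≈ b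
      cancelʳ = GroupProperties.∙-cancelʳ group

      double : ∀ m n → ξ^ ((m ℕ.+ n) ℕ.+ (m ℕ.+ n)) ≈ ξ^ (m ℕ.+ m) ∙ ξ^ (n ℕ.+ n)
      double m n = trans (reflexive (≡.cong ξ^_ (rearrange m n))) (ξ^-+ (m ℕ.+ m) (n ℕ.+ n))
        where
        rearrange : ∀ m n → (m ℕ.+ n) ℕ.+ (m ℕ.+ n) ≡ (m ℕ.+ m) ℕ.+ (n ℕ.+ n)
        rearrange = ℕ.solve-∀

    ∼-isCongruence : IsCongruence group _∼_
    ∼-isCongruence = record
      { isEquivalence = record
        { refl = 0 , 0 , refl
        ; sym = λ (i , j , p) → j , i , sym p
        ; trans = λ {a} {b} {c} (i , j , p) (k , l , q) → i ℕ.+ k , j ℕ.+ l , (begin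
            a ∙ ξ^ ((i ℕ.+ k) ℕ.+ (i ℕ.+ k))           ≈⟨ ∙-congˡ (double i k) ⟩
            a ∙ (ξ^ (i ℕ.+ i) ∙ ξ^ (k ℕ.+ k))          ≈⟨ sym (assoc a (ξ^ (i ℕ.+ i)) (ξ^ (k ℕ.+ k))) ⟩
            a ∙ ξ^ (i ℕ.+ i) ∙ ξ^ (k ℕ.+ k)            ≈⟨ ∙-congʳ p ⟩
            b ∙ ξ^ (j ℕ.+ j) ∙ ξ^ (k ℕ.+ k)            ≈⟨ Solver.solve 3 (λ b j k → (b Solver.⊕ j) Solver.⊕ k Solver.⊜ (b Solver.⊕ k) Solver.⊕ j) refl b (ξ^ (j ℕ.+ j)) (ξ^ (k ℕ.+ k)) ⟩
            b ∙ ξ^ (k ℕ.+ k) ∙ ξ^ (j ℕ.+ j)            ≈⟨ ∙-congʳ q ⟩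
            c ∙ ξ^ (l ℕ.+ l) ∙ ξ^ (j ℕ.+ j)            ≈⟨ Solver.solve 3 (λ c l j → (c Solver.⊕ l) Solver.⊕ j Solver.⊜ c Solver.⊕ (j Solver.⊕ l)) refl c (ξ^ (l ℕ.+ l)) (ξ^ (j ℕ.+ j)) ⟩
            c ∙ (ξ^ (j ℕ.+ j) ∙ ξ^ (l ℕ.+ l))          ≈⟨ ∙-congˡ (sym (double j l)) ⟩
            c ∙ ξ^ ((j ℕ.+ l) ℕ.+ (j ℕ.+ l))           ∎)
        }
      ; reflexive = λ a≈b → 0 , 0 , ∙-congʳ a≈b
      ; ∙-cong = λ {a} {b} {c} {d} (i , j , p) (k , l , q) → i ℕ.+ k , j ℕ.+ l , (begin
          (a ∙ c) ∙ ξ^ ((i ℕ.+ k) ℕ.+ (i ℕ.+ k))       ≈⟨ ∙-congˡ (double i k) ⟩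
          (a ∙ c) ∙ (ξ^ (i ℕ.+ i) ∙ ξ^ (k ℕ.+ k))      ≈⟨ interchange a c (ξ^ (i ℕ.+ i)) (ξ^ (k ℕ.+ k)) ⟩
          (a ∙ ξ^ (i ℕ.+ i)) ∙ (c ∙ ξ^ (k ℕ.+ k))      ≈⟨ ∙-cong p q ⟩
          (b ∙ ξ^ (j ℕ.+ j)) ∙ (d ∙ ξ^ (l ℕ.+ l))      ≈⟨ interchange b (ξ^ (j ℕ.+ j)) d (ξ^ (l ℕ.+ l)) ⟩
          (b ∙ d) ∙ (ξ^ (j ℕ.+ j) ∙ ξ^ (l ℕ.+ l))      ≈⟨ ∙-congˡ (sym (double j l)) ⟩
          (b ∙ d) ∙ ξ^ ((j ℕ.+ l) ℕ.+ (j ℕ.+ l))       ∎)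
      }

  A/ξ² : Ab
  A/ξ² = quotientAb A ∼-isCongruence

  private
    module Q = AbelianGroup (mod2 A)
    module QG = AbelianGroup (mod2 A/ξ²)

  abstract
    -- ξ² is a square already, so ξ²ⁱ and ξ²ʲ can be moved into the square that relates a and b.
    mod2⇒ : ∀ {a b} → a QG.≈ b → a Q.≈ b
    mod2⇒ {a} {b} (d , i , j , p) = d ∙ ξ^ i ∙ (ξ^ j) ⁻¹ , cancelʳ (ξ^ j ∙ ξ^ j) (a ∙ (e ∙ e)) b (begin
      (a ∙ (e ∙ e)) ∙ (ξ^ j ∙ ξ^ j)
        ≈⟨ Solver.solve 4 (λ a d u v → (a Solver.⊕ (d Solver.⊕ d)) Solver.⊕ (v Solver.⊕ v) Solver.⊜ a Solver.⊕ ((d Solver.⊕ v) Solver.⊕ (d Solver.⊕ v))) refl a e (ξ^ i) (ξ^ j) ⟩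
      a ∙ ((e ∙ ξ^ j) ∙ (e ∙ ξ^ j))          ≈⟨ ∙-congˡ (∙-cong restore restore) ⟩
      a ∙ ((d ∙ ξ^ i) ∙ (d ∙ ξ^ i))
        ≈⟨ Solver.solve 3 (λ a d u → a Solver.⊕ ((d Solver.⊕ u) Solver.⊕ (d Solver.⊕ u)) Solver.⊜ (a Solver.⊕ (d Solver.⊕ d)) Solver.⊕ (u Solver.⊕ u)) refl a d (ξ^ i) ⟩
      (a ∙ (d ∙ d)) ∙ (ξ^ i ∙ ξ^ i)          ≈⟨ ∙-congˡ (sym (ξ^-+ i i)) ⟩
      (a ∙ (d ∙ d)) ∙ ξ^ (i ℕ.+ i)           ≈⟨ p ⟩
      b ∙ ξ^ (j ℕ.+ j)                       ≈⟨ ∙-congˡ (ξ^-+ j j) ⟩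
      b ∙ (ξ^ j ∙ ξ^ j)                      ∎)
      where
      e : Carrier
      e = d ∙ ξ^ i ∙ (ξ^ j) ⁻¹
      restore : e ∙ ξ^ j ≈ d ∙ ξ^ i
      restore = GroupProperties.//-rightDividesˡ group (ξ^ j) (d ∙ ξ^ i)

    mod2⇐ : ∀ {a b} → a Q.≈ b → a QG.≈ b
    mod2⇐ (d , p) = d , 0 , 0 , ∙-congʳ p

  module _ (infinite : ∀ n → ξ^ n ≈ ε → n ≡ 0) where

    private
      abstract
        ξ^-increasing : ∀ m n → ξ^ m ≈ ξ^ (m ℕ.+ n) → n ≡ 0
        ξ^-increasing m n eq = infinite n (GroupProperties.∙-cancelˡ group (ξ^ m) (ξ^ n) ε (trans (sym (ξ^-+ m n)) (trans (sym eq) (sym (identityʳ (ξ^ m))))))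

        ξ^-injective : ∀ m n → ξ^ m ≈ ξ^ n → m ≡ n
        ξ^-injective m n eq with ℕ.≤-total m n
        ... | inj₁ m≤n = ≡.trans (≡.sym (ℕ.+-identityʳ m)) (≡.trans (≡.cong (m ℕ.+_) (≡.sym d≡0)) (ℕ.m+[n∸m]≡n m≤n))
          where
          d≡0 : n ℕ.∸ m ≡ 0
          d≡0 = ξ^-increasing m (n ℕ.∸ m) (trans eq (reflexive (≡.cong ξ^_ (≡.sym (ℕ.m+[n∸m]≡n m≤n)))))
        ... | inj₂ n≤m = ≡.sym (≡.trans (≡.sym (ℕ.+-identityʳ n)) (≡.trans (≡.cong (n ℕ.+_) (≡.sym d≡0)) (ℕ.m+[n∸m]≡n n≤m)))
          where
          d≡0 : m ℕ.∸ n ≡ 0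
          d≡0 = ξ^-increasing n (m ℕ.∸ n) (trans (sym eq) (reflexive (≡.cong ξ^_ (≡.sym (ℕ.m+[n∸m]≡n n≤m)))))

        parity-unique : ∀ (p q : Fin 2) i j → Fin.toℕ p ℕ.+ (i ℕ.+ i) ≡ Fin.toℕ q ℕ.+ (j ℕ.+ j) → p ≡ q × i ≡ j
        parity-unique zero zero i j eq = ≡.refl , halve i j eq
          where
          halve : ∀ i j → i ℕ.+ i ≡ j ℕ.+ j → i ≡ j
          halve zero zero _ = ≡.refl
          halve (suc i) (suc j) eq = ≡.cong suc (halve i j (ℕ.suc-injective (ℕ.suc-injective (≡.trans (≡.cong suc (≡.sym (ℕ.+-suc i i))) (≡.trans eq (≡.cong suc (ℕ.+-suc j j)))))))
        parity-unique zero (suc zero) i j eq = ⊥-elim (ℕ.even≢odd i j (≡.trans (≡.cong (i ℕ.+_) (ℕ.+-identityʳ i)) (≡.trans eq (≡.cong (λ n → suc (j ℕ.+ n)) (≡.sym (ℕ.+-identityʳ j))))))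
        parity-unique (suc zero) zero i j eq = Product.map ≡.sym ≡.sym (parity-unique zero (suc zero) j i (≡.sym eq))
        parity-unique (suc zero) (suc zero) i j eq = ≡.refl , proj₂ (parity-unique zero zero i j (ℕ.suc-injective eq))

    abstract
      -- If the square of a is a power ξ²ᵏ, then a ξ⁻ᵏ is 2-torsion in A, so a is τ ξᵏ, and modulo
      -- ξ² only the parity of k matters. Conversely the square of τ ξᵏ is ξ²ᵏ, which determines k
      -- because ξ has infinite order; then τ is determined too.
      torsion-double : ∀ {h₂} → HasCardinality (2-torsion A) h₂ → HasCardinality (2-torsion A/ξ²) (2 ℕ.* h₂)
      torsion-double {h₂} t = product⇒cardinality (2-torsion A/ξ²) element separated complete
        where
        τ : Fin h₂ → Carrier
        τ k = proj₁ (Bijection.to t k)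

        τ² : ∀ k → τ k ∙ τ k ≈ ε
        τ² k = proj₂ (Bijection.to t k)

        square-element : ∀ n k → (τ k ∙ ξ^ n) ∙ (τ k ∙ ξ^ n) ≈ ξ^ (n ℕ.+ n)
        square-element n k = trans (interchange (τ k) (ξ^ n) (τ k) (ξ^ n)) (trans (∙-cong (τ² k) (sym (ξ^-+ n n))) (identityˡ (ξ^ (n ℕ.+ n))))

        element : Fin 2 → Fin h₂ → Setoid.Carrier (2-torsion A/ξ²)
        element p k = τ k ∙ ξ^ Fin.toℕ p , 0 , Fin.toℕ p , trans (identityʳ ((τ k ∙ ξ^ Fin.toℕ p) ∙ (τ k ∙ ξ^ Fin.toℕ p))) (trans (square-element (Fin.toℕ p) k) (sym (identityˡ (ξ^ (Fin.toℕ p ℕ.+ Fin.toℕ p)))))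

        absorb : ∀ p k i → (τ k ∙ ξ^ p) ∙ ξ^ (i ℕ.+ i) ≈ τ k ∙ ξ^ (p ℕ.+ (i ℕ.+ i))
        absorb p k i = trans (assoc (τ k) (ξ^ p) (ξ^ (i ℕ.+ i))) (∙-congˡ (sym (ξ^-+ p (i ℕ.+ i))))

        exponents : ∀ m n k l → τ k ∙ ξ^ m ≈ τ l ∙ ξ^ n → m ℕ.+ m ≡ n ℕ.+ n
        exponents m n k l eq = ξ^-injective (m ℕ.+ m) (n ℕ.+ n) (trans (sym (square-element m k)) (trans (∙-cong eq eq) (square-element n l)))

        separated : ∀ (p : Fin 2) k (q : Fin 2) l → (τ k ∙ ξ^ Fin.toℕ p) ∼ (τ l ∙ ξ^ Fin.toℕ q) → p ≡ q × k ≡ l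
        separated p k q l (i , j , eq) =
          let eq′ = trans (sym (absorb (Fin.toℕ p) k i)) (trans eq (absorb (Fin.toℕ q) l j))
              m = Fin.toℕ p ℕ.+ (i ℕ.+ i)
              n = Fin.toℕ q ℕ.+ (j ℕ.+ j)
              m≡n = proj₂ (parity-unique zero zero m n (exponents m n k l eq′))
          in proj₁ (parity-unique p q i j m≡n) ,
             Bijection.injective t (cancelʳ (ξ^ n) (τ k) (τ l) (trans (∙-congˡ (reflexive (≡.cong ξ^_ (≡.sym m≡n)))) eq′))

        complete : ∀ (a : Setoid.Carrier (2-torsion A/ξ²)) → ∃₂ λ (p : Fin 2) k → proj₁ a ∼ (τ k ∙ ξ^ Fin.toℕ p)
        complete (a , i , j , eq) =
          let k , u≈τ = enumerated (2-torsion A) t (u , u²)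
              -- The relevant exponent j - i has the parity of i + j, which avoids negative
              -- exponents.
              e , even-or-odd = parity (i ℕ.+ j)
          in case k u≈τ e even-or-odd
          where
          u : Carrier
          u = a ∙ ξ^ i ∙ (ξ^ j) ⁻¹
          restore : u ∙ ξ^ j ≈ a ∙ ξ^ i
          restore = GroupProperties.//-rightDividesˡ group (ξ^ j) (a ∙ ξ^ i)
          u² : u ∙ u ≈ ε
          u² = cancelʳ (ξ^ j ∙ ξ^ j) (u ∙ u) ε (begin
            (u ∙ u) ∙ (ξ^ j ∙ ξ^ j)      ≈⟨ interchange u u (ξ^ j) (ξ^ j) ⟩
            (u ∙ ξ^ j) ∙ (u ∙ ξ^ j)      ≈⟨ ∙-cong restore restore ⟩
            (a ∙ ξ^ i) ∙ (a ∙ ξ^ i)      ≈⟨ interchange a (ξ^ i) a (ξ^ i) ⟩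
            (a ∙ a) ∙ (ξ^ i ∙ ξ^ i)      ≈⟨ ∙-congˡ (sym (ξ^-+ i i)) ⟩
            (a ∙ a) ∙ ξ^ (i ℕ.+ i)       ≈⟨ eq ⟩
            ε ∙ ξ^ (j ℕ.+ j)             ≈⟨ ∙-congˡ (ξ^-+ j j) ⟩
            ε ∙ (ξ^ j ∙ ξ^ j)            ∎)
          raised : ∀ k → u ≈ τ k → a ∙ ξ^ (i ℕ.+ i) ≈ τ k ∙ ξ^ (i ℕ.+ j)
          raised k u≈τ = begin
            a ∙ ξ^ (i ℕ.+ i)         ≈⟨ ∙-congˡ (ξ^-+ i i) ⟩
            a ∙ (ξ^ i ∙ ξ^ i)        ≈⟨ sym (assoc a (ξ^ i) (ξ^ i)) ⟩
            (a ∙ ξ^ i) ∙ ξ^ i        ≈⟨ ∙-congʳ (sym restore) ⟩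
            (u ∙ ξ^ j) ∙ ξ^ i        ≈⟨ assoc u (ξ^ j) (ξ^ i) ⟩
            u ∙ (ξ^ j ∙ ξ^ i)        ≈⟨ ∙-cong u≈τ (comm (ξ^ j) (ξ^ i)) ⟩
            τ k ∙ (ξ^ i ∙ ξ^ j)      ≈⟨ ∙-congˡ (sym (ξ^-+ i j)) ⟩
            τ k ∙ ξ^ (i ℕ.+ j)       ∎
          case : ∀ k → u ≈ τ k → ∀ e → i ℕ.+ j ≡ e ℕ.+ e ⊎ i ℕ.+ j ≡ suc (e ℕ.+ e) → ∃₂ λ (p : Fin 2) k → a ∼ (τ k ∙ ξ^ Fin.toℕ p)
          case k u≈τ e (inj₁ even) = zero , k , i , e , trans (raised k u≈τ) (trans (∙-congˡ (reflexive (≡.cong ξ^_ even))) (sym (absorb 0 k e)))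
          case k u≈τ e (inj₂ odd) = suc zero , k , i , e , trans (raised k u≈τ) (trans (∙-congˡ (reflexive (≡.cong ξ^_ odd))) (sym (absorb 1 k e)))

      mod2-cardinality : ExcludedMiddle 0ℓ → ∀ {N} (colour : Carrier → Fin N) → (∀ a b → colour a ≡ colour b → a ∼ b) →
        ∀ {h₂} → HasCardinality (2-torsion A) h₂ → HasCardinality (AbelianGroup.setoid (mod2 A)) (2 ℕ.* h₂)
      mod2-cardinality em colour same-colour t =
        let c = torsion⇒mod2 em A/ξ² (λ m β separated → Fin.injective⇒≤ {f = colour ∘ β} (λ {i} {j} eq → separated i j (same-colour (β i) (β j) eq))) (torsion-double t)
        in family⇒cardinality (AbelianGroup.setoid (mod2 A)) (Bijection.to c)
             (λ i j eq → Bijection.injective c (mod2⇐ {Bijection.to c i} {Bijection.to c j} eq))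
             (λ a → let j , eq = enumerated (AbelianGroup.setoid (mod2 A/ξ²)) c a in j , mod2⇒ {a} {Bijection.to c j} eq)

-- The class of ξ has infinite order and A/⟨ξ²⟩ is finite, the latter in the form of finitely many
-- colours that determine a class.
record Coloured (A : Ab) : Set where
  open AbelianGroup A
  field
    ξ : Carrier
    infinite : ∀ n → InfiniteOrder.ξ^_ A ξ n ≈ ε → n ≡ 0
    colours : ℕ
    colour : Carrier → Fin colours
    same-colour : ∀ a b → colour a ≡ colour b → InfiniteOrder._∼_ A ξ a b

  abstract
    mod2-cardinality : ExcludedMiddle 0ℓ → ∀ {h₂} → HasCardinality (2-torsion A) h₂ → HasCardinality (AbelianGroup.setoid (mod2 A)) (2 ℕ.* h₂)
    mod2-cardinality em = InfiniteOrder.mod2-cardinality A ξ infinite em colour same-colour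

-- Finiteness of the class group modulo the square of [x]

module Reduction (em : ExcludedMiddle 0ℓ) (K : FunctionField) (x : Place K) where
  open FunctionField K using (F)
  open CommutativeRing (fieldRing F) hiding (zero)
  open Valuations em {K}
  open Divisors em K
  open RiemannRoch em K
  open PolesAt em K x
  open Finiteness em K using (bounded-inverse)
  open Constants em K using (few-constants)
  open CompletionValuation em {K}
  open Adeles em K
  private
    module U = AbelianGroup (Units (𝔸 K))
    module X = PolesAt em K

  abstract
    -- A function u that vanishes along the poles of b⁻¹ off x, with at least their order, dominates
    -- the orders of b there, so `maximal-divisor` applies to b.
    divisor-off-x : ∀ (b : U.Carrier) → (∀ y → ¬ y ≈ₚ x → + 0 ≤⟦ y ⟧ proj₁ b ⟪ y ⟫) →
      ∃[ E ] (∀ z → z ∈ₚ E → ¬ z ≈ₚ x) × (∀ z → ¬ z ≈ₚ x → HasOrder z (proj₁ b ⟪ z ⟫) (+ mult E z))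
    divisor-off-x b integral =
      let S , b⁻¹-integral = poles-of (proj₁ (b U.⁻¹))
          B , b⁻¹-bounded = adele-bounded-below (proj₁ (b U.⁻¹)) S
          _ , u , u≉0 , Lu = vanishing (copies B S)
          E , good , maximal = maximal-divisor W (λ {y} {z} → W-resp {y} {z}) u≉0
            (λ z n (z≉x , p) → bounded S B u z n (b⁻¹-integral z) (b⁻¹-bounded z) (L-away {z = z} Lu z≉x) p em)
      in E , (λ z z∈E → proj₁ (good z z∈E)) , λ z z≉x → exact E z z≉x (good z) (maximal z) (idele-order b z) em
      where
      W : Place K → ℕ → Set
      W z n = ¬ z ≈ₚ x × + n ≤⟦ z ⟧ proj₁ b ⟪ z ⟫
      W-resp : ∀ {y z} n → y ≈ₚ z → W y n → W z n
      W-resp {y} {z} n y≈z (y≉x , p) = (λ z≈x → y≉x (≈ₚ-trans {w = y} {z} {x} y≈z z≈x)) , adele-≤-at (proj₁ b) {z} {y} (≈ₚ-sym {y = y} {z} y≈z) p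
      inverse-bound : ∀ {z n N} → + n ≤⟦ z ⟧ proj₁ b ⟪ z ⟫ → N ≤⟦ z ⟧ proj₁ (b U.⁻¹) ⟪ z ⟫ → + n ℤ.≤ ℤ.- N
      inverse-bound {z} {n} {N} p q =
        let m , r = idele-order b z
        in ℤ.≤-trans (≤-hasOrder r p) (≡.subst (ℤ._≤ ℤ.- N) (ℤ.neg-involutive m) (ℤ.neg-mono-≤ (≤-hasOrder (idele-inverse-order b {z} r) q)))
      bounded : ∀ S B u z n → (¬ z ∈ₚ S → + 0 ≤⟦ z ⟧ proj₁ (b U.⁻¹) ⟪ z ⟫) → (z ∈ₚ S → ℤ.- (+ B) ≤⟦ z ⟧ proj₁ (b U.⁻¹) ⟪ z ⟫) →
        + mult (copies B S) z ≤[ z ] u → + n ≤⟦ z ⟧ proj₁ b ⟪ z ⟫ → Dec (z ∈ₚ S) → + n ≤[ z ] u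
      bounded S B u z n b⁻¹-integral b⁻¹-bounded vanishes p (no z∉S) = ≤-weaken (ℤ.≤-trans (inverse-bound p (b⁻¹-integral z∉S)) (+≤+ z≤n)) vanishes
      bounded S B u z n b⁻¹-integral b⁻¹-bounded vanishes p (yes z∈S) = ≤-weaken (ℤ.≤-trans (inverse-bound p (b⁻¹-bounded z∈S))
        (≡.subst (ℤ._≤ + mult (copies B S) z) (≡.sym (ℤ.neg-involutive (+ B)))
          (+≤+ (ℕ.≤-trans (ℕ.m≤m*n B (mult S z) ⦃ ℕ.>-nonZero (mult-∈ {z} {S} z∈S) ⦄) (ℕ.≤-reflexive (≡.sym (mult-copies z B S))))))) vanishes
      exact : ∀ E z → ¬ z ≈ₚ x → (z ∈ₚ E → W z (mult E z)) → ¬ W z (suc (mult E z)) → ∃[ m ] HasOrder z (proj₁ b ⟪ z ⟫) m → Dec (z ∈ₚ E) → HasOrder z (proj₁ b ⟪ z ⟫) (+ mult E z)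
      exact E z z≉x good maximal (m , r) z∈?E = ≡.subst (HasOrder z (proj₁ b ⟪ z ⟫)) (ℤ.≤-antisym
          (ℤ.≮⇒≥ (λ mult<m → maximal (z≉x , hasOrder⇒≤ r (ℤ.i<j⇒suc[i]≤j mult<m))))
          (lower z∈?E)) r
        where
        lower : Dec (z ∈ₚ E) → + mult E z ℤ.≤ m
        lower (yes z∈E) = ≤-hasOrder r (proj₂ (good z∈E))
        lower (no z∉E) = ≡.subst (λ n → + n ℤ.≤ m) (≡.sym (mult-∉ {z} E z∉E)) (≤-hasOrder r (integral z z≉x))

  bound-C : ℕ
  bound-C = card x ℕ.* defect

  -- What (card z)ᵏ ≤ `bound-C` leaves possible for k: finitely many values, and only zero at places
  -- with a large residue field.
  Small : Place K → ℕ → Set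
  Small z k = k ≤ bound-C × (k ≡ 0 ⊎ card z ≤ bound-C)

  abstract
    -- If f has order k + mult E z at z, then Minkowski's bound for E′ = k z gives (card z)ᵏ ≤
    -- `bound-C`.
    small-excess : ∀ E → (∀ z → z ∈ₚ E → ¬ z ≈ₚ x) →
      ∃[ f ] f ≉ 0# × (∀ z → ¬ z ≈ₚ x → ∃[ k ] Order z f (+ k ℤ.+ + mult E z) × Small z k)
    small-excess E E∌x =
      let M , f , f≉0 , Lf , minimal = bounded-inverse few-constants x E
      in f , f≉0 , λ z z≉x → excess M f Lf minimal z z≉x (order {z} f≉0)
      where
      small : ∀ z k → card z ℕ.^ k ≤ bound-C → Small z k
      small z zero _ = z≤n , inj₁ ≡.refl
      small z (suc k) p = ℕ.≤-trans (X.n≤card^n z (suc k)) p , inj₂ (ℕ.≤-trans (ℕ.m≤m*n (card z) (card z ℕ.^ k) ⦃ ℕ.>-nonZero (X.1≤card^ z k) ⦄) p)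
      excess : ∀ M f → L E (x^ M) f → (∀ E′ → (∀ z → z ∈ₚ E′ ++ E → ¬ z ≈ₚ x) → L (E′ ++ E) (x^ M) f → norm E′ ≤ bound-C) →
        ∀ z → ¬ z ≈ₚ x → ∃[ m ] Order z f m → ∃[ k ] Order z f (+ k ℤ.+ + mult E z) × Small z k
      excess M f Lf minimal z z≉x (m , r) = k , ≡.subst (Order z f) (≡.sym k+mult≡m) r , small z k (≡.subst (_≤ bound-C) (X.norm-x^ z k)
          (minimal (X.x^_ z k) off-x (∈L (λ z′ → bounded z′ em))))
        where
        k : ℕ
        k = ℤ.∣ m ℤ.- + mult E z ∣
        k+mult≡m : + k ℤ.+ + mult E z ≡ m
        k+mult≡m = ≡.trans (≡.cong (ℤ._+ + mult E z) (ℤ.0≤i⇒+∣i∣≡i (ℤ.i≤j⇒0≤j-i (≤-order r (L-away {z = z} Lf z≉x))))) (cancel m (+ mult E z))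
          where
          cancel : ∀ m n → (m ℤ.- n) ℤ.+ n ≡ m
          cancel = ℤ.solve-∀
        off-x : ∀ z′ → z′ ∈ₚ X.x^_ z k ++ E → ¬ z′ ≈ₚ x
        off-x z′ z′∈ = case em
          where
          case : Dec (z′ ∈ₚ E) → ¬ z′ ≈ₚ x
          case (yes z′∈E) = E∌x z′ z′∈E
          case (no z′∉E) z′≈x = ℕ.1+n≰n (ℕ.≤-trans (mult-∈ {z′} {X.x^_ z k ++ E} z′∈) (ℕ.≤-reflexive (≡.trans (mult-++ z′ (X.x^_ z k) E)
            (≡.cong₂ ℕ._+_ (X.mult-x^-≉ z {z′} k (λ z′≈z → z≉x (≈ₚ-trans {w = z} {z′} {x} (≈ₚ-sym {y = z′} {z} z′≈z) z′≈x))) (mult-∉ {z′} E z′∉E)))))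
        bounded : ∀ z′ → Dec (z′ ≈ₚ z) → + mult (X.x^_ z k ++ E) z′ ℤ.- + mult (x^ M) z′ ≤[ z′ ] f
        bounded z′ (no z′≉z) = ≡.subst (λ n → + n ℤ.- + mult (x^ M) z′ ≤[ z′ ] f)
          (≡.sym (≡.trans (mult-++ z′ (X.x^_ z k) E) (≡.cong (ℕ._+ mult E z′) (X.mult-x^-≉ z {z′} k z′≉z)))) (bound Lf z′)
        bounded z′ (yes z′≈z) = ≤-at {z} {z′} (≈ₚ-sym {y = z′} {z} z′≈z) (order⇒≤ r (ℤ.≤-reflexive (≡.trans
          (≡.cong₂ (λ i j → + i ℤ.- + j) (≡.trans (mult-++ z′ (X.x^_ z k) E) (≡.cong₂ ℕ._+_ (X.mult-x^ z {z′} k z′≈z) (mult-resp {z′} {z} E z′≈z)))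
            (mult-x^-≉ {z′} M (λ z′≈x → z≉x (≈ₚ-trans {w = z} {z′} {x} (≈ₚ-sym {y = z′} {z} z′≈z) z′≈x))))
          (≡.trans (≡.cong (ℤ._- + 0) (ℤ.pos-+ k (mult E z))) (≡.trans (ℤ.+-identityʳ (+ k ℤ.+ + mult E z)) k+mult≡m)))))

module _ (A : Ab) where
  open AbelianGroup A
  open SetoidReasoning setoid
  open CommutativeMonoidSolver commutativeMonoid using (solve; _⊕_; _⊜_)

  abstract
    quotient-shift : ∀ g g′ a a′ s s′ → (g′ ∙ g ⁻¹) ∙ (a ∙ s) ∙ ((g ∙ a ⁻¹) ∙ (g′ ∙ a′ ⁻¹) ⁻¹ ∙ (s′ ∙ s ⁻¹)) ≈ a′ ∙ s′
    quotient-shift g g′ a a′ s s′ = begin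
      (g′ ∙ g ⁻¹) ∙ (a ∙ s) ∙ ((g ∙ a ⁻¹) ∙ (g′ ∙ a′ ⁻¹) ⁻¹ ∙ (s′ ∙ s ⁻¹))
        ≈⟨ ∙-congˡ (∙-congʳ (∙-congˡ (trans (sym (AbelianGroupProperties.⁻¹-∙-comm A g′ (a′ ⁻¹))) (∙-congˡ (GroupProperties.⁻¹-involutive group a′))))) ⟩
      (g′ ∙ g ⁻¹) ∙ (a ∙ s) ∙ ((g ∙ a ⁻¹) ∙ (g′ ⁻¹ ∙ a′) ∙ (s′ ∙ s ⁻¹))
        ≈⟨ solve 10 (λ g g⁻ g′ g′⁻ a a⁻ s s⁻ a′ s′ →
             ((g′ ⊕ g⁻) ⊕ (a ⊕ s)) ⊕ (((g ⊕ a⁻) ⊕ (g′⁻ ⊕ a′)) ⊕ (s′ ⊕ s⁻)) ⊜ ((g ⊕ g⁻) ⊕ (g′ ⊕ g′⁻)) ⊕ (((a ⊕ a⁻) ⊕ (s ⊕ s⁻)) ⊕ (a′ ⊕ s′)))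
             refl g (g ⁻¹) g′ (g′ ⁻¹) a (a ⁻¹) s (s ⁻¹) a′ s′ ⟩
      ((g ∙ g ⁻¹) ∙ (g′ ∙ g′ ⁻¹)) ∙ (((a ∙ a ⁻¹) ∙ (s ∙ s ⁻¹)) ∙ (a′ ∙ s′))
        ≈⟨ ∙-cong (∙-cong (inverseʳ g) (inverseʳ g′)) (∙-congʳ (∙-cong (inverseʳ a) (inverseʳ s))) ⟩
      (ε ∙ ε) ∙ ((ε ∙ ε) ∙ (a′ ∙ s′))
        ≈⟨ trans (∙-cong (identityˡ ε) (trans (∙-congʳ (identityˡ ε)) (identityˡ (a′ ∙ s′)))) (identityˡ (a′ ∙ s′)) ⟩
      a′ ∙ s′                                                            ∎

module AdelicClasses (Γ A O : Ring) (ι : Γ ⟶ʳ A) (κ : O ⟶ʳ A) where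
  open AbelianGroup (Units A)
  private
    module A = CommutativeRing A
    module Γ = AbelianGroup (Units Γ)
    module O = AbelianGroup (Units O)
    module Cl = AbelianGroup (Adelic.classGroup Γ A O ι κ)
    module ι = RingHomomorphism ι
    module κ = RingHomomorphism κ
    module ιˣ = GroupHomomorphism (Functoriality.Units-map {Γ} {A} ι)

  infixl 7 _⊘_
  _⊘_ : Γ.Carrier → Carrier → Carrier
  γ ⊘ a = ιˣ.⟦ γ ⟧ ∙ a ⁻¹

  abstract
    -- Modulo principal ideles a is the inverse of γ ⊘ a. So the classes of a s and a′ s′ agree once
    -- (γ ⊘ a) (γ′ ⊘ a′)⁻¹ and s s′⁻¹ differ by a unit of O.
    class-cong : ∀ γ γ′ (u : O.Carrier) a a′ s s′ → κ.⟦ proj₁ u ⟧ A.≈ proj₁ ((γ ⊘ a) ∙ (γ′ ⊘ a′) ⁻¹ ∙ (s′ ∙ s ⁻¹)) → a ∙ s Cl.≈ a′ ∙ s′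
    class-cong γ γ′ u a a′ s s′ eq = γ′ Γ.∙ γ Γ.⁻¹ , u ,
      A.trans (A.*-cong (A.*-congʳ (ι.*-homo (proj₁ γ′) (proj₁ (γ Γ.⁻¹)))) eq) (quotient-shift (Units A) ιˣ.⟦ γ ⟧ ιˣ.⟦ γ′ ⟧ a a′ s s′)

    class-ε : ∀ (a : Carrier) → a Cl.≈ Cl.ε → ∃[ γ ] ∃[ u ] (ι.⟦ proj₁ {B = IsUnit Γ} γ ⟧ A.* proj₁ a) A.* κ.⟦ proj₁ {B = IsUnit O} u ⟧ A.≈ A.1#
    class-ε a eq = eq

module ClassGroup (em : ExcludedMiddle 0ℓ) {K : FunctionField} (x : Place K) (π : Uniformiser x) where
  open FunctionField K using (F)
  open CommutativeRing (fieldRing F) using (Carrier; _≈_; _≉_; 0#; 1#; _+_; _*_; _-_)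
  open Field em F using (inverse; inverse-nonzero; *-nonzero)
  open Valuations em {K}
  open Divisors em K using (mult; card)
  open Finiteness em K using (small-places; order-at-x)
  open Constants em K using (few-constants)
  open CompletionValuation em {K}
  open Adeles em K
  open Approximation𝔸 x using (clear-poles)
  open Reduction em K x
  open LocalUniformiser em x π using (ϖ; ϖ-order-at-x; ϖ-order-off-x)
  open AdelicClasses (F⊂𝔸 K) (𝔸 K) (𝒪𝔸 K) (inclusion (𝔸 K) (principal-isSubring K)) (inclusion (𝔸 K) (integralAdele-isSubring K))
  private
    module R (y : Place K) = CommutativeRing (completion y)
    module A = CommutativeRing (𝔸 K)
    module U = AbelianGroup (Units (𝔸 K))
    module Γ = AbelianGroup (Units (F⊂𝔸 K))
    module O = AbelianGroup (Units (𝒪𝔸 K))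

  open InfiniteOrder (Cl K) ϖ using (ξ^_; ξ^-induction; _∼_)

  Ord : U.Carrier → Place K → ℤ → Set
  Ord a y m = HasOrder y (proj₁ a ⟪ y ⟫) m

  abstract
    ord-∙ : ∀ a b {y m n} → Ord a y m → Ord b y n → Ord (a U.∙ b) y (m ℤ.+ n)
    ord-∙ a b p q = hasOrder-* p q

    ord-⁻¹ : ∀ a {y m} → Ord a y m → Ord (a U.⁻¹) y (ℤ.- m)
    ord-⁻¹ a {y} = idele-inverse-order a {y}

    ξ^-order-at-x : ∀ n → Ord (ξ^ n) x (+ n)
    ξ^-order-at-x = ξ^-induction (λ n a → Ord a x (+ n)) (hasOrder-1 {x}) (λ n a p → ord-∙ ϖ a (ϖ-order-at-x {x} (≈ₚ-refl {y = x})) p)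

    ξ^-order-off-x : ∀ {y} → ¬ y ≈ₚ x → ∀ n → Ord (ξ^ n) y (+ 0)
    ξ^-order-off-x {y} y≉x = ξ^-induction (λ n a → Ord a y (+ 0)) (hasOrder-1 {y}) (λ n a p → ord-∙ ϖ a (ϖ-order-off-x {y} y≉x) p)

    integral-unit : ∀ (o : U.Carrier) → (∀ y → Ord o y (+ 0)) → Σ[ u ∈ O.Carrier ] proj₁ (proj₁ u) A.≈ proj₁ o
    integral-unit o@(o₀ , o⁻¹ , p , q) unit = (to-integral o₀ (λ y → hasOrder⇒≤ (unit y) ℤ.≤-refl) ,
      to-integral o⁻¹ (λ y → hasOrder⇒≤ (ord-⁻¹ o {y} (unit y)) ℤ.≤-refl) , p , q) , A.refl {o₀}

    -- Let f clear the poles of a off x, let E be the divisor of f a there, and let g be the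
    -- function of `small-excess` for E. With γ = g/f the quotient γ/a is g/(f a), whose orders off
    -- x are the excess of g over E.
    reduce : ∀ (a : U.Carrier) → ∃[ γ ] (∀ z → ¬ z ≈ₚ x → ∃[ k ] Ord (γ ⊘ a) z (+ k) × Small z k)
    reduce a =
      let f , f≉0 , integral = clear-poles (proj₁ a)
          h , hf≈1 = inverse f≉0
          E , E∌x , E-order = divisor-off-x (f· f f≉0 U.∙ a) integral
          g , g≉0 , excess = small-excess E E∌x
          gh≉0 = *-nonzero g≉0 (inverse-nonzero hf≈1)
      in (principal (g * h) , principal-unit gh≉0) , λ z z≉x →
        let k , g-order , small = excess z z≉x
        in k , quotient-order f f≉0 h hf≈1 g gh≉0 k (mult E z) z g-order (E-order z z≉x) (order f≉0) (idele-order a z) , small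
      where
      f· : ∀ f → f ≉ 0# → U.Carrier
      f· f f≉0 = proj₁ (principal f) , proj₁ (proj₁ (principal-unit f≉0)) , proj₁ (proj₂ (principal-unit f≉0)) , proj₂ (proj₂ (principal-unit f≉0))
      quotient-order : ∀ f f≉0 h → h * f ≈ 1# → ∀ g (gh≉0 : g * h ≉ 0#) k e z → Order z g (+ k ℤ.+ + e) → Ord (f· f f≉0 U.∙ a) z (+ e) →
        ∃[ m ] Order z f m → ∃[ n ] Ord a z n → Ord ((principal (g * h) , principal-unit gh≉0) ⊘ a) z (+ k)
      quotient-order f f≉0 h hf≈1 g gh≉0 k e z g-order fa-order (m , f-order) (n , a-order) =
        ≡.subst (Ord ((principal (g * h) , principal-unit gh≉0) ⊘ a) z)
          (≡.trans (≡.cong (λ i → ((+ k ℤ.+ i) ℤ.- m) ℤ.- n) (hasOrder-unique fa-order (hasOrder-* (embed-order f-order) a-order))) (cancel (+ k) m n))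
          (hasOrder-* (embed-order (order-* g-order (order-inverse hf≈1 f-order))) (ord-⁻¹ a {z} a-order))
        where
        cancel : ∀ k m n → ((k ℤ.+ (m ℤ.+ n)) ℤ.- m) ℤ.- n ≡ k
        cancel = ℤ.solve-∀

    unit-order : ∀ (u : O.Carrier) y {m} → HasOrder y (proj₁ (proj₁ u) ⟪ y ⟫) m → m ≡ + 0
    unit-order (u , u⁻¹ , u⁻¹u≈1 , _) y {m} p = ℤ.≤-antisym
      (≡.subst (ℤ._≤ + 0) (ℤ.neg-involutive m) (ℤ.neg-mono-≤ (≤-hasOrder (inverse-order {y} {proj₁ (proj₁ u) y} {proj₁ (proj₁ u⁻¹) y} (u⁻¹u≈1 y) p) (from-integral u⁻¹ y))))
      (≤-hasOrder p (from-integral u y))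

    -- A relation γ a u = 1 with u a unit everywhere makes γ a function of order 0 off x and of
    -- order -n at x, and `order-at-x` forces n = 0.
    trivial-class : ∀ (a : U.Carrier) (γ : Γ.Carrier) (u : O.Carrier) → (proj₁ (proj₁ γ) A.* proj₁ a) A.* proj₁ (proj₁ u) A.≈ A.1# →
      ∀ n → Ord a x (+ n) → (∀ {y} → ¬ y ≈ₚ x → Ord a y (+ 0)) → n ≡ 0
    trivial-class a γ@((γ₀ , f , γ≈f) , γ₀⁻¹ , γ-inverse) u@(u₀ , u₀⁻¹ , u-inverse) eq n at-x off-x =
      ℤ.+-injective (≡.trans (≡.sym (ℤ.neg-involutive (+ n))) (≡.cong ℤ.-_
        (order-at-x few-constants x {f} {ℤ.- (+ n)} (λ z z≉x → order-f z (+ 0) (off-x {z} z≉x)) (order-f x (+ n) at-x))))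
      where
      uˣ γˣ : U.Carrier
      uˣ = proj₁ u₀ , proj₁ u₀⁻¹ , u-inverse
      γˣ = γ₀ , proj₁ γ₀⁻¹ , γ-inverse
      solve-m : ∀ m k l → (m ℤ.+ k) ℤ.+ l ≡ + 0 → l ≡ + 0 → m ≡ ℤ.- k
      solve-m m k l sum≡0 l≡0 = ≡.trans (≡.sym (expand m k)) (≡.trans (≡.cong (ℤ._- k) (≡.trans (≡.cong (λ i → m ℤ.+ k ℤ.+ i) (≡.sym l≡0)) sum≡0)) (ℤ.+-identityˡ (ℤ.- k)))
        where
        expand : ∀ m k → (m ℤ.+ k ℤ.+ + 0) ℤ.- k ≡ m
        expand = ℤ.solve-∀
      order-f : ∀ y k → Ord a y k → Order y f (ℤ.- k)
      order-f y k p =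
        let m , γ-order = idele-order γˣ y
            l , u-order′ = idele-order uˣ y
            sum≡0 = hasOrder-unique (order-resp (eq y) (hasOrder-* (hasOrder-* γ-order p) u-order′)) (hasOrder-1 {y})
        in ≡.subst (Order y f) (solve-m m k l sum≡0 (unit-order u y u-order′)) (order-embed (order-resp (γ≈f y) γ-order))

    infinite-order : ∀ n → AbelianGroup._≈_ (Cl K) (ξ^ n) (AbelianGroup.ε (Cl K)) → n ≡ 0
    infinite-order n eq =
      let γ , u , eq′ = class-ε (ξ^ n) eq
      in trivial-class (ξ^ n) γ u eq′ n (ξ^-order-at-x n) (λ {y} y≉x → ξ^-order-off-x {y} y≉x n)

    -- The idele o by which the two sides differ up to principal ideles has order 0 everywhere: off
    -- x the reduced ideles have equal orders, and at x the factors s and s′ balance them. Hence o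
    -- is a unit of the integral adeles.
    same-divisor : ∀ (a a′ s s′ : U.Carrier) γ γ′ {m m′ e e′} →
      (∀ z → ¬ z ≈ₚ x → ∃[ k ] Ord (γ ⊘ a) z k × Ord (γ′ ⊘ a′) z k) → (∀ {y} → ¬ y ≈ₚ x → Ord s y (+ 0)) → (∀ {y} → ¬ y ≈ₚ x → Ord s′ y (+ 0)) →
      Ord (γ ⊘ a) x m → Ord (γ′ ⊘ a′) x m′ → Ord s x e → Ord s′ x e′ → m ℤ.+ e′ ≡ m′ ℤ.+ e →
      AbelianGroup._≈_ (Cl K) (AbelianGroup._∙_ (Cl K) a s) (AbelianGroup._∙_ (Cl K) a′ s′)
    same-divisor a a′ s s′ γ γ′ {m} {m′} {e} {e′} same-off-x s-off-x s′-off-x b-order b′-order s-order s′-order m+e′≡m′+e =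
      let u , eq = integral-unit o (λ y → unit y em) in class-cong γ γ′ u a a′ s s′ eq
      where
      o : U.Carrier
      o = (γ ⊘ a) U.∙ (γ′ ⊘ a′) U.⁻¹ U.∙ (s′ U.∙ s U.⁻¹)
      o-order : ∀ {y m m′ e e′} → Ord (γ ⊘ a) y m → Ord (γ′ ⊘ a′) y m′ → Ord s y e → Ord s′ y e′ → Ord o y ((m ℤ.- m′) ℤ.+ (e′ ℤ.- e))
      o-order {y} p p′ r r′ = ord-∙ ((γ ⊘ a) U.∙ (γ′ ⊘ a′) U.⁻¹) (s′ U.∙ s U.⁻¹)
        (ord-∙ (γ ⊘ a) ((γ′ ⊘ a′) U.⁻¹) p (ord-⁻¹ (γ′ ⊘ a′) {y} p′)) (ord-∙ s′ (s U.⁻¹) r′ (ord-⁻¹ s {y} r))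
      balance : ∀ m m′ e e′ → m ℤ.+ e′ ≡ m′ ℤ.+ e → (m ℤ.- m′) ℤ.+ (e′ ℤ.- e) ≡ + 0
      balance m m′ e e′ eq = ≡.trans (regroup m m′ e e′) (≡.trans (≡.cong (ℤ._- (m′ ℤ.+ e)) eq) (ℤ.+-inverseʳ (m′ ℤ.+ e)))
        where
        regroup : ∀ m m′ e e′ → (m ℤ.- m′) ℤ.+ (e′ ℤ.- e) ≡ (m ℤ.+ e′) ℤ.- (m′ ℤ.+ e)
        regroup = ℤ.solve-∀
      unit : ∀ y → Dec (y ≈ₚ x) → Ord o y (+ 0)
      unit y (yes y≈x) = adele-order-at (proj₁ o) {y} {x} y≈x (≡.subst (Ord o x) (balance m m′ e e′ m+e′≡m′+e) (o-order b-order b′-order s-order s′-order))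
      unit y (no y≉x) =
        let k , p , p′ = same-off-x y y≉x
        in ≡.subst (Ord o y) (balance k k (+ 0) (+ 0) ≡.refl) (o-order p p′ (s-off-x {y} y≉x) (s′-off-x {y} y≉x))

  -- The class of an idele a modulo the squares of powers of [x] is determined by
  -- the orders at T of the reduced idele γ / a and the parity of its order at x.
  private
    T : List (Place K)
    T = proj₁ (small-places bound-C)

    reduced : U.Carrier → U.Carrier
    reduced a = proj₁ (reduce a) ⊘ a

    abstract
      T-covers : ∀ z → card z ≤ bound-C → z ∈ₚ T
      T-covers = proj₂ (small-places bound-C)

      digit : ∀ a y → Σ[ e ∈ Fin (suc bound-C) ] (¬ y ≈ₚ x → Ord (reduced a) y (+ Fin.toℕ e))
      digit a y = case em
        where
        case : Dec (y ≈ₚ x) → Σ[ e ∈ Fin (suc bound-C) ] (¬ y ≈ₚ x → Ord (reduced a) y (+ Fin.toℕ e))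
        case (yes y≈x) = zero , λ y≉x → ⊥-elim (y≉x y≈x)
        case (no y≉x) =
          let k , p , k≤C , _ = proj₂ (reduce a) y y≉x
          in Fin.fromℕ< (s≤s k≤C) , λ _ → ≡.subst (λ n → Ord (reduced a) y (+ n)) (≡.sym (Fin.toℕ-fromℕ< (s≤s k≤C))) p

      order-parity : ∀ a → Σ[ p ∈ Fin 2 ] ∃[ j ] Ord (reduced a) x (+ Fin.toℕ p ℤ.+ j ℤ.* + 2)
      order-parity a =
        let m , r = idele-order (reduced a) x
        in Fin.fromℕ< (ℤ.n%ℕd<d m 2) , m ℤ./ℕ 2 , ≡.subst (Ord (reduced a) x)
             (≡.trans (ℤ.a≡a%ℕn+[a/ℕn]*n m 2) (≡.cong (λ n → + n ℤ.+ (m ℤ./ℕ 2) ℤ.* + 2) (≡.sym (Fin.toℕ-fromℕ< (ℤ.n%ℕd<d m 2))))) r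

    colour : U.Carrier → Fin (suc bound-C ℕ.^ length T ℕ.* 2)
    colour a = Fin.combine (Fin.funToFin (λ i → proj₁ (digit a (lookup T i)))) (proj₁ (order-parity a))

    abstract
      same-orders : ∀ a a′ → (∀ i → proj₁ (digit a (lookup T i)) ≡ proj₁ (digit a′ (lookup T i))) →
        ∀ z → ¬ z ≈ₚ x → ∃[ k ] Ord (reduced a) z k × Ord (reduced a′) z k
      same-orders a a′ same z z≉x =
        let k , p , _ , k-small = proj₂ (reduce a) z z≉x
            k′ , p′ , _ , k′-small = proj₂ (reduce a′) z z≉x
        in case k k′ p p′ k-small k′-small
        where
        at-T : z ∈ₚ T → ∃[ k ] Ord (reduced a) z k × Ord (reduced a′) z k
        at-T z∈T = + Fin.toℕ (proj₁ (digit a y)) ,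
          adele-order-at (proj₁ (reduced a)) {z} {y} z≈y (proj₂ (digit a y) y≉x) ,
          adele-order-at (proj₁ (reduced a′)) {z} {y} z≈y (≡.subst (λ e → Ord (reduced a′) y (+ Fin.toℕ e)) (≡.sym (same (Any.index z∈T))) (proj₂ (digit a′ y) y≉x))
          where
          y : Place K
          y = lookup T (Any.index z∈T)
          z≈y : z ≈ₚ y
          z≈y = lookup-index z∈T
          y≉x : ¬ y ≈ₚ x
          y≉x y≈x = z≉x (≈ₚ-trans {w = z} {y} {x} z≈y y≈x)
        case : ∀ k k′ → Ord (reduced a) z (+ k) → Ord (reduced a′) z (+ k′) → k ≡ 0 ⊎ card z ≤ bound-C → k′ ≡ 0 ⊎ card z ≤ bound-C →
          ∃[ k ] Ord (reduced a) z k × Ord (reduced a′) z k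
        case k k′ p p′ (inj₁ ≡.refl) (inj₁ ≡.refl) = + 0 , p , p′
        case k k′ p p′ (inj₂ small) _ = at-T (T-covers z small)
        case k k′ p p′ (inj₁ _) (inj₂ small) = at-T (T-covers z small)

      difference : ∀ j → ∃₂ λ i i′ → j ℤ.+ + i′ ≡ + i
      difference (+ n) = n , 0 , ℤ.+-identityʳ (+ n)
      difference -[1+ n ] = 0 , suc n , ℤ.+-inverseˡ (+ suc n)

      same-class : ∀ a a′ → colour a ≡ colour a′ → a ∼ a′
      same-class a a′ eq =
        let same-digits , same-parity = Fin.combine-injective (Fin.funToFin (λ i → proj₁ (digit a (lookup T i)))) (proj₁ (order-parity a))
                                          (Fin.funToFin (λ i → proj₁ (digit a′ (lookup T i)))) (proj₁ (order-parity a′)) eq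
            p , j , r = order-parity a
            p′ , j′ , r′ = order-parity a′
            -- Natural numbers with i - i′ = j - j′: the orders at x, which have equal parity,
            -- become balanced by ξ²ⁱ and ξ²ⁱ′.
            i , i′ , j-j′ = difference (j ℤ.- j′)
        in i , i′ , same-divisor a a′ (ξ^ (i ℕ.+ i)) (ξ^ (i′ ℕ.+ i′)) (proj₁ (reduce a)) (proj₁ (reduce a′))
             (same-orders a a′ (funToFin-injective (λ i → proj₁ (digit a (lookup T i))) (λ i → proj₁ (digit a′ (lookup T i))) same-digits))
             (λ {y} y≉x → ξ^-order-off-x {y} y≉x (i ℕ.+ i)) (λ {y} y≉x → ξ^-order-off-x {y} y≉x (i′ ℕ.+ i′)) r r′ (ξ^-order-at-x (i ℕ.+ i)) (ξ^-order-at-x (i′ ℕ.+ i′))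
             (balance p p′ same-parity j j′ i i′ j-j′)
        where
        funToFin-injective : ∀ {m n} (f g : Fin m → Fin n) → Fin.funToFin f ≡ Fin.funToFin g → ∀ i → f i ≡ g i
        funToFin-injective {m} {n} f g eq i = ≡.trans (≡.sym (Fin.finToFun-funToFin f i)) (≡.trans (≡.cong (λ h → Fin.finToFun {n} {m} h i) eq) (Fin.finToFun-funToFin g i))
        balance : ∀ (p p′ : Fin 2) → p ≡ p′ → ∀ j j′ i i′ → (j ℤ.- j′) ℤ.+ + i′ ≡ + i →
          (+ Fin.toℕ p ℤ.+ j ℤ.* + 2) ℤ.+ + (i′ ℕ.+ i′) ≡ (+ Fin.toℕ p′ ℤ.+ j′ ℤ.* + 2) ℤ.+ + (i ℕ.+ i)
        balance p p ≡.refl j j′ i i′ eq = ≡.trans (≡.cong (λ n → (+ Fin.toℕ p ℤ.+ j ℤ.* + 2) ℤ.+ n) (ℤ.pos-+ i′ i′)) (≡.trans (regroup (+ Fin.toℕ p) j j′ (+ i′))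
          (≡.cong (λ n → (+ Fin.toℕ p ℤ.+ j′ ℤ.* + 2) ℤ.+ n) (≡.trans (≡.cong₂ ℤ._+_ eq eq) (≡.sym (ℤ.pos-+ i i)))))
          where
          regroup : ∀ p j j′ i′ → (p ℤ.+ j ℤ.* + 2) ℤ.+ (i′ ℤ.+ i′) ≡ (p ℤ.+ j′ ℤ.* + 2) ℤ.+ (((j ℤ.- j′) ℤ.+ i′) ℤ.+ ((j ℤ.- j′) ℤ.+ i′))
          regroup = ℤ.solve-∀

  coloured : Coloured (Cl K)
  coloured = record
    { ξ = ϖ
    ; infinite = infinite-order
    ; colours = suc bound-C ℕ.^ length T ℕ.* 2
    ; colour = colour
    ; same-colour = same-class
    }

-- The two cases of the theorem

record CompleteInvariant (S : Setoid 0ℓ 0ℓ) (A : Ab) : Set where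
  private
    module S = Setoid S
    module A = AbelianGroup A
  field
    f : S.Carrier → A.Carrier
    cong : ∀ a b → a S.≈ b → f a A.≈ f b
    injective : ∀ a b → f a A.≈ f b → a S.≈ b
    surjective : ∀ t → ∃[ a ] f a A.≈ t

  abstract
    cardinality : ∀ {n} → HasCardinality (AbelianGroup.setoid A) n → HasCardinality S n
    cardinality c = family⇒cardinality S (λ i → proj₁ (surjective (to i)))
      (λ i j eq → Bijection.injective c (A.trans (A.sym (proj₂ (surjective (to i)))) (A.trans (cong _ _ eq) (proj₂ (surjective (to j))))))
      (λ a → let i , fa≈ = enumerated A.setoid c (f a) in i , injective a _ (A.trans fa≈ (A.sym (proj₂ (surjective (to i))))))
      where open Bijection c using (to)

module Dichotomy (em : ExcludedMiddle 0ℓ) {K : FunctionField} (x : Place K) (π : Uniformiser x) where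
  open HeckeGraph em x π
  open Labels em x π
  private
    module Q = AbelianGroup (mod2 (Cl K))

  abstract
    label-invariant : (∀ g g′ → Connected g g′ → labelOf g Q.≈ labelOf g′) → CompleteInvariant components (mod2 (Cl K))
    label-invariant same-label = record { f = labelOf ; cong = same-label ; injective = same-label⇒Connected ; surjective = vertex-with-label }

    components-cardinality : ∀ {h₂} → HasCardinality (2-torsion (Cl K)) h₂ → (∀ g g′ → Connected g g′ → labelOf g Q.≈ labelOf g′) → HasCardinality components (2 ℕ.* h₂)
    components-cardinality {h₂} torsion same-label = CompleteInvariant.cardinality (label-invariant same-label) {2 ℕ.* h₂} (Coloured.mod2-cardinality (ClassGroup.coloured em x π) em {h₂} torsion)

    constant-labels : IsSquare (Cl K) [x] → ∀ g g′ → Connected g g′ → labelOf g Q.≈ labelOf g′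
    constant-labels square g g′ g~g′ = Q.sym {labelOf g′} {labelOf g} (equal (labels-in-component g g′ g~g′))
      where
      equal : labelOf g′ Q.≈ labelOf g ⊎ labelOf g′ Q.≈ labelOf g Q.∙ [x] → labelOf g′ Q.≈ labelOf g
      equal (inj₁ eq) = eq
      equal (inj₂ eq) = Q.trans {labelOf g′} {labelOf g Q.∙ [x]} {labelOf g} eq
        (Q.trans {labelOf g Q.∙ [x]} {labelOf g Q.∙ Q.ε} {labelOf g} (Q.∙-congˡ {labelOf g} {[x]} {Q.ε} (square⇒≈₂ε {[x]} square)) (Q.identityʳ (labelOf g)))

    distinct-labels : ∀ g g′ → ¬ Connected g g′ → ¬ labelOf g Q.≈ labelOf g′
    distinct-labels g g′ g≁g′ eq = g≁g′ (same-label⇒Connected g g′ eq)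

    module _ (¬square : ¬ IsSquare (Cl K) [x]) where

      shifted : ∀ a → ¬ a Q.≈ a Q.∙ [x]
      shifted a a≈ax = ¬square (≈₂ε⇒square {[x]} (Q.sym {Q.ε} {[x]} (GroupProperties.∙-cancelˡ Q.group a Q.ε [x] (Q.trans {a Q.∙ Q.ε} {a} {a Q.∙ [x]} (Q.identityʳ a) a≈ax))))

      two-labels : ∀ g → ∃₂ λ ℓ₁ ℓ₂ → ¬ ℓ₁ Q.≈ ℓ₂ × ℓ₂ Q.≈ ℓ₁ Q.∙ [x] × (∀ g′ → Connected g g′ → labelOf g′ Q.≈ ℓ₁ ⊎ labelOf g′ Q.≈ ℓ₂)
      two-labels g = labelOf g , labelOf g Q.∙ [x] , shifted (labelOf g) , Q.refl {labelOf g Q.∙ [x]} , labels-in-component g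

      edge-changes-label : ∀ g g′ → Edge g g′ → ¬ labelOf g Q.≈ labelOf g′
      edge-changes-label g g′ edge eq = shifted (labelOf g) (Q.trans {labelOf g} {labelOf g′} {labelOf g Q.∙ [x]} eq (edge-label g g′ edge))

      private
        module _ (g : Vertex) where
          side : ∀ h → Dec (labelOf h Q.≈ labelOf g) → Bool
          side h (yes _) = true
          side h (no _) = false
          same-side : ∀ h h′ → labelOf h Q.≈ labelOf h′ → ∀ p q → side h p ≡ side h′ q
          same-side h h′ eq (yes _) (yes _) = ≡.refl
          same-side h h′ eq (no _) (no _) = ≡.refl
          same-side h h′ eq (yes p) (no ¬q) = ⊥-elim (¬q (Q.trans {labelOf h′} {labelOf h} {labelOf g} (Q.sym {labelOf h} {labelOf h′} eq) p))
          same-side h h′ eq (no ¬p) (yes q) = ⊥-elim (¬p (Q.trans {labelOf h} {labelOf h′} {labelOf g} eq q))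
          -- Within the component of g, a label other than that of g is its product with [x]. So
          -- equal colours mean equal labels, which an edge excludes.
          different : ∀ h h′ → Edge h h′ → labelOf h Q.≈ labelOf g ⊎ labelOf h Q.≈ labelOf g Q.∙ [x] → labelOf h′ Q.≈ labelOf g ⊎ labelOf h′ Q.≈ labelOf g Q.∙ [x] →
            ∀ p q → side h p ≢ side h′ q
          different h h′ edge _ _ (yes _) (no _) ()
          different h h′ edge _ _ (no _) (yes _) ()
          different h h′ edge _ _ (yes p) (yes q) _ = edge-changes-label h h′ edge (Q.trans {labelOf h} {labelOf g} {labelOf h′} p (Q.sym {labelOf h′} {labelOf g} q))
          different h h′ edge (inj₁ p) _ (no ¬p) (no _) _ = ¬p p
          different h h′ edge _ (inj₁ q) (no _) (no ¬q) _ = ¬q q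
          different h h′ edge (inj₂ p) (inj₂ q) (no _) (no _) _ = edge-changes-label h h′ edge
            (Q.trans {labelOf h} {labelOf g Q.∙ [x]} {labelOf h′} p (Q.sym {labelOf h′} {labelOf g Q.∙ [x]} q))

          colour : Vertex → Bool
          colour h = side h em

          colour-cong : ∀ h h′ → Setoid._≈_ (vertices K) h h′ → colour h ≡ colour h′
          colour-cong h h′ h≈h′ = same-side h h′ (Func.cong (label K) {h} {h′} h≈h′) em em

          underlying : ∀ (h h′ : Setoid.Carrier (componentOf g)) → Setoid._≈_ (componentOf g) h h′ → Setoid._≈_ (vertices K) (proj₁ h) (proj₁ h′)
          underlying h h′ (γ , κ , u , Matrices.mat≈ p q r s) = γ , κ , u , Matrices.mat≈ p q r s

          colour-edge : ∀ h h′ → Connected g h → Connected g h′ → Edge h h′ → colour h ≢ colour h′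
          colour-edge h h′ g~h g~h′ edge = different h h′ edge (labels-in-component g h g~h) (labels-in-component g h′ g~h′) em em

      bipartite : ∀ g → IsBipartite g
      bipartite g = record { to = λ h → colour g (proj₁ h) ; cong = λ {h} {h′} h≈h′ → colour-cong g (proj₁ h) (proj₁ h′) (underlying g h h′ h≈h′) } ,
        λ h h′ edge → colour-edge g (proj₁ h) (proj₁ h′) (proj₂ h) (proj₂ h′) edge

open import Data.Nat.Base using (_*_)

proposition4p2 :
    (em : ExcludedMiddle 0ℓ) (K : FunctionField) (x : Place K) (π : Uniformiser x)
    (h₂ : ℕ) → HasCardinality (2-torsion (Cl K)) h₂ →
    let open HeckeGraph em x π
        open AbelianGroup (mod2 (Cl K))
    in
    (IsSquare (Cl K) [x] →
      (∀ g g′ → Connected g g′ → labelOf g ≈ labelOf g′) ×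
      HasCardinality components (2 * h₂) ×
      (∀ g g′ → ¬ Connected g g′ → ¬ labelOf g ≈ labelOf g′))
    ×
    (¬ IsSquare (Cl K) [x] →
      (∀ g → ∃₂ λ ℓ₁ ℓ₂ → ¬ ℓ₁ ≈ ℓ₂ × ℓ₂ ≈ ℓ₁ ∙ [x] ×
        (∀ g′ → Connected g g′ → labelOf g′ ≈ ℓ₁ ⊎ labelOf g′ ≈ ℓ₂)) ×
      (∀ g g′ → Edge g g′ → ¬ labelOf g ≈ labelOf g′) ×
      (∀ g → IsBipartite g))
proposition4p2 em K x π h₂ torsion =
  (λ square → constant-labels square , components-cardinality torsion (constant-labels square) , distinct-labels) ,
  (λ ¬square → two-labels ¬square , edge-changes-label ¬square , bipartite ¬square)
  where open Dichotomy em x π
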